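{- Let $f\in\mathbb{Z}[X]$ be a polynomial of degree $2$ or $3$. Then $G_f$ exists, i.e. there is an integer $G\geq 2$ such that for every integer $k\geq G$ there exists an integer $n\geq 0$ such that none of the integers $f(n+1),f(n+2),\dots,f(n+k)$ is coprime to all the others. Moreover, for every integer $k\geq G_f$ there are infinitely many integers $n\geq 0$ such that none of $f(n+1),f(n+2),\dots,f(n+k)$ is coprime to all the others.
   Context: For a polynomial $f\in\mathbb{Z}[X]$, consider the sequence $s(n)=f(n)$, $n\geq 1$. We say that a block of $k$ consecutive terms $f(n+1),\dots,f(n+k)$ (with $n\geq 0$) has the property "none of them is coprime to all the others" if for every $i\in\{1,\dots,k\}$ there exists $j\in\{1,\dots,k\}$, $j\neq i$, with $\gcd(f(n+i),f(n+j))>1$. $G_f$ denotes the smallest integer $G\geq 2$ such that for every $k\geq G$ there exist $k$ consecutive terms $f(n+1),\dots,f(n+k)$ ($n\ge 0$) with this property (if such an integer exists). -}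

module Defs where

open import Data.Nat using (ℕ; zero; suc; _≤_; _<_; _>_)
open import Data.Nat.GCD using (gcd)
open import Data.Integer using (ℤ; +_; ∣_∣) renaming (_+_ to _+ℤ_; _*_ to _*ℤ_)
open import Data.List using (List; []; _∷_; _++_; [_]; length)
open import Data.Product using (Σ; ∃; ∃-syntax; _×_)
open import Relation.Binary.PropositionalEquality using (_≡_; _≢_)

-- A polynomial in ℤ[X] is represented by its coefficient list,
-- lowest degree first: a₀ ∷ a₁ ∷ … ∷ a_d ∷ [] represents a₀ + a₁ X + … + a_d X^d.
Poly : Set
Poly = List ℤ

eval : Poly → ℤ → ℤ
eval []       x = + 0
eval (a ∷ cs) x = a +ℤ (x *ℤ eval cs x)

HasDegree : Poly → ℕ → Set
HasDegree f d = Σ (List ℤ) λ cs → Σ ℤ λ a →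
  (f ≡ cs ++ [ a ]) × (a ≢ + 0) × (length cs ≡ d)

s : Poly → ℕ → ℤ
s f m = eval f (+ m)

NoneCoprimeToOthers : Poly → ℕ → ℕ → Set
NoneCoprimeToOthers f n k =
  ∀ i → 1 ≤ i → i ≤ k →
    ∃[ j ] (1 ≤ j × j ≤ k × j ≢ i ×
            gcd ∣ s f (n Data.Nat.+ i) ∣ ∣ s f (n Data.Nat.+ j) ∣ > 1)
  where import Data.Nat

Works : Poly → ℕ → Set
Works f G = 2 ≤ G × (∀ k → G ≤ k → ∃[ n ] NoneCoprimeToOthers f n k)

IsGf : Poly → ℕ → Set
IsGf f G = Works f G × (∀ G' → G' < G → Works f G' → Data.Empty.⊥)
  where import Data.Empty

{-# OPTIONS --safe #-}
-- By the Chinese remainder theorem it suffices to attach to each position i of an interval of length k a prime p, with one residue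
-- class for each prime used, such that p divides f at i and at another position of the interval; adding multiples of the moduli
-- to n gives infinitely many n.  Completing the square or the cube, c f(x) = g(A x + B) with g = X² - Δ or g = X³ + P X + Q.
--
-- If g has an integer root then f has a root modulo every large prime.  Give class 0 to the primes between a constant Y and k,
-- except for many free primes p ≤ k/2 supplied by Chebyshev's estimates, chosen in one class modulo a few small primes that cover
-- their multiples p m.  The positions left over are Y-smooth, hence few, and each of them gets a free prime of its own.
--
-- If g is irreducible, two facts are needed.
-- (A) ∑ 1/p over the primes modulo which g has a root is unbounded.  Otherwise compare with the values of the norm form N of
--     ℤ[X]/(g) on a box: two points of one class modulo p on which p ∣ N differ by a vector whose norm is at least p, so
--     only O(1/p) of the points of the box have norm divisible by p.
-- (B) At least c K primes have two roots of g at distance δ d with 1 ≤ d ≤ K.  These are the prime divisors of ∏ T(d), where T is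
--     a resultant.  If they were few they would carry nearly all of K!; but modulo each of them g splits, and the pigeonhole
--     principle on differences in a √K × √K box shows that such primes carry at most about √(K!).
-- Choosing classes greedily for primes from (A) covers all but k/E positions, and each remaining one gets its own prime from (B).
module Submission where

open import Defs
open import Data.Nat using (ℕ; zero; suc; _+_; _*_; _∸_; _^_; _≤_; _<_; _>_; z≤n; s≤s; NonZero; _≤?_; _<?_; _⊔_; _!; >-nonZero; >-nonZero⁻¹; ≢-nonZero; nonZero)
open import Data.Nat.Properties
open import Data.Nat.Divisibility using (_∣_; divides; _∣?_; ∣-trans; ∣-refl; ∣⇒≤; m∣m*n; ∣m∣n⇒∣m+n; ∣m+n∣m⇒∣n; ∣1⇒≡1; 0∣⇒≡0; *-monoʳ-∣; *-pres-∣; ∣n⇒∣m*n; ∣m⇒∣m*n; *-cancelʳ-∣; m≤n⇒m!∣n!; _∣0)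
open import Data.Nat.DivMod using (_/_; _%_; m≡m%n+[m/n]*n; m%n<n; m/n*n≤m; /-monoˡ-≤; m*n/n≡m)
open import Data.Nat.Primality using (Prime; prime?; prime⇒nonZero; prime⇒nonTrivial; euclidsLemma; prime⇒irreducible; productOfPrimes≥1)
open import Data.Nat.Primality.Factorisation using (factorise; module PrimeFactorisation)
open import Data.Nat.Coprimality using (Coprime; coprime-divisor; coprime-Bézout)
open import Data.Nat.GCD using (module Bézout; gcd; gcd-greatest; gcd[m,n]∣m; gcd[m,n]∣n)
open import Data.Nat.Induction using (<-rec)
open import Data.Product.Properties using (≡-dec)
open import Data.Nat.ListAction using (sum; product)
open import Data.Nat.ListAction.Properties using (product-++; ∈⇒∣product)
open import Data.Integer using (ℤ; +_; -[1+_]; ∣_∣; _%ℕ_; _/ℕ_) renaming (_+_ to _⊕_; _*_ to _⊗_; _-_ to _⊖_; -_ to ⊝_)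
open import Data.Integer.Divisibility.Signed using () renaming (_∣_ to _∣ℤ_; _∣?_ to _∣ℤ?_; divides to dividesℤ)
open import Data.Bool using (Bool; true; false)
open import Data.Empty using (⊥; ⊥-elim)
open import Data.Product using (∃-syntax; _×_; _,_; proj₁; proj₂)
open import Data.Sum using (_⊎_; inj₁; inj₂; [_,_]′)
open import Data.List using (List; []; _∷_; _++_; map; length; filter; upTo; concatMap; cartesianProduct)
open import Data.List.Properties using (map-++; length-map; length-++; length-upTo; length-filter; filter-accept; filter-reject)
open import Data.List.Membership.Propositional using (_∈_; _∉_)
open import Data.List.Membership.DecPropositional _≟_ using (_∈?_)
open import Data.List.Membership.Propositional.Properties using (∈-∃++; ∈-++⁺ˡ; ∈-++⁺ʳ; ∈-++⁻; ∈-map⁺; ∈-map⁻; ∈-filter⁺; ∈-filter⁻; ∈-upTo⁺; ∈-upTo⁻; ∈-cartesianProduct⁺; ∈-cartesianProduct⁻)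
open import Data.List.Relation.Unary.All using (All; []; _∷_) renaming (lookup to All-lookup; tabulate to All-tabulate; map to All-map)
open import Data.List.Relation.Unary.Any using (here; there)
open import Data.List.Relation.Unary.AllPairs using ([]; _∷_)
open import Data.List.Relation.Unary.Unique.Propositional using (Unique)
open import Relation.Nullary using (¬_; Dec; yes; no; ¬?; _×-dec_)
open import Relation.Binary.PropositionalEquality using (_≡_; _≢_; refl; sym; trans; cong; cong₂; subst; subst₂; module ≡-Reasoning)
open import Function using (_∘_; id; case_of_)

import Data.Integer.Properties as ℤₚ
import Data.Integer.Divisibility.Signed as ℤ∣
import Data.Integer.DivMod as ℤ/
import Data.List.Relation.Unary.Unique.Propositional.Properties as Uniqueₚ
import Data.Integer.Tactic.RingSolver as ℤ-Ring
import Data.Nat.Tactic.RingSolver as ℕ-Ring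

-- Counting in lists

-- A prime that uses one root of f covers a second position only if it is smaller than k, and there
-- are only about k / log k such primes. For irreducible g the greedy choice is only known to leave
-- at most a fixed proportion of the k positions, too many for those primes. Hence (B): primes of
-- any size with two roots at distance at most k/2. Its count is linear in K, without a logarithm,
-- because each value T(d) is at most a power of K: the gap between K! and √(K!) is about K^(K/2),
-- and one prime closes only a bounded power of K of it. The degree enters here. Two distinct roots
-- of g modulo p force g of degree 2 or 3 to split modulo every power of p, as the roots add up to
-- 0. Only then is the binary form of g a product of linear forms, to each of which the pigeonhole
-- principle applies. If g has an integer root, close pairs may be missing altogether (g = X² has
-- one root modulo p). But then all large primes can be used, and the left-over positions can be
-- pressed below k / log k, down to smooth numbers, which number a power of log k.

unique-⊆⇒length≤ : ∀ {A : Set} {xs ys : List A} → Unique xs → (∀ {x} → x ∈ xs → x ∈ ys) → length xs ≤ length ys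
unique-⊆⇒length≤ {xs = []} u sub = z≤n
unique-⊆⇒length≤ {xs = x ∷ xs} (x∉ ∷ u) sub with ∈-∃++ (sub (here refl))
... | as , bs , refl = begin
  suc (length xs)               ≤⟨ s≤s (unique-⊆⇒length≤ u sub′) ⟩
  suc (length (as ++ bs))       ≡⟨ cong suc (length-++ as) ⟩
  suc (length as + length bs)   ≡⟨ +-suc (length as) (length bs) ⟨
  length as + suc (length bs)   ≡⟨ length-++ as ⟨
  length (as ++ x ∷ bs)         ∎
  where
  open ≤-Reasoning
  sub′ : ∀ {y} → y ∈ xs → y ∈ as ++ bs
  sub′ {y} y∈ with ∈-++⁻ as (sub (there y∈))
  ... | inj₁ y∈as = ∈-++⁺ˡ y∈as
  ... | inj₂ (here refl) = ⊥-elim (All-lookup x∉ y∈ refl)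
  ... | inj₂ (there y∈bs) = ∈-++⁺ʳ as y∈bs

map⁺-injOn : ∀ {A B : Set} (φ : A → B) {xs : List A} → (∀ {x y} → x ∈ xs → y ∈ xs → φ x ≡ φ y → x ≡ y) → Unique xs → Unique (map φ xs)
map⁺-injOn φ {[]} inj u = []
map⁺-injOn φ {x ∷ xs} inj (x∉ ∷ u) =
  All-tabulate (λ {z} z∈ e → case ∈-map⁻ φ z∈ of λ { (y , y∈ , z≡) → All-lookup x∉ y∈ (inj (here refl) (there y∈) (trans e z≡)) })
  ∷ map⁺-injOn φ (λ a b → inj (there a) (there b)) u

injOn⇒length≤ : ∀ {A B : Set} (φ : A → B) {xs : List A} {ys : List B} → Unique xs →
  (∀ {x} → x ∈ xs → φ x ∈ ys) → (∀ {x y} → x ∈ xs → y ∈ xs → φ x ≡ φ y → x ≡ y) → length xs ≤ length ys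
injOn⇒length≤ φ {xs} {ys} u into inj = subst (_≤ length ys) (length-map φ xs)
  (unique-⊆⇒length≤ (map⁺-injOn φ inj u) λ z∈ → case ∈-map⁻ φ z∈ of λ { (y , y∈ , refl) → into y∈ })

length-cartesianProduct : ∀ {A B : Set} (xs : List A) (ys : List B) → length (cartesianProduct xs ys) ≡ length xs * length ys
length-cartesianProduct [] ys = refl
length-cartesianProduct (x ∷ xs) ys = trans (length-++ (map (x ,_) ys)) (cong₂ _+_ (length-map (x ,_) ys) (length-cartesianProduct xs ys))

length-filter-split : ∀ {A : Set} {P : A → Set} (P? : ∀ x → Dec (P x)) (xs : List A) →
  length (filter P? xs) + length (filter (λ x → ¬? (P? x)) xs) ≡ length xs
length-filter-split P? [] = refl
length-filter-split P? (x ∷ xs) with P? x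
... | yes _ = cong suc (length-filter-split P? xs)
... | no _ = trans (+-suc _ _) (cong suc (length-filter-split P? xs))

*-^ : ∀ a b n → (a * b) ^ n ≡ a ^ n * b ^ n
*-^ a b zero = refl
*-^ a b (suc n) rewrite *-^ a b n = interchange a b (a ^ n) (b ^ n)
  where
  interchange : ∀ a b c d → a * b * (c * d) ≡ a * c * (b * d)
  interchange = ℕ-Ring.solve-∀

-- Sums and products over lists

∑ : ∀ {A : Set} → List A → (A → ℕ) → ℕ
∑ [] f = 0
∑ (x ∷ xs) f = f x + ∑ xs f

∏ : ∀ {A : Set} → List A → (A → ℕ) → ℕ
∏ [] f = 1
∏ (x ∷ xs) f = f x * ∏ xs f

𝟙 : ∀ {P : Set} → Dec P → ℕ
𝟙 (yes _) = 1
𝟙 (no _) = 0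

module _ {A : Set} where

  ∑-cong : ∀ (xs : List A) {f g} → (∀ x → x ∈ xs → f x ≡ g x) → ∑ xs f ≡ ∑ xs g
  ∑-cong [] h = refl
  ∑-cong (x ∷ xs) h = cong₂ _+_ (h x (here refl)) (∑-cong xs λ y y∈ → h y (there y∈))

  ∑-mono : ∀ (xs : List A) {f g} → (∀ x → x ∈ xs → f x ≤ g x) → ∑ xs f ≤ ∑ xs g
  ∑-mono [] h = z≤n
  ∑-mono (x ∷ xs) h = +-mono-≤ (h x (here refl)) (∑-mono xs λ y y∈ → h y (there y∈))

  ∑-+ : ∀ (xs : List A) f g → ∑ xs (λ x → f x + g x) ≡ ∑ xs f + ∑ xs g
  ∑-+ [] f g = refl
  ∑-+ (x ∷ xs) f g rewrite ∑-+ xs f g = interchange (f x) (g x) (∑ xs f) (∑ xs g)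
    where
    interchange : ∀ a b c d → a + b + (c + d) ≡ a + c + (b + d)
    interchange = ℕ-Ring.solve-∀

  ∑-*ˡ : ∀ (xs : List A) c f → ∑ xs (λ x → c * f x) ≡ c * ∑ xs f
  ∑-*ˡ [] c f = sym (*-zeroʳ c)
  ∑-*ˡ (x ∷ xs) c f rewrite ∑-*ˡ xs c f = sym (*-distribˡ-+ c (f x) (∑ xs f))

  ∑-const : ∀ (xs : List A) c → ∑ xs (λ _ → c) ≡ length xs * c
  ∑-const [] c = refl
  ∑-const (x ∷ xs) c = cong (λ t → c + t) (∑-const xs c)

  ∑-𝟙 : ∀ {P : A → Set} (P? : ∀ x → Dec (P x)) (xs : List A) → ∑ xs (λ x → 𝟙 (P? x)) ≡ length (filter P? xs)
  ∑-𝟙 P? [] = refl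
  ∑-𝟙 P? (x ∷ xs) with P? x
  ... | yes _ = cong suc (∑-𝟙 P? xs)
  ... | no _ = ∑-𝟙 P? xs

  ∏-cong : ∀ (xs : List A) {f g} → (∀ x → x ∈ xs → f x ≡ g x) → ∏ xs f ≡ ∏ xs g
  ∏-cong [] h = refl
  ∏-cong (x ∷ xs) h = cong₂ _*_ (h x (here refl)) (∏-cong xs λ y y∈ → h y (there y∈))

  ∏-mono : ∀ (xs : List A) {f g} → (∀ x → x ∈ xs → f x ≤ g x) → ∏ xs f ≤ ∏ xs g
  ∏-mono [] h = ≤-refl
  ∏-mono (x ∷ xs) h = *-mono-≤ (h x (here refl)) (∏-mono xs λ y y∈ → h y (there y∈))

  ∏-* : ∀ (xs : List A) f g → ∏ xs (λ x → f x * g x) ≡ ∏ xs f * ∏ xs g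
  ∏-* [] f g = refl
  ∏-* (x ∷ xs) f g rewrite ∏-* xs f g = interchange (f x) (g x) (∏ xs f) (∏ xs g)
    where
    interchange : ∀ a b c d → a * b * (c * d) ≡ a * c * (b * d)
    interchange = ℕ-Ring.solve-∀

  ∏-const : ∀ (xs : List A) c → ∏ xs (λ _ → c) ≡ c ^ length xs
  ∏-const [] c = refl
  ∏-const (x ∷ xs) c = cong (c *_) (∏-const xs c)

  ∏-^ : ∀ (xs : List A) f n → ∏ xs (λ x → f x ^ n) ≡ ∏ xs f ^ n
  ∏-^ [] f n = sym (^-zeroˡ n)
  ∏-^ (x ∷ xs) f n rewrite ∏-^ xs f n = sym (*-^ (f x) (∏ xs f) n)

  ∏-base^ : ∀ (xs : List A) p f → ∏ xs (λ x → p ^ f x) ≡ p ^ ∑ xs f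
  ∏-base^ [] p f = refl
  ∏-base^ (x ∷ xs) p f rewrite ∏-base^ xs p f = sym (^-distribˡ-+-* p (f x) (∑ xs f))

  ∏-∣ : ∀ (xs : List A) {f g} → (∀ x → x ∈ xs → f x ∣ g x) → ∏ xs f ∣ ∏ xs g
  ∏-∣ [] h = ∣-refl
  ∏-∣ (x ∷ xs) h = *-pres-∣ (h x (here refl)) (∏-∣ xs λ y y∈ → h y (there y∈))

  ∏-pos : ∀ (xs : List A) {f} → (∀ x → x ∈ xs → 1 ≤ f x) → 1 ≤ ∏ xs f
  ∏-pos [] h = ≤-refl
  ∏-pos (x ∷ xs) h = *-mono-≤ (h x (here refl)) (∏-pos xs λ y y∈ → h y (there y∈))

  ∑-∈ : ∀ {xs : List A} {x} f → x ∈ xs → f x ≤ ∑ xs f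
  ∑-∈ f (here refl) = m≤m+n _ _
  ∑-∈ {y ∷ xs} f (there m) = ≤-trans (∑-∈ f m) (m≤n+m _ (f y))

  ∣∏ : ∀ {xs : List A} {x} f → x ∈ xs → f x ∣ ∏ xs f
  ∣∏ f (here refl) = m∣m*n _
  ∣∏ {y ∷ xs} f (there m) = ∣n⇒∣m*n (f y) (∣∏ f m)

∑-swap : ∀ {A B : Set} (xs : List A) (ys : List B) (f : A → B → ℕ) →
  ∑ xs (λ x → ∑ ys (λ y → f x y)) ≡ ∑ ys (λ y → ∑ xs (λ x → f x y))
∑-swap [] ys f = sym (trans (∑-const ys 0) (*-zeroʳ (length ys)))
∑-swap (x ∷ xs) ys f rewrite ∑-swap xs ys f = sym (∑-+ ys (f x) (λ y → ∑ xs (λ x → f x y)))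

∏-swap : ∀ {A B : Set} (xs : List A) (ys : List B) (f : A → B → ℕ) →
  ∏ xs (λ x → ∏ ys (λ y → f x y)) ≡ ∏ ys (λ y → ∏ xs (λ x → f x y))
∏-swap [] ys f = sym (trans (∏-const ys 1) (^-zeroˡ (length ys)))
∏-swap (x ∷ xs) ys f rewrite ∏-swap xs ys f = sym (∏-* ys (f x) (λ y → ∏ xs (λ x → f x y)))

𝟙-yes : ∀ {P : Set} (d : Dec P) → P → 𝟙 d ≡ 1
𝟙-yes (yes _) p = refl
𝟙-yes (no ¬p) p = ⊥-elim (¬p p)

𝟙-no : ∀ {P : Set} (d : Dec P) → ¬ P → 𝟙 d ≡ 0
𝟙-no (yes p) ¬p = ⊥-elim (¬p p)
𝟙-no (no _) ¬p = refl

𝟙≤1 : ∀ {P : Set} (d : Dec P) → 𝟙 d ≤ 1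
𝟙≤1 (yes _) = ≤-refl
𝟙≤1 (no _) = z≤n

𝟙-mono : ∀ {P Q : Set} (d : Dec P) (e : Dec Q) → (P → Q) → 𝟙 d ≤ 𝟙 e
𝟙-mono (yes p) e h = ≤-reflexive (sym (𝟙-yes e (h p)))
𝟙-mono (no _) e h = z≤n

-- Primes

prime≥2 : ∀ {p} → Prime p → 2 ≤ p
prime≥2 {suc (suc p)} pr = s≤s (s≤s z≤n)
prime≥2 {zero} pr = ⊥-elim (case prime⇒nonZero pr of λ ())
prime≥2 {suc zero} pr = ⊥-elim (case prime⇒nonTrivial pr of λ ())

prime≥1 : ∀ {p} → Prime p → 1 ≤ p
prime≥1 pr = ≤-trans (s≤s z≤n) (prime≥2 pr)

prime∤1 : ∀ {p} → Prime p → ¬ p ∣ 1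
prime∤1 pr d = case subst (2 ≤_) (∣1⇒≡1 d) (prime≥2 pr) of λ { (s≤s ()) }

∃-prime-∣ : ∀ n → 2 ≤ n → ∃[ p ] (Prime p × p ∣ n)
∃-prime-∣ n 2≤n with factorise n {{>-nonZero (≤-trans (s≤s z≤n) 2≤n)}}
... | record { factors = [] ; isFactorisation = eq } = ⊥-elim (1+n≰n (subst (2 ≤_) eq 2≤n))
... | record { factors = p ∷ ps ; isFactorisation = eq ; factorsPrime = pr ∷ _ } = p , pr , subst (p ∣_) (sym eq) (m∣m*n (product ps))

prime-∣-prime : ∀ {p q} → Prime p → Prime q → p ∣ q → p ≡ q
prime-∣-prime {p} pp pq p∣q with prime⇒irreducible pq p∣q
... | inj₁ refl = ⊥-elim (prime∤1 pp ∣-refl)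
... | inj₂ e = e

prime-∣^ : ∀ {p} → Prime p → ∀ a e → p ∣ a ^ e → p ∣ a
prime-∣^ pp a zero d = ⊥-elim (prime∤1 pp d)
prime-∣^ pp a (suc e) d with euclidsLemma a (a ^ e) pp d
... | inj₁ x = x
... | inj₂ y = prime-∣^ pp a e y

prime-∣∏ : ∀ {A : Set} {p} → Prime p → ∀ (xs : List A) f → p ∣ ∏ xs f → ∃[ x ] (x ∈ xs × p ∣ f x)
prime-∣∏ pp [] f d = ⊥-elim (prime∤1 pp d)
prime-∣∏ pp (x ∷ xs) f d with euclidsLemma (f x) _ pp d
... | inj₁ h = x , here refl , h
... | inj₂ h = case prime-∣∏ pp xs f h of λ { (y , y∈ , hy) → y , there y∈ , hy }

coprime-by-primes : ∀ {a b} → (∀ {r} → Prime r → r ∣ a → r ∣ b → ⊥) → Coprime a b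
-- The common divisor 0 occurs only for a = b = 0, where every prime divides both.
coprime-by-primes {a} {b} h {zero} (i∣a , i∣b) rewrite 0∣⇒≡0 i∣a | 0∣⇒≡0 i∣b = ⊥-elim (case ∃-prime-∣ 2 ≤-refl of λ { (r , pr , _) → h pr (r ∣0) (r ∣0) })
coprime-by-primes h {suc zero} _ = refl
coprime-by-primes h {suc (suc i)} (i∣a , i∣b) = ⊥-elim (case ∃-prime-∣ (suc (suc i)) (s≤s (s≤s z≤n)) of λ { (r , pr , r∣i) → h pr (∣-trans r∣i i∣a) (∣-trans r∣i i∣b) })

coprime-*-∣ : ∀ {m n k} → Coprime m n → m ∣ k → n ∣ k → m * n ∣ k
coprime-*-∣ {m} {n} {k} c (divides q refl) n∣k = subst (m * n ∣_) (*-comm m q) (*-monoʳ-∣ m (coprime-divisor (λ { (x , y) → c (y , x) }) (subst (n ∣_) (*-comm q m) n∣k)))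

∏-prime-powers-∣ : ∀ (ps : List ℕ) (e : ℕ → ℕ) n → Unique ps → All Prime ps → (∀ p → p ∈ ps → p ^ e p ∣ n) → ∏ ps (λ p → p ^ e p) ∣ n
∏-prime-powers-∣ [] e n u pr h = divides n (sym (*-identityʳ n))
∏-prime-powers-∣ (p ∷ ps) e n (p∉ ∷ u) (pp ∷ pr) h =
  coprime-*-∣ (coprime-by-primes cop) (h p (here refl)) (∏-prime-powers-∣ ps e n u pr (λ q q∈ → h q (there q∈)))
  where
  cop : ∀ {r} → Prime r → r ∣ p ^ e p → r ∣ ∏ ps (λ q → q ^ e q) → ⊥
  cop {r} rr d d′ with prime-∣∏ rr ps _ d′
  ... | q , q∈ , r∣q = All-lookup p∉ q∈ (trans (sym (prime-∣-prime rr pp (prime-∣^ rr p (e p) d))) (prime-∣-prime rr (All-lookup pr q∈) (prime-∣^ rr q (e q) r∣q)))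

-- Divisibility of integers by naturals

abs-∣ : ∀ {n x} → + n ∣ℤ x → n ∣ ∣ x ∣
abs-∣ = ℤ∣.∣⇒∣ᵤ

∣-abs : ∀ {n x} → n ∣ ∣ x ∣ → + n ∣ℤ x
∣-abs = ℤ∣.∣ᵤ⇒∣

primeℤ : ∀ {p} → Prime p → ∀ x y → + p ∣ℤ x ⊗ y → + p ∣ℤ x ⊎ + p ∣ℤ y
primeℤ {p} pp x y d with euclidsLemma ∣ x ∣ ∣ y ∣ pp (subst (p ∣_) (ℤₚ.abs-* x y) (abs-∣ d))
... | inj₁ h = inj₁ (∣-abs h)
... | inj₂ h = inj₂ (∣-abs h)

inverse-mod : ∀ {m n} → Coprime m n → ∃[ b ] + n ∣ℤ (+ m ⊗ b ⊖ + 1)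
inverse-mod {m} {n} c with coprime-Bézout c
... | Bézout.+- x y eq = + x , dividesℤ (+ y) (begin
    + m ⊗ + x ⊖ + 1                ≡⟨ cong (_⊖ + 1) (trans (ℤₚ.*-comm (+ m) (+ x)) (sym (ℤₚ.pos-* x m))) ⟩
    + (x * m) ⊖ + 1                ≡⟨ cong (λ t → + t ⊖ + 1) eq ⟨
    + (1 + y * n) ⊖ + 1            ≡⟨ cong (_⊖ + 1) (ℤₚ.pos-+ 1 (y * n)) ⟩
    (+ 1 ⊕ + (y * n)) ⊖ + 1        ≡⟨ cong (λ t → (+ 1 ⊕ t) ⊖ + 1) (ℤₚ.pos-* y n) ⟩
    (+ 1 ⊕ + y ⊗ + n) ⊖ + 1        ≡⟨ lem (+ y ⊗ + n) ⟩
    + y ⊗ + n                      ∎)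
  where
  open ≡-Reasoning
  lem : ∀ t → (+ 1 ⊕ t) ⊖ + 1 ≡ t
  lem = ℤ-Ring.solve-∀
... | Bézout.-+ x y eq = ⊝ (+ x) , dividesℤ (⊝ (+ y)) (begin
    + m ⊗ ⊝ (+ x) ⊖ + 1             ≡⟨ lem (+ m) (+ x) ⟩
    ⊝ (+ 1 ⊕ + x ⊗ + m)             ≡⟨ cong (λ t → ⊝ (+ 1 ⊕ t)) (ℤₚ.pos-* x m) ⟨
    ⊝ (+ 1 ⊕ + (x * m))             ≡⟨ cong ⊝_ (ℤₚ.pos-+ 1 (x * m)) ⟨
    ⊝ (+ (1 + x * m))               ≡⟨ cong (λ t → ⊝ (+ t)) eq ⟩
    ⊝ (+ (y * n))                   ≡⟨ cong ⊝_ (ℤₚ.pos-* y n) ⟩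
    ⊝ (+ y ⊗ + n)                   ≡⟨ ℤₚ.neg-distribˡ-* (+ y) (+ n) ⟩
    ⊝ (+ y) ⊗ + n                   ∎)
  where
  open ≡-Reasoning
  lem : ∀ m x → m ⊗ ⊝ x ⊖ + 1 ≡ ⊝ (+ 1 ⊕ x ⊗ m)
  lem = ℤ-Ring.solve-∀

prime-coprime : ∀ {p} → Prime p → ∀ {a} → ¬ p ∣ a → Coprime a p
prime-coprime {p} pp {a} p∤a = coprime-by-primes λ {r} rr r∣a r∣p → p∤a (subst (_∣ a) (prime-∣-prime rr pp r∣p) r∣a)

prime-inverse : ∀ {p} → Prime p → ∀ a → ¬ (+ p ∣ℤ a) → ∃[ b ] + p ∣ℤ (a ⊗ b ⊖ + 1)
prime-inverse {p} pp (+ a) h = inverse-mod (prime-coprime pp λ d → h (∣-abs d))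
prime-inverse {p} pp a@(-[1+ k ]) h with inverse-mod (prime-coprime pp {suc k} λ d → h (∣-abs d))
... | b , d = ⊝ b , subst (λ t → + p ∣ℤ (t ⊖ + 1)) (lem (+ suc k) b) d
  where
  lem : ∀ a b → a ⊗ b ≡ (⊝ a) ⊗ (⊝ b)
  lem = ℤ-Ring.solve-∀

∣ℤ-≡ : ∀ {k x y} → x ≡ y → k ∣ℤ x → k ∣ℤ y
∣ℤ-≡ refl d = d

-- Residue systems and the Chinese remainder theorem

eval-cong : ∀ {m} f {x y} → m ∣ℤ (x ⊖ y) → m ∣ℤ (eval f x ⊖ eval f y)
eval-cong [] d = dividesℤ (+ 0) refl
eval-cong (a ∷ f) {x} {y} d = ∣ℤ-≡ (lem a x y (eval f x) (eval f y))
  (ℤ∣.∣m∣n⇒∣m+n (ℤ∣.∣n⇒∣m*n x (eval-cong f d)) (ℤ∣.∣m⇒∣m*n (eval f y) d))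
  where
  lem : ∀ a x y u v → x ⊗ (u ⊖ v) ⊕ (x ⊖ y) ⊗ v ≡ (a ⊕ x ⊗ u) ⊖ (a ⊕ y ⊗ v)
  lem = ℤ-Ring.solve-∀

∣-transfer : ∀ {m x y} → m ∣ℤ (x ⊖ y) → m ∣ℤ y → m ∣ℤ x
∣-transfer {x = x} {y} d e = ∣ℤ-≡ (lem x y) (ℤ∣.∣m∣n⇒∣m+n d e)
  where
  lem : ∀ x y → (x ⊖ y) ⊕ y ≡ x
  lem = ℤ-Ring.solve-∀

eval-transfer : ∀ {m} f {x y} → m ∣ℤ (x ⊖ y) → m ∣ℤ eval f y → m ∣ℤ eval f x
eval-transfer f d = ∣-transfer (eval-cong f d)

∣-⊖-sym : ∀ {m} x y → m ∣ℤ (x ⊖ y) → m ∣ℤ (y ⊖ x)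
∣-⊖-sym x y d = ∣ℤ-≡ (lem x y) (ℤ∣.∣m⇒∣-m d)
  where
  lem : ∀ x y → ⊝ (x ⊖ y) ≡ y ⊖ x
  lem = ℤ-Ring.solve-∀

%ℕ-cong : ∀ x p .{{_ : NonZero p}} → + p ∣ℤ (+ (x %ℕ p) ⊖ x)
%ℕ-cong x p = dividesℤ (⊝ (x /ℕ p)) (trans (cong (λ t → + (x %ℕ p) ⊖ t) (ℤ/.a≡a%ℕn+[a/ℕn]*n x p)) (lem (+ (x %ℕ p)) (x /ℕ p) (+ p)))
  where
  lem : ∀ r q p → r ⊖ (r ⊕ q ⊗ p) ≡ (⊝ q) ⊗ p
  lem = ℤ-Ring.solve-∀

-- The bound `N` is met by the solution of the empty system, and each further congruence only adds a
-- multiple of the earlier moduli. It serves to place the interval beyond the zeros of f.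
chinese-remainder : ∀ (ms : List (ℕ × ℤ)) → All (Prime ∘ proj₁) ms → Unique (map proj₁ ms) → ∀ N →
  ∃[ n ] (N ≤ n × ∀ {m} → m ∈ ms → + proj₁ m ∣ℤ (+ n ⊖ proj₂ m))
chinese-remainder [] _ _ N = N , ≤-refl , λ ()
chinese-remainder ((p , r) ∷ ms) (pp ∷ prs) (p∉ ∷ u) N with chinese-remainder ms prs u N
... | n₀ , N≤n₀ , h₀ = n , ≤-trans N≤n₀ (m≤m+n n₀ (M * t)) , h
  where
  instance _ = prime⇒nonZero pp
  M = ∏ ms proj₁
  p∤M : ¬ p ∣ M
  p∤M d with prime-∣∏ pp ms proj₁ d
  ... | m , m∈ , p∣m = All-lookup p∉ (∈-map⁺ proj₁ m∈) (prime-∣-prime pp (All-lookup prs m∈) p∣m)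
  inv = inverse-mod (prime-coprime pp p∤M)
  b = proj₁ inv
  t = (b ⊗ (r ⊖ + n₀)) %ℕ p
  n = n₀ + M * t
  n≡ : + n ≡ + n₀ ⊕ + M ⊗ + t
  n≡ = trans (ℤₚ.pos-+ n₀ (M * t)) (cong (λ z → + n₀ ⊕ z) (ℤₚ.pos-* M t))
  lem₁ : ∀ M t b e n r → M ⊗ (t ⊖ b ⊗ (r ⊖ n)) ⊕ (M ⊗ b ⊖ + 1) ⊗ (r ⊖ n) ≡ (n ⊕ M ⊗ t) ⊖ r
  lem₁ = ℤ-Ring.solve-∀
  lem₂ : ∀ M t n r → (n ⊖ r) ⊕ M ⊗ t ≡ (n ⊕ M ⊗ t) ⊖ r
  lem₂ = ℤ-Ring.solve-∀
  h : ∀ {m} → m ∈ (p , r) ∷ ms → + proj₁ m ∣ℤ (+ n ⊖ proj₂ m)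
  h (here refl) = subst (λ z → + p ∣ℤ (z ⊖ r)) (sym n≡) (∣ℤ-≡ (lem₁ (+ M) (+ t) b (+ 0) (+ n₀) r)
    (ℤ∣.∣m∣n⇒∣m+n (ℤ∣.∣n⇒∣m*n (+ M) (%ℕ-cong (b ⊗ (r ⊖ + n₀)) p)) (ℤ∣.∣m⇒∣m*n (r ⊖ + n₀) (proj₂ inv))))
  h {q , r′} (there m∈) = subst (λ z → + q ∣ℤ (z ⊖ r′)) (sym n≡) (∣ℤ-≡ (lem₂ (+ M) (+ t) (+ n₀) r′)
    (ℤ∣.∣m∣n⇒∣m+n (h₀ m∈) (ℤ∣.∣m⇒∣m*n {m = + M} (+ t) (∣-abs {x = + M} (∣∏ proj₁ m∈)))))

-- Covering plans and the intervals they produce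

-- A common divisor exceeding 1 makes the gcd exceed 1 only if the values are not both 0, since gcd
-- 0 0 = 0. Intervals are therefore placed where f does not vanish.
EventuallyNonzero : Poly → Set
EventuallyNonzero f = ∃[ N ] ∀ n → N ≤ n → eval f (+ n) ≢ + 0

-- If the sum vanished, |a| would equal x |q|, which is at least x.
∣a+xq∣≥1 : ∀ a x q → ∣ a ∣ < x → q ≢ + 0 → a ⊕ + x ⊗ q ≢ + 0
∣a+xq∣≥1 a x q a<x q≢0 e = <-irrefl refl (begin-strict
  x              ≡⟨ *-identityʳ x ⟨
  x * 1          ≤⟨ *-monoʳ-≤ x (n≢0⇒n>0 λ z → q≢0 (ℤₚ.∣i∣≡0⇒i≡0 z)) ⟩
  x * ∣ q ∣      ≡⟨ ℤₚ.abs-* (+ x) q ⟨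
  ∣ + x ⊗ q ∣    ≡⟨ cong ∣_∣ (trans (lem a (+ x ⊗ q)) (cong (λ z → z ⊖ a) e)) ⟩
  ∣ + 0 ⊖ a ∣    ≡⟨ cong ∣_∣ (ℤₚ.+-identityˡ (⊝ a)) ⟩
  ∣ ⊝ a ∣        ≡⟨ ℤₚ.∣-i∣≡∣i∣ a ⟩
  ∣ a ∣          <⟨ a<x ⟩
  x              ∎)
  where
  open ≤-Reasoning
  lem : ∀ a y → y ≡ (a ⊕ y) ⊖ a
  lem = ℤ-Ring.solve-∀

leading≢0⇒eventuallyNonzero : ∀ cs a → a ≢ + 0 → EventuallyNonzero (cs ++ a ∷ [])
leading≢0⇒eventuallyNonzero [] a a≢0 = 0 , λ n _ e → a≢0 (trans (lem a (+ n)) e)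
  where
  lem : ∀ a n → a ≡ a ⊕ n ⊗ + 0
  lem = ℤ-Ring.solve-∀
leading≢0⇒eventuallyNonzero (c ∷ cs) a a≢0 with leading≢0⇒eventuallyNonzero cs a a≢0
... | N , h = N ⊔ suc ∣ c ∣ , λ n N≤n → ∣a+xq∣≥1 c n (eval (cs ++ a ∷ []) (+ n))
  (≤-trans (m≤n⊔m N (suc ∣ c ∣)) N≤n) (h n (≤-trans (m≤m⊔n N (suc ∣ c ∣)) N≤n))

∣gcd⇒gcd>1 : ∀ {g a b} → 1 < g → g ∣ a → g ∣ b → a ≢ 0 → gcd a b > 1
∣gcd⇒gcd>1 {g} {a} {b} 1<g g∣a g∣b a≢0 = ≤-trans 1<g (∣⇒≤ {{≢-nonZero λ e → a≢0 (0∣⇒≡0 (subst (_∣ a) e (gcd[m,n]∣m a b)))}} (gcd-greatest g∣a g∣b))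

-- A pair (p, r) prescribes n ≡ r modulo p, so that r + i stands for n + i. The data do not mention
-- n: a plan is a finite certificate that any solution of the congruences realises.
record Plan (f : Poly) (k : ℕ) : Set where
  field
    residues : List (ℕ × ℤ)
    primes   : All (Prime ∘ proj₁) residues
    distinct : Unique (map proj₁ residues)
    covers   : ∀ i → 1 ≤ i → i ≤ k → ∃[ j ] (1 ≤ j × j ≤ k × j ≢ i ×
      ∃[ m ] (m ∈ residues × + proj₁ m ∣ℤ eval f (proj₂ m ⊕ + i) × + proj₁ m ∣ℤ eval f (proj₂ m ⊕ + j)))

plan⇒noneCoprime : ∀ {f k} → EventuallyNonzero f → Plan f k → ∃[ n ] NoneCoprimeToOthers f n k
plan⇒noneCoprime {f} {k} (N , nz) P = n , λ i 1≤i i≤k → case covers i 1≤i i≤k of λ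
  { (j , 1≤j , j≤k , j≢i , m@(p , r) , m∈ , di , dj) →
    j , 1≤j , j≤k , j≢i , ∣gcd⇒gcd>1 (prime≥2 (All-lookup primes m∈)) (abs-∣ (move m∈ i di)) (abs-∣ (move m∈ j dj))
      (λ e → nz (n + i) (≤-trans N≤n (m≤m+n n i)) (ℤₚ.∣i∣≡0⇒i≡0 e)) }
  where
  open Plan P
  crt = chinese-remainder residues primes distinct N
  n = proj₁ crt
  N≤n = proj₁ (proj₂ crt)
  lem : ∀ n r i → n ⊖ r ≡ (n ⊕ i) ⊖ (r ⊕ i)
  lem = ℤ-Ring.solve-∀
  move : ∀ {m} → m ∈ residues → ∀ i → + proj₁ m ∣ℤ eval f (proj₂ m ⊕ + i) → + proj₁ m ∣ℤ s f (n + i)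
  move {p , r} m∈ i d = eval-transfer f (∣ℤ-≡ (trans (lem (+ n) r (+ i)) (cong (λ z → z ⊖ (r ⊕ + i)) (sym (ℤₚ.pos-+ n i)))) (proj₂ (proj₂ crt) m∈)) d

-- Translating n by a common multiple of the finitely many gcds involved keeps each of them a common divisor.
noneCoprime-unbounded : ∀ {f n k} → EventuallyNonzero f → NoneCoprimeToOthers f n k → ∀ N → ∃[ n′ ] (N ≤ n′ × NoneCoprimeToOthers f n′ k)
noneCoprime-unbounded {f} {n} {k} (N₀ , nz) nc N = n′ , ≤-trans (m≤m⊔n N N₀) big , nc′
  where
  g : ℕ → ℕ → ℕ
  g i j = gcd ∣ s f (n + i) ∣ ∣ s f (n + j) ∣
  -- `1 ⊔` keeps M positive even if some gcd is 0; the extra index 0 in the ranges is harmless.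
  M = ∏ (upTo (suc k)) λ i → ∏ (upTo (suc k)) λ j → 1 ⊔ g i j
  M≥1 : 1 ≤ M
  M≥1 = ∏-pos (upTo (suc k)) λ i _ → ∏-pos (upTo (suc k)) λ j _ → m≤m⊔n 1 (g i j)
  t = N ⊔ N₀
  n′ = n + t * M
  big : t ≤ n′
  big = ≤-trans (≤-trans (≤-reflexive (sym (*-identityʳ t))) (*-monoʳ-≤ t M≥1)) (m≤n+m (t * M) n)
  g∣M : ∀ {i j} → i ≤ k → j ≤ k → g i j > 1 → g i j ∣ M
  g∣M {i} {j} i≤k j≤k g>1 = subst (_∣ M) (m≤n⇒m⊔n≡n (<⇒≤ g>1))
    (∣-trans (∣∏ (λ j → 1 ⊔ g i j) (∈-upTo⁺ (s≤s j≤k))) (∣∏ (λ i → ∏ (upTo (suc k)) λ j → 1 ⊔ g i j) (∈-upTo⁺ (s≤s i≤k))))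
  lem : ∀ n i c → c ≡ ((n ⊕ c) ⊕ i) ⊖ (n ⊕ i)
  lem = ℤ-Ring.solve-∀
  shifted : ∀ {d} → d ∣ M → ∀ i → d ∣ ∣ s f (n + i) ∣ → d ∣ ∣ s f (n′ + i) ∣
  shifted {d} d∣M i h = abs-∣ (eval-transfer f {+ (n′ + i)} {+ (n + i)} (∣ℤ-≡ eq (∣-abs {d} {+ (t * M)} (∣n⇒∣m*n t d∣M))) (∣-abs h))
    where
    eq : + (t * M) ≡ + (n′ + i) ⊖ + (n + i)
    eq = trans (lem (+ n) (+ i) (+ (t * M))) (cong₂ _⊖_ (sym (trans (ℤₚ.pos-+ n′ i) (cong (_⊕ + i) (ℤₚ.pos-+ n (t * M))))) (sym (ℤₚ.pos-+ n i)))
  nc′ : NoneCoprimeToOthers f n′ k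
  nc′ i 1≤i i≤k with nc i 1≤i i≤k
  ... | j , 1≤j , j≤k , j≢i , g>1 = j , 1≤j , j≤k , j≢i , ∣gcd⇒gcd>1 g>1
    (shifted (g∣M i≤k j≤k g>1) i (gcd[m,n]∣m ∣ s f (n + i) ∣ ∣ s f (n + j) ∣))
    (shifted (g∣M i≤k j≤k g>1) j (gcd[m,n]∣n ∣ s f (n + i) ∣ ∣ s f (n + j) ∣))
    (λ e → nz (n′ + i) (≤-trans (≤-trans (m≤n⊔m N N₀) big) (m≤m+n n′ i)) (ℤₚ.∣i∣≡0⇒i≡0 e))

-- Covering an interval

RootMod : Poly → ℕ → Set
RootMod f p = ∃[ x ] + p ∣ℤ eval f x

-- The numerator of ∑ 1/p over the common denominator `product ps`.
recipSum : List ℕ → ℕ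
recipSum [] = 0
recipSum (p ∷ ps) = product ps + p * recipSum ps

-- Divergence of ∑ 1/p without fractions: beyond every y there is a finite block of primes with ∑
-- 1/p ≥ 1/C, where C does not depend on y.
ManyRootPrimes : Poly → Set
ManyRootPrimes f = ∃[ C ] ∀ y → ∃[ ps ] (Unique ps × All (λ p → Prime p × y < p × RootMod f p) ps × product ps ≤ C * recipSum ps)

-- The prime may be far larger than the interval; it then serves a single position. The fixed factor
-- δ in the distance comes from clearing denominators when roots of g are carried back to f.
RootPair : Poly → ℕ → ℕ → ℕ → Set
RootPair f δ K p = Prime p × ∃[ d ] ∃[ x ] (1 ≤ d × d ≤ K × + p ∣ℤ eval f x × + p ∣ℤ eval f (x ⊕ + (δ * d)))

ManyRootPairs : Poly → Set
ManyRootPairs f = ∃[ c ] ∃[ δ ] ∃[ K₀ ] (1 ≤ δ × ∀ K → K₀ ≤ K → ∃[ ps ] (Unique ps × All (RootPair f δ K) ps × K ≤ c * length ps))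

recipSum-++ : ∀ ps qs → recipSum (ps ++ qs) ≡ recipSum ps * product qs + product ps * recipSum qs
recipSum-++ [] qs = sym (+-identityʳ (recipSum qs))
recipSum-++ (p ∷ ps) qs rewrite recipSum-++ ps qs | product-++ ps qs =
  lem p (product ps) (product qs) (recipSum ps) (recipSum qs)
  where
  lem : ∀ p a b r s → a * b + p * (r * b + a * s) ≡ (a + p * r) * b + p * a * s
  lem = ℕ-Ring.solve-∀

∈⇒≤sum : ∀ {x xs} → x ∈ xs → x ≤ sum xs
∈⇒≤sum (here refl) = m≤m+n _ _
∈⇒≤sum {xs = y ∷ _} (there m) = ≤-trans (∈⇒≤sum m) (m≤n+m _ y)

-- Blocks are concatenated, each starting beyond the sum of the primes already chosen, which keeps
-- them distinct. Each block adds at least 1 / (C + 1), so (C + 1) E of them suffice; C + 1 replaces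
-- C in order to be cancellable.
large-recipSum : ∀ {f} → ManyRootPrimes f → ∀ E → ∃[ ps ] (Unique ps × All (λ p → Prime p × RootMod f p) ps × E * product ps ≤ recipSum ps)
large-recipSum {f} (C , blocks) E with iter (suc C * E)
  where
  iter : ∀ j → ∃[ ps ] (Unique ps × All (λ p → Prime p × RootMod f p) ps × j * product ps ≤ suc C * recipSum ps)
  iter zero = [] , [] , [] , z≤n
  iter (suc j) with iter j
  ... | ps , u , r , h with blocks (sum ps)
  ... | qs , u′ , r′ , h′ = ps ++ qs , Uniqueₚ.++⁺ u u′ disj , All-tabulate rooted , bound
    where
    disj : ∀ {x} → x ∈ ps × x ∈ qs → ⊥
    disj (a , b) = <⇒≱ (proj₁ (proj₂ (All-lookup r′ b))) (∈⇒≤sum a)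
    rooted : ∀ {x} → x ∈ ps ++ qs → Prime x × RootMod f x
    rooted x∈ with ∈-++⁻ ps x∈
    ... | inj₁ a = All-lookup r a
    ... | inj₂ b = case All-lookup r′ b of λ { (p , _ , q) → p , q }
    lem₁ : ∀ j a b → suc j * (a * b) ≡ j * a * b + a * b
    lem₁ = ℕ-Ring.solve-∀
    lem₂ : ∀ c a b r s → c * r * b + a * (c * s) ≡ c * (r * b + a * s)
    lem₂ = ℕ-Ring.solve-∀
    open ≤-Reasoning
    bound : suc j * product (ps ++ qs) ≤ suc C * recipSum (ps ++ qs)
    bound = begin
      suc j * product (ps ++ qs)                            ≡⟨ cong (suc j *_) (product-++ ps qs) ⟩
      suc j * (product ps * product qs)                     ≡⟨ lem₁ j (product ps) (product qs) ⟩
      j * product ps * product qs + product ps * product qs ≤⟨ +-mono-≤ (*-monoˡ-≤ (product qs) h) (*-monoʳ-≤ (product ps) (≤-trans h′ (m≤n+m _ (recipSum qs)))) ⟩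
      suc C * recipSum ps * product qs + product ps * (suc C * recipSum qs) ≡⟨ lem₂ (suc C) (product ps) (product qs) (recipSum ps) (recipSum qs) ⟩
      suc C * (recipSum ps * product qs + product ps * recipSum qs) ≡⟨ cong (suc C *_) (recipSum-++ ps qs) ⟨
      suc C * recipSum (ps ++ qs) ∎
... | ps , u , r , h = ps , u , r , *-cancelˡ-≤ (suc C) (≤-trans (≤-reflexive (sym (*-assoc (suc C) E (product ps)))) h)

∏-pred≤product : ∀ ps → ∏ ps (_∸ 1) ≤ product ps
∏-pred≤product [] = ≤-refl
∏-pred≤product (p ∷ ps) = *-mono-≤ (m∸n≤m p 1) (∏-pred≤product ps)

-- (1 + ∑ 1/p) ∏ (1 - 1/p) ≤ 1, cleared of denominators
[1+recipSum]∏-pred : ∀ ps → All (1 ≤_) ps → (product ps + recipSum ps) * ∏ ps (_∸ 1) ≤ product ps * product ps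
[1+recipSum]∏-pred [] _ = ≤-refl
[1+recipSum]∏-pred (suc q ∷ ps) (_ ∷ h) = begin
  (suc q * a + (a + suc q * r)) * (q * φ)        ≡⟨ lem₁ q a r φ ⟩
  q * suc q * ((a + r) * φ) + q * a * φ          ≤⟨ +-mono-≤ (*-monoʳ-≤ (q * suc q) ([1+recipSum]∏-pred ps h)) (*-monoʳ-≤ (q * a) (∏-pred≤product ps)) ⟩
  q * suc q * (a * a) + q * a * a                ≤⟨ m≤m+n _ (a * a) ⟩
  q * suc q * (a * a) + q * a * a + a * a        ≡⟨ lem₂ q a ⟩
  suc q * a * (suc q * a)                        ∎
  where
  open ≤-Reasoning
  a = product ps
  r = recipSum ps
  φ = ∏ ps (_∸ 1)
  lem₁ : ∀ q a r φ → (suc q * a + (a + suc q * r)) * (q * φ) ≡ q * suc q * ((a + r) * φ) + q * a * φ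
  lem₁ = ℕ-Ring.solve-∀
  lem₂ : ∀ q a → q * suc q * (a * a) + q * a * a + a * a ≡ suc q * a * (suc q * a)
  lem₂ = ℕ-Ring.solve-∀

∃-above-average : ∀ {A : Set} (x : A) xs (f : A → ℕ) → ∃[ y ] (y ∈ x ∷ xs × ∑ (x ∷ xs) f ≤ suc (length xs) * f y)
∃-above-average x [] f = x , here refl , ≤-refl
∃-above-average x (z ∷ zs) f with ∃-above-average z zs f
... | y , y∈ , h with ≤-total (f x) (f y)
... | inj₁ le = y , there y∈ , +-mono-≤ le h
... | inj₂ ge = x , here refl , +-monoʳ-≤ (f x) (≤-trans h (*-monoʳ-≤ (suc (length zs)) ge))

popular-class : ∀ {A : Set} (φ : A → ℕ) p → (U : List A) → 1 ≤ p → (∀ {i} → i ∈ U → φ i < p) → ∃[ c ] (length U ≤ p * length (filter (λ i → φ i ≟ c) U))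
popular-class φ (suc p) U _ φ< with ∃-above-average 0 (map suc (upTo p)) (λ c → length (filter (λ i → φ i ≟ c) U))
... | c , _ , h = c , (begin
  length U                                                   ≡⟨ trans (∑-const U 1) (*-identityʳ (length U)) ⟨
  ∑ U (λ _ → 1)                                              ≤⟨ ∑-mono U (λ i i∈ → ≤-trans (≤-reflexive (sym (𝟙-yes (φ i ≟ φ i) refl))) (∑-∈ (λ c → 𝟙 (φ i ≟ c)) (class∈ (φ i) (φ< i∈)))) ⟩
  ∑ U (λ i → ∑ classes (λ c → 𝟙 (φ i ≟ c)))                  ≡⟨ ∑-swap U classes (λ i c → 𝟙 (φ i ≟ c)) ⟩
  ∑ classes (λ c → ∑ U (λ i → 𝟙 (φ i ≟ c)))                  ≡⟨ ∑-cong classes (λ c _ → ∑-𝟙 (λ i → φ i ≟ c) U) ⟩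
  ∑ classes (λ c → length (filter (λ i → φ i ≟ c) U))        ≤⟨ h ⟩
  suc (length (map suc (upTo p))) * length (filter (λ i → φ i ≟ c) U) ≡⟨ cong (λ n → suc n * length (filter (λ i → φ i ≟ c) U)) (trans (length-map suc (upTo p)) (length-upTo p)) ⟩
  suc p * length (filter (λ i → φ i ≟ c) U) ∎)
  where
  open ≤-Reasoning
  classes = 0 ∷ map suc (upTo p)
  class∈ : ∀ r → r < suc p → r ∈ classes
  class∈ zero _ = here refl
  class∈ (suc r) (s≤s r<p) = there (∈-map⁺ suc (∈-upTo⁺ r<p))

Covered : Poly → ℕ → List (ℕ × ℤ) → ℕ → Set
Covered f k ms i = ∃[ j ] (1 ≤ j × j ≤ k × j ≢ i ×
  ∃[ m ] (m ∈ ms × + proj₁ m ∣ℤ eval f (proj₂ m ⊕ + i) × + proj₁ m ∣ℤ eval f (proj₂ m ⊕ + j)))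

Covered-mono : ∀ {f k ms ms′ i} → (∀ {m} → m ∈ ms → m ∈ ms′) → Covered f k ms i → Covered f k ms′ i
Covered-mono sub (j , a , b , c , m , m∈ , d) = j , a , b , c , m , sub m∈ , d

-- When 2 D ≤ k, the positions i - D and i + D cannot both fall outside 1, ..., k.
partner : ∀ {k D i} → 1 ≤ D → 2 * D ≤ k → 1 ≤ i → i ≤ k → ∃[ j ] (1 ≤ j × j ≤ k × j ≢ i × (j ≡ i + D ⊎ i ≡ j + D))
partner {k} {D} {i} 1≤D 2D≤k 1≤i i≤k with i + D ≤? k
... | yes h = i + D , ≤-trans 1≤i (m≤m+n i D) , h , (λ e → m≢1+n+m i {D ∸ 1} (trans (sym e) (trans (+-comm i D) (cong (_+ i) (sym (m+[n∸m]≡n 1≤D)))))) , inj₁ refl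
... | no h = i ∸ D , m<n⇒0<n∸m D<i , ≤-trans (m∸n≤m i D) i≤k , (λ e → <⇒≢ (∸-monoʳ-< {i} 1≤D (<⇒≤ D<i)) e) , inj₂ (sym (m∸n+n≡m (<⇒≤ D<i)))
  where
  open ≤-Reasoning
  D<i : D < i
  D<i = +-cancelʳ-< D D i (begin-strict
    D + D ≡⟨ cong (λ z → D + z) (sym (+-identityʳ D)) ⟩
    2 * D ≤⟨ 2D≤k ⟩
    k     <⟨ ≰⇒> h ⟩
    i + D ∎)

%≡⇒∣⊖ : ∀ {p c} i .{{_ : NonZero p}} → i % p ≡ c → + p ∣ℤ (+ i ⊖ + c)
%≡⇒∣⊖ {p} i refl = dividesℤ (+ (i / p)) (begin
  + i ⊖ + (i % p)                                   ≡⟨ cong (λ z → + z ⊖ + (i % p)) (m≡m%n+[m/n]*n i p) ⟩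
  + (i % p + i / p * p) ⊖ + (i % p)                 ≡⟨ cong (_⊖ + (i % p)) (ℤₚ.pos-+ (i % p) (i / p * p)) ⟩
  (+ (i % p) ⊕ + (i / p * p)) ⊖ + (i % p)           ≡⟨ lem (+ (i % p)) (+ (i / p * p)) ⟩
  + (i / p * p)                                     ≡⟨ ℤₚ.pos-* (i / p) p ⟩
  + (i / p) ⊗ + p                                   ∎)
  where
  open ≡-Reasoning
  lem : ∀ a b → (a ⊕ b) ⊖ a ≡ b
  lem = ℤ-Ring.solve-∀

class-covered : ∀ {f k p x i} c → Prime p → 2 * p ≤ k → + p ∣ℤ eval f x → 1 ≤ i → i ≤ k → + p ∣ℤ (+ i ⊖ c) → Covered f k ((p , x ⊖ c) ∷ []) i
class-covered {f} {k} {p} {x} {i} c pp 2p≤k root 1≤i i≤k d with partner (prime≥1 pp) 2p≤k 1≤i i≤k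
... | j , 1≤j , j≤k , j≢i , rel = j , 1≤j , j≤k , j≢i , (p , x ⊖ c) , here refl , hit i d , hit j (dj rel)
  where
  lem : ∀ x c i → i ⊖ c ≡ ((x ⊖ c) ⊕ i) ⊖ x
  lem = ℤ-Ring.solve-∀
  hit : ∀ i → + p ∣ℤ (+ i ⊖ c) → + p ∣ℤ eval f ((x ⊖ c) ⊕ + i)
  hit i d = eval-transfer f (∣ℤ-≡ (lem x c (+ i)) d) root
  lem₁ : ∀ i p c → (i ⊖ c) ⊕ p ≡ (i ⊕ p) ⊖ c
  lem₁ = ℤ-Ring.solve-∀
  lem₂ : ∀ j p c → ((j ⊕ p) ⊖ c) ⊖ p ≡ j ⊖ c
  lem₂ = ℤ-Ring.solve-∀
  dj : j ≡ i + p ⊎ i ≡ j + p → + p ∣ℤ (+ j ⊖ c)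
  dj (inj₁ refl) = ∣ℤ-≡ (trans (lem₁ (+ i) (+ p) c) (cong (_⊖ c) (sym (ℤₚ.pos-+ i p)))) (ℤ∣.∣m∣n⇒∣m+n d ℤ∣.∣-refl)
  dj (inj₂ refl) = ∣ℤ-≡ (lem₂ (+ j) (+ p) c) (ℤ∣.∣m∣n⇒∣m-n (subst (λ z → + p ∣ℤ (z ⊖ c)) (ℤₚ.pos-+ j p) d) ℤ∣.∣-refl)

-- Each prime takes the residue class most frequent among the positions still uncovered, so at most
-- a fraction 1 - 1/p of them survives. The condition 2 p ≤ k provides every member of the class
-- with another one at distance p.
greedy : ∀ {f k} ps → All (λ p → Prime p × RootMod f p) ps → All (λ p → 2 * p ≤ k) ps → ∀ U → All (λ i → 1 ≤ i × i ≤ k) U →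
  ∃[ ms ] ∃[ V ] (map proj₁ ms ≡ ps × All (λ i → 1 ≤ i × i ≤ k) V × length V * product ps ≤ length U * ∏ ps (_∸ 1) × (∀ {i} → i ∈ U → i ∈ V ⊎ Covered f k ms i))
greedy [] _ _ U hU = [] , U , refl , hU , ≤-refl , inj₁
greedy {f} {k} (suc q ∷ ps) ((pp , x , root) ∷ rs) (2p≤k ∷ sm) U hU with popular-class (_% suc q) (suc q) U (s≤s z≤n) (λ {i} _ → m%n<n i (suc q))
... | c , pop with greedy {f} {k} ps rs sm (filter (λ i → ¬? (i % suc q ≟ c)) U) (All-tabulate λ i∈ → All-lookup hU (proj₁ (∈-filter⁻ (λ i → ¬? (i % suc q ≟ c)) i∈)))
... | ms , V , refl , hV , bound , cov = (p , x ⊖ + c) ∷ ms , V , refl , hV , bound′ , cov′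
  where
  p = suc q
  Q? = λ i → i % p ≟ c
  U⁺ = filter Q? U
  U⁻ = filter (λ i → ¬? (Q? i)) U
  φ = ∏ ps (_∸ 1)
  drop-popular : p * length U⁻ ≤ q * length U
  drop-popular = +-cancelˡ-≤ (p * length U⁺) _ _ (begin
    p * length U⁺ + p * length U⁻ ≡⟨ *-distribˡ-+ p (length U⁺) (length U⁻) ⟨
    p * (length U⁺ + length U⁻)   ≡⟨ cong (p *_) (length-filter-split Q? U) ⟩
    length U + q * length U       ≤⟨ +-monoˡ-≤ _ pop ⟩
    p * length U⁺ + q * length U  ∎)
    where open ≤-Reasoning
  open ≤-Reasoning
  lem₁ : ∀ v p a → v * (p * a) ≡ p * (v * a)
  lem₁ = ℕ-Ring.solve-∀
  lem₂ : ∀ p u φ → p * (u * φ) ≡ p * u * φ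
  lem₂ = ℕ-Ring.solve-∀
  lem₃ : ∀ q u φ → q * u * φ ≡ u * (q * φ)
  lem₃ = ℕ-Ring.solve-∀
  bound′ : length V * (p * product ps) ≤ length U * (q * φ)
  bound′ = begin
    length V * (p * product ps)  ≡⟨ lem₁ (length V) p (product ps) ⟩
    p * (length V * product ps)  ≤⟨ *-monoʳ-≤ p bound ⟩
    p * (length U⁻ * φ)          ≡⟨ lem₂ p (length U⁻) φ ⟩
    p * length U⁻ * φ            ≤⟨ *-monoˡ-≤ φ drop-popular ⟩
    q * length U * φ             ≡⟨ lem₃ q (length U) φ ⟩
    length U * (q * φ)           ∎
  cov′ : ∀ {i} → i ∈ U → i ∈ V ⊎ Covered f k ((p , x ⊖ + c) ∷ ms) i
  cov′ {i} i∈ with Q? i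
  ... | yes e = inj₂ (Covered-mono {f} {k} (λ { (here e) → here e ; (there ()) }) (class-covered {f} {k} {p} {x} (+ c) pp 2p≤k root (proj₁ (All-lookup hU i∈)) (proj₂ (All-lookup hU i∈)) (%≡⇒∣⊖ i e)))
  ... | no ¬e with cov (∈-filter⁺ (λ i → ¬? (Q? i)) i∈ ¬e)
  ... | inj₁ v = inj₁ v
  ... | inj₂ cv = inj₂ (Covered-mono {f} {k} there cv)

-- The position is matched with the lower or with the upper root of the pair, according to the side
-- on which its partner lies inside the interval.
pair-covered : ∀ {f k δ K p i} → 1 ≤ δ → 2 * (δ * K) ≤ k → RootPair f δ K p → 1 ≤ i → i ≤ k → ∃[ r ] Covered f k ((p , r) ∷ []) i
pair-covered {f} {k} {δ} {K} {p} {i} 1≤δ small (pp , d , x , 1≤d , d≤K , h₀ , h₁) 1≤i i≤k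
  with partner {k} {δ * d} {i} (*-mono-≤ 1≤δ 1≤d) (≤-trans (*-monoʳ-≤ 2 (*-monoʳ-≤ δ d≤K)) small) 1≤i i≤k
... | j , 1≤j , j≤k , j≢i , inj₁ refl = x ⊖ + i , j , 1≤j , j≤k , j≢i , (p , x ⊖ + i) , here refl ,
      subst (λ z → + p ∣ℤ eval f z) (lem₁ x (+ i)) h₀ ,
      subst (λ z → + p ∣ℤ eval f z) (trans (lem₂ x (+ i) (+ (δ * d))) (cong (x ⊖ + i ⊕_) (sym (ℤₚ.pos-+ i (δ * d))))) h₁
  where
  lem₁ : ∀ x i → x ≡ x ⊖ i ⊕ i
  lem₁ = ℤ-Ring.solve-∀
  lem₂ : ∀ x i e → x ⊕ e ≡ x ⊖ i ⊕ (i ⊕ e)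
  lem₂ = ℤ-Ring.solve-∀
... | j , 1≤j , j≤k , j≢i , inj₂ refl = x ⊖ + j , j , 1≤j , j≤k , j≢i , (p , x ⊖ + j) , here refl ,
      subst (λ z → + p ∣ℤ eval f z) (trans (lem₂ x (+ j) (+ (δ * d))) (cong (x ⊖ + j ⊕_) (sym (ℤₚ.pos-+ j (δ * d))))) h₁ ,
      subst (λ z → + p ∣ℤ eval f z) (lem₁ x (+ j)) h₀
  where
  lem₁ : ∀ x i → x ≡ x ⊖ i ⊕ i
  lem₁ = ℤ-Ring.solve-∀
  lem₂ : ∀ x i e → x ⊕ e ≡ x ⊖ i ⊕ (i ⊕ e)
  lem₂ = ℤ-Ring.solve-∀

assign : ∀ {f k} (P : ℕ → Set) → (∀ {p i} → P p → 1 ≤ i → i ≤ k → ∃[ r ] Covered f k ((p , r) ∷ []) i) →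
  ∀ U → All (λ i → 1 ≤ i × i ≤ k) U → ∀ qs → Unique qs → All P qs → length U ≤ length qs →
  ∃[ ms ] (Unique (map proj₁ ms) × (∀ {p} → p ∈ map proj₁ ms → p ∈ qs) × (∀ {i} → i ∈ U → Covered f k ms i))
assign P cover [] _ qs _ _ _ = [] , [] , (λ ()) , λ ()
assign {f} {k} P cover (i ∷ U) ((1≤i , i≤k) ∷ hU) (q ∷ qs) (q∉ ∷ u) (Pq ∷ Pqs) (s≤s le) with cover Pq 1≤i i≤k | assign {f} {k} P cover U hU qs u Pqs le
... | r , cv | ms , um , sub , cov = (q , r) ∷ ms , All-tabulate (λ p∈ → All-lookup q∉ (sub p∈)) ∷ um ,
  (λ { (here e) → here e ; (there p∈) → there (sub p∈) }) ,
  λ { (here refl) → Covered-mono {f} {k} (λ { (here e) → here e ; (there ()) }) cv ; (there i∈) → Covered-mono {f} {k} there (cov i∈) }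

EventuallyPlan : Poly → Set
EventuallyPlan f = ∃[ G ] ∀ k → G ≤ k → Plan f k

positions : ℕ → List ℕ
positions k = map suc (upTo k)

∈-positions : ∀ {k i} → 1 ≤ i → i ≤ k → i ∈ positions k
∈-positions {i = suc i} _ i<k = ∈-map⁺ suc (∈-upTo⁺ i<k)

positions-range : ∀ k → All (λ i → 1 ≤ i × i ≤ k) (positions k)
positions-range k = All-tabulate λ i∈ → case ∈-map⁻ suc i∈ of λ { (j , j∈ , refl) → s≤s z≤n , ∈-upTo⁻ j∈ }

-- With K = ⌊k / 2δ⌋ the root pairs supply about k / (2δc) primes. The reciprocal sum is made at
-- least 2δc, so the greedy step leaves at most k / (1 + 2δc) positions. The surplus grows linearly
-- with k and eventually pays for the fixed list `ps` of primes already spent.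
rootPrimes+rootPairs⇒plan : ∀ {f} → ManyRootPrimes f → ManyRootPairs f → EventuallyPlan f
rootPrimes+rootPairs⇒plan {f} rootPrimes (c , δ , K₀ , 1≤δ , pairs) with large-recipSum {f} rootPrimes (2 * δ * c)
... | ps , ups , rps , many = G , plan
  where
  B = 2 * δ * (c * length ps + 1)
  K₁ = K₀ + suc (c * (B + length ps))
  G = 2 * δ * K₁ + 2 * sum ps
  instance _ = >-nonZero (*-mono-≤ (s≤s (z≤n {1})) 1≤δ)
  prime≥1s : All (1 ≤_) ps
  prime≥1s = All-map (prime≥1 ∘ proj₁) rps
  Π = product ps
  φ = ∏ ps (_∸ 1)
  1≤Π : 1 ≤ Π
  1≤Π = productOfPrimes≥1 (All-map proj₁ rps)
  thin : (1 + 2 * δ * c) * φ ≤ Π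
  thin = *-cancelˡ-≤ Π {{>-nonZero 1≤Π}} (begin
    Π * ((1 + 2 * δ * c) * φ)      ≡⟨ lem Π (2 * δ * c) φ ⟩
    (Π + 2 * δ * c * Π) * φ        ≤⟨ *-monoˡ-≤ φ (+-monoʳ-≤ Π many) ⟩
    (Π + recipSum ps) * φ          ≤⟨ [1+recipSum]∏-pred ps prime≥1s ⟩
    Π * Π                          ∎)
    where
    open ≤-Reasoning
    lem : ∀ a e φ → a * ((1 + e) * φ) ≡ (a + e * a) * φ
    lem = ℕ-Ring.solve-∀
  module _ (k : ℕ) (G≤k : G ≤ k) where
    K = k / (2 * δ)
    k<2δ[1+K] : k < 2 * δ * suc K
    k<2δ[1+K] = begin-strict
      k                                       ≡⟨ m≡m%n+[m/n]*n k (2 * δ) ⟩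
      k % (2 * δ) + K * (2 * δ)               <⟨ +-monoˡ-< _ (m%n<n k (2 * δ)) ⟩
      2 * δ + K * (2 * δ)                     ≡⟨ *-comm (suc K) (2 * δ) ⟩
      2 * δ * suc K                           ∎
      where open ≤-Reasoning
    K₁≤K : K₁ ≤ K
    K₁≤K = ≤-pred (*-cancelˡ-< (2 * δ) K₁ (suc K) (≤-<-trans (≤-trans (m≤m+n _ (2 * sum ps)) G≤k) k<2δ[1+K]))
    small : 2 * (δ * K) ≤ k
    small = ≤-trans (≤-reflexive (trans (sym (*-assoc 2 δ K)) (*-comm (2 * δ) K))) (m/n*n≤m k (2 * δ))
    gr = greedy {f} {k} ps rps (All-tabulate λ p∈ → ≤-trans (*-monoʳ-≤ 2 (∈⇒≤sum p∈)) (≤-trans (m≤n+m (2 * sum ps) (2 * δ * K₁)) G≤k)) (positions k) (positions-range k)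
    ms = proj₁ gr
    V = proj₁ (proj₂ gr)
    ms≡ = proj₁ (proj₂ (proj₂ gr))
    hV = proj₁ (proj₂ (proj₂ (proj₂ gr)))
    bound = proj₁ (proj₂ (proj₂ (proj₂ (proj₂ gr))))
    cov = proj₂ (proj₂ (proj₂ (proj₂ (proj₂ gr))))
    V-small : (1 + 2 * δ * c) * length V ≤ k
    V-small = *-cancelʳ-≤ _ k Π {{>-nonZero 1≤Π}} (begin
      (1 + 2 * δ * c) * length V * Π      ≡⟨ *-assoc (1 + 2 * δ * c) (length V) Π ⟩
      (1 + 2 * δ * c) * (length V * Π)    ≤⟨ *-monoʳ-≤ (1 + 2 * δ * c) bound ⟩
      (1 + 2 * δ * c) * (length (positions k) * φ) ≡⟨ cong (λ z → (1 + 2 * δ * c) * (z * φ)) (trans (length-map suc (upTo k)) (length-upTo k)) ⟩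
      (1 + 2 * δ * c) * (k * φ)           ≡⟨ lem (2 * δ * c) k φ ⟩
      k * ((1 + 2 * δ * c) * φ)           ≤⟨ *-monoʳ-≤ k thin ⟩
      k * Π                               ∎)
      where
      open ≤-Reasoning
      lem : ∀ e k φ → (1 + e) * (k * φ) ≡ k * ((1 + e) * φ)
      lem = ℕ-Ring.solve-∀
    pr = pairs K (≤-trans (m≤m+n K₀ _) K₁≤K)
    qs = proj₁ pr
    new? = λ q → ¬? (q ∈? ps)
    qs′ = filter new? qs
    length-qs : length qs ≤ length ps + length qs′
    length-qs = begin
      length qs                                                     ≡⟨ length-filter-split (_∈? ps) qs ⟨
      length (filter (_∈? ps) qs) + length qs′                      ≤⟨ +-monoˡ-≤ _ (unique-⊆⇒length≤ (Uniqueₚ.filter⁺ (_∈? ps) (proj₁ (proj₂ pr))) (λ q∈ → proj₂ (∈-filter⁻ (_∈? ps) {xs = qs} q∈))) ⟩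
      length ps + length qs′                                        ∎
      where open ≤-Reasoning
    -- If the new primes were too few, then K ≤ c (|V| + |ps|). Together with (1 + 2δc) |V| ≤ k < 2δ
    -- (K + 1) this gives |V| ≤ B, hence K ≤ c (B + |ps|), which `K₁` was chosen to exceed.
    enough : length V ≤ length qs′
    enough with length V ≤? length qs′
    ... | yes h = h
    ... | no h = ⊥-elim (<⇒≱ (≤-trans (m≤n+m _ K₀) K₁≤K) (begin
        K                               ≤⟨ K≤ ⟩
        c * (length V + length ps)      ≤⟨ *-monoʳ-≤ c (+-monoˡ-≤ (length ps) V≤B) ⟩
        c * (B + length ps)             ∎))
      where
      open ≤-Reasoning
      K≤ : K ≤ c * (length V + length ps)
      K≤ = ≤-trans (proj₂ (proj₂ (proj₂ pr))) (*-monoʳ-≤ c (≤-trans length-qs (≤-trans (≤-reflexive (+-comm (length ps) (length qs′))) (+-monoˡ-≤ (length ps) (<⇒≤ (≰⇒> h))))))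
      lem₁ : ∀ e c v p → e * suc (c * (v + p)) ≡ e * c * v + e * (c * p + 1)
      lem₁ = ℕ-Ring.solve-∀
      V≤B : length V ≤ B
      V≤B = +-cancelˡ-≤ (2 * δ * c * length V) _ _ (begin
        2 * δ * c * length V + length V  ≡⟨ +-comm (2 * δ * c * length V) (length V) ⟩
        (1 + 2 * δ * c) * length V       ≤⟨ V-small ⟩
        k                                ≤⟨ <⇒≤ k<2δ[1+K] ⟩
        2 * δ * suc K                    ≤⟨ *-monoʳ-≤ (2 * δ) (s≤s K≤) ⟩
        2 * δ * suc (c * (length V + length ps)) ≡⟨ lem₁ (2 * δ) c (length V) (length ps) ⟩
        2 * δ * c * length V + B         ∎)
    rest = assign {f} {k} (RootPair f δ K) (pair-covered {f} {k} {δ} {K} 1≤δ small) V hV qs′ (Uniqueₚ.filter⁺ new? (proj₁ (proj₂ pr)))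
      (All-tabulate λ q∈ → All-lookup (proj₁ (proj₂ (proj₂ pr))) (proj₁ (∈-filter⁻ new? q∈))) enough
    ms′ = proj₁ rest
    new : ∀ {q} → q ∈ map proj₁ ms′ → q ∈ qs × q ∉ ps
    new q∈ = ∈-filter⁻ new? {xs = qs} (proj₁ (proj₂ (proj₂ rest)) q∈)
    split : ∀ {m} → m ∈ ms ++ ms′ → m ∈ ms ⊎ m ∈ ms′
    split = ∈-++⁻ ms
    plan : Plan f k
    plan = record
      { residues = ms ++ ms′
      ; primes = All-tabulate λ m∈ → case split m∈ of λ
          { (inj₁ a) → proj₁ (All-lookup rps (subst (_ ∈_) ms≡ (∈-map⁺ proj₁ a)))
          ; (inj₂ b) → proj₁ (All-lookup (proj₁ (proj₂ (proj₂ pr))) (proj₁ (new (∈-map⁺ proj₁ b)))) }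
      ; distinct = subst Unique (sym (trans (map-++ proj₁ ms ms′) (cong (_++ map proj₁ ms′) ms≡)))
          (Uniqueₚ.++⁺ ups (proj₁ (proj₂ rest)) λ { (a , b) → proj₂ (new b) a })
      ; covers = λ i 1≤i i≤k → case cov (∈-positions 1≤i i≤k) of λ
          { (inj₁ v) → Covered-mono {f} {k} (∈-++⁺ʳ ms) (proj₂ (proj₂ (proj₂ rest)) v)
          ; (inj₂ cv) → Covered-mono {f} {k} ∈-++⁺ˡ cv }
      }

-- Truncated valuations

interval : ℕ → List ℕ
interval zero = []
interval (suc n) = suc n ∷ interval n

∈-interval⁺ : ∀ {n i} → 1 ≤ i → i ≤ n → i ∈ interval n
∈-interval⁺ {zero} (s≤s _) ()
∈-interval⁺ {suc n} {i} 1≤i i≤n with i ≟ suc n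
... | yes refl = here refl
... | no ne = there (∈-interval⁺ 1≤i (≤-pred (≤∧≢⇒< i≤n ne)))

∈-interval⁻ : ∀ {n i} → i ∈ interval n → 1 ≤ i × i ≤ n
∈-interval⁻ {suc n} (here refl) = s≤s z≤n , ≤-refl
∈-interval⁻ {suc n} (there i∈) = proj₁ (∈-interval⁻ i∈) , m≤n⇒m≤1+n (proj₂ (∈-interval⁻ i∈))

interval-unique : ∀ n → Unique (interval n)
interval-unique zero = []
interval-unique (suc n) = All-tabulate (λ i∈ e → 1+n≰n (subst (_≤ n) (sym e) (proj₂ (∈-interval⁻ i∈)))) ∷ interval-unique n

length-interval : ∀ n → length (interval n) ≡ n
length-interval zero = refl
length-interval (suc n) = cong suc (length-interval n)

-- The powers of p that divide n form a chain, so for a prime p and n > 0 this is min (E, v_p(n)).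
-- Written as a sum over exponents it can be exchanged with sums over n.
val : ℕ → ℕ → ℕ → ℕ
val p E n = ∑ (interval E) (λ e → 𝟙 (p ^ e ∣? n))

^-mono-∣ : ∀ p {d e} → d ≤ e → p ^ d ∣ p ^ e
^-mono-∣ p {d} {e} d≤e = subst (p ^ d ∣_) (trans (sym (^-distribˡ-+-* p d (e ∸ d))) (cong (p ^_) (m+[n∸m]≡n d≤e))) (m∣m*n (p ^ (e ∸ d)))

val-full : ∀ p E n → p ^ E ∣ n → val p E n ≡ E
val-full p E n d = trans (∑-cong (interval E) (λ e e∈ → 𝟙-yes (p ^ e ∣? n) (∣-trans (^-mono-∣ p (proj₂ (∈-interval⁻ e∈))) d)))
  (trans (∑-const (interval E) 1) (trans (*-identityʳ _) (length-interval E)))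

^val-∣ : ∀ p E n → p ^ val p E n ∣ n
^val-∣ p zero n = divides n (sym (*-identityʳ n))
^val-∣ p (suc E) n with p ^ suc E ∣? n
... | yes d = subst (λ e → p ^ suc e ∣ n) (sym (val-full p E n (∣-trans (^-mono-∣ p (n≤1+n E)) d))) d
... | no _ = ^val-∣ p E n

∣⇒≤val : ∀ p E n {j} → j ≤ E → p ^ j ∣ n → j ≤ val p E n
∣⇒≤val p zero n z≤n d = z≤n
∣⇒≤val p (suc E) n {j} j≤ d with j ≟ suc E
... | yes refl = ≤-reflexive (sym (val-full p (suc E) n d))
... | no ne = ≤-trans (∣⇒≤val p E n (≤-pred (≤∧≢⇒< j≤ ne)) d) (m≤n+m _ _)

val-mono : ∀ p E {m n} → m ∣ n → val p E m ≤ val p E n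
val-mono p E {m} {n} m∣n = ∑-mono (interval E) λ e _ → 𝟙-mono (p ^ e ∣? m) (p ^ e ∣? n) (λ d → ∣-trans d m∣n)

∏-mono-at : ∀ {A : Set} {x : A} {xs} {f g : A → ℕ} c → x ∈ xs → (∀ y → y ∈ xs → f y ≤ g y) → c * f x ≤ g x → c * ∏ xs f ≤ ∏ xs g
∏-mono-at {xs = x ∷ xs} {f} c (here refl) h hx = ≤-trans (≤-reflexive (sym (*-assoc c (f x) _))) (*-mono-≤ hx (∏-mono xs λ y y∈ → h y (there y∈)))
∏-mono-at {xs = y ∷ xs} {f} c (there x∈) h hx = ≤-trans (≤-reflexive (lem c (f y) _)) (*-mono-≤ (h y (here refl)) (∏-mono-at c x∈ (λ z z∈ → h z (there z∈)) hx))
  where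
  lem : ∀ c a b → c * (a * b) ≡ a * (c * b)
  lem = ℕ-Ring.solve-∀

-- One prime factor is removed at a time; restoring it raises the exponent of that prime by one. The
-- bound n < 2 ^ E ensures that the truncation at E never takes effect.
≤-∏^val : ∀ E ps → (∀ {p} → p ∈ ps → 1 ≤ p) → ∀ n → 1 ≤ n → n < 2 ^ E → (∀ {p} → Prime p → p ∣ n → p ∈ ps) → n ≤ ∏ ps (λ p → p ^ val p E n)
≤-∏^val E ps pos n = <-rec _ step n
  where
  step : ∀ n → (∀ {m} → m < n → 1 ≤ m → m < 2 ^ E → (∀ {p} → Prime p → p ∣ m → p ∈ ps) → m ≤ ∏ ps (λ p → p ^ val p E m)) →
         1 ≤ n → n < 2 ^ E → (∀ {p} → Prime p → p ∣ n → p ∈ ps) → n ≤ ∏ ps (λ p → p ^ val p E n)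
  step (suc zero) rec _ _ _ = ∏-pos ps λ p p∈ → m^n>0 p {{>-nonZero (pos p∈)}} (val p E 1)
  step n@(suc (suc _)) rec _ n< hp with ∃-prime-∣ n (s≤s (s≤s z≤n))
  ... | p , pp , p∣n@(divides (suc m′) n≡) = begin
      n                                         ≡⟨ trans n≡ (*-comm m p) ⟩
      p * m                                     ≤⟨ *-monoʳ-≤ p (rec m<n (s≤s z≤n) (<-trans m<n n<) (λ qq q∣m → hp qq (∣-trans q∣m m∣n))) ⟩
      p * ∏ ps (λ q → q ^ val q E m)            ≤⟨ ∏-mono-at {f = λ q → q ^ val q E m} {g = λ q → q ^ val q E n} p (hp pp p∣n)
                                                    (λ q q∈ → ^-monoʳ-≤ q {{>-nonZero (pos q∈)}} (val-mono q E m∣n)) at-p ⟩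
      ∏ ps (λ q → q ^ val q E n)                ∎
    where
    open ≤-Reasoning
    m = suc m′
    m∣n : m ∣ n
    m∣n = divides p (trans n≡ (*-comm m p))
    m<n : m < n
    m<n = subst (m <_) (sym n≡) (m<m*n m p (prime≥2 pp))
    v = val p E m
    p^1+v∣n : p ^ suc v ∣ n
    p^1+v∣n = subst (p ^ suc v ∣_) (sym (trans n≡ (*-comm m p))) (*-monoʳ-∣ p (^val-∣ p E m))
    v<E : suc v ≤ E
    v<E with suc v ≤? E
    ... | yes h = h
    ... | no h = ⊥-elim (<⇒≱ n< (≤-trans (^-monoˡ-≤ E (prime≥2 pp)) (≤-trans (^-monoʳ-≤ p {{prime⇒nonZero pp}} (<⇒≤ (≰⇒> h))) (∣⇒≤ p^1+v∣n))))
    at-p : p * p ^ v ≤ p ^ val p E n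
    at-p = ^-monoʳ-≤ p {{prime⇒nonZero pp}} (∣⇒≤val p E n v<E p^1+v∣n)
  step n@(suc (suc _)) rec _ n< hp | p , pp , divides zero ()

n<2^n : ∀ n → n < 2 ^ n
n<2^n zero = s≤s z≤n
n<2^n (suc n) = begin-strict
  suc n            ≤⟨ n<2^n n ⟩
  2 ^ n            <⟨ m<m+n (2 ^ n) (≤-trans (m^n>0 2 n) (≤-reflexive (sym (+-identityʳ _)))) ⟩
  2 * 2 ^ n        ∎
  where open ≤-Reasoning

-- Factorials and Chebyshev's estimates

-- This is ⌊m / q⌋ for q ≥ 1. It is defined as a count so that sums over d and over prime powers can
-- be exchanged.
multiples : ℕ → ℕ → ℕ
multiples m q = ∑ (interval m) (λ d → 𝟙 (q ∣? d))

multiples-bounds : ∀ m q → 1 ≤ q → q * multiples m q ≤ m × m < q * suc (multiples m q)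
multiples-bounds zero q 1≤q = ≤-reflexive (*-zeroʳ q) , ≤-trans 1≤q (≤-reflexive (sym (*-identityʳ q)))
multiples-bounds (suc m) q 1≤q with multiples-bounds m q 1≤q | q ∣? suc m
... | lo , hi | yes (divides t e) = ≤-trans (*-monoʳ-≤ q c<t) (≤-reflexive (trans (*-comm q t) (sym e))) , (begin-strict
    suc m               ≤⟨ hi ⟩
    q * suc c           <⟨ *-monoʳ-< q {{>-nonZero 1≤q}} (n<1+n (suc c)) ⟩
    q * suc (suc c)     ∎)
  where
  open ≤-Reasoning
  c = multiples m q
  c<t : c < t
  c<t = *-cancelˡ-< q c t (≤-trans (s≤s lo) (≤-reflexive (trans e (*-comm t q))))
... | lo , hi | no ¬d = m≤n⇒m≤1+n lo , ≤∧≢⇒< hi λ e → ¬d (subst (q ∣_) (sym e) (m∣m*n _))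

factorial≡∏ : ∀ n → n ! ≡ ∏ (interval n) id
factorial≡∏ zero = refl
factorial≡∏ (suc n) = cong (suc n *_) (factorial≡∏ n)

primesUpTo : ℕ → List ℕ
primesUpTo n = filter prime? (interval n)

primesUpTo-prime : ∀ {n p} → p ∈ primesUpTo n → Prime p × p ≤ n
primesUpTo-prime {n} p∈ = case ∈-filter⁻ prime? {xs = interval n} p∈ of λ { (a , b) → b , proj₂ (∈-interval⁻ a) }

primesUpTo-complete : ∀ {n p} → Prime p → p ≤ n → p ∈ primesUpTo n
primesUpTo-complete pp p≤n = ∈-filter⁺ prime? (∈-interval⁺ (prime≥1 pp) p≤n) pp

primesUpTo-unique : ∀ n → Unique (primesUpTo n)
primesUpTo-unique n = Uniqueₚ.filter⁺ prime? (interval-unique n)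

-- Legendre's formula for the exponent of p in m!, exact for prime p as soon as m < 2 ^ E.
legendre : ℕ → ℕ → ℕ → ℕ
legendre E m p = ∑ (interval E) (λ e → multiples m (p ^ e))

∑val≡legendre : ∀ E m p → ∑ (interval m) (λ d → val p E d) ≡ legendre E m p
∑val≡legendre E m p = ∑-swap (interval m) (interval E) (λ d e → 𝟙 (p ^ e ∣? d))

factorial≤∏^legendre : ∀ E N m → m ≤ N → N < 2 ^ E → m ! ≤ ∏ (primesUpTo N) (λ p → p ^ legendre E m p)
factorial≤∏^legendre E N m m≤N N< = begin
  m !                                                             ≡⟨ factorial≡∏ m ⟩
  ∏ (interval m) id                                               ≤⟨ ∏-mono (interval m) (λ d d∈ → ≤-∏^val E ps (λ p∈ → prime≥1 (proj₁ (primesUpTo-prime {N} p∈))) d (proj₁ (∈-interval⁻ d∈)) (≤-<-trans (≤-trans (proj₂ (∈-interval⁻ d∈)) m≤N) N<)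
                                                                       λ pp p∣d → primesUpTo-complete pp (≤-trans (∣⇒≤ {{>-nonZero (proj₁ (∈-interval⁻ d∈))}} p∣d) (≤-trans (proj₂ (∈-interval⁻ d∈)) m≤N))) ⟩
  ∏ (interval m) (λ d → ∏ ps (λ p → p ^ val p E d))               ≡⟨ ∏-swap (interval m) ps (λ d p → p ^ val p E d) ⟩
  ∏ ps (λ p → ∏ (interval m) (λ d → p ^ val p E d))               ≡⟨ ∏-cong ps (λ p _ → trans (∏-base^ (interval m) p (λ d → val p E d)) (cong (p ^_) (∑val≡legendre E m p))) ⟩
  ∏ ps (λ p → p ^ legendre E m p)                                 ∎
  where
  open ≤-Reasoning
  ps = primesUpTo N

∏^legendre≤factorial : ∀ E N m → ∏ (primesUpTo N) (λ p → p ^ legendre E m p) ≤ m !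
∏^legendre≤factorial E N m = ∣⇒≤ {{m !≢0}} (∏-prime-powers-∣ ps (legendre E m) (m !) (primesUpTo-unique N) (All-tabulate λ p∈ → proj₁ (primesUpTo-prime {N} p∈)) λ p _ →
  subst₂ _∣_ (trans (∏-base^ (interval m) p (λ d → val p E d)) (cong (p ^_) (∑val≡legendre E m p))) (sym (factorial≡∏ m)) (∏-∣ (interval m) (λ d _ → ^val-∣ p E d)))
  where
  ps = primesUpTo N

-- From n to n + 1 the central binomial coefficient is multiplied by 2 (2n + 1) / (n + 1), which
-- lies between 2 and 4.
2^n[n!]²≤[2n]! : ∀ n → 2 ^ n * (n ! * n !) ≤ (2 * n) !
2^n[n!]²≤[2n]! zero = ≤-refl
2^n[n!]²≤[2n]! (suc n) = begin
  2 * a * (suc n * b * (suc n * b))       ≡⟨ lem n a b ⟩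
  2 * suc n * suc n * (a * (b * b))       ≤⟨ *-mono-≤ (*-monoʳ-≤ (2 * suc n) (s≤s (m≤m+n n (n + 0)))) (2^n[n!]²≤[2n]! n) ⟩
  2 * suc n * suc (2 * n) * (2 * n) !     ≡⟨ *-assoc (2 * suc n) (suc (2 * n)) ((2 * n) !) ⟩
  2 * suc n * (suc (2 * n)) !             ≡⟨ cong (_* (suc (2 * n)) !) (lem′ n) ⟩
  (suc (suc (2 * n))) !                   ≡⟨ cong _! (lem′ n) ⟨
  (2 * suc n) !                           ∎
  where
  open ≤-Reasoning
  a = 2 ^ n
  b = n !
  lem : ∀ n a b → 2 * a * (suc n * b * (suc n * b)) ≡ 2 * suc n * suc n * (a * (b * b))
  lem = ℕ-Ring.solve-∀
  lem′ : ∀ n → 2 * suc n ≡ suc (suc (2 * n))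
  lem′ = ℕ-Ring.solve-∀

[2n]!≤4^n[n!]² : ∀ n → (2 * n) ! ≤ 4 ^ n * (n ! * n !)
[2n]!≤4^n[n!]² zero = ≤-refl
[2n]!≤4^n[n!]² (suc n) = begin
  (2 * suc n) !                           ≡⟨ cong _! (lem′ n) ⟩
  suc (suc (2 * n)) * (suc (2 * n) * (2 * n) !) ≤⟨ *-monoʳ-≤ (suc (suc (2 * n))) (*-mono-≤ (n≤1+n (suc (2 * n))) ([2n]!≤4^n[n!]² n)) ⟩
  suc (suc (2 * n)) * (suc (suc (2 * n)) * (a * (b * b))) ≡⟨ lem n a b ⟩
  4 * a * (suc n * b * (suc n * b))       ∎
  where
  open ≤-Reasoning
  a = 4 ^ n
  b = n !
  lem : ∀ n a b → suc (suc (2 * n)) * (suc (suc (2 * n)) * (a * (b * b))) ≡ 4 * a * (suc n * b * (suc n * b))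
  lem = ℕ-Ring.solve-∀
  lem′ : ∀ n → 2 * suc n ≡ suc (suc (2 * n))
  lem′ = ℕ-Ring.solve-∀

multiples-double : ∀ n q → 1 ≤ q → multiples (2 * n) q ≤ 𝟙 (q ≤? 2 * n) + 2 * multiples n q
multiples-double n q 1≤q with q ≤? 2 * n
... | yes _ = ≤-pred (*-cancelˡ-< q c₂ (suc (suc (2 * c₁))) (begin-strict
    q * c₂                ≤⟨ proj₁ (multiples-bounds (2 * n) q 1≤q) ⟩
    2 * n                 <⟨ *-monoʳ-< 2 (proj₂ (multiples-bounds n q 1≤q)) ⟩
    2 * (q * suc c₁)      ≡⟨ lem q c₁ ⟩
    q * suc (suc (2 * c₁)) ∎))
  where
  open ≤-Reasoning
  c₁ = multiples n q
  c₂ = multiples (2 * n) q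
  lem : ∀ q c → 2 * (q * suc c) ≡ q * suc (suc (2 * c))
  lem = ℕ-Ring.solve-∀
... | no h with multiples (2 * n) q | proj₁ (multiples-bounds (2 * n) q 1≤q)
... | zero | _ = z≤n
... | suc c | b = ⊥-elim (h (≤-trans (≤-trans (≤-reflexive (sym (*-identityʳ q))) (*-monoʳ-≤ q (s≤s (z≤n {c})))) b))

multiples-double≥ : ∀ n q → 1 ≤ q → 2 * multiples n q ≤ multiples (2 * n) q
multiples-double≥ n q 1≤q = ≤-pred (*-cancelˡ-< q (2 * c₁) (suc c₂) (begin-strict
    q * (2 * c₁)          ≡⟨ lem q c₁ ⟩
    2 * (q * c₁)          ≤⟨ *-monoʳ-≤ 2 (proj₁ (multiples-bounds n q 1≤q)) ⟩
    2 * n                 <⟨ proj₂ (multiples-bounds (2 * n) q 1≤q) ⟩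
    q * suc c₂            ∎))
  where
  open ≤-Reasoning
  c₁ = multiples n q
  c₂ = multiples (2 * n) q
  lem : ∀ q c → q * (2 * c) ≡ 2 * (q * c)
  lem = ℕ-Ring.solve-∀

-- For p ≥ 2 and N ≥ 1 this is ⌊log_p N⌋, cut off at E.
expsBelow : ℕ → ℕ → ℕ → ℕ
expsBelow E N p = ∑ (interval E) (λ e → 𝟙 (p ^ e ≤? N))

^expsBelow≤ : ∀ E N p → 1 ≤ p → 1 ≤ N → p ^ expsBelow E N p ≤ N
^expsBelow≤ zero N p _ 1≤N = 1≤N
^expsBelow≤ (suc E) N p 1≤p 1≤N with p ^ suc E ≤? N
... | no _ = ^expsBelow≤ E N p 1≤p 1≤N
... | yes h = subst (λ e → p ^ suc e ≤ N) (sym all) h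
  where
  all : expsBelow E N p ≡ E
  all = trans (∑-cong (interval E) (λ e e∈ → 𝟙-yes (p ^ e ≤? N) (≤-trans (^-monoʳ-≤ p {{>-nonZero 1≤p}} (m≤n⇒m≤1+n (proj₂ (∈-interval⁻ e∈)))) h)))
    (trans (∑-const (interval E) 1) (trans (*-identityʳ _) (length-interval E)))

∏^+ : ∀ (ps : List ℕ) (a b : ℕ → ℕ) → ∏ ps (λ p → p ^ (a p + b p)) ≡ ∏ ps (λ p → p ^ a p) * ∏ ps (λ p → p ^ b p)
∏^+ ps a b = trans (∏-cong ps λ p _ → ^-distribˡ-+-* p (a p) (b p)) (∏-* ps (λ p → p ^ a p) (λ p → p ^ b p))

∏^2* : ∀ (ps : List ℕ) (a : ℕ → ℕ) → ∏ ps (λ p → p ^ (2 * a p)) ≡ ∏ ps (λ p → p ^ a p) * ∏ ps (λ p → p ^ a p)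
∏^2* ps a = trans (∏-cong ps {λ p → p ^ (2 * a p)} {λ p → p ^ (a p + a p)} λ p _ → cong (λ z → p ^ (a p + z)) (+-identityʳ (a p))) (∏^+ ps a a)

-- The exponent of p in the central binomial coefficient is a sum of terms ⌊2n / p^e⌋ - 2 ⌊n / p^e⌋,
-- each at most 1 and equal to 0 once p^e > 2n. So no prime contributes more than 2n to it.
2^n≤∏^expsBelow : ∀ n E → 1 ≤ n → 2 * n < 2 ^ E → 2 ^ n ≤ ∏ (primesUpTo (2 * n)) (λ p → p ^ expsBelow E (2 * n) p)
2^n≤∏^expsBelow n E 1≤n n< = *-cancelʳ-≤ _ _ (n ! * n !) {{>-nonZero (*-mono-≤ (n!>0 n) (n!>0 n))}} (begin
  2 ^ n * (n ! * n !)                                           ≤⟨ 2^n[n!]²≤[2n]! n ⟩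
  (2 * n) !                                                     ≤⟨ factorial≤∏^legendre E (2 * n) (2 * n) ≤-refl n< ⟩
  ∏ ps (λ p → p ^ legendre E (2 * n) p)                         ≤⟨ ∏-mono ps (λ p p∈ → ^-monoʳ-≤ p {{prime⇒nonZero (proj₁ (primesUpTo-prime {2 * n} p∈))}} (leg p (prime≥1 (proj₁ (primesUpTo-prime {2 * n} p∈))))) ⟩
  ∏ ps (λ p → p ^ (L p + 2 * legendre E n p))                   ≡⟨ trans (∏^+ ps L (λ p → 2 * legendre E n p)) (cong (∏ ps (λ p → p ^ L p) *_) (∏^2* ps (legendre E n))) ⟩
  ∏ ps (λ p → p ^ L p) * (B * B)                                ≤⟨ *-monoʳ-≤ (∏ ps (λ p → p ^ L p)) (*-mono-≤ (∏^legendre≤factorial E (2 * n) n) (∏^legendre≤factorial E (2 * n) n)) ⟩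
  ∏ ps (λ p → p ^ L p) * (n ! * n !)                            ∎)
  where
  open ≤-Reasoning
  ps = primesUpTo (2 * n)
  L = expsBelow E (2 * n)
  B = ∏ ps (λ p → p ^ legendre E n p)
  n!>0 : ∀ n → 1 ≤ n !
  n!>0 n = >-nonZero⁻¹ (n !) {{n !≢0}}
  leg : ∀ p → 1 ≤ p → legendre E (2 * n) p ≤ L p + 2 * legendre E n p
  leg p 1≤p = begin
    legendre E (2 * n) p                                                        ≤⟨ ∑-mono (interval E) (λ e _ → multiples-double n (p ^ e) (m^n>0 p {{>-nonZero 1≤p}} e)) ⟩
    ∑ (interval E) (λ e → 𝟙 (p ^ e ≤? 2 * n) + 2 * multiples n (p ^ e))         ≡⟨ trans (∑-+ (interval E) (λ e → 𝟙 (p ^ e ≤? 2 * n)) (λ e → 2 * multiples n (p ^ e))) (cong (λ z → L p + z) (∑-*ˡ (interval E) 2 (λ e → multiples n (p ^ e)))) ⟩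
    L p + 2 * legendre E n p                                                    ∎

primesIn : ℕ → ℕ → List ℕ
primesIn a b = filter (λ p → suc a ≤? p) (primesUpTo b)

∏-filter : ∀ {A : Set} {P : A → Set} (P? : ∀ x → Dec (P x)) (xs : List A) f → ∏ xs f ≡ ∏ (filter P? xs) f * ∏ (filter (λ x → ¬? (P? x)) xs) f
∏-filter P? [] f = refl
∏-filter P? (x ∷ xs) f with P? x
... | yes _ = trans (cong (f x *_) (∏-filter P? xs f)) (sym (*-assoc (f x) _ _))
... | no _ = trans (cong (f x *_) (∏-filter P? xs f)) (lem (f x) (∏ (filter P? xs) f) (∏ (filter (λ x → ¬? (P? x)) xs) f))
  where
  lem : ∀ c a b → c * (a * b) ≡ a * (c * b)
  lem = ℕ-Ring.solve-∀

-- A prime in (n, 2n] divides (2n)! but not n!, so it divides the central binomial coefficient,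
-- which is at most 4^n.
product-primesIn≤4^ : ∀ n → ∏ (primesIn n (2 * n)) id ≤ 4 ^ n
product-primesIn≤4^ n = *-cancelʳ-≤ _ _ (n ! * n !) {{>-nonZero (*-mono-≤ (n!>0 n) (n!>0 n))}} (begin
  W * (n ! * n !)                                               ≤⟨ *-monoʳ-≤ W (*-mono-≤ n!≤ n!≤) ⟩
  W * (B * B)                                                   ≡⟨ cong₂ _*_ W≡ (sym (∏^2* ps (legendre E n))) ⟩
  ∏ ps (λ p → p ^ 𝟙 (suc n ≤? p)) * ∏ ps (λ p → p ^ (2 * legendre E n p)) ≡⟨ ∏^+ ps (λ p → 𝟙 (suc n ≤? p)) (λ p → 2 * legendre E n p) ⟨
  ∏ ps (λ p → p ^ (𝟙 (suc n ≤? p) + 2 * legendre E n p))        ≤⟨ ∏-mono ps (λ p p∈ → ^-monoʳ-≤ p {{prime⇒nonZero (proj₁ (primesUpTo-prime {2 * n} p∈))}} (leg p (proj₁ (primesUpTo-prime {2 * n} p∈)) (proj₂ (primesUpTo-prime {2 * n} p∈)))) ⟩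
  ∏ ps (λ p → p ^ legendre E (2 * n) p)                         ≤⟨ ∏^legendre≤factorial E (2 * n) (2 * n) ⟩
  (2 * n) !                                                     ≤⟨ [2n]!≤4^n[n!]² n ⟩
  4 ^ n * (n ! * n !)                                           ∎)
  where
  open ≤-Reasoning
  E = suc (2 * n)
  ps = primesUpTo (2 * n)
  W = ∏ (primesIn n (2 * n)) id
  B = ∏ ps (λ p → p ^ legendre E n p)
  n!>0 : ∀ n → 1 ≤ n !
  n!>0 n = >-nonZero⁻¹ (n !) {{n !≢0}}
  n!≤ : n ! ≤ B
  n!≤ = factorial≤∏^legendre E (2 * n) n (m≤m+n n (n + 0)) (<-trans (n<1+n (2 * n)) (n<2^n E))
  P? = λ p → suc n ≤? p
  W≡ : W ≡ ∏ ps (λ p → p ^ 𝟙 (P? p))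
  W≡ = trans (sym (*-identityʳ W)) (trans (cong₂ _*_
    (∏-cong (filter P? ps) (λ p p∈ → sym (trans (cong (p ^_) (𝟙-yes (P? p) (proj₂ (∈-filter⁻ P? {xs = ps} p∈)))) (*-identityʳ p))))
    (sym (trans (∏-cong (filter (λ p → ¬? (P? p)) ps) (λ p p∈ → cong (p ^_) (𝟙-no (P? p) (proj₂ (∈-filter⁻ (λ p → ¬? (P? p)) {xs = ps} p∈))))) (trans (∏-const (filter (λ p → ¬? (P? p)) ps) 1) (^-zeroˡ (length (filter (λ p → ¬? (P? p)) ps)))))))
    (sym (∏-filter P? ps (λ p → p ^ 𝟙 (P? p)))))
  leg : ∀ p → Prime p → p ≤ 2 * n → 𝟙 (P? p) + 2 * legendre E n p ≤ legendre E (2 * n) p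
  leg p pp p≤2n with P? p
  ... | no _ = ≤-trans (≤-reflexive (sym (∑-*ˡ (interval E) 2 (λ e → multiples n (p ^ e))))) (∑-mono (interval E) λ e _ → multiples-double≥ n (p ^ e) (m^n>0 p {{prime⇒nonZero pp}} e))
  ... | yes n<p = ≤-trans (≤-reflexive (cong (λ z → 1 + 2 * z) zero-leg)) (≤-trans one (∑-∈ (λ e → multiples (2 * n) (p ^ e)) (∈-interval⁺ {E} {1} ≤-refl (s≤s z≤n))))
    where
    mult0 : ∀ e → e ∈ interval E → multiples n (p ^ e) ≡ 0
    mult0 e e∈ with multiples n (p ^ e) | proj₁ (multiples-bounds n (p ^ e) (m^n>0 p {{prime⇒nonZero pp}} e))
    ... | zero | _ = refl
    ... | suc c | b = ⊥-elim (<⇒≱ n<p (≤-trans (≤-trans (≤-reflexive (sym (*-identityʳ p))) (^-monoʳ-≤ p {{prime⇒nonZero pp}} (proj₁ (∈-interval⁻ e∈)))) (≤-trans (m≤m*n (p ^ e) (suc c)) b)))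
    zero-leg : legendre E n p ≡ 0
    zero-leg = trans (∑-cong (interval E) mult0) (trans (∑-const (interval E) 0) (*-zeroʳ (length (interval E))))
    one : 1 ≤ multiples (2 * n) (p ^ 1)
    one with multiples (2 * n) (p ^ 1) | proj₂ (multiples-bounds (2 * n) (p ^ 1) (m^n>0 p {{prime⇒nonZero pp}} 1))
    ... | zero | b = ⊥-elim (<⇒≱ b (≤-trans (≤-reflexive (trans (*-identityʳ (p ^ 1)) (*-identityʳ p))) p≤2n))
    ... | suc c | _ = s≤s z≤n

∏-mono-⊆ : ∀ {xs ys : List ℕ} → Unique xs → (∀ {x} → x ∈ xs → x ∈ ys) → (∀ {y} → y ∈ ys → 1 ≤ y) → ∏ xs id ≤ ∏ ys id
∏-mono-⊆ {[]} {ys} u sub pos = ∏-pos ys (λ y y∈ → pos y∈)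
∏-mono-⊆ {x ∷ xs} (x∉ ∷ u) sub pos with ∈-∃++ (sub (here refl))
... | as , bs , refl = ≤-trans (*-monoʳ-≤ x (∏-mono-⊆ {xs} {as ++ bs} u sub′ (λ {y} y∈ → pos (case ∈-++⁻ as y∈ of λ { (inj₁ a) → ∈-++⁺ˡ a ; (inj₂ b) → ∈-++⁺ʳ as (there b) })))) (≤-reflexive (move as))
  where
  sub′ : ∀ {y} → y ∈ xs → y ∈ as ++ bs
  sub′ {y} y∈ with ∈-++⁻ as (sub (there y∈))
  ... | inj₁ y∈as = ∈-++⁺ˡ y∈as
  ... | inj₂ (here refl) = ⊥-elim (All-lookup x∉ y∈ refl)
  ... | inj₂ (there y∈bs) = ∈-++⁺ʳ as y∈bs
  move : ∀ as → x * ∏ (as ++ bs) id ≡ ∏ (as ++ x ∷ bs) id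
  move [] = refl
  move (a ∷ as) = trans (lem x a _) (cong (a *_) (move as))
    where
    lem : ∀ c a b → c * (a * b) ≡ a * (c * b)
    lem = ℕ-Ring.solve-∀

-- At powers of 2 the halving is exact: the bounds for (m, 2m] and for [1, m] are both 4^m and
-- multiply to 4^(2m).
primorial≤4^ : ∀ i → ∏ (primesUpTo (2 ^ i)) id ≤ 4 ^ (2 ^ i)
primorial≤4^ zero = s≤s z≤n
primorial≤4^ (suc i) = begin
  ∏ (primesUpTo (2 * m)) id                                                     ≡⟨ ∏-filter (λ p → suc m ≤? p) (primesUpTo (2 * m)) id ⟩
  ∏ (primesIn m (2 * m)) id * ∏ small id                                        ≤⟨ *-mono-≤ (product-primesIn≤4^ m) (∏-mono-⊆ {small} (Uniqueₚ.filter⁺ _ (primesUpTo-unique (2 * m))) small⊆ (λ p∈ → prime≥1 (proj₁ (primesUpTo-prime {m} p∈)))) ⟩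
  4 ^ m * ∏ (primesUpTo m) id                                                   ≤⟨ *-monoʳ-≤ (4 ^ m) (primorial≤4^ i) ⟩
  4 ^ m * 4 ^ m                                                                 ≡⟨ ^-distribˡ-+-* 4 m m ⟨
  4 ^ (m + m)                                                                   ≡⟨ cong (λ z → 4 ^ (m + z)) (+-identityʳ m) ⟨
  4 ^ (2 * m)                                                                   ∎
  where
  open ≤-Reasoning
  m = 2 ^ i
  small = filter (λ p → ¬? (suc m ≤? p)) (primesUpTo (2 * m))
  small⊆ : ∀ {p} → p ∈ small → p ∈ primesUpTo m
  small⊆ p∈ = case ∈-filter⁻ (λ p → ¬? (suc m ≤? p)) {xs = primesUpTo (2 * m)} p∈ of λ { (a , b) → primesUpTo-complete (proj₁ (primesUpTo-prime {2 * m} a)) (≤-pred (≰⇒> b)) }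

2^-cancel-≤ : ∀ {a b} → 2 ^ a ≤ 2 ^ b → a ≤ b
2^-cancel-≤ {a} {b} h with a ≤? b
... | yes le = le
... | no nle = ⊥-elim (<⇒≱ (^-monoʳ-< 2 (s≤s (s≤s z≤n)) (≰⇒> nle)) h)

-- Write z = 2^j and N = 32 z². The central binomial coefficient of order N/2 is at least 2^(16 z²).
-- Primes up to z contribute at most N^z. A prime between z and z² contributes at most N ≤ p³, where
-- j ≥ 5 is used, so together these give at most (4^(z²))³ = 2^(6 z²). The remaining 2^(10 z²) must
-- come from the window, at most N for each prime, and `5 + (j + j)` is the binary logarithm of N.
many-primes-in-window : ∀ j → 5 ≤ j → 10 * 2 ^ (j + j) ≤ (5 + (j + j)) * (2 ^ j + length (primesIn (2 ^ (j + j)) (2 ^ (5 + (j + j)))))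
many-primes-in-window j 5≤j = +-cancelˡ-≤ (6 * ZZ) _ _ (2^-cancel-≤ (begin
  2 ^ (6 * ZZ + 10 * ZZ)                          ≡⟨ cong (2 ^_) (lem₁ ZZ) ⟩
  2 ^ n                                           ≤⟨ 2^n≤∏^expsBelow n E (m^n>0 2 (4 + (j + j))) (^-monoʳ-< 2 (s≤s (s≤s z≤n)) (n<1+n (5 + (j + j)))) ⟩
  ∏ ps g                                          ≡⟨ trans (∏-filter P? ps g) (cong (∏ big g *_) (∏-filter R? rest g)) ⟩
  ∏ big g * (∏ mid g * ∏ small g)                 ≤⟨ *-mono-≤ (crude big (∈ps ∘ big⊆) M ≤-refl) (*-mono-≤ mid≤ (crude small (∈ps ∘ rest⊆ ∘ small⊆) Z small-few)) ⟩
  N ^ M * ((4 ^ ZZ) ^ 3 * N ^ Z)                  ≡⟨ cong₂ _*_ (^-*-assoc 2 (5 + (j + j)) M) (cong₂ _*_ (trans (^-*-assoc 4 ZZ 3) (^-*-assoc 2 2 (ZZ * 3))) (^-*-assoc 2 (5 + (j + j)) Z)) ⟩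
  2 ^ (l * M) * (2 ^ (2 * (ZZ * 3)) * 2 ^ (l * Z)) ≡⟨ cong (2 ^ (l * M) *_) (^-distribˡ-+-* 2 (2 * (ZZ * 3)) (l * Z)) ⟨
  2 ^ (l * M) * 2 ^ (2 * (ZZ * 3) + l * Z)        ≡⟨ ^-distribˡ-+-* 2 (l * M) (2 * (ZZ * 3) + l * Z) ⟨
  2 ^ (l * M + (2 * (ZZ * 3) + l * Z))            ≡⟨ cong (2 ^_) (lem₂ l M ZZ Z) ⟩
  2 ^ (6 * ZZ + l * (Z + M))                      ∎))
  where
  open ≤-Reasoning
  l = 5 + (j + j)
  ZZ = 2 ^ (j + j)
  Z = 2 ^ j
  n = 2 ^ (4 + (j + j))
  N = 2 ^ (5 + (j + j))
  E = 6 + (j + j)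
  ps = primesUpTo N
  g : ℕ → ℕ
  g p = p ^ expsBelow E N p
  P? = λ p → suc ZZ ≤? p
  R? = λ p → suc Z ≤? p
  big = primesIn ZZ N
  rest = filter (λ p → ¬? (P? p)) ps
  mid = filter R? rest
  small = filter (λ p → ¬? (R? p)) rest
  M = length big
  lem₁ : ∀ z → 6 * z + 10 * z ≡ 2 * (2 * (2 * (2 * z)))
  lem₁ = ℕ-Ring.solve-∀
  lem₂ : ∀ l m zz z → l * m + (2 * (zz * 3) + l * z) ≡ 6 * zz + l * (z + m)
  lem₂ = ℕ-Ring.solve-∀
  1≤N : 1 ≤ N
  1≤N = m^n>0 2 (5 + (j + j))
  big⊆ : ∀ {p} → p ∈ big → p ∈ ps
  big⊆ p∈ = proj₁ (∈-filter⁻ P? {xs = ps} p∈)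
  rest⊆ : ∀ {p} → p ∈ rest → p ∈ ps
  rest⊆ p∈ = proj₁ (∈-filter⁻ (λ p → ¬? (P? p)) {xs = ps} p∈)
  small⊆ : ∀ {p} → p ∈ small → p ∈ rest
  small⊆ p∈ = proj₁ (∈-filter⁻ (λ p → ¬? (R? p)) {xs = rest} p∈)
  ∈ps : ∀ {p} → p ∈ ps → Prime p
  ∈ps p∈ = proj₁ (primesUpTo-prime {N} p∈)
  crude : ∀ xs → (∀ {p} → p ∈ xs → Prime p) → ∀ c → length xs ≤ c → ∏ xs g ≤ N ^ c
  crude xs pr c le = begin
    ∏ xs g            ≤⟨ ∏-mono xs (λ p p∈ → ^expsBelow≤ E N p (prime≥1 (pr p∈)) 1≤N) ⟩
    ∏ xs (λ _ → N)    ≡⟨ ∏-const xs N ⟩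
    N ^ length xs     ≤⟨ ^-monoʳ-≤ N {{>-nonZero 1≤N}} le ⟩
    N ^ c             ∎
  small-few : length small ≤ Z
  small-few = subst (length small ≤_) (length-interval Z) (unique-⊆⇒length≤ (Uniqueₚ.filter⁺ _ (Uniqueₚ.filter⁺ _ (primesUpTo-unique N)))
    (λ p∈ → ∈-interval⁺ (prime≥1 (∈ps (rest⊆ (small⊆ p∈)))) (≤-pred (≰⇒> (proj₂ (∈-filter⁻ (λ p → ¬? (R? p)) {xs = rest} p∈))))))
  cube : ∀ {p} → Z < p → Prime p → N ≤ p ^ 3
  cube {p} Z<p pp = begin
    2 ^ (5 + (j + j))  ≤⟨ ^-monoʳ-≤ 2 (≤-trans (+-monoˡ-≤ (j + j) 5≤j) (≤-reflexive (lem j))) ⟩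
    2 ^ (j * 3)        ≡⟨ ^-*-assoc 2 j 3 ⟨
    Z ^ 3              ≤⟨ ^-monoˡ-≤ 3 (<⇒≤ Z<p) ⟩
    p ^ 3              ∎
    where
    lem : ∀ j → j + (j + j) ≡ j * 3
    lem = ℕ-Ring.solve-∀
  mid⊆ : ∀ {p} → p ∈ mid → p ∈ primesUpTo ZZ
  mid⊆ p∈ = case ∈-filter⁻ R? {xs = rest} p∈ of λ { (a , _) → primesUpTo-complete (∈ps (rest⊆ a)) (≤-pred (≰⇒> (proj₂ (∈-filter⁻ (λ p → ¬? (P? p)) {xs = ps} a)))) }
  mid≤ : ∏ mid g ≤ (4 ^ ZZ) ^ 3
  mid≤ = begin
    ∏ mid g                       ≤⟨ ∏-mono mid (λ p p∈ → ≤-trans (^expsBelow≤ E N p (prime≥1 (proj₁ (primesUpTo-prime {ZZ} (mid⊆ p∈)))) 1≤N) (cube (proj₂ (∈-filter⁻ R? {xs = rest} p∈)) (proj₁ (primesUpTo-prime {ZZ} (mid⊆ p∈))))) ⟩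
    ∏ mid (λ p → p ^ 3)           ≡⟨ ∏-^ mid id 3 ⟩
    ∏ mid id ^ 3                  ≤⟨ ^-monoˡ-≤ 3 (∏-mono-⊆ {mid} (Uniqueₚ.filter⁺ _ (Uniqueₚ.filter⁺ _ (primesUpTo-unique N))) mid⊆ (λ p∈ → prime≥1 (proj₁ (primesUpTo-prime {ZZ} p∈)))) ⟩
    ∏ (primesUpTo ZZ) id ^ 3      ≤⟨ ^-monoˡ-≤ 3 (primorial≤4^ (j + j)) ⟩
    (4 ^ ZZ) ^ 3                  ∎

-- The induction on e replaces j by its half, where the base at most halves. One factor is then
-- linear in j/2 and the others are covered by the induction hypothesis with the constant enlarged
-- by 2^(e+1); each part is at most 2^⌊j/2⌋. The base `9 + (j + j)` is the number of exponents
-- allowed in `smooths` for numbers below 2^(8 + 2j).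
polynomial≤2^ : ∀ e c → ∃[ J ] ∀ j → J ≤ j → c * (9 + (j + j)) ^ e ≤ 2 ^ j
polynomial≤2^ zero c = c , λ j c≤j → ≤-trans (≤-reflexive (*-identityʳ c)) (≤-trans c≤j (<⇒≤ (n<2^n j)))
polynomial≤2^ (suc e) c with polynomial≤2^ e (c * 2 ^ suc e)
... | J , h = suc ((J ⊔ 5) + (J ⊔ 5)) , λ j J≤j → begin
    c * (9 + (j + j)) ^ suc e                       ≤⟨ *-monoʳ-≤ c (^-monoˡ-≤ (suc e) (half j)) ⟩
    c * (2 * b (i j)) ^ suc e                       ≡⟨ cong (c *_) (*-^ 2 (b (i j)) (suc e)) ⟩
    c * (2 ^ suc e * (b (i j) * b (i j) ^ e))       ≡⟨ lem c (2 ^ suc e) (b (i j)) (b (i j) ^ e) ⟩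
    c * 2 ^ suc e * b (i j) ^ e * b (i j)           ≤⟨ *-mono-≤ (h (i j) (≤-trans (m≤m⊔n J 5) (i≥ j J≤j))) (lin (i j) (≤-trans (m≤n⊔m J 5) (i≥ j J≤j))) ⟩
    2 ^ i j * 2 ^ i j                               ≡⟨ ^-distribˡ-+-* 2 (i j) (i j) ⟨
    2 ^ (i j + i j)                                 ≤⟨ ^-monoʳ-≤ 2 (i+i≤ j) ⟩
    2 ^ j                                           ∎
  where
  open ≤-Reasoning
  i : ℕ → ℕ
  i j = j / 2
  b : ℕ → ℕ
  b i = 9 + (i + i)
  lem : ∀ c t x y → c * (t * (x * y)) ≡ c * t * y * x
  lem = ℕ-Ring.solve-∀
  twice : ∀ x → x * 2 ≡ x + x
  twice = ℕ-Ring.solve-∀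
  i+i≤ : ∀ j → i j + i j ≤ j
  i+i≤ j = subst (_≤ j) (twice (j / 2)) (m/n*n≤m j 2)
  j≤ : ∀ j → j ≤ suc (i j + i j)
  j≤ j = begin
    j                    ≡⟨ m≡m%n+[m/n]*n j 2 ⟩
    j % 2 + j / 2 * 2    ≤⟨ +-mono-≤ (≤-pred (m%n<n j 2)) (≤-reflexive (twice (j / 2))) ⟩
    suc (i j + i j)      ∎
  half : ∀ j → 9 + (j + j) ≤ 2 * b (i j)
  half j = begin
    9 + (j + j)                                         ≤⟨ +-monoʳ-≤ 9 (+-mono-≤ (j≤ j) (j≤ j)) ⟩
    9 + (suc (i j + i j) + suc (i j + i j))             ≤⟨ m≤m+n _ 7 ⟩
    9 + (suc (i j + i j) + suc (i j + i j)) + 7         ≡⟨ eq (i j) ⟩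
    2 * b (i j)                                         ∎
    where
    eq : ∀ i → 9 + (suc (i + i) + suc (i + i)) + 7 ≡ 2 * (9 + (i + i))
    eq = ℕ-Ring.solve-∀
  i≥ : ∀ j → suc ((J ⊔ 5) + (J ⊔ 5)) ≤ j → J ⊔ 5 ≤ i j
  i≥ j h = ≮⇒≥ λ lt → <⇒≱ (≤-trans (s≤s (+-mono-≤ lt (<⇒≤ lt))) h) (j≤ j)
  lin : ∀ i → 5 ≤ i → 9 + (i + i) ≤ 2 ^ i
  lin i 5≤i = subst (λ i → 9 + (i + i) ≤ 2 ^ i) (m+[n∸m]≡n 5≤i) (go (i ∸ 5))
    where
    go : ∀ d → 9 + ((5 + d) + (5 + d)) ≤ 2 ^ (5 + d)
    go zero = m≤m+n 19 13
    go (suc d) = begin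
      9 + ((5 + suc d) + (5 + suc d))       ≡⟨ eq d ⟩
      2 + (9 + ((5 + d) + (5 + d)))         ≤⟨ +-mono-≤ (≤-trans (m≤m+n 2 30) (^-monoʳ-≤ 2 (m≤m+n 5 d))) (go d) ⟩
      2 ^ (5 + d) + 2 ^ (5 + d)             ≡⟨ cong (λ z → 2 ^ (5 + d) + z) (+-identityʳ _) ⟨
      2 * 2 ^ (5 + d)                       ≡⟨ cong (2 ^_) (sym (+-suc 5 d)) ⟩
      2 ^ (5 + suc d)                       ∎
      where
      eq : ∀ d → 9 + ((5 + suc d) + (5 + suc d)) ≡ 2 + (9 + ((5 + d) + (5 + d)))
      eq = ℕ-Ring.solve-∀

-- Smooth numbers and polynomials with a root modulo every large prime

∃-prime> : ∀ y → ∃[ p ] (Prime p × y < p)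
∃-prime> y with ∃-prime-∣ (suc (y !)) (s≤s (>-nonZero⁻¹ (y !) {{y !≢0}}))
... | p , pp , p∣ = p , pp , ≰⇒> λ p≤y → prime∤1 pp (∣m+n∣m⇒∣n (subst (p ∣_) (+-comm 1 (y !)) p∣) (∣-trans (∣-factorial (prime≥1 pp)) (m≤n⇒m!∣n! p≤y)))
  where
  ∣-factorial : ∀ {p} → 1 ≤ p → p ∣ p !
  ∣-factorial {suc p} _ = m∣m*n (p !)

primes-above : ∀ y n → ∃[ qs ] (Unique qs × All (λ q → Prime q × y < q) qs × length qs ≡ n)
primes-above y zero = [] , [] , [] , refl
primes-above y (suc n) with primes-above y n
... | qs , u , pr , len with ∃-prime> (y + sum qs)
... | p , pp , p> = p ∷ qs , All-tabulate (λ q∈ e → <⇒≱ p> (≤-trans (≤-reflexive e) (≤-trans (∈⇒≤sum q∈) (m≤n+m (sum qs) y)))) ∷ u , (pp , ≤-<-trans (m≤m+n y (sum qs)) p>) ∷ pr , cong suc len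

-- Contains every Y-smooth number below 2 ^ L.
smooths : ℕ → ℕ → List ℕ
smooths zero L = 1 ∷ []
smooths (suc Y) L = map (λ { (e , m) → suc Y ^ e * m }) (cartesianProduct (upTo (suc L)) (smooths Y L))

length-smooths : ∀ Y L → length (smooths Y L) ≡ suc L ^ Y
length-smooths zero L = refl
length-smooths (suc Y) L = trans (length-map _ (cartesianProduct (upTo (suc L)) (smooths Y L))) (trans (length-cartesianProduct (upTo (suc L)) (smooths Y L)) (cong₂ _*_ (length-upTo (suc L)) (length-smooths Y L)))

strip : ∀ b → 2 ≤ b → ∀ n → 1 ≤ n → ∃[ v ] ∃[ m ] (n ≡ b ^ v * m × ¬ b ∣ m)
strip b 2≤b n = <-rec _ step n
  where
  step : ∀ n → (∀ {m} → m < n → 1 ≤ m → ∃[ v ] ∃[ m′ ] (m ≡ b ^ v * m′ × ¬ b ∣ m′)) → 1 ≤ n → ∃[ v ] ∃[ m ] (n ≡ b ^ v * m × ¬ b ∣ m)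
  step n rec 1≤n with b ∣? n
  ... | no ¬d = 0 , n , sym (+-identityʳ n) , ¬d
  ... | yes (divides zero e) = ⊥-elim (1+n≰n (subst (1 ≤_) e 1≤n))
  ... | yes (divides m@(suc _) e) with rec {m} (subst (m <_) (sym e) (m<m*n m b 2≤b)) (s≤s z≤n)
  ... | v , m′ , e′ , ¬d = suc v , m′ , trans e (trans (*-comm m b) (trans (cong (b *_) e′) (sym (*-assoc b (b ^ v) m′)))) , ¬d

SmoothsComplete : ℕ → ℕ → Set
SmoothsComplete Y L = ∀ n → 1 ≤ n → n < 2 ^ L → (∀ {p} → Prime p → p ∣ n → p ≤ Y) → n ∈ smooths Y L

-- All powers of `suc Y` are stripped, whether it is prime or not: the cofactor is no longer
-- divisible by it, so its prime factors are at most Y. The base 1 cannot be stripped and takes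
-- exponent 0.
∈-smooths-suc : ∀ Y L → SmoothsComplete Y L → SmoothsComplete (suc Y) L
∈-smooths-suc zero L rec n 1≤n n< h = subst (_∈ smooths 1 L) (+-identityʳ n)
  (∈-map⁺ _ (∈-cartesianProduct⁺ (∈-upTo⁺ {suc L} (s≤s z≤n)) (rec n 1≤n n< λ pp p∣ → ⊥-elim (1+n≰n (≤-trans (prime≥2 pp) (h pp p∣))))))
∈-smooths-suc Y@(suc _) L rec n 1≤n n< h with strip (suc Y) (s≤s (s≤s z≤n)) n 1≤n
... | v , zero , e , ¬d = ⊥-elim (¬d (suc Y ∣0))
... | v , m@(suc _) , e , ¬d = subst (_∈ smooths (suc Y) L) (sym e) (∈-map⁺ _ (∈-cartesianProduct⁺ (∈-upTo⁺ (s≤s v≤L)) (rec m (s≤s z≤n) (≤-<-trans m≤n n<) smooth)))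
  where
  instance
    _ = m^n≢0 (suc Y) v
  m≤n : m ≤ n
  m≤n = subst (m ≤_) (sym e) (m≤n*m m (suc Y ^ v))
  v≤L : v ≤ L
  v≤L = 2^-cancel-≤ (≤-trans (^-monoˡ-≤ v (s≤s (s≤s (z≤n {_})))) (≤-trans (≤-trans (m≤m*n (suc Y ^ v) m) (≤-reflexive (sym e))) (<⇒≤ n<)))
  smooth : ∀ {p} → Prime p → p ∣ m → p ≤ Y
  smooth {p} pp p∣m with p ≟ suc Y
  ... | yes refl = ⊥-elim (¬d p∣m)
  ... | no ne = ≤-pred (≤∧≢⇒< (h pp (subst (p ∣_) (sym e) (∣n⇒∣m*n (suc Y ^ v) p∣m))) ne)

∈-smooths : ∀ Y L → SmoothsComplete Y L
∈-smooths zero L (suc zero) _ _ h = here refl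
∈-smooths zero L (suc (suc n)) _ _ h with ∃-prime-∣ (suc (suc n)) (s≤s (s≤s z≤n))
... | p , pp , p∣ = ⊥-elim (1+n≰n (≤-trans (prime≥1 pp) (h pp p∣)))
∈-smooths (suc Y) L = ∈-smooths-suc Y L (∈-smooths Y L)

search : ∀ {P : ℕ → Set} (P? : ∀ x → Dec (P x)) xs → (∃[ x ] (x ∈ xs × P x)) ⊎ (∀ {x} → x ∈ xs → ¬ P x)
search P? [] = inj₂ λ ()
search P? (x ∷ xs) with P? x | search P? xs
... | yes p | _ = inj₁ (x , here refl , p)
... | no ¬p | inj₁ (y , y∈ , p) = inj₁ (y , there y∈ , p)
... | no ¬p | inj₂ h = inj₂ λ { (here refl) → ¬p ; (there y∈) → h y∈ }

bracket : ∀ J k → 2 ^ (6 + (J + J)) ≤ k → ∃[ j ] (J ≤ j × 2 ^ (6 + (j + j)) ≤ k × k < 2 ^ (8 + (j + j)))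
bracket J k = go (suc k) J (m≤n+m (suc k) J)
  where
  open ≤-Reasoning
  go : ∀ fuel J → k < J + fuel → 2 ^ (6 + (J + J)) ≤ k → ∃[ j ] (J ≤ j × 2 ^ (6 + (j + j)) ≤ k × k < 2 ^ (8 + (j + j)))
  go zero J k< lo = ⊥-elim (<⇒≱ k< (begin
    J + 0               ≡⟨ +-identityʳ J ⟩
    J                   ≤⟨ ≤-trans (m≤m+n J J) (m≤n+m (J + J) 6) ⟩
    6 + (J + J)         ≤⟨ <⇒≤ (n<2^n (6 + (J + J))) ⟩
    2 ^ (6 + (J + J))   ≤⟨ lo ⟩
    k                   ∎))
  go (suc fuel) J k< lo with k <? 2 ^ (8 + (J + J))
  ... | yes hi = J , ≤-refl , lo , hi
  ... | no ¬hi with go fuel (suc J) (subst (k <_) (+-suc J fuel) k<) (subst (λ e → 2 ^ e ≤ k) (cong (λ z → 7 + z) (sym (+-suc J J))) (≮⇒≥ ¬hi))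
  ... | j , J<j , lo′ , hi = j , <⇒≤ J<j , lo′ , hi

attach : ∀ {f} (cs : List (ℕ × ℤ)) → All (λ c → RootMod f (proj₁ c)) cs →
  ∃[ ms ] (map proj₁ ms ≡ map proj₁ cs × ∀ {c} → c ∈ cs → ∃[ x ] (+ proj₁ c ∣ℤ eval f x × (proj₁ c , x ⊖ proj₂ c) ∈ ms))
attach [] _ = [] , refl , λ ()
attach {f} ((p , c) ∷ cs) ((x , root) ∷ rs) with attach {f} cs rs
... | ms , e , h = (p , x ⊖ c) ∷ ms , cong (p ∷_) e , λ { (here refl) → x , root , here refl ; (there c∈) → case h c∈ of λ { (y , r , m∈) → y , r , there m∈ } }

-- For a free prime p ≡ c modulo all the q, the position 1 + m p lies in the class 1 + c m modulo q.
-- Thus the one prime q attached to m covers these positions for all free primes at once.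
multipliers : ℕ → List ℕ → ℕ → List (ℕ × ℤ)
multipliers c [] m = []
multipliers c (q ∷ qs) m = (q , + suc (c * m)) ∷ multipliers c qs (suc m)

map-multipliers : ∀ c qs m → map proj₁ (multipliers c qs m) ≡ qs
map-multipliers c [] m = refl
map-multipliers c (q ∷ qs) m = cong (q ∷_) (map-multipliers c qs (suc m))

∈-multipliers : ∀ c qs m d → d < length qs → ∃[ q ] (q ∈ qs × (q , + suc (c * (m + d))) ∈ multipliers c qs m)
∈-multipliers c (q ∷ qs) m zero _ = q , here refl , here (cong (λ z → q , + suc (c * z)) (+-identityʳ m))
∈-multipliers c (q ∷ qs) m (suc d) (s≤s d<) with ∈-multipliers c qs (suc m) d d<
... | q′ , q′∈ , h = q′ , there q′∈ , there (subst (λ z → (q′ , + suc (c * z)) ∈ multipliers c qs (suc m)) (sym (+-suc m d)) h)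


-- A position is written 1 + t. The primes of `NF` all own the class of 1, so each of them covers
-- every 1 + t with p dividing t > 0, with position 1 as partner. The primes of `Fr` are withheld
-- from this; the positions 1 + m p that they would have covered fall to the auxiliary primes `qs`,
-- one for each m. What remains has t smooth.
module AllRoots {f : Poly} (M₀ : ℕ) (root : ∀ p → Prime p → M₀ < p → RootMod f p)
  (qs : List ℕ) (uqs : Unique qs) (pqs : All (λ q → Prime q × M₀ < q) qs) where

  Y = suc (M₀ + sum qs)
  Q = product qs

  1≤Q : 1 ≤ Q
  1≤Q = productOfPrimes≥1 (All-map proj₁ pqs)

  instance
    Q≢0 : NonZero Q
    Q≢0 = >-nonZero 1≤Q

  q≤Y : ∀ {q} → q ∈ qs → q ≤ Y
  q≤Y q∈ = ≤-trans (∈⇒≤sum q∈) (≤-trans (m≤n+m (sum qs) M₀) (n≤1+n _))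

  root′ : ∀ {p} → Prime p → Y < p → RootMod f p
  root′ pp Y<p = root _ pp (≤-trans (s≤s (≤-trans (m≤m+n M₀ (sum qs)) (n≤1+n _))) Y<p)

  -- Free primes lie in (4^j, 32 · 4^j] and k in [64 · 4^j, 256 · 4^j). The lower bound on k gives 2
  -- p ≤ k, so a free prime can serve any position; `hi′` bounds the multipliers m of positions 1 +
  -- m p by the number of auxiliary primes.
  module Scale (k j : ℕ) (poly : 2 * Q * (9 + (j + j)) ^ Y ≤ 2 ^ j) (5≤j : 5 ≤ j) (Y≤j : Y ≤ j) (lo : 2 ^ (6 + (j + j)) ≤ k) (hi : k < 2 ^ (8 + (j + j))) (hi′ : k < length qs * 2 ^ (j + j)) where

    ZZ L B : ℕ
    ZZ = 2 ^ (j + j)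
    L = 8 + (j + j)
    B = 9 + (j + j)

    W : List ℕ
    W = primesIn ZZ (2 ^ (5 + (j + j)))

    -- Position 1 belongs to t = 0, which is not among the smooth numbers, and is added separately.
    left : List ℕ
    left = 1 ∷ filter (_≤? k) (map suc (smooths Y L))

    j<ZZ : j < ZZ
    j<ZZ = <-≤-trans (n<2^n j) (^-monoʳ-≤ 2 (m≤m+n j j))

    2ZZ≤k : 2 * ZZ ≤ k
    2ZZ≤k = ≤-trans (^-monoʳ-≤ 2 (m≤n+m (suc (j + j)) 5)) lo

    1≤k : 1 ≤ k
    1≤k = ≤-trans (m^n>0 2 (6 + (j + j))) lo

    W-spec : ∀ {p} → p ∈ W → Prime p × ZZ < p × 2 * p ≤ k
    W-spec p∈ with ∈-filter⁻ (λ p → suc ZZ ≤? p) {xs = primesUpTo (2 ^ (5 + (j + j)))} p∈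
    ... | a , b = proj₁ (primesUpTo-prime {2 ^ (5 + (j + j))} a) , b , ≤-trans (*-monoʳ-≤ 2 (proj₂ (primesUpTo-prime {2 ^ (5 + (j + j))} a))) lo

    left-range : All (λ i → 1 ≤ i × i ≤ k) left
    left-range = (≤-refl , 1≤k) ∷ All-tabulate λ i∈ → case ∈-filter⁻ (_≤? k) {xs = map suc (smooths Y L)} i∈ of λ { (a , i≤k) → case ∈-map⁻ suc a of λ { (_ , _ , refl) → s≤s z≤n , i≤k } }

    module Class (c : ℕ) (popular : length W ≤ Q * length (filter (λ p → p % Q ≟ c) W)) where

      c? : ∀ p → Dec (p % Q ≡ c)
      c? p = p % Q ≟ c

      Fr : List ℕ
      Fr = filter c? W

      Fr-spec : ∀ {p} → p ∈ Fr → (Prime p × ZZ < p × 2 * p ≤ k) × p % Q ≡ c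
      Fr-spec p∈ = case ∈-filter⁻ c? {xs = W} p∈ of λ { (a , b) → W-spec a , b }

      Fr-unique : Unique Fr
      Fr-unique = Uniqueₚ.filter⁺ c? (Uniqueₚ.filter⁺ _ (primesUpTo-unique (2 ^ (5 + (j + j)))))

      -- Otherwise the most popular class, and with it the whole window, would have size polynomial
      -- in j. Then (5 + 2j)(2^j + |W|) would be at most 2 · 4^j, against the lower bound 10 · 4^j
      -- of `many-primes-in-window`.
      enough : length left ≤ length Fr
      enough with length left ≤? length Fr
      ... | yes h = h
      ... | no h = ⊥-elim (<⇒≱ contra (many-primes-in-window j 5≤j))
        where
        open ≤-Reasoning
        few : length left ≤ 1 + B ^ Y
        few = s≤s (≤-trans (length-filter (_≤? k) (map suc (smooths Y L))) (≤-reflexive (trans (length-map suc (smooths Y L)) (length-smooths Y L))))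
        lem₁ : ∀ q b → q * (b + b) ≡ 2 * q * b
        lem₁ = ℕ-Ring.solve-∀
        W≤ : length W ≤ 2 ^ j
        W≤ = begin
          length W            ≤⟨ popular ⟩
          Q * length Fr       ≤⟨ *-monoʳ-≤ Q (≤-trans (≤-pred (≤-trans (≰⇒> h) few)) (m≤n+m (B ^ Y) (B ^ Y))) ⟩
          Q * (B ^ Y + B ^ Y) ≡⟨ lem₁ Q (B ^ Y) ⟩
          2 * Q * B ^ Y       ≤⟨ poly ⟩
          2 ^ j               ∎
        l≤ : 5 + (j + j) ≤ 2 ^ j
        l≤ = begin
          5 + (j + j)         ≤⟨ m≤n+m (5 + (j + j)) 4 ⟩
          B                   ≡⟨ *-identityʳ B ⟨
          B ^ 1               ≤⟨ ^-monoʳ-≤ B (s≤s (z≤n {M₀ + sum qs})) ⟩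
          B ^ Y               ≤⟨ m≤n*m (B ^ Y) (2 * Q) {{m*n≢0 2 Q}} ⟩
          2 * Q * B ^ Y       ≤⟨ poly ⟩
          2 ^ j               ∎
        contra : (5 + (j + j)) * (2 ^ j + length W) < 10 * ZZ
        contra = begin-strict
          (5 + (j + j)) * (2 ^ j + length W)   ≤⟨ *-mono-≤ l≤ (+-monoʳ-≤ (2 ^ j) W≤) ⟩
          2 ^ j * (2 ^ j + 2 ^ j)              ≡⟨ trans (*-distribˡ-+ (2 ^ j) (2 ^ j) (2 ^ j)) (cong₂ _+_ (sym (^-distribˡ-+-* 2 j j)) (sym (^-distribˡ-+-* 2 j j))) ⟩
          ZZ + ZZ                              ≡⟨ cong (λ z → ZZ + z) (+-identityʳ ZZ) ⟨
          2 * ZZ                               <⟨ *-monoˡ-< ZZ {{m^n≢0 2 (j + j)}} {2} {10} (s≤s (s≤s (s≤s z≤n))) ⟩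
          10 * ZZ                              ∎

      old? : ∀ p → Dec (Y < p × p ∉ Fr)
      old? p = (Y <? p) ×-dec ¬? (p ∈? Fr)

      NF : List ℕ
      NF = filter old? (primesUpTo k)

      NF-spec : ∀ {p} → p ∈ NF → Prime p × Y < p × p ∉ Fr
      NF-spec p∈ = case ∈-filter⁻ old? {xs = primesUpTo k} p∈ of λ { (a , b) → proj₁ (primesUpTo-prime {k} a) , b }

      module Build
        (m₁ : List (ℕ × ℤ)) (keys₁ : map proj₁ m₁ ≡ NF) (hit₁ : ∀ {p} → p ∈ NF → ∃[ x ] (+ p ∣ℤ eval f x × (p , x ⊖ + 1) ∈ m₁))
        (m₂ : List (ℕ × ℤ)) (keys₂ : map proj₁ m₂ ≡ qs) (hit₂ : ∀ m → m < length qs → ∃[ q ] ∃[ x ] (q ∈ qs × + q ∣ℤ eval f x × (q , x ⊖ + suc (c * m)) ∈ m₂))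
        (m₃ : List (ℕ × ℤ)) (u₃ : Unique (map proj₁ m₃)) (keys₃ : ∀ {p} → p ∈ map proj₁ m₃ → p ∈ Fr) (cov₃ : ∀ {i} → i ∈ left → Covered f k m₃ i)
        where

        ms : List (ℕ × ℤ)
        ms = m₁ ++ (m₂ ++ m₃)

        coveredNF : ∀ {t p} → 1 ≤ t → suc t ≤ k → p ∈ NF → p ∣ t → Covered f k ms (suc t)
        coveredNF {t} {p} 1≤t t<k p∈ p∣t with hit₁ p∈
        ... | x , rt , m∈ = 1 , ≤-refl , 1≤k , (λ e → 1+n≰n (subst (2 ≤_) (sym e) (s≤s 1≤t))) , (p , x ⊖ + 1) , ∈-++⁺ˡ m∈ ,
              eval-transfer f (∣ℤ-≡ (trans (lem x (+ t)) (cong (λ z → ((x ⊖ + 1) ⊕ z) ⊖ x) (sym (ℤₚ.pos-+ 1 t)))) (∣-abs {p} {+ t} p∣t)) rt ,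
              subst (λ z → + p ∣ℤ eval f z) (lem′ x) rt
          where
          lem : ∀ x t → t ≡ ((x ⊖ + 1) ⊕ (+ 1 ⊕ t)) ⊖ x
          lem = ℤ-Ring.solve-∀
          lem′ : ∀ x → x ≡ (x ⊖ + 1) ⊕ + 1
          lem′ = ℤ-Ring.solve-∀

        coveredA : ∀ {t p m} → t ≡ m * p → suc t ≤ k → p ∈ Fr → Covered f k ms (suc t)
        coveredA {t} {p} {m} t≡ t<k p∈ with hit₂ m m<T
          where
          open ≤-Reasoning
          m<T : m < length qs
          m<T = *-cancelʳ-< ZZ m (length qs) (begin-strict
            m * ZZ              ≤⟨ *-monoʳ-≤ m (<⇒≤ (proj₁ (proj₂ (proj₁ (Fr-spec p∈))))) ⟩
            m * p               ≡⟨ t≡ ⟨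
            t                   <⟨ t<k ⟩
            k                   <⟨ hi′ ⟩
            length qs * ZZ      ∎)
        ... | q , x , q∈ , rt , m∈ = Covered-mono {f} {k} (λ { (here refl) → ∈-++⁺ʳ m₁ (∈-++⁺ˡ m∈) ; (there ()) })
                (class-covered {f} {k} {q} {x} {suc t} (+ suc (c * m)) (proj₁ (All-lookup pqs q∈)) (≤-trans (*-monoʳ-≤ 2 (≤-trans (q≤Y q∈) (≤-trans Y≤j (<⇒≤ j<ZZ)))) 2ZZ≤k) rt (s≤s z≤n) t<k q∣)
          where
          lem : ∀ m p c → m ⊗ (p ⊖ c) ≡ (+ 1 ⊕ m ⊗ p) ⊖ (+ 1 ⊕ c ⊗ m)
          lem = ℤ-Ring.solve-∀
          Q∣ : + Q ∣ℤ (+ p ⊖ + c)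
          Q∣ = %≡⇒∣⊖ p (proj₂ (Fr-spec p∈))
          q∣ : + q ∣ℤ (+ suc t ⊖ + suc (c * m))
          q∣ = ∣ℤ-≡ (trans (lem (+ m) (+ p) (+ c)) (cong₂ (λ u v → (+ 1 ⊕ u) ⊖ (+ 1 ⊕ v)) (trans (sym (ℤₚ.pos-* m p)) (cong +_ (sym t≡))) (sym (ℤₚ.pos-* c m))))
            (ℤ∣.∣n⇒∣m*n (+ m) (ℤ∣.∣-trans (∣-abs {q} {+ Q} (∈⇒∣product q∈)) Q∣))

        covers′ : ∀ i → 1 ≤ i → i ≤ k → Covered f k ms i
        covers′ (suc zero) _ _ = Covered-mono {f} {k} (λ m∈ → ∈-++⁺ʳ m₁ (∈-++⁺ʳ m₂ m∈)) (cov₃ (here refl))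
        covers′ (suc t@(suc _)) _ t<k with search (λ p → p ∣? t) NF
        ... | inj₁ (p , p∈ , p∣t) = coveredNF (s≤s z≤n) t<k p∈ p∣t
        ... | inj₂ none with search (λ p → p ∣? t) Fr
        ... | inj₁ (p , p∈ , divides m t≡) = coveredA {m = m} t≡ t<k p∈
        ... | inj₂ none′ = Covered-mono {f} {k} (λ m∈ → ∈-++⁺ʳ m₁ (∈-++⁺ʳ m₂ m∈)) (cov₃ (there (∈-filter⁺ (_≤? k) (∈-map⁺ suc (∈-smooths Y L t (s≤s z≤n) (<-trans t<k hi) smooth)) t<k)))
          where
          smooth : ∀ {p} → Prime p → p ∣ t → p ≤ Y
          smooth {p} pp p∣t with Y <? p
          ... | no ¬h = ≮⇒≥ ¬h
          ... | yes Y<p with p ∈? Fr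
          ... | yes p∈ = ⊥-elim (none′ p∈ p∣t)
          ... | no p∉ = ⊥-elim (none (∈-filter⁺ old? (primesUpTo-complete pp (≤-trans (∣⇒≤ p∣t) (<⇒≤ t<k))) (Y<p , p∉)) p∣t)

        disj : ∀ {p} → p ∈ qs × p ∈ map proj₁ m₃ → ⊥
        disj (a , b) = <⇒≱ (<-trans j<ZZ (proj₁ (proj₂ (proj₁ (Fr-spec (keys₃ b)))))) (≤-trans (q≤Y a) Y≤j)
        disj′ : ∀ {p} → p ∈ NF × p ∈ qs ++ map proj₁ m₃ → ⊥
        disj′ (a , b) with ∈-++⁻ qs b
        ... | inj₁ b₁ = <⇒≱ (proj₁ (proj₂ (NF-spec a))) (q≤Y b₁)
        ... | inj₂ b₂ = proj₂ (proj₂ (NF-spec a)) (keys₃ b₂)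


        plan : Plan f k
        plan = record
          { residues = ms
          ; primes = All-tabulate λ {m} m∈ → case ∈-++⁻ m₁ m∈ of λ
              { (inj₁ a) → proj₁ (NF-spec (subst (proj₁ m ∈_) keys₁ (∈-map⁺ proj₁ a)))
              ; (inj₂ b) → case ∈-++⁻ m₂ b of λ
                { (inj₁ b₁) → proj₁ (All-lookup pqs (subst (proj₁ m ∈_) keys₂ (∈-map⁺ proj₁ b₁)))
                ; (inj₂ b₂) → proj₁ (proj₁ (Fr-spec (keys₃ (∈-map⁺ proj₁ b₂)))) } }
          ; distinct = subst Unique (sym (trans (map-++ proj₁ m₁ (m₂ ++ m₃)) (cong₂ _++_ keys₁ (trans (map-++ proj₁ m₂ m₃) (cong (_++ map proj₁ m₃) keys₂)))))
              (Uniqueₚ.++⁺ (Uniqueₚ.filter⁺ old? (primesUpTo-unique k)) (Uniqueₚ.++⁺ uqs u₃ disj) disj′)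
          ; covers = covers′
          }

      classOne : ℕ → ℕ × ℤ
      classOne p = p , + 1

      keys-classOne : ∀ xs → map proj₁ (map classOne xs) ≡ xs
      keys-classOne [] = refl
      keys-classOne (x ∷ xs) = cong (x ∷_) (keys-classOne xs)

      at₁ : ∃[ ms ] (map proj₁ ms ≡ map proj₁ (map classOne NF) × ∀ {c} → c ∈ map classOne NF → ∃[ x ] (+ proj₁ c ∣ℤ eval f x × (proj₁ c , x ⊖ proj₂ c) ∈ ms))
      at₁ = attach {f} (map classOne NF) (All-tabulate λ c∈ → case ∈-map⁻ classOne c∈ of λ { (p , p∈ , refl) → root′ (proj₁ (NF-spec p∈)) (proj₁ (proj₂ (NF-spec p∈))) })

      at₂ : ∃[ ms ] (map proj₁ ms ≡ map proj₁ (multipliers c qs 0) × ∀ {d} → d ∈ multipliers c qs 0 → ∃[ x ] (+ proj₁ d ∣ℤ eval f x × (proj₁ d , x ⊖ proj₂ d) ∈ ms))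
      at₂ = attach {f} (multipliers c qs 0) (All-tabulate λ {x} x∈ → case All-lookup pqs (subst (proj₁ x ∈_) (map-multipliers c qs 0) (∈-map⁺ proj₁ x∈)) of λ { (pp , M<) → root _ pp M< })

      at₃ : ∃[ ms ] (Unique (map proj₁ ms) × (∀ {p} → p ∈ map proj₁ ms → p ∈ Fr) × (∀ {i} → i ∈ left → Covered f k ms i))
      at₃ = assign {f} {k} (λ p → Prime p × 2 * p ≤ k × RootMod f p)
        (λ { {p} {i} (pp , 2p≤k , x , rt) 1≤i i≤k → x ⊖ + i , class-covered {f} {k} {p} {x} {i} (+ i) pp 2p≤k rt 1≤i i≤k (∣ℤ-≡ (sym (ℤₚ.+-inverseʳ (+ i))) (dividesℤ (+ 0) refl)) })
        left left-range Fr Fr-unique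
        (All-tabulate λ p∈ → case Fr-spec p∈ of λ { ((pp , ZZ<p , 2p≤k) , _) → pp , 2p≤k , root′ pp (≤-<-trans Y≤j (<-trans j<ZZ ZZ<p)) }) enough

      plan : Plan f k
      plan = Build.plan
        (proj₁ at₁) (trans (proj₁ (proj₂ at₁)) (keys-classOne NF)) (λ p∈ → proj₂ (proj₂ at₁) (∈-map⁺ classOne p∈))
        (proj₁ at₂) (trans (proj₁ (proj₂ at₂)) (map-multipliers c qs 0)) hit₂
        (proj₁ at₃) (proj₁ (proj₂ at₃)) (proj₁ (proj₂ (proj₂ at₃))) (proj₂ (proj₂ (proj₂ at₃)))
        where
        hit₂ : ∀ m → m < length qs → ∃[ q ] ∃[ x ] (q ∈ qs × + q ∣ℤ eval f x × (q , x ⊖ + suc (c * m)) ∈ proj₁ at₂)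
        hit₂ m m< = case ∈-multipliers c qs 0 m m< of λ { (q , q∈ , x∈) → case proj₂ (proj₂ at₂) x∈ of λ { (x , rt , m∈) → q , x , q∈ , rt , m∈ } }

<2^+⇒<* : ∀ {k n} e b → n ≡ 2 ^ e → k < 2 ^ (e + b) → k < n * 2 ^ b
<2^+⇒<* {k} e b n≡ h = subst (k <_) (trans (^-distribˡ-+-* 2 e b) (cong (_* 2 ^ b) (sym n≡))) h

allRoots⇒plan : ∀ {f} M₀ → (∀ p → Prime p → M₀ < p → RootMod f p) → EventuallyPlan f
allRoots⇒plan {f} M₀ root = 2 ^ (6 + (J′ + J′)) , plan
  where
  -- One auxiliary prime for each multiplier below 2^8, the bound that `bracket` gives for k / 4^j.
  aux = primes-above M₀ (2 ^ 8)
  open AllRoots {f} M₀ root (proj₁ aux) (proj₁ (proj₂ aux)) (proj₁ (proj₂ (proj₂ aux)))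
  J = proj₁ (polynomial≤2^ Y (2 * Q))
  J′ = J ⊔ (5 ⊔ Y)
  plan : ∀ k → 2 ^ (6 + (J′ + J′)) ≤ k → Plan f k
  plan k G≤k = case bracket J′ k G≤k of λ { (j , J′≤j , lo , hi) →
    go j lo hi (proj₂ (polynomial≤2^ Y (2 * Q)) j (≤-trans (m≤m⊔n J (5 ⊔ Y)) J′≤j)) (≤-trans (m≤m⊔n 5 Y) (≤-trans (m≤n⊔m J (5 ⊔ Y)) J′≤j)) (≤-trans (m≤n⊔m 5 Y) (≤-trans (m≤n⊔m J (5 ⊔ Y)) J′≤j))
      (<2^+⇒<* 8 (j + j) (proj₂ (proj₂ (proj₂ aux))) hi) }
    where
    go : ∀ j → 2 ^ (6 + (j + j)) ≤ k → k < 2 ^ (8 + (j + j)) → 2 * Q * (9 + (j + j)) ^ Y ≤ 2 ^ j → 5 ≤ j → Y ≤ j → k < length (proj₁ aux) * 2 ^ (j + j) → Plan f k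
    go j lo hi poly′ 5≤j Y≤j hi′ = case popular-class (_% Q) Q W 1≤Q (λ {i} _ → m%n<n i Q) of λ { (c , popular) → Class.plan c popular }
      where open Scale k j poly′ 5≤j Y≤j lo hi hi′

-- Polynomials modulo prime powers

∣∸⇒≡ : ∀ {p a b} → a < p → a ≤ b → b < p → p ∣ b ∸ a → b ≡ a
∣∸⇒≡ {p} {a} {b} a<p a≤b b<p d with b ∸ a in eq
... | zero = ≤-antisym (m∸n≡0⇒m≤n eq) a≤b
... | suc _ = ⊥-elim (<⇒≱ (≤-<-trans (subst (_≤ b) eq (m∸n≤m b a)) b<p) (∣⇒≤ d))

abs-⊖-≥ : ∀ {a b} → a ≤ b → ∣ + b ⊖ + a ∣ ≡ b ∸ a
abs-⊖-≥ {a} {b} a≤b = trans (cong ∣_∣ (ℤₚ.[+m]-[+n]≡m⊖n b a)) (cong ∣_∣ (ℤₚ.⊖-≥ a≤b))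

∣⊖⇒≡ : ∀ {p a b} → a < p → b < p → + p ∣ℤ (+ a ⊖ + b) → a ≡ b
∣⊖⇒≡ {p} {a} {b} a<p b<p d with ≤-total a b
... | inj₁ a≤b = sym (∣∸⇒≡ a<p a≤b b<p (subst (p ∣_) (abs-⊖-≥ a≤b) (abs-∣ (∣-⊖-sym (+ a) (+ b) d))))
... | inj₂ b≤a = ∣∸⇒≡ b<p b≤a a<p (subst (p ∣_) (abs-⊖-≥ b≤a) (abs-∣ d))

-- Horner's scheme for the quotient of f(X) - f(r) by X - r.
quot : Poly → ℤ → Poly
quot [] r = []
quot (c ∷ []) r = []
quot (c ∷ g@(_ ∷ _)) r = eval g r ∷ quot g r

eval-quot : ∀ f r x → eval f x ⊖ eval f r ≡ (x ⊖ r) ⊗ eval (quot f r) x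
eval-quot [] r x = lem x r
  where
  lem : ∀ x r → + 0 ⊖ + 0 ≡ (x ⊖ r) ⊗ + 0
  lem = ℤ-Ring.solve-∀
eval-quot (c ∷ []) r x = lem c x r
  where
  lem : ∀ c x r → (c ⊕ x ⊗ + 0) ⊖ (c ⊕ r ⊗ + 0) ≡ (x ⊖ r) ⊗ + 0
  lem = ℤ-Ring.solve-∀
eval-quot (c ∷ g@(_ ∷ _)) r x = begin
  (c ⊕ x ⊗ eval g x) ⊖ (c ⊕ r ⊗ eval g r)                          ≡⟨ lem₁ c x r (eval g x) (eval g r) ⟩
  (x ⊖ r) ⊗ eval g r ⊕ x ⊗ (eval g x ⊖ eval g r)                   ≡⟨ cong (λ z → (x ⊖ r) ⊗ eval g r ⊕ x ⊗ z) (eval-quot g r x) ⟩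
  (x ⊖ r) ⊗ eval g r ⊕ x ⊗ ((x ⊖ r) ⊗ eval (quot g r) x)           ≡⟨ lem₂ x r (eval g r) (eval (quot g r) x) ⟩
  (x ⊖ r) ⊗ (eval g r ⊕ x ⊗ eval (quot g r) x)                     ∎
  where
  open ≡-Reasoning
  lem₁ : ∀ c x r u v → (c ⊕ x ⊗ u) ⊖ (c ⊕ r ⊗ v) ≡ (x ⊖ r) ⊗ v ⊕ x ⊗ (u ⊖ v)
  lem₁ = ℤ-Ring.solve-∀
  lem₂ : ∀ x r v q → (x ⊖ r) ⊗ v ⊕ x ⊗ ((x ⊖ r) ⊗ q) ≡ (x ⊖ r) ⊗ (v ⊕ x ⊗ q)
  lem₂ = ℤ-Ring.solve-∀

quot-leading : ∀ c cs a r → ∃[ cs′ ] (quot (c ∷ cs ++ a ∷ []) r ≡ cs′ ++ a ∷ [] × length cs′ ≡ length cs)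
quot-leading c [] a r = [] , cong (_∷ []) (lem a r) , refl
  where
  lem : ∀ a r → a ⊕ r ⊗ + 0 ≡ a
  lem = ℤ-Ring.solve-∀
quot-leading c (d ∷ cs) a r with quot-leading d cs a r
... | cs′ , e , l = eval (d ∷ cs ++ a ∷ []) r ∷ cs′ , cong (eval (d ∷ cs ++ a ∷ []) r ∷_) e , cong suc l

lagrange : ∀ {p} → Prime p → ∀ n cs a → length cs ≡ n → ¬ (+ p ∣ℤ a) → ∀ rs → Unique rs → All (λ r → r < p × + p ∣ℤ eval (cs ++ a ∷ []) (+ r)) rs → length rs ≤ n
lagrange pp n cs a _ p∤a [] _ _ = z≤n
lagrange {p} pp n [] a _ p∤a (r ∷ rs) _ ((_ , d) ∷ _) = ⊥-elim (p∤a (∣ℤ-≡ (lem a (+ r)) d))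
  where
  lem : ∀ a r → a ⊕ r ⊗ + 0 ≡ a
  lem = ℤ-Ring.solve-∀
lagrange {p} pp (suc n) (c ∷ cs) a len p∤a (r ∷ rs) (r∉ ∷ u) ((r<p , d) ∷ hs) with quot-leading c cs a (+ r)
... | cs′ , e , l = s≤s (lagrange pp n cs′ a (trans l (suc-injective len)) p∤a rs u (All-tabulate λ {x} x∈ → proj₁ (All-lookup hs x∈) , root x x∈))
  where
  root : ∀ x → x ∈ rs → + p ∣ℤ eval (cs′ ++ a ∷ []) (+ x)
  root x x∈ with primeℤ pp (+ x ⊖ + r) (eval (quot (c ∷ cs ++ a ∷ []) (+ r)) (+ x)) (∣ℤ-≡ (eval-quot (c ∷ cs ++ a ∷ []) (+ r) (+ x)) (ℤ∣.∣m∣n⇒∣m-n (proj₂ (All-lookup hs x∈)) d))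
  ... | inj₁ x≡r = ⊥-elim (All-lookup r∉ x∈ (sym (∣⊖⇒≡ (proj₁ (All-lookup hs x∈)) r<p x≡r)))
  ... | inj₂ h = subst (λ g → + p ∣ℤ eval g (+ x)) e h

rootsMod : Poly → ℕ → List ℕ
rootsMod f p = filter (λ r → + p ∣ℤ? eval f (+ r)) (upTo p)

length-rootsMod : ∀ {p} → Prime p → ∀ cs a → ¬ (+ p ∣ℤ a) → length (rootsMod (cs ++ a ∷ []) p) ≤ length cs
length-rootsMod {p} pp cs a p∤a = lagrange pp (length cs) cs a refl p∤a _ (Uniqueₚ.filter⁺ _ (Uniqueₚ.upTo⁺ p))
  (All-tabulate λ r∈ → case ∈-filter⁻ (λ r → + p ∣ℤ? eval (cs ++ a ∷ []) (+ r)) {xs = upTo p} r∈ of λ { (b , d) → ∈-upTo⁻ b , d })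

∈-rootsMod : ∀ f {p} .{{_ : NonZero p}} x → + p ∣ℤ eval f x → (x %ℕ p) ∈ rootsMod f p
∈-rootsMod f {p} x d = ∈-filter⁺ (λ r → + p ∣ℤ? eval f (+ r)) (∈-upTo⁺ (ℤ/.n%ℕd<d x p)) (eval-transfer f (%ℕ-cong x p) d)

deriv : Poly → ℤ → ℤ
deriv [] x = + 0
deriv (a ∷ f) x = eval f x ⊕ x ⊗ deriv f x

deriv-cong : ∀ {m} f {x y} → m ∣ℤ (x ⊖ y) → m ∣ℤ (deriv f x ⊖ deriv f y)
deriv-cong [] d = dividesℤ (+ 0) refl
deriv-cong (a ∷ f) {x} {y} d = ∣ℤ-≡ (lem x y (eval f x) (eval f y) (deriv f x) (deriv f y))
  (ℤ∣.∣m∣n⇒∣m+n (eval-cong f d) (ℤ∣.∣m∣n⇒∣m+n (ℤ∣.∣n⇒∣m*n x (deriv-cong f d)) (ℤ∣.∣m⇒∣m*n (deriv f y) d)))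
  where
  lem : ∀ x y u v u′ v′ → (u ⊖ v) ⊕ (x ⊗ (u′ ⊖ v′) ⊕ (x ⊖ y) ⊗ v′) ≡ (u ⊕ x ⊗ u′) ⊖ (v ⊕ y ⊗ v′)
  lem = ℤ-Ring.solve-∀

taylor : ∀ f x h → ∃[ c ] eval f (x ⊕ h) ≡ eval f x ⊕ h ⊗ deriv f x ⊕ h ⊗ h ⊗ c
taylor [] x h = + 0 , lem h
  where
  lem : ∀ h → + 0 ≡ + 0 ⊕ h ⊗ + 0 ⊕ h ⊗ h ⊗ + 0
  lem = ℤ-Ring.solve-∀
taylor (a ∷ f) x h with taylor f x h
... | c , e = x ⊗ c ⊕ deriv f x ⊕ h ⊗ c , trans (cong (λ z → a ⊕ (x ⊕ h) ⊗ z) e) (lem a x h (eval f x) (deriv f x) c)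
  where
  lem : ∀ a x h u v c → a ⊕ (x ⊕ h) ⊗ (u ⊕ h ⊗ v ⊕ h ⊗ h ⊗ c) ≡ (a ⊕ x ⊗ u) ⊕ h ⊗ (u ⊕ x ⊗ v) ⊕ h ⊗ h ⊗ (x ⊗ c ⊕ v ⊕ h ⊗ c)
  lem = ℤ-Ring.solve-∀

prime-power-cancel : ∀ {p} → Prime p → ∀ e x u → ¬ (+ p ∣ℤ u) → + (p ^ e) ∣ℤ x ⊗ u → + (p ^ e) ∣ℤ x
prime-power-cancel {p} pp e x u p∤u d = ∣-abs (coprime-divisor (coprime-by-primes cop) (subst (p ^ e ∣_) (trans (ℤₚ.abs-* x u) (*-comm ∣ x ∣ ∣ u ∣)) (abs-∣ d)))
  where
  cop : ∀ {r} → Prime r → r ∣ p ^ e → r ∣ ∣ u ∣ → ⊥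
  cop rr r∣ r∣u = p∤u (∣-abs (subst (_∣ ∣ u ∣) (prime-∣-prime rr pp (prime-∣^ rr p e r∣)) r∣u))

-- By Taylor's formula f(y) - f(x) is y - x times a number congruent to f′(x) modulo p, and that
-- factor can be cancelled from a divisibility by p^e.
hensel-unique : ∀ {p} → Prime p → ∀ f e x y → + p ∣ℤ (y ⊖ x) → ¬ (+ p ∣ℤ deriv f x) → + (p ^ e) ∣ℤ eval f x → + (p ^ e) ∣ℤ eval f y → + (p ^ e) ∣ℤ (y ⊖ x)
hensel-unique {p} pp f e x y p∣h p∤f′ dx dy with taylor f x (y ⊖ x)
... | c , eq = prime-power-cancel pp e (y ⊖ x) (deriv f x ⊕ (y ⊖ x) ⊗ c) unit (∣ℤ-≡ eq′ (ℤ∣.∣m∣n⇒∣m-n dy dx))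
  where
  unit : ¬ (+ p ∣ℤ (deriv f x ⊕ (y ⊖ x) ⊗ c))
  unit d = p∤f′ (ℤ∣.∣m+n∣n⇒∣m d (ℤ∣.∣m⇒∣m*n c p∣h))
  lem₁ : ∀ x y → x ⊕ (y ⊖ x) ≡ y
  lem₁ = ℤ-Ring.solve-∀
  lem₂ : ∀ u h v c → (u ⊕ h ⊗ v ⊕ h ⊗ h ⊗ c) ⊖ u ≡ h ⊗ (v ⊕ h ⊗ c)
  lem₂ = ℤ-Ring.solve-∀
  eq′ : eval f y ⊖ eval f x ≡ (y ⊖ x) ⊗ (deriv f x ⊕ (y ⊖ x) ⊗ c)
  eq′ = trans (cong (λ z → z ⊖ eval f x) (trans (cong (eval f) (sym (lem₁ x y))) eq)) (lem₂ (eval f x) (y ⊖ x) (deriv f x) c)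

∣ℤ-* : ∀ {a b x y} → + a ∣ℤ x → + b ∣ℤ y → + (a * b) ∣ℤ x ⊗ y
∣ℤ-* {a} {b} {x} {y} d e = ∣-abs (subst (a * b ∣_) (sym (ℤₚ.abs-* x y)) (*-pres-∣ (abs-∣ d) (abs-∣ e)))

-- A Newton step in which f′ is inverted only modulo p. This gains a single power of p each time,
-- and the quadratic Taylor term is divisible by p · p^E because p divides F as well.
hensel-lift : ∀ {p} → Prime p → ∀ f r → + p ∣ℤ eval f r → ¬ (+ p ∣ℤ deriv f r) → ∀ E → ∃[ R ] (+ p ∣ℤ (R ⊖ r) × + (p ^ E) ∣ℤ eval f R)
hensel-lift {p} pp f r root unit zero = r , ∣ℤ-≡ (sym (ℤₚ.+-inverseʳ r)) (dividesℤ (+ 0) refl) , ∣-abs (divides ∣ eval f r ∣ (sym (*-identityʳ ∣ eval f r ∣)))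
hensel-lift {p} pp f r root unit (suc E) with hensel-lift pp f r root unit E
... | R , p∣ , pE∣ = R′ , ∣ℤ-≡ (lem₁ R r h) (ℤ∣.∣m∣n⇒∣m+n p∣ p∣h) , ∣ℤ-≡ (sym (trans (proj₂ tay) (lem₂ F t F′ c)))
    (ℤ∣.∣m∣n⇒∣m+n (subst (λ z → + z ∣ℤ (F ⊗ (⊝ (F′ ⊗ t ⊖ + 1)))) (*-comm (p ^ E) p) (∣ℤ-* pE∣ (ℤ∣.∣m⇒∣-m (proj₂ inv))))
      (ℤ∣.∣m⇒∣m*n (t ⊗ t ⊗ c) (∣ℤ-* p∣F pE∣)))
  where
  F = eval f R
  F′ = deriv f R
  p∣F : + p ∣ℤ F
  p∣F = eval-transfer f p∣ root
  unit′ : ¬ (+ p ∣ℤ F′)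
  unit′ d = unit (∣-transfer (∣-⊖-sym F′ (deriv f r) (deriv-cong f p∣)) d)
  inv = prime-inverse pp F′ unit′
  t = proj₁ inv
  h = ⊝ (F ⊗ t)
  R′ = R ⊕ h
  p∣h : + p ∣ℤ h
  p∣h = ℤ∣.∣m⇒∣-m (ℤ∣.∣m⇒∣m*n t p∣F)
  tay = taylor f R h
  c = proj₁ tay
  lem₁ : ∀ R r h → (R ⊖ r) ⊕ h ≡ (R ⊕ h) ⊖ r
  lem₁ = ℤ-Ring.solve-∀
  lem₂ : ∀ F t F′ c → F ⊕ (⊝ (F ⊗ t)) ⊗ F′ ⊕ (⊝ (F ⊗ t)) ⊗ (⊝ (F ⊗ t)) ⊗ c ≡ F ⊗ (⊝ (F′ ⊗ t ⊖ + 1)) ⊕ (F ⊗ F) ⊗ (t ⊗ t ⊗ c)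
  lem₂ = ℤ-Ring.solve-∀

-- Collisions modulo q and a lower bound for the number of primes dividing values of a polynomial

^-cancelʳ-≤ : ∀ k {a b} → 1 ≤ k → a ^ k ≤ b ^ k → a ≤ b
^-cancelʳ-≤ k {a} {b} 1≤k h with a ≤? b
... | yes le = le
... | no nle = ⊥-elim (<⇒≱ (^-monoˡ-< k {{>-nonZero 1≤k}} (≰⇒> nle)) h)

^-cancelˡ-≤ : ∀ z {a b} → 2 ≤ z → z ^ a ≤ z ^ b → a ≤ b
^-cancelˡ-≤ z {a} {b} 2≤z h with a ≤? b
... | yes le = le
... | no nle = ⊥-elim (<⇒≱ (^-monoʳ-< z 2≤z (≰⇒> nle)) h)

2ab≤a²+b² : ∀ a b → 2 * (a * b) ≤ a * a + b * b
2ab≤a²+b² a b with ≤-total a b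
... | inj₁ a≤b = subst (λ b → 2 * (a * b) ≤ a * a + b * b) (m+[n∸m]≡n a≤b) (≤-trans (m≤m+n _ (d * d)) (≤-reflexive (lem a d)))
  where
  d = b ∸ a
  lem : ∀ a d → 2 * (a * (a + d)) + d * d ≡ a * a + (a + d) * (a + d)
  lem = ℕ-Ring.solve-∀
... | inj₂ b≤a = subst (λ a → 2 * (a * b) ≤ a * a + b * b) (m+[n∸m]≡n b≤a) (≤-trans (m≤m+n _ (d * d)) (≤-reflexive (lem b d)))
  where
  d = a ∸ b
  lem : ∀ b d → 2 * ((b + d) * b) + d * d ≡ (b + d) * (b + d) + b * b
  lem = ℕ-Ring.solve-∀

∑-pick : ∀ (xs : List ℕ) r (g : ℕ → ℕ) → Unique xs → r ∈ xs → ∑ xs (λ c → 𝟙 (r ≟ c) * g c) ≡ g r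
∑-pick (x ∷ xs) r g (x∉ ∷ u) (here refl) = trans (cong₂ _+_ (trans (cong (_* g r) (𝟙-yes (r ≟ r) refl)) (+-identityʳ (g r)))
  (trans (∑-cong xs λ c c∈ → cong (_* g c) (𝟙-no (r ≟ c) (All-lookup x∉ c∈))) (trans (∑-const xs 0) (*-zeroʳ (length xs))))) (+-identityʳ (g r))
∑-pick (x ∷ xs) r g (x∉ ∷ u) (there r∈) = trans (cong (λ z → z * g x + ∑ xs (λ c → 𝟙 (r ≟ c) * g c)) (𝟙-no (r ≟ x) (λ e → All-lookup x∉ r∈ (sym e)))) (∑-pick xs r g u r∈)

-- If n_c elements fall into class c, the coinciding ordered pairs number ∑ n_c². Summing n_c² ≥ 2 h
-- n_c - h² over the q classes gives at least 2 h K - q h², and q h ≤ K.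
collisions : ∀ {A : Set} (xs : List A) (ρ : A → ℕ) q h → (∀ x → ρ x < q) → q * h ≤ length xs → length xs * h ≤ ∑ xs (λ x → ∑ xs (λ y → 𝟙 (ρ y ≟ ρ x)))
collisions xs ρ q h ρ< qh≤ = +-cancelʳ-≤ (K * h) _ _ (begin
  K * h + K * h                                              ≡⟨ lem K h ⟩
  2 * (h * K)                                                ≡⟨ cong (λ z → 2 * (h * z)) (sym ∑n≡K) ⟩
  2 * (h * ∑ cs n)                                           ≡⟨ cong (2 *_) (∑-*ˡ cs h n) ⟨
  2 * ∑ cs (λ c → h * n c)                                   ≡⟨ ∑-*ˡ cs 2 (λ c → h * n c) ⟨
  ∑ cs (λ c → 2 * (h * n c))                                 ≤⟨ ∑-mono cs (λ c _ → ≤-trans (2ab≤a²+b² h (n c)) (≤-reflexive (+-comm (h * h) (n c * n c)))) ⟩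
  ∑ cs (λ c → n c * n c + h * h)                             ≡⟨ ∑-+ cs (λ c → n c * n c) (λ _ → h * h) ⟩
  ∑ cs (λ c → n c * n c) + ∑ cs (λ _ → h * h)                ≡⟨ cong₂ _+_ sq (trans (∑-const cs (h * h)) (trans (cong (_* (h * h)) (length-upTo q)) (sym (*-assoc q h h)))) ⟩
  ∑ xs (λ x → n (ρ x)) + q * h * h                           ≤⟨ +-monoʳ-≤ _ (*-monoˡ-≤ h qh≤) ⟩
  ∑ xs (λ x → n (ρ x)) + K * h                               ∎)
  where
  open ≤-Reasoning
  K = length xs
  cs = upTo q
  n : ℕ → ℕ
  n c = ∑ xs (λ y → 𝟙 (ρ y ≟ c))
  lem : ∀ k h → k * h + k * h ≡ 2 * (h * k)
  lem = ℕ-Ring.solve-∀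
  weigh : ∀ (g : ℕ → ℕ) → ∑ cs (λ c → n c * g c) ≡ ∑ xs (λ x → g (ρ x))
  weigh g = trans (∑-cong cs λ c _ → trans (*-comm (n c) (g c)) (trans (sym (∑-*ˡ xs (g c) _)) (∑-cong xs λ x _ → *-comm (g c) (𝟙 (ρ x ≟ c)))))
    (trans (∑-swap cs xs (λ c x → 𝟙 (ρ x ≟ c) * g c)) (∑-cong xs λ x _ → ∑-pick cs (ρ x) g (Uniqueₚ.upTo⁺ q) (∈-upTo⁺ (ρ< x))))
  sq : ∑ cs (λ c → n c * n c) ≡ ∑ xs (λ x → n (ρ x))
  sq = weigh n
  ∑n≡K : ∑ cs n ≡ K
  ∑n≡K = trans (∑-cong cs λ c _ → sym (*-identityʳ (n c))) (trans (weigh (λ _ → 1)) (trans (∑-const xs 1) (*-identityʳ K)))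

same-cell : ∀ {q} .{{_ : NonZero q}} a b → a / q ≡ b / q → + q ∣ℤ (+ a ⊖ + b) → a ≡ b
same-cell {q} a b e d = begin
  a                      ≡⟨ m≡m%n+[m/n]*n a q ⟩
  a % q + a / q * q      ≡⟨ cong₂ (λ u v → u + v * q) (∣⊖⇒≡ (m%n<n a q) (m%n<n b q) d′) e ⟩
  b % q + b / q * q      ≡⟨ m≡m%n+[m/n]*n b q ⟨
  b                      ∎
  where
  open ≡-Reasoning
  lem : ∀ a b u v → (a ⊖ b) ⊖ ((a ⊖ u) ⊖ (b ⊖ v)) ≡ u ⊖ v
  lem = ℤ-Ring.solve-∀
  d′ : + q ∣ℤ (+ (a % q) ⊖ + (b % q))
  d′ = ∣ℤ-≡ (lem (+ a) (+ b) (+ (a % q)) (+ (b % q))) (ℤ∣.∣m∣n⇒∣m-n d (ℤ∣.∣m∣n⇒∣m-n (%≡⇒∣⊖ a refl) (%≡⇒∣⊖ b refl)))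

linProd : List ℤ → ℤ → ℤ → ℤ
linProd [] u v = + 1
linProd (r ∷ rs) u v = (u ⊖ r ⊗ v) ⊗ linProd rs u v

a^b≤[a+b]! : ∀ a b → a ^ b ≤ (a + b) !
a^b≤[a+b]! a zero = >-nonZero⁻¹ ((a + 0) !) {{(a + 0) !≢0}}
a^b≤[a+b]! a (suc b) = ≤-trans (*-mono-≤ (≤-trans (m≤m+n a b) (n≤1+n (a + b))) (a^b≤[a+b]! a b)) (≤-reflexive (cong _! (sym (+-suc a b))))

∃-sqrt : ∀ n → ∃[ z ] (z * z ≤ n × n < suc z * suc z)
∃-sqrt zero = 0 , z≤n , s≤s z≤n
∃-sqrt (suc n) with ∃-sqrt n
... | z , lo , hi with suc n ≟ suc z * suc z
... | no ne = z , m≤n⇒m≤1+n lo , ≤∧≢⇒< hi ne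
... | yes e = suc z , ≤-reflexive (sym e) , subst (_< suc (suc z) * suc (suc z)) (sym e) (*-mono-< (n<1+n (suc z)) (n<1+n (suc z)))

-- In both applications `F` is the homogenised g, of degree m, and `T`, of degree t + 1, is up to a
-- constant a factor of the resultant of g and a translate of g. Its constant term is 1, so a prime
-- dividing T(x) divides no factor common to the other coefficients: `T-lead` and `T-simple` rest on
-- this. `T-lower` makes the product of T(1), ..., T(K) at least (K!)^(t+1).
record SplitData : Set where
  field
    m t C Cₜ : ℕ
    m≥1 : 1 ≤ m
    C≥1 : 1 ≤ C
    F : ℤ → ℤ → ℤ
    F-bound : ∀ x u v → ∣ u ∣ ≤ x → ∣ v ∣ ≤ x → ∣ F u v ∣ ≤ C * x ^ m
    F-nonzero : ∀ u v → F u v ≡ + 0 → u ≡ + 0 × v ≡ + 0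
    cs : List ℤ
    lead : ℤ
    length-cs : length cs ≡ suc t
  T : Poly
  T = cs ++ lead ∷ []
  field
    T-lower : ∀ d → 1 ≤ d → d ^ suc t ≤ ∣ eval T (+ d) ∣
    T-upper : ∀ d → 1 ≤ d → ∣ eval T (+ d) ∣ ≤ Cₜ * d ^ suc t
    T-lead : ∀ {p x} → Prime p → + p ∣ℤ eval T x → ¬ (+ p ∣ℤ lead)
    T-simple : ∀ {p x} → Prime p → + p ∣ℤ eval T x → ¬ (+ p ∣ℤ deriv T x)
    T-splits : ∀ {p x} → Prime p → + p ∣ℤ eval T x → ∀ E → ∃[ rs ] (length rs ≡ m × ∀ u v → + (p ^ E) ∣ℤ (F u v ⊖ linProd rs u v))

module _ (D : SplitData) where
  open SplitData D

  private
    Tₙ : ℕ → ℕ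
    Tₙ d = ∣ eval T (+ d) ∣

  module Scale (x K : ℕ) (K≡ : K ≡ x * x) (1≤K : 1 ≤ K) where
    private
      ds = interval K
      V = ∏ ds Tₙ
      Tmax = Cₜ * K ^ suc t
      E = Tmax + K
      Tₙ≥1 : ∀ {d} → d ∈ ds → 1 ≤ Tₙ d
      Tₙ≥1 {d} d∈ = ≤-trans (m^n>0 d {{>-nonZero (proj₁ (∈-interval⁻ d∈))}} (suc t)) (T-lower d (proj₁ (∈-interval⁻ d∈)))
      Tₙ≤ : ∀ {d} → d ∈ ds → Tₙ d ≤ Tmax
      Tₙ≤ {d} d∈ = ≤-trans (T-upper d (proj₁ (∈-interval⁻ d∈))) (*-monoʳ-≤ Cₜ (^-monoˡ-≤ (suc t) (proj₂ (∈-interval⁻ d∈))))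
      V≥1 : 1 ≤ V
      V≥1 = ∏-pos ds (λ d d∈ → Tₙ≥1 d∈)
      ∣V? = λ p → p ∣? V

    divisors : List ℕ
    divisors = filter ∣V? (primesUpTo V)

    divisors-spec : ∀ {p} → p ∈ divisors → Prime p × ∃[ d ] (d ∈ ds × + p ∣ℤ eval T (+ d))
    divisors-spec p∈ with ∈-filter⁻ ∣V? {xs = primesUpTo V} p∈
    ... | a , p∣V = pp , (case prime-∣∏ pp ds Tₙ p∣V of λ { (d , d∈ , h) → d , d∈ , ∣-abs h })
      where pp = proj₁ (primesUpTo-prime {V} a)

    divisors-unique : Unique divisors
    divisors-unique = Uniqueₚ.filter⁺ ∣V? (primesUpTo-unique V)

    private
      N = length divisors
      leg = legendre E K
      S = ∏ divisors (λ p → p ^ leg p)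
      Tmax≥1 : 1 ≤ Tmax
      Tmax≥1 = ≤-trans (Tₙ≥1 (∈-interval⁺ 1≤K ≤-refl)) (Tₙ≤ (∈-interval⁺ 1≤K ≤-refl))

      -- T has at most t + 1 roots modulo p by Lagrange, and each has at most one lift modulo p^e by
      -- Hensel. So each of the ⌊K / p^e⌋ + 1 blocks of length p^e contains at most t + 1 of the d.
      -- The incomplete block costs the extra 1, which disappears once p^e exceeds all the values.
      roots-count : ∀ {p} → p ∈ divisors → ∀ e → 1 ≤ e → ∑ ds (λ d → 𝟙 (p ^ e ∣? Tₙ d)) ≤ suc t * (𝟙 (p ^ e ≤? Tmax) + multiples K (p ^ e))
      roots-count {p} p∈ e 1≤e with divisors-spec p∈
      ... | pp , d₀ , _ , root₀ with p ^ e ≤? Tmax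
      ... | no big = ≤-trans (≤-reflexive (trans (∑-cong ds (λ d d∈ → 𝟙-no (p ^ e ∣? Tₙ d) (λ h → big (≤-trans (∣⇒≤ {{>-nonZero (Tₙ≥1 d∈)}} h) (Tₙ≤ d∈))))) (trans (∑-const ds 0) (*-zeroʳ (length ds))))) z≤n
      ... | yes _ = begin
          ∑ ds (λ d → 𝟙 (q∣? d))                             ≡⟨ ∑-𝟙 q∣? ds ⟩
          length (filter q∣? ds)                             ≤⟨ injOn⇒length≤ (λ d → d / q , d % p) {ys = cartesianProduct (upTo (suc c)) (rootsMod T p)} (Uniqueₚ.filter⁺ q∣? (interval-unique K)) into inj ⟩
          length (cartesianProduct (upTo (suc c)) (rootsMod T p)) ≡⟨ trans (length-cartesianProduct (upTo (suc c)) (rootsMod T p)) (cong (_* length (rootsMod T p)) (length-upTo (suc c))) ⟩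
          suc c * length (rootsMod T p)                      ≤⟨ *-monoʳ-≤ (suc c) (subst (length (rootsMod T p) ≤_) length-cs (length-rootsMod pp cs lead (T-lead pp root₀))) ⟩
          suc c * suc t                                      ≡⟨ *-comm (suc c) (suc t) ⟩
          suc t * suc c                                      ∎
        where
        open ≤-Reasoning
        q = p ^ e
        c = multiples K q
        q∣? = λ d → q ∣? Tₙ d
        instance
          p≢0 = prime⇒nonZero pp
          q≢0 = m^n≢0 p e
        p∣q : p ∣ q
        p∣q = subst (_∣ q) (*-identityʳ p) (^-mono-∣ p 1≤e)
        into : ∀ {d} → d ∈ filter q∣? ds → (d / q , d % p) ∈ cartesianProduct (upTo (suc c)) (rootsMod T p)
        into {d} d∈ with ∈-filter⁻ q∣? {xs = ds} d∈
        ... | d∈ds , q∣T = ∈-cartesianProduct⁺ (∈-upTo⁺ (*-cancelʳ-< q (d / q) (suc c) (≤-<-trans (m/n*n≤m d q) (≤-<-trans (proj₂ (∈-interval⁻ d∈ds)) (subst (K <_) (*-comm q (suc c)) (proj₂ (multiples-bounds K q (m^n>0 p e))))))))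
              (∈-rootsMod T (+ d) (∣-abs (∣-trans p∣q q∣T)))
        inj : ∀ {a b} → a ∈ filter q∣? ds → b ∈ filter q∣? ds → (a / q , a % p) ≡ (b / q , b % p) → a ≡ b
        inj {a} {b} a∈ b∈ eq = same-cell a b (cong proj₁ eq) (hensel-unique pp T e (+ b) (+ a) p∣a-b (T-simple pp (∣-abs (∣-trans p∣q qb))) (∣-abs qb) (∣-abs (proj₂ (∈-filter⁻ q∣? {xs = ds} a∈))))
          where
          qb = proj₂ (∈-filter⁻ q∣? {xs = ds} b∈)
          lem : ∀ a b c → (a ⊖ c) ⊖ (b ⊖ c) ≡ a ⊖ b
          lem = ℤ-Ring.solve-∀
          p∣a-b : + p ∣ℤ (+ a ⊖ + b)
          p∣a-b = ∣ℤ-≡ (lem (+ a) (+ b) (+ (b % p))) (ℤ∣.∣m∣n⇒∣m-n (%≡⇒∣⊖ a (cong proj₂ eq)) (%≡⇒∣⊖ b refl))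

      -- The exponent of p in V is at most t + 1 times the sum of its exponent in K! and ⌊log_p
      -- Tmax⌋. The first parts form S, the share of K! carried by the divisors; the second parts
      -- cost at most Tmax for each of the N primes.
      V-upper : V ≤ (S * Tmax ^ N) ^ suc t
      V-upper = begin
        V                                                                  ≤⟨ ∏-mono ds (λ d d∈ → ≤-∏^val E divisors (λ p∈ → prime≥1 (proj₁ (divisors-spec p∈))) (Tₙ d) (Tₙ≥1 d∈) (≤-<-trans (≤-trans (Tₙ≤ d∈) (m≤m+n Tmax K)) (n<2^n E)) (complete d d∈)) ⟩
        ∏ ds (λ d → ∏ divisors (λ p → p ^ val p E (Tₙ d)))                 ≡⟨ ∏-swap ds divisors (λ d p → p ^ val p E (Tₙ d)) ⟩
        ∏ divisors (λ p → ∏ ds (λ d → p ^ val p E (Tₙ d)))                 ≡⟨ ∏-cong divisors (λ p _ → ∏-base^ ds p (λ d → val p E (Tₙ d))) ⟩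
        ∏ divisors (λ p → p ^ ∑ ds (λ d → val p E (Tₙ d)))                 ≤⟨ ∏-mono divisors (λ p p∈ → ^-monoʳ-≤ p {{prime⇒nonZero (proj₁ (divisors-spec p∈))}} (exponent p p∈)) ⟩
        ∏ divisors (λ p → p ^ (suc t * (expsBelow E Tmax p + leg p)))      ≡⟨ ∏-cong divisors (λ p _ → trans (cong (p ^_) (*-comm (suc t) (expsBelow E Tmax p + leg p))) (sym (^-*-assoc p (expsBelow E Tmax p + leg p) (suc t)))) ⟩
        ∏ divisors (λ p → (p ^ (expsBelow E Tmax p + leg p)) ^ suc t)      ≡⟨ ∏-^ divisors (λ p → p ^ (expsBelow E Tmax p + leg p)) (suc t) ⟩
        ∏ divisors (λ p → p ^ (expsBelow E Tmax p + leg p)) ^ suc t        ≤⟨ ^-monoˡ-≤ (suc t) split ⟩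
        (S * Tmax ^ N) ^ suc t                                             ∎
        where
        open ≤-Reasoning
        complete : ∀ d → d ∈ ds → ∀ {p} → Prime p → p ∣ Tₙ d → p ∈ divisors
        complete d d∈ pp p∣T = ∈-filter⁺ ∣V? (primesUpTo-complete pp (∣⇒≤ {{>-nonZero V≥1}} p∣V)) p∣V
          where p∣V = ∣-trans p∣T (∣∏ Tₙ d∈)
        exponent : ∀ p → p ∈ divisors → ∑ ds (λ d → val p E (Tₙ d)) ≤ suc t * (expsBelow E Tmax p + leg p)
        exponent p p∈ = begin
          ∑ ds (λ d → ∑ (interval E) (λ e → 𝟙 (p ^ e ∣? Tₙ d)))            ≡⟨ ∑-swap ds (interval E) (λ d e → 𝟙 (p ^ e ∣? Tₙ d)) ⟩
          ∑ (interval E) (λ e → ∑ ds (λ d → 𝟙 (p ^ e ∣? Tₙ d)))            ≤⟨ ∑-mono (interval E) (λ e e∈ → roots-count p∈ e (proj₁ (∈-interval⁻ e∈))) ⟩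
          ∑ (interval E) (λ e → suc t * (𝟙 (p ^ e ≤? Tmax) + multiples K (p ^ e))) ≡⟨ ∑-*ˡ (interval E) (suc t) (λ e → 𝟙 (p ^ e ≤? Tmax) + multiples K (p ^ e)) ⟩
          suc t * ∑ (interval E) (λ e → 𝟙 (p ^ e ≤? Tmax) + multiples K (p ^ e)) ≡⟨ cong (suc t *_) (∑-+ (interval E) (λ e → 𝟙 (p ^ e ≤? Tmax)) (λ e → multiples K (p ^ e))) ⟩
          suc t * (expsBelow E Tmax p + leg p)                             ∎
        split : ∏ divisors (λ p → p ^ (expsBelow E Tmax p + leg p)) ≤ S * Tmax ^ N
        split = begin
          ∏ divisors (λ p → p ^ (expsBelow E Tmax p + leg p))              ≡⟨ ∏^+ divisors (expsBelow E Tmax) leg ⟩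
          ∏ divisors (λ p → p ^ expsBelow E Tmax p) * S                    ≤⟨ *-monoˡ-≤ S (∏-mono divisors (λ p p∈ → ^expsBelow≤ E Tmax p (prime≥1 (proj₁ (divisors-spec p∈))) Tmax≥1)) ⟩
          ∏ divisors (λ _ → Tmax) * S                                      ≡⟨ trans (cong (_* S) (∏-const divisors Tmax)) (*-comm (Tmax ^ N) S) ⟩
          S * Tmax ^ N                                                     ∎

      Box : List (ℕ × ℕ)
      Box = cartesianProduct (upTo x) (upTo x)
      Box-unique : Unique Box
      Box-unique = Uniqueₚ.cartesianProduct⁺ (Uniqueₚ.upTo⁺ x) (Uniqueₚ.upTo⁺ x)
      length-Box : length Box ≡ K
      length-Box = trans (length-cartesianProduct (upTo x) (upTo x)) (trans (cong₂ _*_ (length-upTo x) (length-upTo x)) (sym K≡))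
      _≟ᵖ_ : (P P′ : ℕ × ℕ) → Dec (P ≡ P′)
      _≟ᵖ_ = ≡-dec _≟_ _≟_
      Dg = ∏ divisors (λ p → p ^ (m * expsBelow E K p))
      Fᵈ : ℕ × ℕ → ℕ × ℕ → ℕ
      Fᵈ (u , v) (u′ , v′) = ∣ F (+ u ⊖ + u′) (+ v ⊖ + v′) ∣
      -- F vanishes on the diagonal and would make the product over all pairs 0. The substitute `Dg`
      -- is positive and contains, for each p, the exponent due to a point colliding with itself: at
      -- most ⌊log_p K⌋ for each of the m linear factors.
      F̂ : ℕ × ℕ → ℕ × ℕ → ℕ
      F̂ P P′ with P ≟ᵖ P′
      ... | yes _ = Dg
      ... | no _ = Fᵈ P P′
      Dg≥1 : 1 ≤ Dg
      Dg≥1 = ∏-pos divisors λ p p∈ → m^n>0 p {{prime⇒nonZero (proj₁ (divisors-spec p∈))}} (m * expsBelow E K p)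
      Fᵈ≥1 : ∀ P P′ → P ≢ P′ → 1 ≤ Fᵈ P P′
      Fᵈ≥1 (u , v) (u′ , v′) ne = n≢0⇒n>0 λ z → case F-nonzero (+ u ⊖ + u′) (+ v ⊖ + v′) (ℤₚ.∣i∣≡0⇒i≡0 z) of λ
        { (a , b) → ne (cong₂ _,_ (ℤₚ.+-injective (ℤₚ.i-j≡0⇒i≡j (+ u) (+ u′) a)) (ℤₚ.+-injective (ℤₚ.i-j≡0⇒i≡j (+ v) (+ v′) b))) }
      F̂≥1 : ∀ P P′ → 1 ≤ F̂ P P′
      F̂≥1 P P′ with P ≟ᵖ P′
      ... | yes _ = Dg≥1
      ... | no ne = Fᵈ≥1 P P′ ne
      Π₂ = ∏ Box (λ P → ∏ Box (λ P′ → F̂ P P′))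
      B = C * x ^ m
      ∣⊖∣≤x : ∀ {a b} → a ∈ upTo x → b ∈ upTo x → ∣ + a ⊖ + b ∣ ≤ x
      ∣⊖∣≤x {a} {b} a∈ b∈ with ≤-total a b
      ... | inj₁ le = ≤-trans (≤-reflexive (trans (ℤₚ.∣i-j∣≡∣j-i∣ (+ a) (+ b)) (abs-⊖-≥ le))) (≤-trans (m∸n≤m b a) (<⇒≤ (∈-upTo⁻ b∈)))
      ... | inj₂ ge = ≤-trans (≤-reflexive (abs-⊖-≥ ge)) (≤-trans (m∸n≤m a b) (<⇒≤ (∈-upTo⁻ a∈)))
      Fᵈ≤B : ∀ {P P′} → P ∈ Box → P′ ∈ Box → Fᵈ P P′ ≤ B
      Fᵈ≤B P∈ P′∈ = case ∈-cartesianProduct⁻ (upTo x) (upTo x) P∈ of λ { (a , b) → case ∈-cartesianProduct⁻ (upTo x) (upTo x) P′∈ of λ { (a′ , b′) → F-bound x _ _ (∣⊖∣≤x a a′) (∣⊖∣≤x b b′) } }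
      x≥1 : 1 ≤ x
      x≥1 = n≢0⇒n>0 λ { refl → 1+n≰n (subst (1 ≤_) K≡ 1≤K) }
      B≥1 : 1 ≤ B
      B≥1 = *-mono-≤ C≥1 (m^n>0 x {{>-nonZero x≥1}} m)
      off : ∀ P Ps → P ∈ Box → All (λ P′ → P ≢ P′) Ps → (∀ {P′} → P′ ∈ Ps → P′ ∈ Box) → ∏ Ps (F̂ P) ≤ B ^ length Ps
      off P Ps P∈ ne sub = ≤-trans (∏-mono Ps bound) (≤-reflexive (∏-const Ps B))
        where
        bound : ∀ P′ → P′ ∈ Ps → F̂ P P′ ≤ B
        bound P′ P′∈ with P ≟ᵖ P′
        ... | yes e = ⊥-elim (All-lookup ne P′∈ e)
        ... | no _ = Fᵈ≤B P∈ (sub P′∈)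
      row : ∀ P Ps → P ∈ Box → Unique Ps → (∀ {P′} → P′ ∈ Ps → P′ ∈ Box) → ∏ Ps (F̂ P) ≤ B ^ length Ps * Dg
      row P [] P∈ u sub = ≤-trans Dg≥1 (≤-reflexive (sym (+-identityʳ Dg)))
      row P (P′ ∷ Ps) P∈ (P′∉ ∷ u) sub with P ≟ᵖ P′
      ... | yes refl = begin
          Dg * ∏ Ps (F̂ P)          ≤⟨ *-monoʳ-≤ Dg (off P Ps P∈ P′∉ (sub ∘ there)) ⟩
          Dg * B ^ length Ps        ≡⟨ *-comm Dg (B ^ length Ps) ⟩
          B ^ length Ps * Dg        ≤⟨ *-monoˡ-≤ Dg (m≤n*m (B ^ length Ps) B {{>-nonZero B≥1}}) ⟩
          B * B ^ length Ps * Dg    ∎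
        where open ≤-Reasoning
      ... | no _ = ≤-trans (*-mono-≤ (Fᵈ≤B P∈ (sub (here refl))) (row P Ps P∈ u (sub ∘ there))) (≤-reflexive (sym (*-assoc B (B ^ length Ps) Dg)))
      Π₂≤ : Π₂ ≤ (B ^ K * Dg) ^ K
      Π₂≤ = begin
        Π₂                                        ≤⟨ ∏-mono Box (λ P P∈ → row P Box P∈ Box-unique id) ⟩
        ∏ Box (λ _ → B ^ length Box * Dg)         ≡⟨ ∏-const Box (B ^ length Box * Dg) ⟩
        (B ^ length Box * Dg) ^ length Box        ≡⟨ cong (λ n → (B ^ n * Dg) ^ n) length-Box ⟩
        (B ^ K * Dg) ^ K                          ∎
        where open ≤-Reasoning

      linear : ℤ → ℕ × ℕ → ℤ
      linear r (u , v) = + u ⊖ r ⊗ + v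
      -- Levels with p^e > K are cut off. There ⌊K / p^e⌋ = 0, so no guaranteed collision is lost,
      -- and the weight of a diagonal pair stays within the exponent of p in `Dg`.
      hit : ℕ → ℕ → ℤ → ℕ × ℕ → ℕ × ℕ → ℕ
      hit p e r P P′ = 𝟙 (p ^ e ≤? K) * 𝟙 (p ^ e ∣? ∣ linear r P′ ⊖ linear r P ∣)
      weight : ℕ → List ℤ → ℕ × ℕ → ℕ × ℕ → ℕ
      weight p rs P P′ = ∑ rs (λ r → ∑ (interval E) (λ e → hit p e r P P′))

      hits : ∀ {p} → Prime p → ∀ e r → K * multiples K (p ^ e) ≤ ∑ Box (λ P → ∑ Box (λ P′ → hit p e r P P′))
      hits {p} pp e r with p ^ e ≤? K
      ... | no big = ≤-trans (≤-reflexive (trans (cong (K *_) none) (*-zeroʳ K))) z≤n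
        where
        none : multiples K (p ^ e) ≡ 0
        none with multiples K (p ^ e) | proj₁ (multiples-bounds K (p ^ e) (m^n>0 p {{prime⇒nonZero pp}} e))
        ... | zero | _ = refl
        ... | suc c | b = ⊥-elim (big (≤-trans (m≤m*n (p ^ e) (suc c)) b))
      ... | yes _ = begin
          K * h                                                            ≡⟨ cong (_* h) length-Box ⟨
          length Box * h                                                   ≤⟨ collisions Box ρ q h (λ P → ℤ/.n%ℕd<d (linear r P) q) (subst (q * h ≤_) (sym length-Box) (proj₁ (multiples-bounds K q (m^n>0 p e)))) ⟩
          ∑ Box (λ P → ∑ Box (λ P′ → 𝟙 (ρ P′ ≟ ρ P)))                      ≤⟨ ∑-mono Box (λ P _ → ∑-mono Box (λ P′ _ → ≤-trans (𝟙-mono (ρ P′ ≟ ρ P) (q ∣? ∣ linear r P′ ⊖ linear r P ∣) (coll P P′)) (≤-reflexive (sym (+-identityʳ _))))) ⟩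
          ∑ Box (λ P → ∑ Box (λ P′ → 1 * 𝟙 (q ∣? ∣ linear r P′ ⊖ linear r P ∣))) ∎
        where
        open ≤-Reasoning
        q = p ^ e
        h = multiples K q
        instance
          p≢0 = prime⇒nonZero pp
          q≢0 = m^n≢0 p e
        ρ : ℕ × ℕ → ℕ
        ρ P = linear r P %ℕ q
        lem : ∀ a b c → ⊝ (c ⊖ a) ⊕ (c ⊖ b) ≡ a ⊖ b
        lem = ℤ-Ring.solve-∀
        coll : ∀ P P′ → ρ P′ ≡ ρ P → q ∣ ∣ linear r P′ ⊖ linear r P ∣
        coll P P′ eq = abs-∣ (∣ℤ-≡ (lem (linear r P′) (linear r P) (+ ρ P′)) (ℤ∣.∣m∣n⇒∣m+n (ℤ∣.∣m⇒∣-m (%ℕ-cong (linear r P′) q)) (subst (λ z → + q ∣ℤ (+ z ⊖ linear r P)) (sym eq) (%ℕ-cong (linear r P) q))))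

      weights : ∀ {p} → Prime p → ∀ rs → length rs ≡ m → m * (K * leg p) ≤ ∑ Box (λ P → ∑ Box (weight p rs P))
      weights {p} pp rs len = begin
        m * (K * leg p)                                                                      ≡⟨ trans (∑-const rs (K * leg p)) (cong (_* (K * leg p)) len) ⟨
        ∑ rs (λ r → K * leg p)                                                               ≡⟨ ∑-cong rs (λ r _ → sym (∑-*ˡ (interval E) K (λ e → multiples K (p ^ e)))) ⟩
        ∑ rs (λ r → ∑ (interval E) (λ e → K * multiples K (p ^ e)))                          ≤⟨ ∑-mono rs (λ r _ → ∑-mono (interval E) (λ e _ → hits pp e r)) ⟩
        ∑ rs (λ r → ∑ (interval E) (λ e → ∑ Box (λ P → ∑ Box (λ P′ → hit p e r P P′))))      ≡⟨ ∑-cong rs (λ r _ → trans (∑-swap (interval E) Box (λ e P → ∑ Box (λ P′ → hit p e r P P′))) (∑-cong Box (λ P _ → ∑-swap (interval E) Box (λ e P′ → hit p e r P P′)))) ⟩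
        ∑ rs (λ r → ∑ Box (λ P → ∑ Box (λ P′ → ∑ (interval E) (λ e → hit p e r P P′))))      ≡⟨ trans (∑-swap rs Box (λ r P → ∑ Box (λ P′ → ∑ (interval E) (λ e → hit p e r P P′)))) (∑-cong Box (λ P _ → ∑-swap rs Box (λ r P′ → ∑ (interval E) (λ e → hit p e r P P′)))) ⟩
        ∑ Box (λ P → ∑ Box (weight p rs P))                                                  ∎
        where open ≤-Reasoning

      -- Off the diagonal, F at the difference of the points agrees modulo p^(m E) with a product of
      -- m linear factors. The total weight is at most m E, so a divisibility proved for the product
      -- passes to F.
      weight-∣ : ∀ {p} → p ∈ divisors → ∀ rs → length rs ≡ m → (∀ u v → + (p ^ (m * E)) ∣ℤ (F u v ⊖ linProd rs u v)) → ∀ P P′ → p ^ weight p rs P P′ ∣ F̂ P P′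
      weight-∣ {p} p∈ rs len fac P P′ with P ≟ᵖ P′
      ... | yes _ = ∣-trans (^-mono-∣ p le) (∣∏ (λ p → p ^ (m * expsBelow E K p)) p∈)
        where
        open ≤-Reasoning
        le : weight p rs P P′ ≤ m * expsBelow E K p
        le = begin
          weight p rs P P′                        ≤⟨ ∑-mono rs (λ r _ → ∑-mono (interval E) (λ e _ → ≤-trans (*-monoʳ-≤ (𝟙 (p ^ e ≤? K)) (𝟙≤1 (p ^ e ∣? ∣ linear r P′ ⊖ linear r P ∣))) (≤-reflexive (*-identityʳ _)))) ⟩
          ∑ rs (λ _ → expsBelow E K p)            ≡⟨ trans (∑-const rs (expsBelow E K p)) (cong (_* expsBelow E K p) len) ⟩
          m * expsBelow E K p                     ∎
      ... | no _ = abs-∣ {x = F U W} (∣-transfer {x = F U W} {linProd rs U W} (ℤ∣.∣-trans (∣-abs {x = + (p ^ (m * E))} (^-mono-∣ p wt≤)) (fac U W)) (∣-abs (lin rs)))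
        where
        U = + proj₁ P ⊖ + proj₁ P′
        W = + proj₂ P ⊖ + proj₂ P′
        wt : List ℤ → ℕ
        wt rs = ∑ rs (λ r → ∑ (interval E) (λ e → hit p e r P P′))
        each : ∀ r → ∑ (interval E) (λ e → hit p e r P P′) ≤ val p E ∣ linear r P′ ⊖ linear r P ∣
        each r = ∑-mono (interval E) (λ e _ → ≤-trans (*-monoˡ-≤ (𝟙 (p ^ e ∣? ∣ linear r P′ ⊖ linear r P ∣)) (𝟙≤1 (p ^ e ≤? K))) (≤-reflexive (+-identityʳ _)))
        val≤ : ∀ n → val p E n ≤ E
        val≤ n = ≤-trans (∑-mono (interval E) (λ e _ → 𝟙≤1 (p ^ e ∣? n))) (≤-reflexive (trans (∑-const (interval E) 1) (trans (*-identityʳ _) (length-interval E))))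
        wt≤ : wt rs ≤ m * E
        wt≤ = ≤-trans (∑-mono rs (λ r _ → ≤-trans (each r) (val≤ _))) (≤-reflexive (trans (∑-const rs E) (cong (_* E) len)))
        lem : ∀ u v u′ v′ r → ⊝ ((u′ ⊖ r ⊗ v′) ⊖ (u ⊖ r ⊗ v)) ≡ (u ⊖ u′) ⊖ r ⊗ (v ⊖ v′)
        lem = ℤ-Ring.solve-∀
        lin : ∀ rs → p ^ wt rs ∣ ∣ linProd rs U W ∣
        lin [] = ∣-refl
        lin (r ∷ rs) = subst₂ _∣_ (sym (^-distribˡ-+-* p (∑ (interval E) (λ e → hit p e r P P′)) (wt rs))) (sym (ℤₚ.abs-* (U ⊖ r ⊗ W) (linProd rs U W)))
          (*-pres-∣ (∣-trans (^-mono-∣ p (each r)) (subst (p ^ val p E ∣ linear r P′ ⊖ linear r P ∣ ∣_) (trans (sym (ℤₚ.∣-i∣≡∣i∣ (linear r P′ ⊖ linear r P))) (cong ∣_∣ (lem (+ proj₁ P) (+ proj₂ P) (+ proj₁ P′) (+ proj₂ P′) r))) (^val-∣ p E ∣ linear r P′ ⊖ linear r P ∣))) (lin rs))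

      p-part-∣ : ∀ p → p ∈ divisors → p ^ (m * (K * leg p)) ∣ Π₂
      p-part-∣ p p∈ with divisors-spec p∈
      ... | pp , d , _ , root with T-splits pp root (m * E)
      ... | rs , len , fac = ∣-trans (^-mono-∣ p (weights pp rs len)) (subst (_∣ Π₂)
          (trans (∏-cong Box (λ P _ → ∏-base^ Box p (weight p rs P))) (∏-base^ Box p (λ P → ∑ Box (weight p rs P))))
          (∏-∣ Box (λ P _ → ∏-∣ Box (λ P′ _ → weight-∣ p∈ rs len fac P P′))))

      -- For each of the m linear factors and each level e there are at least K ⌊K / p^e⌋ colliding
      -- pairs among the K points of the box. Hence S^(m K) divides the product of F over all pairs,
      -- whose K² factors are at most C x^m apart from the diagonal. As x = √K, S is at most about
      -- K^(K/2).
      S-upper : S ^ m ≤ B ^ K * (K ^ N) ^ m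
      S-upper = ^-cancelʳ-≤ K 1≤K (begin
        (S ^ m) ^ K                                              ≡⟨ ^-*-assoc S m K ⟩
        S ^ (m * K)                                              ≡⟨ ∏-^ divisors (λ p → p ^ leg p) (m * K) ⟨
        ∏ divisors (λ p → (p ^ leg p) ^ (m * K))                 ≡⟨ ∏-cong divisors (λ p _ → trans (^-*-assoc p (leg p) (m * K)) (cong (p ^_) (lem (leg p) m K))) ⟩
        ∏ divisors (λ p → p ^ (m * (K * leg p)))                 ≤⟨ ∣⇒≤ {{>-nonZero (∏-pos Box (λ P _ → ∏-pos Box (λ P′ _ → F̂≥1 P P′)))}} (∏-prime-powers-∣ divisors (λ p → m * (K * leg p)) Π₂ divisors-unique (All-tabulate (λ p∈ → proj₁ (divisors-spec p∈))) p-part-∣) ⟩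
        Π₂                                                       ≤⟨ Π₂≤ ⟩
        (B ^ K * Dg) ^ K                                         ≤⟨ ^-monoˡ-≤ K (*-monoʳ-≤ (B ^ K) Dg≤) ⟩
        (B ^ K * (K ^ N) ^ m) ^ K                          ∎)
        where
        open ≤-Reasoning
        lem : ∀ l m k → l * (m * k) ≡ m * (k * l)
        lem = ℕ-Ring.solve-∀
        Dg≤ : Dg ≤ (K ^ N) ^ m
        Dg≤ = begin
          Dg                                                       ≡⟨ ∏-cong divisors (λ p _ → trans (cong (p ^_) (*-comm m (expsBelow E K p))) (sym (^-*-assoc p (expsBelow E K p) m))) ⟩
          ∏ divisors (λ p → (p ^ expsBelow E K p) ^ m)             ≡⟨ ∏-^ divisors (λ p → p ^ expsBelow E K p) m ⟩
          ∏ divisors (λ p → p ^ expsBelow E K p) ^ m               ≤⟨ ^-monoˡ-≤ m (∏-mono divisors (λ p p∈ → ^expsBelow≤ E K p (prime≥1 (proj₁ (divisors-spec p∈))) 1≤K)) ⟩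
          ∏ divisors (λ _ → K) ^ m                                 ≡⟨ cong (_^ m) (∏-const divisors K) ⟩
          (K ^ N) ^ m                                              ∎

    -- The first factor is about K^(K/2), against about K^K on the left. The difference has to come
    -- from N factors, each a bounded power of K, which forces N to be at least a constant times K.
    factorial-bound : K ! ≤ (C * x) ^ K * (K * Tmax) ^ N
    factorial-bound = ≤-trans K!≤ (^-cancelʳ-≤ m m≥1 (begin
        (S * Tmax ^ N) ^ m                                       ≡⟨ *-^ S (Tmax ^ N) m ⟩
        S ^ m * (Tmax ^ N) ^ m                                   ≤⟨ *-monoˡ-≤ ((Tmax ^ N) ^ m) S-upper ⟩
        B ^ K * (K ^ N) ^ m * (Tmax ^ N) ^ m               ≤⟨ *-monoˡ-≤ ((Tmax ^ N) ^ m) (*-monoˡ-≤ ((K ^ N) ^ m) (^-monoˡ-≤ K B≤)) ⟩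
        ((C * x) ^ m) ^ K * (K ^ N) ^ m * (Tmax ^ N) ^ m         ≡⟨ cong (λ z → z * (K ^ N) ^ m * (Tmax ^ N) ^ m) (trans (^-*-assoc (C * x) m K) (trans (cong ((C * x) ^_) (*-comm m K)) (sym (^-*-assoc (C * x) K m)))) ⟩
        ((C * x) ^ K) ^ m * (K ^ N) ^ m * (Tmax ^ N) ^ m         ≡⟨ *-assoc (((C * x) ^ K) ^ m) ((K ^ N) ^ m) ((Tmax ^ N) ^ m) ⟩
        ((C * x) ^ K) ^ m * ((K ^ N) ^ m * (Tmax ^ N) ^ m)       ≡⟨ cong (((C * x) ^ K) ^ m *_) (sym (*-^ (K ^ N) (Tmax ^ N) m)) ⟩
        ((C * x) ^ K) ^ m * (K ^ N * Tmax ^ N) ^ m               ≡⟨ cong (λ z → ((C * x) ^ K) ^ m * z ^ m) (sym (*-^ K Tmax N)) ⟩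
        ((C * x) ^ K) ^ m * ((K * Tmax) ^ N) ^ m                 ≡⟨ *-^ ((C * x) ^ K) ((K * Tmax) ^ N) m ⟨
        ((C * x) ^ K * (K * Tmax) ^ N) ^ m                       ∎))
      where
      open ≤-Reasoning
      B≤ : B ≤ (C * x) ^ m
      B≤ = begin
        C * x ^ m        ≡⟨ cong (_* x ^ m) (sym (*-identityʳ C)) ⟩
        C ^ 1 * x ^ m    ≤⟨ *-monoˡ-≤ (x ^ m) (^-monoʳ-≤ C {{>-nonZero C≥1}} m≥1) ⟩
        C ^ m * x ^ m    ≡⟨ *-^ C x m ⟨
        (C * x) ^ m      ∎
      K!≤ : K ! ≤ S * Tmax ^ N
      K!≤ = ^-cancelʳ-≤ (suc t) (s≤s z≤n) (begin
        (K !) ^ suc t                      ≡⟨ cong (_^ suc t) (factorial≡∏ K) ⟩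
        ∏ ds id ^ suc t                    ≡⟨ ∏-^ ds id (suc t) ⟨
        ∏ ds (λ d → d ^ suc t)             ≤⟨ ∏-mono ds (λ d d∈ → T-lower d (proj₁ (∈-interval⁻ d∈))) ⟩
        V                                  ≤⟨ V-upper ⟩
        (S * Tmax ^ N) ^ suc t             ∎)

  -- K is rounded down to K′ = 16 z², so that the box has the integral side 4 z. Rounding costs at
  -- most a factor 4, since K ≤ 16 (z + 1)² ≤ 64 z².
  many-divisors : ∃[ c ] ∃[ K₀ ] ∀ K → K₀ ≤ K → ∃[ ps ] (Unique ps × All (λ p → Prime p × ∃[ d ] (1 ≤ d × d ≤ K × + p ∣ℤ eval T (+ d))) ps × K ≤ c * length ps)
  many-divisors = 8 * e , 16 * (z₀ * z₀) , at
    where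
    -- The exponent for which z^e bounds K′ · Tmax: K′ ≤ z³ gives 3 and 3 (t + 1), and Cₜ ≤ z gives
    -- 1.
    e = 3 + (1 + 3 * suc t)
    -- From (4 C)^4 ≤ z follows (4 C z)^(16 z²) ≤ z^(20 z²). On the other side K′! ≥ (2 z²)^(14 z²)
    -- ≥ z^(28 z²), so z^(8 z²) is left for the divisors to supply.
    z₀ = (4 * C) ^ 4 + 16 + Cₜ
    at : ∀ K → 16 * (z₀ * z₀) ≤ K → ∃[ ps ] (Unique ps × All (λ p → Prime p × ∃[ d ] (1 ≤ d × d ≤ K × + p ∣ℤ eval T (+ d))) ps × K ≤ 8 * e * length ps)
    at K K₀≤K with ∃-sqrt (K / 16)
    ... | z , lo , hi = divisors , divisors-unique , All-tabulate spec , K≤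
      where
      open ≤-Reasoning
      zz = z * z
      K′ = 16 * zz
      z₀≤z : z₀ ≤ z
      z₀≤z = ≮⇒≥ λ z<z₀ → <⇒≱ hi (begin
        suc z * suc z             ≤⟨ *-mono-≤ z<z₀ z<z₀ ⟩
        z₀ * z₀                   ≡⟨ m*n/n≡m (z₀ * z₀) 16 ⟨
        z₀ * z₀ * 16 / 16         ≤⟨ /-monoˡ-≤ 16 (≤-trans (≤-reflexive (*-comm (z₀ * z₀) 16)) K₀≤K) ⟩
        K / 16                    ∎)
      4C≤z : (4 * C) ^ 4 ≤ z
      4C≤z = ≤-trans (≤-trans (m≤m+n _ 16) (m≤m+n _ Cₜ)) z₀≤z
      16≤z : 16 ≤ z
      16≤z = ≤-trans (≤-trans (m≤n+m 16 ((4 * C) ^ 4)) (m≤m+n _ Cₜ)) z₀≤z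
      Cₜ≤z : Cₜ ≤ z
      Cₜ≤z = ≤-trans (m≤n+m Cₜ ((4 * C) ^ 4 + 16)) z₀≤z
      1≤z : 1 ≤ z
      1≤z = ≤-trans (s≤s z≤n) 16≤z
      K′≤K : K′ ≤ K
      K′≤K = ≤-trans (*-monoʳ-≤ 16 lo) (≤-trans (≤-reflexive (*-comm 16 (K / 16))) (m/n*n≤m K 16))
      sq : ∀ z → 16 * (z * z) ≡ 4 * z * (4 * z)
      sq = ℕ-Ring.solve-∀
      open Scale (4 * z) K′ (sq z) (≤-trans (*-mono-≤ 1≤z 1≤z) (m≤n*m zz 16))
      N = length divisors
      spec : ∀ {p} → p ∈ divisors → Prime p × ∃[ d ] (1 ≤ d × d ≤ K × + p ∣ℤ eval T (+ d))
      spec p∈ with divisors-spec p∈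
      ... | pp , d , d∈ , r = pp , d , proj₁ (∈-interval⁻ d∈) , ≤-trans (proj₂ (∈-interval⁻ d∈)) K′≤K , r
      instance
        z≢0 = >-nonZero 1≤z
      16zz≤ : K′ ≤ z ^ 3
      16zz≤ = ≤-trans (*-monoˡ-≤ zz 16≤z) (≤-reflexive (cong (λ y → z * (z * y)) (sym (*-identityʳ z))))
      X≤ : K′ * (Cₜ * K′ ^ suc t) ≤ z ^ e
      X≤ = begin
        K′ * (Cₜ * K′ ^ suc t)                     ≤⟨ *-mono-≤ 16zz≤ (*-mono-≤ Cₜ≤z (^-monoˡ-≤ (suc t) 16zz≤)) ⟩
        z ^ 3 * (z * (z ^ 3) ^ suc t)              ≡⟨ cong (λ y → z ^ 3 * (z * y)) (^-*-assoc z 3 (suc t)) ⟩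
        z ^ 3 * z ^ (1 + 3 * suc t)                ≡⟨ ^-distribˡ-+-* z 3 (1 + 3 * suc t) ⟨
        z ^ e                                      ∎
      Cz≤ : (C * (4 * z)) ^ K′ ≤ z ^ (20 * zz)
      Cz≤ = begin
        (C * (4 * z)) ^ K′                         ≡⟨ cong (_^ K′) (l₁ C z) ⟩
        (4 * C * z) ^ K′                           ≡⟨ *-^ (4 * C) z K′ ⟩
        (4 * C) ^ K′ * z ^ K′                      ≡⟨ cong (λ n → (4 * C) ^ n * z ^ K′) (l₂ zz) ⟩
        (4 * C) ^ (4 * (4 * zz)) * z ^ K′          ≡⟨ cong (_* z ^ K′) (^-*-assoc (4 * C) 4 (4 * zz)) ⟨
        ((4 * C) ^ 4) ^ (4 * zz) * z ^ K′          ≤⟨ *-monoˡ-≤ (z ^ K′) (^-monoˡ-≤ (4 * zz) 4C≤z) ⟩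
        z ^ (4 * zz) * z ^ K′                      ≡⟨ ^-distribˡ-+-* z (4 * zz) K′ ⟨
        z ^ (4 * zz + 16 * zz)                     ≡⟨ cong (z ^_) (l₃ zz) ⟩
        z ^ (20 * zz)                              ∎
        where
        l₁ : ∀ c z → c * (4 * z) ≡ 4 * c * z
        l₁ = ℕ-Ring.solve-∀
        l₂ : ∀ n → 16 * n ≡ 4 * (4 * n)
        l₂ = ℕ-Ring.solve-∀
        l₃ : ∀ n → 4 * n + 16 * n ≡ 20 * n
        l₃ = ℕ-Ring.solve-∀
      lower : z ^ (28 * zz) ≤ K′ !
      lower = begin
        z ^ (28 * zz)                              ≡⟨ cong (z ^_) (l₁ zz) ⟩
        z ^ (2 * (14 * zz))                        ≡⟨ ^-*-assoc z 2 (14 * zz) ⟨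
        (z ^ 2) ^ (14 * zz)                        ≤⟨ ^-monoˡ-≤ (14 * zz) (≤-trans (≤-reflexive (cong (z *_) (*-identityʳ z))) (m≤m+n zz (zz + 0))) ⟩
        (2 * zz) ^ (14 * zz)                       ≤⟨ a^b≤[a+b]! (2 * zz) (14 * zz) ⟩
        (2 * zz + 14 * zz) !                       ≡⟨ cong _! (l₂ zz) ⟩
        K′ !                                       ∎
        where
        l₁ : ∀ n → 28 * n ≡ 2 * (14 * n)
        l₁ = ℕ-Ring.solve-∀
        l₂ : ∀ n → 2 * n + 14 * n ≡ 16 * n
        l₂ = ℕ-Ring.solve-∀
      28zz≤ : 28 * zz ≤ 20 * zz + e * N
      28zz≤ = ^-cancelˡ-≤ z (≤-trans (s≤s (s≤s z≤n)) 16≤z) (begin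
        z ^ (28 * zz)                                               ≤⟨ lower ⟩
        K′ !                                                        ≤⟨ factorial-bound ⟩
        (C * (4 * z)) ^ K′ * (K′ * (Cₜ * K′ ^ suc t)) ^ N           ≤⟨ *-mono-≤ Cz≤ (^-monoˡ-≤ N X≤) ⟩
        z ^ (20 * zz) * (z ^ e) ^ N                                 ≡⟨ cong (z ^ (20 * zz) *_) (^-*-assoc z e N) ⟩
        z ^ (20 * zz) * z ^ (e * N)                                 ≡⟨ ^-distribˡ-+-* z (20 * zz) (e * N) ⟨
        z ^ (20 * zz + e * N)                                       ∎)
      8zz≤ : 8 * zz ≤ e * N
      8zz≤ = +-cancelˡ-≤ (20 * zz) _ _ (≤-trans (≤-reflexive (l zz)) 28zz≤)
        where
        l : ∀ n → 20 * n + 8 * n ≡ 28 * n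
        l = ℕ-Ring.solve-∀
      K≤ : K ≤ 8 * e * N
      K≤ = begin
        K                                ≡⟨ m≡m%n+[m/n]*n K 16 ⟩
        K % 16 + K / 16 * 16             ≤⟨ +-monoˡ-≤ (K / 16 * 16) (<⇒≤ (m%n<n K 16)) ⟩
        16 + K / 16 * 16                 ≡⟨ *-comm (suc (K / 16)) 16 ⟩
        16 * suc (K / 16)                ≤⟨ *-monoʳ-≤ 16 hi ⟩
        16 * (suc z * suc z)             ≤⟨ *-monoʳ-≤ 16 (*-mono-≤ (+-monoˡ-≤ z 1≤z) (+-monoˡ-≤ z 1≤z)) ⟩
        16 * ((z + z) * (z + z))         ≡⟨ l₁ z ⟩
        8 * (8 * zz)                     ≤⟨ *-monoʳ-≤ 8 8zz≤ ⟩
        8 * (e * N)                      ≡⟨ *-assoc 8 e N ⟨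
        8 * e * N                        ∎
        where
        l₁ : ∀ z → 16 * ((z + z) * (z + z)) ≡ 8 * (8 * (z * z))
        l₁ = ℕ-Ring.solve-∀

-- Prime divisors of norm forms: a packing argument

open import Data.Vec as Vec using (Vec; []; _∷_)
open import Data.Vec.Relation.Unary.All as VecAll using ([]; _∷_)
import Data.Vec.Properties as Vecₚ

length-concatMap : ∀ {A B : Set} (f : A → List B) xs → length (concatMap f xs) ≡ ∑ xs (λ x → length (f x))
length-concatMap f [] = refl
length-concatMap f (x ∷ xs) = trans (length-++ (f x)) (cong (λ z → length (f x) + z) (length-concatMap f xs))

∈-concatMap : ∀ {A B : Set} (f : A → List B) {xs x y} → x ∈ xs → y ∈ f x → y ∈ concatMap f xs
∈-concatMap f (here refl) y∈ = ∈-++⁺ˡ y∈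
∈-concatMap f {x′ ∷ _} (there x∈) y∈ = ∈-++⁺ʳ (f x′) (∈-concatMap f x∈ y∈)

consPair : ∀ {m} → ℕ × Vec ℕ m → Vec ℕ (suc m)
consPair (a , v) = a ∷ v

box : ∀ m → ℕ → List (Vec ℕ m)
box zero x = [] ∷ []
box (suc m) x = map consPair (cartesianProduct (interval x) (box m x))

length-box : ∀ m x → length (box m x) ≡ x ^ m
length-box zero x = refl
length-box (suc m) x = trans (length-map consPair (cartesianProduct (interval x) (box m x))) (trans (length-cartesianProduct (interval x) (box m x)) (cong₂ _*_ (length-interval x) (length-box m x)))

box-unique : ∀ m x → Unique (box m x)
box-unique zero x = [] ∷ []
box-unique (suc m) x = Uniqueₚ.map⁺ (λ { {a , v} {b , w} e → cong₂ _,_ (Vecₚ.∷-injectiveˡ e) (Vecₚ.∷-injectiveʳ e) }) (Uniqueₚ.cartesianProduct⁺ (interval-unique x) (box-unique m x))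

∈-box⁺ : ∀ {m x} {v : Vec ℕ m} → VecAll.All (λ a → 1 ≤ a × a ≤ x) v → v ∈ box m x
∈-box⁺ [] = here refl
∈-box⁺ ((1≤a , a≤x) ∷ h) = ∈-map⁺ consPair (∈-cartesianProduct⁺ (∈-interval⁺ 1≤a a≤x) (∈-box⁺ h))

∈-box⁻ : ∀ {m x} {v : Vec ℕ m} → v ∈ box m x → VecAll.All (λ a → 1 ≤ a × a ≤ x) v
∈-box⁻ {zero} {x} {[]} _ = []
∈-box⁻ {suc m} {x} {a ∷ v} v∈ with ∈-map⁻ consPair v∈
... | (a′ , v′) , p∈ , refl = case ∈-cartesianProduct⁻ (interval x) (box m x) p∈ of λ { (a∈ , v∈′) → ∈-interval⁻ a∈ ∷ ∈-box⁻ v∈′ }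

toℤ : ∀ {m} → Vec ℕ m → Vec ℤ m
toℤ = Vec.map (λ k → + k)

_⊖ᵛ_ : ∀ {m} → Vec ℤ m → Vec ℤ m → Vec ℤ m
_⊖ᵛ_ = Vec.zipWith _⊖_

cell : ∀ {m} L .{{_ : NonZero L}} → Vec ℕ m → Vec ℕ m
cell L = Vec.map (λ a → suc (a / L))

same-cell-close : ∀ {L} .{{_ : NonZero L}} a b → a / L ≡ b / L → ∣ + a ⊖ + b ∣ ≤ L
same-cell-close {L} a b e = begin
  ∣ + a ⊖ + b ∣                    ≡⟨ cong ∣_∣ eq ⟩
  ∣ + (a % L) ⊖ + (b % L) ∣        ≤⟨ small ⟩
  L                                ∎
  where
  open ≤-Reasoning
  lem : ∀ u v w → (u ⊕ w) ⊖ (v ⊕ w) ≡ u ⊖ v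
  lem = ℤ-Ring.solve-∀
  eq : + a ⊖ + b ≡ + (a % L) ⊖ + (b % L)
  eq = trans (cong₂ (λ u v → + u ⊖ + v) (m≡m%n+[m/n]*n a L) (trans (m≡m%n+[m/n]*n b L) (cong (λ z → b % L + z * L) (sym e))))
    (trans (cong₂ _⊖_ (ℤₚ.pos-+ (a % L) (a / L * L)) (ℤₚ.pos-+ (b % L) (a / L * L))) (lem (+ (a % L)) (+ (b % L)) (+ (a / L * L))))
  small : ∣ + (a % L) ⊖ + (b % L) ∣ ≤ L
  small with ≤-total (a % L) (b % L)
  ... | inj₁ le = ≤-trans (≤-reflexive (trans (ℤₚ.∣i-j∣≡∣j-i∣ (+ (a % L)) (+ (b % L))) (abs-⊖-≥ le))) (≤-trans (m∸n≤m (b % L) (a % L)) (<⇒≤ (m%n<n b L)))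
  ... | inj₂ ge = ≤-trans (≤-reflexive (abs-⊖-≥ ge)) (≤-trans (m∸n≤m (a % L) (b % L)) (<⇒≤ (m%n<n a L)))

same-cellᵛ-close : ∀ {m L} .{{_ : NonZero L}} (a b : Vec ℕ m) → cell L a ≡ cell L b → VecAll.All (λ z → ∣ z ∣ ≤ L) (toℤ a ⊖ᵛ toℤ b)
same-cellᵛ-close [] [] e = []
same-cellᵛ-close (a ∷ as) (b ∷ bs) e = same-cell-close a b (suc-injective (Vecₚ.∷-injectiveˡ e)) ∷ same-cellᵛ-close as bs (Vecₚ.∷-injectiveʳ e)

cell-∈ : ∀ {m L x} .{{_ : NonZero L}} {a : Vec ℕ m} → a ∈ box m x → cell L a ∈ box m (suc (x / L))
cell-∈ {L = L} a∈ = ∈-box⁺ (go (∈-box⁻ a∈))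
  where
  go : ∀ {m x} {a : Vec ℕ m} → VecAll.All (λ a → 1 ≤ a × a ≤ x) a → VecAll.All (λ c → 1 ≤ c × c ≤ suc (x / L)) (cell L a)
  go [] = []
  go ((_ , a≤x) ∷ h) = (s≤s z≤n , s≤s (/-monoˡ-≤ L a≤x)) ∷ go h

⊖ᵛ≡0⇒≡ : ∀ {m} (a b : Vec ℕ m) → VecAll.All (_≡ + 0) (toℤ a ⊖ᵛ toℤ b) → a ≡ b
⊖ᵛ≡0⇒≡ [] [] [] = refl
⊖ᵛ≡0⇒≡ (a ∷ as) (b ∷ bs) (e ∷ es) = cong₂ _∷_ (ℤₚ.+-injective (ℤₚ.i-j≡0⇒i≡j (+ a) (+ b) e)) (⊖ᵛ≡0⇒≡ as bs es)

-- ∑ 1/n² over n > y is at most 1/y. The induction in `go` carries the telescoped bound x² (1/y -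
-- 1/m), cleared of denominators.
sum-squares-of-multiples : ∀ y x → 1 ≤ y → y * ∑ (filter (λ n → suc y ≤? n) (interval x)) (λ n → multiples x n * multiples x n) ≤ x * x
sum-squares-of-multiples y x 1≤y with ≤-<-connex x y
... | inj₁ x≤y = ≤-trans (≤-reflexive (trans (cong (y *_) (∑-above-none x≤y)) (*-zeroʳ y))) z≤n
  where
  ∑-above-none : ∀ {m} → m ≤ y → ∑ (filter (λ n → suc y ≤? n) (interval m)) (λ n → multiples x n * multiples x n) ≡ 0
  ∑-above-none {zero} _ = refl
  ∑-above-none {suc m} m<y = trans (cong (λ ns → ∑ ns (λ n → multiples x n * multiples x n)) (filter-reject (λ n → suc y ≤? n) (<⇒≱ (s≤s m<y)))) (∑-above-none (<⇒≤ m<y))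
... | inj₂ y<x = *-cancelˡ-≤ x {{>-nonZero (≤-trans 1≤y (<⇒≤ y<x))}} (≤-trans (≤-reflexive (lem₀ x y (S x))) (≤-trans (go x (<⇒≤ y<x)) (≤-trans (*-monoʳ-≤ (x * x) (m∸n≤m x y)) (≤-reflexive (*-comm (x * x) x)))))
  where
  open ≤-Reasoning
  sq : ℕ → ℕ
  sq n = multiples x n * multiples x n
  S : ℕ → ℕ
  S m = ∑ (filter (λ n → suc y ≤? n) (interval m)) sq
  lem₀ : ∀ x y s → x * (y * s) ≡ y * x * s
  lem₀ = ℕ-Ring.solve-∀
  S-small : ∀ m → m ≤ y → S m ≡ 0
  S-small zero _ = refl
  S-small (suc m) m<y = trans (cong (λ ns → ∑ ns sq) (filter-reject (λ n → suc y ≤? n) (<⇒≱ (s≤s m<y)))) (S-small m (<⇒≤ m<y))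
  S-suc : ∀ m → y ≤ m → S (suc m) ≡ sq (suc m) + S m
  S-suc m y≤m = cong (λ ns → ∑ ns sq) (filter-accept (λ n → suc y ≤? n) (s≤s y≤m))
  go : ∀ m → y ≤ m → y * m * S m ≤ x * x * (m ∸ y)
  go zero _ = ≤-trans (≤-reflexive (trans (cong (_* S 0) (*-zeroʳ y)) refl)) z≤n
  go (suc m) y≤sm with m≤n⇒m<n∨m≡n y≤sm
  ... | inj₂ y≡ = ≤-trans (≤-reflexive (trans (cong (y * suc m *_) (S-small (suc m) (≤-reflexive (sym y≡)))) (*-zeroʳ (y * suc m)))) z≤n
  ... | inj₁ (s≤s y≤m) = *-cancelˡ-≤ m {{>-nonZero (≤-trans 1≤y y≤m)}} (begin
      m * (y * suc m * S (suc m))                                ≡⟨ cong (λ z → m * (y * suc m * z)) (S-suc m y≤m) ⟩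
      m * (y * suc m * (q * q + S m))                            ≡⟨ lem₁ m y (q * q) (S m) ⟩
      suc m * (y * m * S m) + y * (m * suc m * (q * q))          ≤⟨ +-mono-≤ (*-monoʳ-≤ (suc m) (go m y≤m)) (*-monoʳ-≤ y (*-monoˡ-≤ (q * q) (*-monoˡ-≤ (suc m) (n≤1+n m)))) ⟩
      suc m * (x * x * (m ∸ y)) + y * (suc m * suc m * (q * q))  ≤⟨ +-monoʳ-≤ (suc m * (x * x * (m ∸ y))) (*-monoʳ-≤ y (≤-trans (≤-reflexive (lem₂ (suc m) q)) (*-mono-≤ qm≤x qm≤x))) ⟩
      suc m * (x * x * (m ∸ y)) + y * (x * x)                    ≡⟨ lem₄ ⟩
      m * (x * x * (suc m ∸ y))                                  ∎)
    where
    q = multiples x (suc m)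
    qm≤x : suc m * q ≤ x
    qm≤x = proj₁ (multiples-bounds x (suc m) (s≤s z≤n))
    lem₁ : ∀ m y a s → m * (y * suc m * (a + s)) ≡ suc m * (y * m * s) + y * (m * suc m * a)
    lem₁ = ℕ-Ring.solve-∀
    lem₂ : ∀ m q → m * m * (q * q) ≡ m * q * (m * q)
    lem₂ = ℕ-Ring.solve-∀
    lem₃ : ∀ d y x → suc (y + d) * (x * x * d) + y * (x * x) ≡ (y + d) * (x * x * suc d)
    lem₃ = ℕ-Ring.solve-∀
    lem₄ : suc m * (x * x * (m ∸ y)) + y * (x * x) ≡ m * (x * x * (suc m ∸ y))
    lem₄ = trans (cong (λ z → suc z * (x * x * (m ∸ y)) + y * (x * x)) (sym (m+[n∸m]≡n y≤m))) (trans (lem₃ (m ∸ y) y x) (cong₂ (λ u v → u * (x * x * v)) (m+[n∸m]≡n y≤m) (sym (+-∸-assoc 1 y≤m))))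

∑*product≤recipSum : ∀ ps (c : ℕ → ℕ) D → (∀ {p} → p ∈ ps → c p * p ≤ D) → ∑ ps c * product ps ≤ D * recipSum ps
∑*product≤recipSum [] c D h = z≤n
∑*product≤recipSum (p ∷ ps) c D h = begin
  (c p + ∑ ps c) * (p * product ps)                   ≡⟨ lem (c p) (∑ ps c) p (product ps) ⟩
  c p * p * product ps + p * (∑ ps c * product ps)    ≤⟨ +-mono-≤ (*-monoˡ-≤ (product ps) (h (here refl))) (*-monoʳ-≤ p (∑*product≤recipSum ps c D (h ∘ there))) ⟩
  D * product ps + p * (D * recipSum ps)              ≡⟨ lem′ D (product ps) p (recipSum ps) ⟩
  D * (product ps + p * recipSum ps)                  ∎
  where
  open ≤-Reasoning
  lem : ∀ c s p a → (c + s) * (p * a) ≡ c * p * a + p * (s * a)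
  lem = ℕ-Ring.solve-∀
  lem′ : ∀ D a p r → D * a + p * (D * r) ≡ D * (a + p * r)
  lem′ = ℕ-Ring.solve-∀

-- L is taken maximal with C L^m < q, an m-th root of q / C up to rounding; since L ≥ 1, L + 1 is at
-- most 2 L.
∃-root : ∀ m C q → 1 ≤ m → 1 ≤ C → C < q → ∃[ L ] (1 ≤ L × C * L ^ m < q × q ≤ C * (2 * L) ^ m)
∃-root m C q 1≤m 1≤C C<q = go q 1 ≤-refl (subst (_< q) (sym (trans (cong (C *_) (^-zeroˡ m)) (*-identityʳ C))) C<q) (m≤m+n q 1)
  where
  open ≤-Reasoning
  go : ∀ fuel L → 1 ≤ L → C * L ^ m < q → q ≤ fuel + L → ∃[ L ] (1 ≤ L × C * L ^ m < q × q ≤ C * (2 * L) ^ m)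
  go fuel L 1≤L lo hi with C * suc L ^ m <? q
  ... | no h = L , 1≤L , lo , ≤-trans (≮⇒≥ h) (*-monoʳ-≤ C (^-monoˡ-≤ m (≤-trans (+-monoˡ-≤ L 1≤L) (≤-reflexive (cong (λ z → L + z) (sym (+-identityʳ L)))))))
  go (suc fuel) L 1≤L lo hi | yes h = go fuel (suc L) (s≤s z≤n) h (≤-trans hi (≤-reflexive (sym (+-suc fuel L))))
  go zero L 1≤L lo hi | yes h = ⊥-elim (<⇒≱ h (begin
    q                 ≤⟨ hi ⟩
    L                 ≤⟨ n≤1+n L ⟩
    suc L             ≡⟨ *-identityʳ (suc L) ⟨
    suc L ^ 1         ≤⟨ ^-monoʳ-≤ (suc L) 1≤m ⟩
    suc L ^ m         ≤⟨ m≤n*m (suc L ^ m) C {{>-nonZero 1≤C}} ⟩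
    C * suc L ^ m     ∎))

-- `N` is the norm form of ℤ[X]/(g), of degree m in m variables. The vectors whose norm is divisible
-- by p are either divisible by p or belong to one of at most R types, each tied to a root of f
-- modulo p; by `closed` the norm of a difference within a type is again divisible by p. `N-monic`
-- limits how many first coordinates give a prescribed norm.
record NormData (f : Poly) : Set₁ where
  field
    n C R M₀ : ℕ
  m : ℕ
  m = suc (suc n)
  field
    C≥1 : 1 ≤ C
    N : Vec ℤ m → ℤ
    N-bound : ∀ x v → VecAll.All (λ z → ∣ z ∣ ≤ x) v → ∣ N v ∣ ≤ C * x ^ m
    N-nonzero : ∀ v → N v ≡ + 0 → VecAll.All (_≡ + 0) v
    coeffs : Vec ℤ (suc n) → List ℤ
    length-coeffs : ∀ v → length (coeffs v) ≡ m
    N-monic : ∀ u v → N (u ∷ v) ≡ eval (coeffs v ++ + 1 ∷ []) u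
    Ty : Set
    types : ℕ → List Ty
    Typ : ℕ → Ty → Vec ℤ m → Set
    Typ? : ∀ p τ v → Dec (Typ p τ v)
    types-few : ∀ {p} → Prime p → length (types p) ≤ R
    types-root : ∀ {p τ} → Prime p → M₀ < p → τ ∈ types p → RootMod f p
    classify : ∀ {p} → Prime p → ∀ v → + p ∣ℤ N v → VecAll.All (+ p ∣ℤ_) v ⊎ ∃[ τ ] (τ ∈ types p × Typ p τ v)
    closed : ∀ {p τ v w} → Prime p → τ ∈ types p → Typ p τ v → Typ p τ w → + p ∣ℤ N (v ⊖ᵛ w)

module _ {f : Poly} (D : NormData f) where
  open NormData D

  -- Three lists exhaust the box. In `T₁` the norm is y-smooth; in `T₂` the first two coordinates
  -- share a divisor above y; in `T₃` the vector has a type at some prime above y. The first two are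
  -- at most a quarter of the box each, so `T₃` fills at least half of it, while its size is at most
  -- a constant times x^m ∑ 1/p.
  module Packing (y x L₂ : ℕ) (C≤y : C ≤ y) (M₀≤y : M₀ ≤ y) (8≤y : 8 ≤ y) (1≤x : 1 ≤ x)
    (C< : C * x ^ m < 2 ^ L₂) (few : 8 * m * suc L₂ ^ y ≤ x) where

    Box : List (Vec ℕ m)
    Box = box m x

    Nₙ : Vec ℕ m → ℤ
    Nₙ v = N (toℤ v)

    Nmax : ℕ
    Nmax = C * x ^ m

    Nₙ≤ : ∀ {v} → v ∈ Box → ∣ Nₙ v ∣ ≤ Nmax
    Nₙ≤ {v} v∈ = N-bound x (toℤ v) (go (∈-box⁻ {m} {x} v∈))
      where
      go : ∀ {k} {v : Vec ℕ k} → VecAll.All (λ a → 1 ≤ a × a ≤ x) v → VecAll.All (λ z → ∣ z ∣ ≤ x) (toℤ v)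
      go [] = []
      go ((_ , a≤x) ∷ h) = a≤x ∷ go h

    Nₙ≥1 : ∀ {v} → v ∈ Box → 1 ≤ ∣ Nₙ v ∣
    Nₙ≥1 {a ∷ v} v∈ = n≢0⇒n>0 λ z → case N-nonzero (toℤ (a ∷ v)) (ℤₚ.∣i∣≡0⇒i≡0 z) of λ { (e ∷ _) → case ∈-box⁻ {m} {x} v∈ of λ { ((1≤a , _) ∷ _) → 1+n≰n (subst (1 ≤_) (ℤₚ.+-injective e) 1≤a) } }

    sm : List ℕ
    sm = smooths y L₂

    signed : List ℤ
    signed = map (λ k → + k) sm ++ map (λ k → ⊝ (+ k)) sm

    ∈-signed : ∀ z → ∣ z ∣ ∈ sm → z ∈ signed
    ∈-signed (+ k) k∈ = ∈-++⁺ˡ (∈-map⁺ (λ k → + k) k∈)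
    ∈-signed (-[1+ k ]) k∈ = ∈-++⁺ʳ (map (λ k → + k) sm) (∈-map⁺ (λ k → ⊝ (+ k)) k∈)

    length-signed : length signed ≡ 2 * suc L₂ ^ y
    length-signed = trans (length-++ (map (λ k → + k) sm)) (trans (cong₂ _+_ (trans (length-map (λ k → + k) sm) (length-smooths y L₂)) (trans (length-map _ sm) (length-smooths y L₂))) (cong (λ z → suc L₂ ^ y + z) (sym (+-identityʳ _))))

    -- The values of u solving N (u ∷ v) = z are counted modulo a prime exceeding all of them.
    solutions : Vec ℕ (suc n) × ℤ → List ℕ
    solutions (v , z) = filter (λ u → N (+ u ∷ toℤ v) ℤₚ.≟ z) (interval x)

    solutions-few : ∀ vz → length (solutions vz) ≤ m
    solutions-few (v , z) with ∃-prime> x | coeffs (toℤ v) in eq | length-coeffs (toℤ v)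
    ... | p , pp , x<p | [] | ()
    ... | p , pp , x<p | c ∷ cs | len = lagrange pp m (c ⊖ z ∷ cs) (+ 1) len (λ d → prime∤1 pp (abs-∣ d)) (solutions (v , z)) (Uniqueₚ.filter⁺ _ (interval-unique x))
        (All-tabulate λ {u} u∈ → case ∈-filter⁻ (λ u → N (+ u ∷ toℤ v) ℤₚ.≟ z) {xs = interval x} u∈ of λ { (u∈′ , e) → ≤-<-trans (proj₂ (∈-interval⁻ u∈′)) x<p , ∣ℤ-≡ (vanish u e) (dividesℤ (+ 0) refl) })
      where
      lem : ∀ c z t → (c ⊖ z) ⊕ t ≡ (c ⊕ t) ⊖ z
      lem = ℤ-Ring.solve-∀
      vanish : ∀ u → N (+ u ∷ toℤ v) ≡ z → + 0 ≡ eval (c ⊖ z ∷ cs ++ + 1 ∷ []) (+ u)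
      vanish u e = sym (trans (lem c z (+ u ⊗ eval (cs ++ + 1 ∷ []) (+ u))) (trans (cong (_⊖ z) (trans (sym (trans (N-monic (+ u) (toℤ v)) (cong (λ w → eval (w ++ + 1 ∷ []) (+ u)) eq))) e)) (ℤₚ.+-inverseʳ z)))

    T₁ : List (Vec ℕ m)
    T₁ = concatMap (λ vz → map (_∷ proj₁ vz) (solutions vz)) (cartesianProduct (box (suc n) x) signed)

    T₁-few : 4 * length T₁ ≤ x ^ m
    T₁-few = begin
      4 * length T₁                                                      ≡⟨ cong (4 *_) (length-concatMap (λ vz → map (_∷ proj₁ vz) (solutions vz)) pairs) ⟩
      4 * ∑ pairs (λ vz → length (map (_∷ proj₁ vz) (solutions vz)))     ≤⟨ *-monoʳ-≤ 4 (∑-mono pairs (λ vz _ → ≤-trans (≤-reflexive (length-map (_∷ proj₁ vz) (solutions vz))) (solutions-few vz))) ⟩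
      4 * ∑ pairs (λ _ → m)                                              ≡⟨ cong (4 *_) (trans (∑-const pairs m) (cong (_* m) (trans (length-cartesianProduct (box (suc n) x) signed) (cong₂ _*_ (length-box (suc n) x) length-signed)))) ⟩
      4 * (x ^ suc n * (2 * suc L₂ ^ y) * m)                             ≡⟨ lem (x ^ suc n) (suc L₂ ^ y) m ⟩
      8 * m * suc L₂ ^ y * x ^ suc n                                     ≤⟨ *-monoˡ-≤ (x ^ suc n) few ⟩
      x * x ^ suc n                                                      ∎
      where
      open ≤-Reasoning
      pairs = cartesianProduct (box (suc n) x) signed
      lem : ∀ a b m → 4 * (a * (2 * b) * m) ≡ 8 * m * b * a
      lem = ℕ-Ring.solve-∀

    mults : ℕ → List ℕ
    mults q = filter (q ∣?_) (interval x)

    cons₂ : ℕ × (ℕ × Vec ℕ n) → Vec ℕ m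
    cons₂ (a , b , v) = a ∷ b ∷ v

    -- Two coordinates divisible by q already have density about 1/q², and ∑ 1/q² over all integers
    -- q > y is at most 1/y.
    degenerate : ℕ → List (Vec ℕ m)
    degenerate q = map cons₂ (cartesianProduct (mults q) (cartesianProduct (mults q) (box n x)))

    T₂ : List (Vec ℕ m)
    T₂ = concatMap degenerate (filter (λ q → suc y ≤? q) (interval x))

    T₂-few : y * length T₂ ≤ x ^ m
    T₂-few = begin
      y * length T₂                                          ≡⟨ cong (y *_) (trans (length-concatMap degenerate qs) (∑-cong qs each)) ⟩
      y * ∑ qs (λ q → x ^ n * (multiples x q * multiples x q)) ≡⟨ cong (y *_) (∑-*ˡ qs (x ^ n) (λ q → multiples x q * multiples x q)) ⟩
      y * (x ^ n * ∑ qs (λ q → multiples x q * multiples x q)) ≡⟨ lem y (x ^ n) _ ⟩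
      x ^ n * (y * ∑ qs (λ q → multiples x q * multiples x q)) ≤⟨ *-monoʳ-≤ (x ^ n) (sum-squares-of-multiples y x (≤-trans (s≤s z≤n) 8≤y)) ⟩
      x ^ n * (x * x)                                        ≡⟨ lem′ (x ^ n) x ⟩
      x * (x * x ^ n)                                        ∎
      where
      open ≤-Reasoning
      qs = filter (λ q → suc y ≤? q) (interval x)
      lem : ∀ y a s → y * (a * s) ≡ a * (y * s)
      lem = ℕ-Ring.solve-∀
      lem′ : ∀ a x → a * (x * x) ≡ x * (x * a)
      lem′ = ℕ-Ring.solve-∀
      lem″ : ∀ a b → a * (a * b) ≡ b * (a * a)
      lem″ = ℕ-Ring.solve-∀
      length-mults : ∀ q → length (mults q) ≡ multiples x q
      length-mults q = sym (∑-𝟙 (q ∣?_) (interval x))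
      each : ∀ q → q ∈ qs → length (degenerate q) ≡ x ^ n * (multiples x q * multiples x q)
      each q _ = trans (length-map cons₂ (cartesianProduct (mults q) (cartesianProduct (mults q) (box n x)))) (trans (length-cartesianProduct (mults q) (cartesianProduct (mults q) (box n x))) (trans (cong₂ _*_ (length-mults q) (trans (length-cartesianProduct (mults q) (box n x)) (cong₂ _*_ (length-mults q) (length-box n x)))) (lem″ (multiples x q) (x ^ n))))

    class : ℕ → Ty → List (Vec ℕ m)
    class p τ = filter (λ v → Typ? p τ (toℤ v)) Box

    -- A cubical cell of side L with C L^m < p holds at most one vector of the class: the norm of a
    -- difference is divisible by p and smaller than p, hence 0. The bound p ≤ `Nmax` gives L ≤ x,
    -- so rounding up the number of cells costs only a factor 2 in each direction.
    class-few : ∀ {p τ} → Prime p → y < p → p ≤ Nmax → τ ∈ types p → length (class p τ) * p ≤ C * 4 ^ m * x ^ m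
    class-few {p} {τ} pp y<p p≤ τ∈ with ∃-root m C p (s≤s z≤n) C≥1 (≤-<-trans C≤y y<p)
    ... | L , 1≤L , lo , hi = begin
        length (class p τ) * p                                  ≤⟨ *-mono-≤ (≤-trans count (≤-reflexive (length-box m (suc (x / L))))) hi ⟩
        suc (x / L) ^ m * (C * (2 * L) ^ m)                     ≡⟨ cong (λ z → suc (x / L) ^ m * (C * z)) (*-^ 2 L m) ⟩
        suc (x / L) ^ m * (C * (2 ^ m * L ^ m))                 ≡⟨ lem (suc (x / L) ^ m) C (2 ^ m) (L ^ m) ⟩
        C * 2 ^ m * (suc (x / L) ^ m * L ^ m)                   ≡⟨ cong (C * 2 ^ m *_) (sym (*-^ (suc (x / L)) L m)) ⟩
        C * 2 ^ m * (suc (x / L) * L) ^ m                       ≤⟨ *-monoʳ-≤ (C * 2 ^ m) (^-monoˡ-≤ m cover) ⟩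
        C * 2 ^ m * (2 * x) ^ m                                 ≡⟨ cong (C * 2 ^ m *_) (*-^ 2 x m) ⟩
        C * 2 ^ m * (2 ^ m * x ^ m)                             ≡⟨ lem₂ C (2 ^ m) (x ^ m) ⟩
        C * (2 ^ m * 2 ^ m) * x ^ m                             ≡⟨ cong (λ z → C * z * x ^ m) (sym (*-^ 2 2 m)) ⟩
        C * 4 ^ m * x ^ m                                       ∎
      where
      open ≤-Reasoning
      instance
        L≢0 = >-nonZero 1≤L
      lem : ∀ a c b l → a * (c * (b * l)) ≡ c * b * (a * l)
      lem = ℕ-Ring.solve-∀
      lem₂ : ∀ c b x → c * b * (b * x) ≡ c * (b * b) * x
      lem₂ = ℕ-Ring.solve-∀
      L≤x : L ≤ x
      L≤x = ≮⇒≥ λ x<L → <⇒≱ lo (≤-trans p≤ (*-monoʳ-≤ C (^-monoˡ-≤ m (<⇒≤ x<L))))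
      cover : suc (x / L) * L ≤ 2 * x
      cover = ≤-trans (+-mono-≤ L≤x (m/n*n≤m x L)) (≤-reflexive (cong (λ z → x + z) (sym (+-identityʳ x))))
      T? = λ v → Typ? p τ (toℤ v)
      inj : ∀ {a b} → a ∈ class p τ → b ∈ class p τ → cell L a ≡ cell L b → a ≡ b
      inj {a} {b} a∈ b∈ e = ⊖ᵛ≡0⇒≡ a b (N-nonzero _ (ℤₚ.∣i∣≡0⇒i≡0 (small (abs-∣ (closed pp τ∈ (proj₂ (∈-filter⁻ T? {xs = Box} a∈)) (proj₂ (∈-filter⁻ T? {xs = Box} b∈)))) (≤-<-trans (N-bound L _ (same-cellᵛ-close a b e)) lo))))
        where
        small : ∀ {k} → p ∣ k → k < p → k ≡ 0
        small {zero} _ _ = refl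
        small {suc k} d k<p = ⊥-elim (<⇒≱ k<p (∣⇒≤ d))
      count : length (class p τ) ≤ length (box m (suc (x / L)))
      count = injOn⇒length≤ (cell L) (Uniqueₚ.filter⁺ T? (box-unique m x)) (λ a∈ → cell-∈ (proj₁ (∈-filter⁻ T? {xs = Box} a∈))) inj

    A? : ∀ p → Dec (y < p × 1 ≤ length (types p))
    A? p = (y <? p) ×-dec (1 ≤? length (types p))

    A : List ℕ
    A = filter A? (primesUpTo Nmax)

    A-spec : ∀ {p} → p ∈ A → Prime p × p ≤ Nmax × y < p × 1 ≤ length (types p)
    A-spec p∈ = case ∈-filter⁻ A? {xs = primesUpTo Nmax} p∈ of λ { (a , b) → proj₁ (primesUpTo-prime {Nmax} a) , proj₂ (primesUpTo-prime {Nmax} a) , b }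

    A-unique : Unique A
    A-unique = Uniqueₚ.filter⁺ A? (primesUpTo-unique Nmax)

    A-root : ∀ {p} → p ∈ A → RootMod f p
    A-root {p} p∈ with A-spec p∈
    ... | pp , _ , y<p , ne with types p in eq
    ... | τ ∷ _ = types-root pp (≤-<-trans M₀≤y y<p) (subst (τ ∈_) (sym eq) (here refl))

    classes : ℕ → List (Vec ℕ m)
    classes p = concatMap (class p) (types p)

    T₃ : List (Vec ℕ m)
    T₃ = concatMap classes A

    classes-few : ∀ {p} → p ∈ A → length (classes p) * p ≤ R * (C * 4 ^ m * x ^ m)
    classes-few {p} p∈ with A-spec p∈
    ... | pp , p≤ , y<p , _ = begin
      length (classes p) * p                                 ≡⟨ trans (cong (_* p) (length-concatMap (class p) (types p))) (*-comm _ p) ⟩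
      p * ∑ (types p) (λ τ → length (class p τ))             ≡⟨ ∑-*ˡ (types p) p _ ⟨
      ∑ (types p) (λ τ → p * length (class p τ))             ≤⟨ ∑-mono (types p) (λ τ τ∈ → ≤-trans (≤-reflexive (*-comm p _)) (class-few pp y<p p≤ τ∈)) ⟩
      ∑ (types p) (λ _ → C * 4 ^ m * x ^ m)                  ≡⟨ ∑-const (types p) _ ⟩
      length (types p) * (C * 4 ^ m * x ^ m)                 ≤⟨ *-monoˡ-≤ _ (types-few pp) ⟩
      R * (C * 4 ^ m * x ^ m)                                ∎
      where open ≤-Reasoning

    covered : ∀ {v} → v ∈ Box → v ∈ T₁ ++ (T₂ ++ T₃)
    covered {v} v∈ with search (λ p → y∣? p) (primesUpTo ∣ Nₙ v ∣)
      where
      y∣? : ∀ p → Dec (y < p × p ∣ ∣ Nₙ v ∣)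
      y∣? p = (y <? p) ×-dec (p ∣? ∣ Nₙ v ∣)
    covered {u ∷ v} v∈ | inj₂ none = ∈-++⁺ˡ (∈-concatMap (λ vz → map (_∷ proj₁ vz) (solutions vz)) (∈-cartesianProduct⁺ (∈-box⁺ tail-range) (∈-signed z smooth)) (∈-map⁺ (_∷ v) (∈-filter⁺ (λ u → N (+ u ∷ toℤ v) ℤₚ.≟ z) (∈-interval⁺ (proj₁ head-range) (proj₂ head-range)) refl)))
      where
      z = Nₙ (u ∷ v)
      head-range = VecAll.head (∈-box⁻ {m} {x} v∈)
      tail-range = VecAll.tail (∈-box⁻ {m} {x} v∈)
      smooth : ∣ z ∣ ∈ sm
      smooth = ∈-smooths y L₂ ∣ z ∣ (Nₙ≥1 v∈) (≤-<-trans (Nₙ≤ v∈) C<) λ {p} pp p∣ → ≮⇒≥ λ y<p → none (primesUpTo-complete pp (∣⇒≤ {{>-nonZero (Nₙ≥1 v∈)}} p∣)) (y<p , p∣)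
    covered {v} v∈ | inj₁ (p , p∈ , y<p , p∣) with classify (proj₁ (primesUpTo-prime {∣ Nₙ v ∣} p∈)) (toℤ v) (∣-abs p∣)
    covered {v} v∈ | inj₁ (p , p∈ , y<p , p∣) | inj₂ (τ , τ∈ , typ) = ∈-++⁺ʳ T₁ (∈-++⁺ʳ T₂ (∈-concatMap classes p∈A (∈-concatMap (class p) τ∈ (∈-filter⁺ (λ v → Typ? p τ (toℤ v)) v∈ typ))))
      where
      nonempty : ∀ {A : Set} {x : A} {xs} → x ∈ xs → 1 ≤ length xs
      nonempty (here _) = s≤s z≤n
      nonempty (there _) = s≤s z≤n
      p∈A : p ∈ A
      p∈A = ∈-filter⁺ A? (primesUpTo-complete (proj₁ (primesUpTo-prime {∣ Nₙ v ∣} p∈)) (≤-trans (proj₂ (primesUpTo-prime {∣ Nₙ v ∣} p∈)) (Nₙ≤ v∈))) (y<p , nonempty τ∈)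
    covered {a ∷ b ∷ v} v∈ | inj₁ (p , p∈ , y<p , p∣) | inj₁ (p∣a ∷ p∣b ∷ _) with ∈-box⁻ {m} {x} v∈
    ... | (1≤a , a≤x) ∷ (1≤b , b≤x) ∷ h = ∈-++⁺ʳ T₁ (∈-++⁺ˡ (∈-concatMap degenerate (∈-filter⁺ (λ q → suc y ≤? q) (∈-interval⁺ (≤-trans (s≤s z≤n) y<p) (≤-trans (∣⇒≤ {{>-nonZero 1≤a}} (abs-∣ p∣a)) a≤x)) y<p)
          (∈-map⁺ cons₂ (∈-cartesianProduct⁺ (∈-filter⁺ (p ∣?_) (∈-interval⁺ 1≤a a≤x) (abs-∣ p∣a)) (∈-cartesianProduct⁺ (∈-filter⁺ (p ∣?_) (∈-interval⁺ 1≤b b≤x) (abs-∣ p∣b)) (∈-box⁺ h))))))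

    product≤recipSum : product A ≤ 2 * R * (C * 4 ^ m) * recipSum A
    product≤recipSum = *-cancelˡ-≤ (x ^ m) {{m^n≢0 x m {{>-nonZero 1≤x}}}} (begin
      x ^ m * product A                                          ≤⟨ *-monoˡ-≤ (product A) half ⟩
      2 * length T₃ * product A                                  ≡⟨ *-assoc 2 (length T₃) (product A) ⟩
      2 * (length T₃ * product A)                                ≡⟨ cong (λ z → 2 * (z * product A)) (length-concatMap classes A) ⟩
      2 * (∑ A (λ p → length (classes p)) * product A)           ≤⟨ *-monoʳ-≤ 2 (∑*product≤recipSum A (λ p → length (classes p)) (R * (C * 4 ^ m * x ^ m)) classes-few) ⟩
      2 * (R * (C * 4 ^ m * x ^ m) * recipSum A)                 ≡⟨ lem R (C * 4 ^ m) (x ^ m) (recipSum A) ⟩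
      x ^ m * (2 * R * (C * 4 ^ m) * recipSum A)                 ∎)
      where
      open ≤-Reasoning
      lem : ∀ r c x s → 2 * (r * (c * x) * s) ≡ x * (2 * r * c * s)
      lem = ℕ-Ring.solve-∀
      total : x ^ m ≤ length T₁ + (length T₂ + length T₃)
      total = begin
        x ^ m                                        ≡⟨ length-box m x ⟨
        length Box                                   ≤⟨ unique-⊆⇒length≤ (box-unique m x) covered ⟩
        length (T₁ ++ (T₂ ++ T₃))                    ≡⟨ trans (length-++ T₁) (cong (λ z → length T₁ + z) (length-++ T₂)) ⟩
        length T₁ + (length T₂ + length T₃)          ∎
      lem₁ : ∀ a b c → 4 * (a + (b + c)) ≡ 4 * a + 4 * b + 4 * c
      lem₁ = ℕ-Ring.solve-∀
      lem₂ : ∀ s → 4 * s ≡ s + s + 2 * s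
      lem₂ = ℕ-Ring.solve-∀
      half : x ^ m ≤ 2 * length T₃
      half = *-cancelˡ-≤ 2 (+-cancelˡ-≤ (x ^ m + x ^ m) _ _ (begin
        x ^ m + x ^ m + 2 * x ^ m                            ≡⟨ lem₂ (x ^ m) ⟨
        4 * x ^ m                                            ≤⟨ *-monoʳ-≤ 4 total ⟩
        4 * (length T₁ + (length T₂ + length T₃))            ≡⟨ lem₁ (length T₁) (length T₂) (length T₃) ⟩
        4 * length T₁ + 4 * length T₂ + 4 * length T₃        ≤⟨ +-monoˡ-≤ (4 * length T₃) (+-mono-≤ T₁-few (≤-trans (*-monoˡ-≤ (length T₂) (≤-trans (s≤s (s≤s (s≤s (s≤s z≤n)))) 8≤y)) T₂-few)) ⟩
        x ^ m + x ^ m + 4 * length T₃                        ≡⟨ cong (λ z → x ^ m + x ^ m + z) (*-assoc 2 2 (length T₃)) ⟩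
        x ^ m + x ^ m + 2 * (2 * length T₃)                  ∎))

  -- For fixed y the number of y-smooth values below 2^L₂ is polynomial in j, while the side of the
  -- box is 2^j. With L₂ = C + m j all norms are below 2^L₂, and `few` holds for large j. The
  -- constant obtained does not involve y₀.
  normData⇒manyRootPrimes : ManyRootPrimes f
  normData⇒manyRootPrimes = 2 * R * (C * 4 ^ m) , λ y₀ → at y₀ (polynomial≤2^ (C + M₀ + 8 + y₀) (8 * m * (suc C + m) ^ (C + M₀ + 8 + y₀)))
    where
    at : ∀ y₀ → ∃[ J ] (∀ j → J ≤ j → 8 * m * (suc C + m) ^ (C + M₀ + 8 + y₀) * (9 + (j + j)) ^ (C + M₀ + 8 + y₀) ≤ 2 ^ j) →
      ∃[ ps ] (Unique ps × All (λ p → Prime p × y₀ < p × RootMod f p) ps × product ps ≤ 2 * R * (C * 4 ^ m) * recipSum ps)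
    at y₀ (j , poly) = A , A-unique , All-tabulate (λ p∈ → case A-spec p∈ of λ { (pp , _ , y<p , _) → pp , ≤-<-trans (m≤n+m y₀ (C + M₀ + 8)) y<p , A-root p∈ }) , product≤recipSum
      where
      open ≤-Reasoning
      y = C + M₀ + 8 + y₀
      L₂ = C + m * j
      lem : ∀ c m j → suc (c + m * j) + (8 * c + (9 * m + 8) + (2 * c * j + m * j + 2 * j)) ≡ (suc c + m) * (9 + (j + j))
      lem = ℕ-Ring.solve-∀
      base : suc L₂ ≤ (suc C + m) * (9 + (j + j))
      base = ≤-trans (m≤m+n (suc L₂) _) (≤-reflexive (lem C m j))
      few : 8 * m * suc L₂ ^ y ≤ 2 ^ j
      few = begin
        8 * m * suc L₂ ^ y                                       ≤⟨ *-monoʳ-≤ (8 * m) (^-monoˡ-≤ y base) ⟩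
        8 * m * ((suc C + m) * (9 + (j + j))) ^ y                ≡⟨ cong (8 * m *_) (*-^ (suc C + m) (9 + (j + j)) y) ⟩
        8 * m * ((suc C + m) ^ y * (9 + (j + j)) ^ y)            ≡⟨ *-assoc (8 * m) ((suc C + m) ^ y) ((9 + (j + j)) ^ y) ⟨
        8 * m * (suc C + m) ^ y * (9 + (j + j)) ^ y              ≤⟨ poly j ≤-refl ⟩
        2 ^ j                                                    ∎
      C< : C * (2 ^ j) ^ m < 2 ^ L₂
      C< = begin-strict
        C * (2 ^ j) ^ m              ≡⟨ cong (C *_) (trans (^-*-assoc 2 j m) (cong (2 ^_) (*-comm j m))) ⟩
        C * 2 ^ (m * j)              <⟨ *-monoˡ-< (2 ^ (m * j)) {{m^n≢0 2 (m * j)}} (n<2^n C) ⟩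
        2 ^ C * 2 ^ (m * j)          ≡⟨ ^-distribˡ-+-* 2 C (m * j) ⟨
        2 ^ L₂                       ∎
      open Packing y (2 ^ j) L₂ (≤-trans (≤-trans (m≤m+n C M₀) (m≤m+n (C + M₀) 8)) (m≤m+n (C + M₀ + 8) y₀)) (≤-trans (≤-trans (m≤n+m M₀ C) (m≤m+n (C + M₀) 8)) (m≤m+n (C + M₀ + 8) y₀)) (≤-trans (m≤n+m 8 (C + M₀)) (m≤m+n (C + M₀ + 8) y₀)) (m^n>0 2 j) C< few

-- Reduction to depressed monic polynomials

∤-of-small : ∀ {p} z → z ≢ + 0 → ∣ z ∣ < p → ¬ (+ p ∣ℤ z)
∤-of-small z z≢0 z<p d = <⇒≱ z<p (∣⇒≤ {{≢-nonZero λ e → z≢0 (ℤₚ.∣i∣≡0⇒i≡0 e)}} (abs-∣ d))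

record Reduction (f g : Poly) : Set where
  field
    A B c : ℤ
    A≢0 : A ≢ + 0
    c≢0 : c ≢ + 0
    reduces : ∀ x → c ⊗ eval f x ≡ eval g (A ⊗ x ⊕ B)

  -- A root X of g is pulled back to (X - B) / A modulo p. A translation by A y becomes a
  -- translation by y, so two roots of g at distance A y give two roots of f at distance y.
  descend : ∀ {p} → Prime p → ¬ (+ p ∣ℤ A) → ¬ (+ p ∣ℤ c) → ∀ X → + p ∣ℤ eval g X →
    ∃[ x ] (+ p ∣ℤ eval f x × ∀ Y y → X ⊕ A ⊗ y ≡ Y → + p ∣ℤ eval g Y → + p ∣ℤ eval f (x ⊕ y))
  descend {p} pp p∤A p∤c X root with prime-inverse pp A p∤A
  ... | i , inv = x , divide x (∣ℤ-≡ (lem₁ A B X i) (ℤ∣.∣m⇒∣m*n (X ⊖ B) inv)) root , λ Y y Y≡ rootY → divide (x ⊕ y) (∣ℤ-≡ (trans (lem₂ A B X i y) (cong (λ z → (A ⊗ (x ⊕ y) ⊕ B) ⊖ z) Y≡)) (ℤ∣.∣m⇒∣m*n (X ⊖ B) inv)) rootY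
    where
    x = i ⊗ (X ⊖ B)
    lem₁ : ∀ A B X i → (A ⊗ i ⊖ + 1) ⊗ (X ⊖ B) ≡ (A ⊗ (i ⊗ (X ⊖ B)) ⊕ B) ⊖ X
    lem₁ = ℤ-Ring.solve-∀
    lem₂ : ∀ A B X i y → (A ⊗ i ⊖ + 1) ⊗ (X ⊖ B) ≡ (A ⊗ (i ⊗ (X ⊖ B) ⊕ y) ⊕ B) ⊖ (X ⊕ A ⊗ y)
    lem₂ = ℤ-Ring.solve-∀
    divide : ∀ x {X} → + p ∣ℤ ((A ⊗ x ⊕ B) ⊖ X) → + p ∣ℤ eval g X → + p ∣ℤ eval f x
    divide x d r with primeℤ pp c (eval f x) (∣ℤ-≡ (sym (reduces x)) (eval-transfer g d r))
    ... | inj₁ p∣c = ⊥-elim (p∤c p∣c)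
    ... | inj₂ h = h

  bad : ℕ
  bad = ∣ A ∣ + ∣ c ∣

  rootMod : ∀ {p} → Prime p → bad < p → ∀ X → + p ∣ℤ eval g X → RootMod f p
  rootMod pp bad<p X root = case descend pp (∤-of-small A A≢0 (≤-<-trans (m≤m+n ∣ A ∣ ∣ c ∣) bad<p)) (∤-of-small c c≢0 (≤-<-trans (m≤n+m ∣ c ∣ ∣ A ∣) bad<p)) X root of λ { (x , r , _) → x , r }

  root⇒plan : ∀ X → eval g X ≡ + 0 → EventuallyPlan f
  root⇒plan X e = allRoots⇒plan {f} bad λ p pp bad<p → rootMod pp bad<p X (∣ℤ-≡ (sym e) (dividesℤ (+ 0) refl))

⊗-self : ∀ z → z ⊗ z ≡ + (∣ z ∣ * ∣ z ∣)
⊗-self (+ n) = sym (ℤₚ.pos-* n n)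
⊗-self (-[1+ n ]) = refl

⊗≢0 : ∀ {x y} → x ≢ + 0 → y ≢ + 0 → x ⊗ y ≢ + 0
⊗≢0 {x} x≢0 y≢0 e = case ℤₚ.i*j≡0⇒i≡0∨j≡0 x e of λ { (inj₁ a) → x≢0 a ; (inj₂ b) → y≢0 b }

⊗≡0ˡ : ∀ {x y} → x ≢ + 0 → x ⊗ y ≡ + 0 → y ≡ + 0
⊗≡0ˡ {x} x≢0 e = case ℤₚ.i*j≡0⇒i≡0∨j≡0 x e of λ { (inj₁ a) → ⊥-elim (x≢0 a) ; (inj₂ b) → b }

∣z∣≥1 : ∀ {z} → z ≢ + 0 → 1 ≤ ∣ z ∣
∣z∣≥1 z≢0 = n≢0⇒n>0 λ e → z≢0 (ℤₚ.∣i∣≡0⇒i≡0 e)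

_≟ℤ0 : ∀ z → Dec (z ≡ + 0)
z ≟ℤ0 = z ℤₚ.≟ + 0

lowest-terms : ∀ u v → v ≢ + 0 → ∃[ d ] ∃[ u′ ] ∃[ v′ ] (d ≢ + 0 × u ≡ d ⊗ u′ × v ≡ d ⊗ v′ × Coprime ∣ u′ ∣ ∣ v′ ∣)
lowest-terms u v v≢0 with ∣-abs {gcd ∣ u ∣ ∣ v ∣} {u} (gcd[m,n]∣m ∣ u ∣ ∣ v ∣) | ∣-abs {gcd ∣ u ∣ ∣ v ∣} {v} (gcd[m,n]∣n ∣ u ∣ ∣ v ∣)
... | dividesℤ u′ eu | dividesℤ v′ ev = + d , u′ , v′ , d≢0 , trans eu (ℤₚ.*-comm u′ (+ d)) , trans ev (ℤₚ.*-comm v′ (+ d)) , cop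
  where
  d = gcd ∣ u ∣ ∣ v ∣
  d≢0 : + d ≢ + 0
  d≢0 e = v≢0 (trans ev (trans (cong (v′ ⊗_) e) (ℤₚ.*-zeroʳ v′)))
  instance
    d-nz = ≢-nonZero {d} λ e → d≢0 (cong +_ e)
  cop : Coprime ∣ u′ ∣ ∣ v′ ∣
  cop {i} (i∣u , i∣v) = ∣1⇒≡1 (*-cancelʳ-∣ d (subst (i * d ∣_) (sym (+-identityʳ d)) (gcd-greatest
    (subst (i * d ∣_) (sym (trans (cong ∣_∣ eu) (ℤₚ.abs-* u′ (+ d)))) (*-pres-∣ i∣u ∣-refl))
    (subst (i * d ∣_) (sym (trans (cong ∣_∣ ev) (ℤₚ.abs-* v′ (+ d)))) (*-pres-∣ i∣v ∣-refl)))))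

-- The last step of the rational root theorem: a denominator that divides a power of its coprime
-- numerator is 1.
coprime-∣^⇒unit : ∀ {u v} k → Coprime u v → v ∣ u ^ k → v ≡ 1
coprime-∣^⇒unit zero c d = ∣1⇒≡1 d
coprime-∣^⇒unit {u} (suc k) c d = coprime-∣^⇒unit {u} k c (coprime-divisor (λ { (x , y) → c (y , x) }) d)

unit-sign : ∀ v → ∣ v ∣ ≡ 1 → v ≡ + 1 ⊎ v ≡ -[1+ 0 ]
unit-sign (+ 1) refl = inj₁ refl
unit-sign (-[1+ 0 ]) refl = inj₂ refl

∃-integer? : ∀ (P : ℤ → Set) → (∀ z → Dec (P z)) → ∀ b → (∀ z → P z → ∣ z ∣ ≤ b) → (∃[ z ] P z) ⊎ (∀ z → ¬ P z)
∃-integer? P P? b bounded with search (λ n → P? (+ n)) (upTo (suc b)) | search (λ n → P? (⊝ (+ n))) (upTo (suc b))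
... | inj₁ (n , _ , h) | _ = inj₁ (+ n , h)
... | inj₂ _ | inj₁ (n , _ , h) = inj₁ (⊝ (+ n) , h)
... | inj₂ no⁺ | inj₂ no⁻ = inj₂ λ { z@(+ n) h → no⁺ (∈-upTo⁺ (s≤s (bounded z h))) h ; z@(-[1+ n ]) h → no⁻ (∈-upTo⁺ (s≤s (bounded z h))) h }

⊕-bound : ∀ {a b α β X} → ∣ a ∣ ≤ α * X → ∣ b ∣ ≤ β * X → ∣ a ⊕ b ∣ ≤ (α + β) * X
⊕-bound {a} {b} {α} {β} {X} ha hb = ≤-trans (ℤₚ.∣i+j∣≤∣i∣+∣j∣ a b) (≤-trans (+-mono-≤ ha hb) (≤-reflexive (sym (*-distribʳ-+ X α β))))

⊗-bound : ∀ {a b α β} → ∣ a ∣ ≤ α → ∣ b ∣ ≤ β → ∣ a ⊗ b ∣ ≤ α * β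
⊗-bound {a} {b} ha hb = ≤-trans (≤-reflexive (ℤₚ.abs-* a b)) (*-mono-≤ ha hb)

coeffSum : Poly → ℕ
coeffSum cs = ∑ cs ∣_∣

eval-upper : ∀ cs a d → 1 ≤ d → ∣ eval (cs ++ a ∷ []) (+ d) ∣ ≤ coeffSum (cs ++ a ∷ []) * d ^ length cs
eval-upper [] a d 1≤d = ≤-trans (≤-reflexive (cong ∣_∣ (lem a (+ d)))) (≤-reflexive (sym (trans (*-identityʳ _) (+-identityʳ ∣ a ∣))))
  where
  lem : ∀ a d → a ⊕ d ⊗ + 0 ≡ a
  lem = ℤ-Ring.solve-∀
eval-upper (c ∷ cs) a d 1≤d = ⊕-bound {c} {+ d ⊗ eval (cs ++ a ∷ []) (+ d)} {∣ c ∣} {coeffSum (cs ++ a ∷ [])} {d * d ^ length cs}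
  (m≤m*n ∣ c ∣ (d * d ^ length cs) {{m^n≢0 d (suc (length cs)) {{>-nonZero 1≤d}}}})
  (≤-trans (≤-reflexive (ℤₚ.abs-* (+ d) (eval (cs ++ a ∷ []) (+ d)))) (≤-trans (*-monoʳ-≤ d (eval-upper cs a d 1≤d)) (≤-reflexive (lem d (coeffSum (cs ++ a ∷ [])) (d ^ length cs)))))
  where
  lem : ∀ d s p → d * (s * p) ≡ s * (d * p)
  lem = ℕ-Ring.solve-∀

∣1⊕z∣≥ : ∀ z → ∣ z ∣ ∸ 1 ≤ ∣ + 1 ⊕ z ∣
∣1⊕z∣≥ z = ≤-trans (∸-monoˡ-≤ 1 (≤-trans (≤-reflexive (cong ∣_∣ (lem z))) (ℤₚ.∣i-j∣≤∣i∣+∣j∣ (+ 1 ⊕ z) (+ 1)))) (≤-reflexive (m+n∸n≡m ∣ + 1 ⊕ z ∣ 1))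
  where
  lem : ∀ z → z ≡ (+ 1 ⊕ z) ⊖ + 1
  lem = ℤ-Ring.solve-∀

∣⇒∣⊗ˡ : ∀ {p x} y → + p ∣ℤ x → + p ∣ℤ x ⊗ y
∣⇒∣⊗ˡ y = ℤ∣.∣m⇒∣m*n y

∣⇒∣⊗ʳ : ∀ {p y} x → + p ∣ℤ y → + p ∣ℤ x ⊗ y
∣⇒∣⊗ʳ x = ℤ∣.∣n⇒∣m*n x

splits⇒manyRootPairs : ∀ {f} (S : SplitData) δ → 1 ≤ δ →
  (∀ {p} d → Prime p → + p ∣ℤ eval (SplitData.T S) (+ d) → ∃[ x ] (+ p ∣ℤ eval f x × + p ∣ℤ eval f (x ⊕ + (δ * d)))) → ManyRootPairs f
splits⇒manyRootPairs {f} S δ 1≤δ pair = go (many-divisors S)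
  where
  go : (∃[ c ] ∃[ K₀ ] ∀ K → K₀ ≤ K → ∃[ ps ] (Unique ps × All (λ p → Prime p × ∃[ d ] (1 ≤ d × d ≤ K × + p ∣ℤ eval (SplitData.T S) (+ d))) ps × K ≤ c * length ps)) → ManyRootPairs f
  go (c , K₀ , h) = c , δ , K₀ , 1≤δ , λ K K₀≤K → case h K K₀≤K of λ
    { (ps , u , spec , len) → ps , u , All-map (λ { (pp , d , 1≤d , d≤K , r) → case pair d pp r of λ { (x , a , b) → pp , d , x , 1≤d , d≤K , a , b } }) spec , len }

-- Quadratic polynomials

module Quadratic (Δ : ℤ) (irr : ∀ X → X ⊗ X ≢ Δ) where

  g : Poly
  g = ⊝ Δ ∷ + 0 ∷ + 1 ∷ []

  g-eval : ∀ X → eval g X ≡ X ⊗ X ⊖ Δ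
  g-eval = lem Δ
    where
    lem : ∀ Δ X → ⊝ Δ ⊕ X ⊗ (+ 0 ⊕ X ⊗ (+ 1 ⊕ X ⊗ + 0)) ≡ X ⊗ X ⊖ Δ
    lem = ℤ-Ring.solve-∀

  abstract
    F : ℤ → ℤ → ℤ
    F u v = u ⊗ u ⊖ Δ ⊗ (v ⊗ v)

    F-def : ∀ u v → F u v ≡ u ⊗ u ⊖ Δ ⊗ (v ⊗ v)
    F-def u v = refl

  Δ≢0 : Δ ≢ + 0
  Δ≢0 e = irr (+ 0) (sym e)

  square≡0 : ∀ u → u ⊗ u ≡ + 0 → u ≡ + 0
  square≡0 u e = case ℤₚ.i*j≡0⇒i≡0∨j≡0 u e of λ { (inj₁ a) → a ; (inj₂ b) → b }

  -- A zero with v ≠ 0, in lowest terms, would be a rational and hence integral square root of Δ.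
  F-anisotropic : ∀ u v → F u v ≡ + 0 → v ≡ + 0
  F-anisotropic u v e with v ≟ℤ0
  ... | yes v≡0 = v≡0
  ... | no v≢0 with lowest-terms u v v≢0
  ... | d , u′ , v′ , d≢0 , refl , refl , cop = ⊥-elim (irr u′ (trans u′² (trans (cong (Δ ⊗_) v′²) (ℤₚ.*-identityʳ Δ))))
    where
    lem : ∀ d u v Δ → (d ⊗ u) ⊗ (d ⊗ u) ⊖ Δ ⊗ ((d ⊗ v) ⊗ (d ⊗ v)) ≡ (d ⊗ d) ⊗ (u ⊗ u ⊖ Δ ⊗ (v ⊗ v))
    lem = ℤ-Ring.solve-∀
    u′² : u′ ⊗ u′ ≡ Δ ⊗ (v′ ⊗ v′)
    u′² = ℤₚ.i-j≡0⇒i≡j (u′ ⊗ u′) (Δ ⊗ (v′ ⊗ v′)) (⊗≡0ˡ (⊗≢0 d≢0 d≢0) (trans (sym (lem d u′ v′ Δ)) (trans (sym (F-def (d ⊗ u′) (d ⊗ v′))) e)))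
    v′∣ : + ∣ v′ ∣ ∣ℤ (u′ ⊗ u′)
    v′∣ = ∣ℤ-≡ (sym u′²) (ℤ∣.∣n⇒∣m*n Δ (ℤ∣.∣m⇒∣m*n v′ (∣-abs {∣ v′ ∣} {v′} ∣-refl)))
    unit : ∣ v′ ∣ ≡ 1
    unit = coprime-∣^⇒unit {∣ u′ ∣} 2 cop (subst (∣ v′ ∣ ∣_) (trans (ℤₚ.abs-* u′ u′) (cong (∣ u′ ∣ *_) (sym (*-identityʳ ∣ u′ ∣)))) (abs-∣ v′∣))
    v′² : v′ ⊗ v′ ≡ + 1
    v′² = case unit-sign v′ unit of λ { (inj₁ refl) → refl ; (inj₂ refl) → refl }

  F-nonzero : ∀ u v → F u v ≡ + 0 → u ≡ + 0 × v ≡ + 0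
  F-nonzero u v e with F-anisotropic u v e
  ... | refl = square≡0 u (trans (lem u Δ) (trans (sym (F-def u (+ 0))) e)) , refl
    where
    lem : ∀ u Δ → u ⊗ u ≡ u ⊗ u ⊖ Δ ⊗ (+ 0 ⊗ + 0)
    lem = ℤ-Ring.solve-∀

  C : ℕ
  C = 1 + ∣ Δ ∣

  F-bound : ∀ x u v → ∣ u ∣ ≤ x → ∣ v ∣ ≤ x → ∣ F u v ∣ ≤ C * x ^ 2
  F-bound x u v hu hv = ≤-trans (≤-reflexive (cong ∣_∣ (F-def u v))) (≤-trans (⊕-bound {u ⊗ u} {⊝ (Δ ⊗ (v ⊗ v))} {1} {∣ Δ ∣} {x * x}
      (≤-trans (⊗-bound {u} {u} hu hu) (≤-reflexive (sym (+-identityʳ (x * x)))))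
      (≤-trans (≤-reflexive (ℤₚ.∣-i∣≡∣i∣ (Δ ⊗ (v ⊗ v)))) (⊗-bound {Δ} {v ⊗ v} ≤-refl (⊗-bound {v} {v} hv hv))))
    (≤-reflexive (cong (λ z → C * (x * z)) (sym (*-identityʳ x)))))

  module _ {f : Poly} (red : Reduction f g) where
    open Reduction red using (A; c; A≢0; c≢0; bad; rootMod; descend)

    -- Here T(d) = 1 - 4 Δ β² d². If p divides it, r₀ = 2 Δ β d satisfies r₀² ≡ Δ modulo p, so ± r₀
    -- are roots of g at distance 4 Δ β d. Since the constant term is 1, p divides none of 2, A, c,
    -- Δ, all of which divide σ; that makes the roots distinct and lets them be carried back to f.
    module Split (β σ : ℤ) (β≡ : β ≡ A ⊗ (c ⊗ c ⊗ Δ)) (σ≡ : σ ≡ ⊝ (+ 4 ⊗ (Δ ⊗ (β ⊗ β)))) where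

      β≢0 : β ≢ + 0
      β≢0 = subst (_≢ + 0) (sym β≡) (⊗≢0 A≢0 (⊗≢0 (⊗≢0 c≢0 c≢0) Δ≢0))

      T : Poly
      T = + 1 ∷ + 0 ∷ σ ∷ []

      T-eval : ∀ x → eval T x ≡ + 1 ⊕ σ ⊗ (x ⊗ x)
      T-eval = lem σ
        where
        lem : ∀ σ x → + 1 ⊕ x ⊗ (+ 0 ⊕ x ⊗ (σ ⊕ x ⊗ + 0)) ≡ + 1 ⊕ σ ⊗ (x ⊗ x)
        lem = ℤ-Ring.solve-∀

      module _ {p x} (pp : Prime p) (root : + p ∣ℤ eval T x) where

        ∤-part : ∀ y z → σ ⊗ (x ⊗ x) ≡ y ⊗ z → ¬ (+ p ∣ℤ y)
        ∤-part y z e d = prime∤1 pp (abs-∣ (ℤ∣.∣m+n∣n⇒∣m {m = + 1} {n = σ ⊗ (x ⊗ x)} (∣ℤ-≡ (T-eval x) root) (∣ℤ-≡ (sym e) (∣⇒∣⊗ˡ z d))))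

        p∤σ : ¬ (+ p ∣ℤ σ)
        p∤σ = ∤-part σ (x ⊗ x) refl

        p∤β : ¬ (+ p ∣ℤ β)
        p∤β d = p∤σ (∣ℤ-≡ (sym σ≡) (ℤ∣.∣m⇒∣-m (∣⇒∣⊗ʳ (+ 4) (∣⇒∣⊗ʳ Δ (∣⇒∣⊗ˡ β d)))))

        p∤A : ¬ (+ p ∣ℤ A)
        p∤A d = p∤β (∣ℤ-≡ (sym β≡) (∣⇒∣⊗ˡ (c ⊗ c ⊗ Δ) d))

        p∤c : ¬ (+ p ∣ℤ c)
        p∤c d = p∤β (∣ℤ-≡ (sym β≡) (∣⇒∣⊗ʳ A (∣⇒∣⊗ˡ Δ (∣⇒∣⊗ˡ c d))))

        r₀ : ℤ
        r₀ = + 2 ⊗ (Δ ⊗ (β ⊗ x))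

        p∤2r₀ : ¬ (+ p ∣ℤ (+ 2 ⊗ r₀))
        p∤2r₀ = ∤-part (+ 2 ⊗ r₀) (⊝ (β ⊗ x)) (trans (cong (_⊗ (x ⊗ x)) σ≡) (lem Δ β x))
          where
          lem : ∀ Δ β x → ⊝ (+ 4 ⊗ (Δ ⊗ (β ⊗ β))) ⊗ (x ⊗ x) ≡ (+ 2 ⊗ (+ 2 ⊗ (Δ ⊗ (β ⊗ x)))) ⊗ ⊝ (β ⊗ x)
          lem = ℤ-Ring.solve-∀

        g[±r₀] : ∀ r → r ⊗ r ≡ r₀ ⊗ r₀ → + p ∣ℤ eval g r
        g[±r₀] r e = ∣ℤ-≡ (sym (trans (g-eval r) (trans (cong (_⊖ Δ) e) (trans (lem Δ β x) (cong (λ z → ⊝ Δ ⊗ (+ 1 ⊕ z ⊗ (x ⊗ x))) (sym σ≡)))))) (∣⇒∣⊗ʳ (⊝ Δ) (∣ℤ-≡ (T-eval x) root))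
          where
          lem : ∀ Δ β x → (+ 2 ⊗ (Δ ⊗ (β ⊗ x))) ⊗ (+ 2 ⊗ (Δ ⊗ (β ⊗ x))) ⊖ Δ ≡ ⊝ Δ ⊗ (+ 1 ⊕ ⊝ (+ 4 ⊗ (Δ ⊗ (β ⊗ β))) ⊗ (x ⊗ x))
          lem = ℤ-Ring.solve-∀

        T-simple : ¬ (+ p ∣ℤ deriv T x)
        T-simple d = ∤-part (σ ⊗ x) x (lem₂ σ x) (∣ℤ-≡ (lem₁ σ x) d′)
          where
          lem₁ : ∀ σ x → x ⊗ σ ≡ σ ⊗ x
          lem₁ = ℤ-Ring.solve-∀
          lem₂ : ∀ σ x → σ ⊗ (x ⊗ x) ≡ (σ ⊗ x) ⊗ x
          lem₂ = ℤ-Ring.solve-∀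
          lem₃ : ∀ σ x → (+ 0 ⊕ x ⊗ (σ ⊕ x ⊗ + 0)) ⊕ x ⊗ ((σ ⊕ x ⊗ + 0) ⊕ x ⊗ (+ 0 ⊕ x ⊗ + 0)) ≡ + 2 ⊗ (x ⊗ σ)
          lem₃ = ℤ-Ring.solve-∀
          d′ : + p ∣ℤ (x ⊗ σ)
          d′ = [ (λ p∣2 → ⊥-elim (p∤2r₀ (∣⇒∣⊗ˡ r₀ p∣2))) , id ]′ (primeℤ pp (+ 2) (x ⊗ σ) (∣ℤ-≡ (lem₃ σ x) d))

        T-splits : ∀ E → ∃[ rs ] (length rs ≡ 2 × ∀ u v → + (p ^ E) ∣ℤ (F u v ⊖ linProd rs u v))
        T-splits E = from-lift (hensel-lift pp g r₀ (g[±r₀] r₀ refl) (λ d → p∤2r₀ (∣ℤ-≡ (g′ r₀ Δ) d)) E)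
          where
          g′ : ∀ X Δ → (+ 0 ⊕ X ⊗ (+ 1 ⊕ X ⊗ + 0)) ⊕ X ⊗ ((+ 1 ⊕ X ⊗ + 0) ⊕ X ⊗ (+ 0 ⊕ X ⊗ + 0)) ≡ + 2 ⊗ X
          g′ = ℤ-Ring.solve-∀
          lem : ∀ Δ r u v → (r ⊗ r ⊖ Δ) ⊗ (v ⊗ v) ≡ (u ⊗ u ⊖ Δ ⊗ (v ⊗ v)) ⊖ ((u ⊖ r ⊗ v) ⊗ ((u ⊖ ⊝ r ⊗ v) ⊗ + 1))
          lem = ℤ-Ring.solve-∀
          from-lift : ∃[ R ] (+ p ∣ℤ (R ⊖ r₀) × + (p ^ E) ∣ℤ eval g R) → ∃[ rs ] (length rs ≡ 2 × ∀ u v → + (p ^ E) ∣ℤ (F u v ⊖ linProd rs u v))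
          from-lift (r , _ , h) = r ∷ ⊝ r ∷ [] , refl , λ u v → ∣ℤ-≡ (trans (cong (_⊗ (v ⊗ v)) (g-eval r)) (trans (lem Δ r u v) (cong (_⊖ linProd (r ∷ ⊝ r ∷ []) u v) (sym (F-def u v))))) (ℤ∣.∣m⇒∣m*n (v ⊗ v) h)

      T-lower : ∀ d → 1 ≤ d → d ^ 2 ≤ ∣ eval T (+ d) ∣
      T-lower d 1≤d = begin
        d ^ 2                              ≡⟨ cong (d *_) (*-identityʳ d) ⟩
        d * d                              ≤⟨ ∸-monoˡ-≤ {suc (d * d)} 1 (≤-trans (+-monoˡ-≤ (d * d) 1≤dd) (+-monoʳ-≤ (d * d) (m≤m+n (d * d) (2 * (d * d))))) ⟩
        4 * (d * d) ∸ 1                    ≤⟨ ∸-monoˡ-≤ 1 (*-monoˡ-≤ (d * d) 4≤s) ⟩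
        ∣ σ ∣ * (d * d) ∸ 1                ≡⟨ cong (_∸ 1) (trans (cong (∣ σ ∣ *_) (sym (ℤₚ.abs-* (+ d) (+ d)))) (sym (ℤₚ.abs-* σ (+ d ⊗ + d)))) ⟩
        ∣ σ ⊗ (+ d ⊗ + d) ∣ ∸ 1            ≤⟨ ∣1⊕z∣≥ (σ ⊗ (+ d ⊗ + d)) ⟩
        ∣ + 1 ⊕ σ ⊗ (+ d ⊗ + d) ∣          ≡⟨ cong ∣_∣ (T-eval (+ d)) ⟨
        ∣ eval T (+ d) ∣                   ∎
        where
        open ≤-Reasoning
        1≤dd : 1 ≤ d * d
        1≤dd = *-mono-≤ 1≤d 1≤d
        4≤s : 4 ≤ ∣ σ ∣
        4≤s = ≤-trans (*-monoʳ-≤ 4 (∣z∣≥1 (⊗≢0 Δ≢0 (⊗≢0 β≢0 β≢0)))) (≤-reflexive (trans (sym (ℤₚ.abs-* (+ 4) (Δ ⊗ (β ⊗ β)))) (trans (sym (ℤₚ.∣-i∣≡∣i∣ (+ 4 ⊗ (Δ ⊗ (β ⊗ β))))) (cong ∣_∣ (sym σ≡)))))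

      splitData : SplitData
      splitData = record
        { m = 2 ; t = 1 ; C = C ; Cₜ = coeffSum T ; m≥1 = s≤s z≤n ; C≥1 = s≤s z≤n
        ; F = F ; F-bound = F-bound ; F-nonzero = F-nonzero
        ; cs = + 1 ∷ + 0 ∷ [] ; lead = σ ; length-cs = refl
        ; T-lower = T-lower ; T-upper = λ d 1≤d → eval-upper (+ 1 ∷ + 0 ∷ []) σ d 1≤d
        ; T-lead = λ {p} {x} pp r → p∤σ {p} {x} pp r ; T-simple = λ {p} {x} pp r → T-simple {p} {x} pp r ; T-splits = λ {p} {x} pp r → T-splits {p} {x} pp r
        }

      -- Chosen so that A δ d = 2 r₀. The square keeps δ positive whatever the signs of c and Δ;
      -- this is why β contains c² Δ.
      δ : ℕ
      δ = 4 * (∣ c ⊗ Δ ∣ * ∣ c ⊗ Δ ∣)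

      manyRootPairs : ManyRootPairs f
      manyRootPairs = splits⇒manyRootPairs {f} splitData δ (*-mono-≤ (s≤s (z≤n {3})) (*-mono-≤ (∣z∣≥1 cΔ≢0) (∣z∣≥1 cΔ≢0))) pair
        where
        cΔ≢0 : c ⊗ Δ ≢ + 0
        cΔ≢0 = ⊗≢0 c≢0 Δ≢0
        δ≡ : ∀ d → + (δ * d) ≡ + 4 ⊗ ((c ⊗ Δ) ⊗ (c ⊗ Δ)) ⊗ + d
        δ≡ d = trans (ℤₚ.pos-* δ d) (cong (_⊗ + d) (trans (ℤₚ.pos-* 4 (∣ c ⊗ Δ ∣ * ∣ c ⊗ Δ ∣)) (cong (+ 4 ⊗_) (sym (⊗-self (c ⊗ Δ))))))
        lem : ∀ A c Δ d → ⊝ (+ 2 ⊗ (Δ ⊗ ((A ⊗ (c ⊗ c ⊗ Δ)) ⊗ d))) ⊕ A ⊗ (+ 4 ⊗ ((c ⊗ Δ) ⊗ (c ⊗ Δ)) ⊗ d) ≡ + 2 ⊗ (Δ ⊗ ((A ⊗ (c ⊗ c ⊗ Δ)) ⊗ d))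
        lem = ℤ-Ring.solve-∀
        r₀-shift : ∀ d → ⊝ (+ 2 ⊗ (Δ ⊗ (β ⊗ + d))) ⊕ A ⊗ + (δ * d) ≡ + 2 ⊗ (Δ ⊗ (β ⊗ + d))
        r₀-shift d = subst (λ b → ⊝ (+ 2 ⊗ (Δ ⊗ (b ⊗ + d))) ⊕ A ⊗ + (δ * d) ≡ + 2 ⊗ (Δ ⊗ (b ⊗ + d))) (sym β≡) (trans (cong (λ z → ⊝ (+ 2 ⊗ (Δ ⊗ ((A ⊗ (c ⊗ c ⊗ Δ)) ⊗ + d))) ⊕ A ⊗ z) (δ≡ d)) (lem A c Δ (+ d)))
        neg² : ∀ r → ⊝ r ⊗ ⊝ r ≡ r ⊗ r
        neg² = ℤ-Ring.solve-∀
        pair : ∀ {p} d → Prime p → + p ∣ℤ eval T (+ d) → ∃[ x ] (+ p ∣ℤ eval f x × + p ∣ℤ eval f (x ⊕ + (δ * d)))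
        pair {p} d pp root = case descend pp (p∤A {p} {+ d} pp root) (p∤c {p} {+ d} pp root) (⊝ r) (g[±r₀] {p} {+ d} pp root (⊝ r) (neg² r)) of λ
          { (x , rx , shift) → x , rx , shift r (+ (δ * d)) (r₀-shift d) (g[±r₀] {p} {+ d} pp root r refl) }
          where
          r = + 2 ⊗ (Δ ⊗ (β ⊗ + d))

    Norm : Vec ℤ 2 → ℤ
    Norm v = F (Vec.head v) (Vec.head (Vec.tail v))

    Typ : ℕ → ℕ → Vec ℤ 2 → Set
    Typ p r (u ∷ v ∷ []) = + p ∣ℤ (u ⊖ + r ⊗ v)

    monic : ∀ Δ u v → u ⊗ u ⊖ Δ ⊗ (v ⊗ v) ≡ ⊝ (Δ ⊗ (v ⊗ v)) ⊕ u ⊗ (+ 0 ⊕ u ⊗ (+ 1 ⊕ u ⊗ + 0))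
    monic = ℤ-Ring.solve-∀
    is-root : ∀ {p r} → r ∈ rootsMod g p → + p ∣ℤ eval g (+ r)
    is-root {p} r∈ = proj₂ (∈-filter⁻ (λ r → + p ∣ℤ? eval g (+ r)) {xs = upTo p} r∈)
    abstract
      -- If p divides v it also divides u²; otherwise u / v is a root of g modulo p.
      classify-F : ∀ {p} → Prime p → ∀ u v → + p ∣ℤ F u v → VecAll.All (+ p ∣ℤ_) (u ∷ v ∷ []) ⊎ ∃[ r ] (r ∈ rootsMod g p × + p ∣ℤ (u ⊖ + r ⊗ v))
      classify-F {p} pp u v d₀ with + p ∣ℤ? v
      ... | yes p∣v = inj₁ (p∣u ∷ p∣v ∷ [])
        where
        d : + p ∣ℤ (u ⊗ u ⊖ Δ ⊗ (v ⊗ v))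
        d = ∣ℤ-≡ (F-def u v) d₀
        lem : ∀ u v Δ → (u ⊗ u ⊖ Δ ⊗ (v ⊗ v)) ⊕ Δ ⊗ (v ⊗ v) ≡ u ⊗ u
        lem = ℤ-Ring.solve-∀
        p∣u : + p ∣ℤ u
        p∣u = case primeℤ pp u u (∣ℤ-≡ (lem u v Δ) (ℤ∣.∣m∣n⇒∣m+n d (∣⇒∣⊗ʳ Δ (∣⇒∣⊗ˡ v p∣v)))) of λ { (inj₁ a) → a ; (inj₂ b) → b }
      ... | no p∤v with prime-inverse pp v p∤v
      ... | i , inv = inj₂ ((u ⊗ i) %ℕ p , ∈-rootsMod g (u ⊗ i) (∣ℤ-≡ (trans (lem₁ u v i Δ) (sym (g-eval (u ⊗ i)))) (ℤ∣.∣m∣n⇒∣m+n (∣⇒∣⊗ˡ (i ⊗ i) d) (∣⇒∣⊗ˡ (Δ ⊗ (v ⊗ i ⊕ + 1)) inv))) ,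
          ∣ℤ-≡ (lem₂ u v i (+ ((u ⊗ i) %ℕ p))) (ℤ∣.∣m∣n⇒∣m+n (ℤ∣.∣m⇒∣-m (∣⇒∣⊗ˡ v (%ℕ-cong (u ⊗ i) p))) (ℤ∣.∣m⇒∣-m (∣⇒∣⊗ʳ u inv))))
        where
        instance
          p≢0 : NonZero p
          p≢0 = prime⇒nonZero pp
        d : + p ∣ℤ (u ⊗ u ⊖ Δ ⊗ (v ⊗ v))
        d = ∣ℤ-≡ (F-def u v) d₀
        lem₁ : ∀ u v i Δ → (u ⊗ u ⊖ Δ ⊗ (v ⊗ v)) ⊗ (i ⊗ i) ⊕ (v ⊗ i ⊖ + 1) ⊗ (Δ ⊗ (v ⊗ i ⊕ + 1)) ≡ (u ⊗ i) ⊗ (u ⊗ i) ⊖ Δ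
        lem₁ = ℤ-Ring.solve-∀
        lem₂ : ∀ u v i r → ⊝ ((r ⊖ u ⊗ i) ⊗ v) ⊕ ⊝ (u ⊗ (v ⊗ i ⊖ + 1)) ≡ u ⊖ r ⊗ v
        lem₂ = ℤ-Ring.solve-∀

      -- Modulo p the form is (u - r v)(u + r v), and the first factor is additive in (u, v).
      closed-F : ∀ {p r} u v u′ v′ → + p ∣ℤ eval g (+ r) → + p ∣ℤ (u ⊖ + r ⊗ v) → + p ∣ℤ (u′ ⊖ + r ⊗ v′) → + p ∣ℤ F (u ⊖ u′) (v ⊖ v′)
      closed-F {p} {r} u v u′ v′ root h h′ = ∣ℤ-≡ (trans (lem (+ r) u v u′ v′ Δ) (sym (F-def (u ⊖ u′) (v ⊖ v′)))) (ℤ∣.∣m∣n⇒∣m+n (∣⇒∣⊗ˡ ((u ⊖ u′) ⊕ + r ⊗ (v ⊖ v′)) (ℤ∣.∣m∣n⇒∣m-n h h′)) (∣⇒∣⊗ˡ ((v ⊖ v′) ⊗ (v ⊖ v′)) (∣ℤ-≡ (g-eval (+ r)) root)))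
        where
        lem : ∀ r u v u′ v′ Δ → ((u ⊖ r ⊗ v) ⊖ (u′ ⊖ r ⊗ v′)) ⊗ ((u ⊖ u′) ⊕ r ⊗ (v ⊖ v′)) ⊕ (r ⊗ r ⊖ Δ) ⊗ ((v ⊖ v′) ⊗ (v ⊖ v′)) ≡ (u ⊖ u′) ⊗ (u ⊖ u′) ⊖ Δ ⊗ ((v ⊖ v′) ⊗ (v ⊖ v′))
        lem = ℤ-Ring.solve-∀

    normData : NormData f
    normData = record
      { n = 0 ; C = C ; R = 2 ; M₀ = bad ; C≥1 = s≤s z≤n ; N = Norm
      ; N-bound = λ { x (u ∷ v ∷ []) (hu ∷ hv ∷ []) → F-bound x u v hu hv }
      ; N-nonzero = λ { (u ∷ v ∷ []) e → case F-nonzero u v e of λ { (a , b) → a ∷ b ∷ [] } }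
      ; coeffs = λ { (v ∷ []) → ⊝ (Δ ⊗ (v ⊗ v)) ∷ + 0 ∷ [] }
      ; length-coeffs = λ { (v ∷ []) → refl }
      ; N-monic = λ { u (v ∷ []) → trans (F-def u v) (monic Δ u v) }
      ; Ty = ℕ ; types = rootsMod g ; Typ = Typ
      ; Typ? = λ { p r (u ∷ v ∷ []) → + p ∣ℤ? (u ⊖ + r ⊗ v) }
      ; types-few = λ pp → length-rootsMod pp (⊝ Δ ∷ + 0 ∷ []) (+ 1) (λ d → prime∤1 pp (abs-∣ d))
      ; types-root = λ {p} {r} pp bad<p r∈ → rootMod pp bad<p (+ r) (is-root r∈)
      ; classify = λ { pp (u ∷ v ∷ []) d → classify-F pp u v d }
      ; closed = λ { {p} {r} {u ∷ v ∷ []} {u′ ∷ v′ ∷ []} pp r∈ h h′ → closed-F {p} {r} u v u′ v′ (is-root r∈) h h′ }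
      }

    irreducible⇒plan : EventuallyPlan f
    irreducible⇒plan = rootPrimes+rootPairs⇒plan {f} (normData⇒manyRootPrimes normData) (Split.manyRootPairs (A ⊗ (c ⊗ c ⊗ Δ)) (⊝ (+ 4 ⊗ (Δ ⊗ ((A ⊗ (c ⊗ c ⊗ Δ)) ⊗ (A ⊗ (c ⊗ c ⊗ Δ)))))) refl refl)

completeSquare : ∀ a₀ a₁ a → a ≢ + 0 → Reduction (a₀ ∷ a₁ ∷ a ∷ []) (⊝ (a₁ ⊗ a₁ ⊖ + 4 ⊗ (a ⊗ a₀)) ∷ + 0 ∷ + 1 ∷ [])
completeSquare a₀ a₁ a a≢0 = record
  { A = + 2 ⊗ a ; B = a₁ ; c = + 4 ⊗ a ; A≢0 = ⊗≢0 {+ 2} (λ ()) a≢0 ; c≢0 = ⊗≢0 {+ 4} (λ ()) a≢0 ; reduces = completed a₀ a₁ a }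
  where
  completed : ∀ a₀ a₁ a x → (+ 4 ⊗ a) ⊗ (a₀ ⊕ x ⊗ (a₁ ⊕ x ⊗ (a ⊕ x ⊗ + 0))) ≡ ⊝ (a₁ ⊗ a₁ ⊖ + 4 ⊗ (a ⊗ a₀)) ⊕ ((+ 2 ⊗ a) ⊗ x ⊕ a₁) ⊗ (+ 0 ⊕ ((+ 2 ⊗ a) ⊗ x ⊕ a₁) ⊗ (+ 1 ⊕ ((+ 2 ⊗ a) ⊗ x ⊕ a₁) ⊗ + 0))
  completed = ℤ-Ring.solve-∀

∃-√? : ∀ Δ → (∃[ X ] X ⊗ X ≡ Δ) ⊎ (∀ X → X ⊗ X ≢ Δ)
∃-√? Δ = ∃-integer? (λ X → X ⊗ X ≡ Δ) (λ X → X ⊗ X ℤₚ.≟ Δ) ∣ Δ ∣ bounded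
  where
  bounded : ∀ z → z ⊗ z ≡ Δ → ∣ z ∣ ≤ ∣ Δ ∣
  bounded z refl = subst (∣ z ∣ ≤_) (sym (ℤₚ.abs-* z z)) (n≤n*n ∣ z ∣)
    where
    n≤n*n : ∀ n → n ≤ n * n
    n≤n*n zero = z≤n
    n≤n*n (suc n) = m≤m*n (suc n) (suc n)

quadratic⇒plan : ∀ a₀ a₁ a → a ≢ + 0 → EventuallyPlan (a₀ ∷ a₁ ∷ a ∷ [])
quadratic⇒plan a₀ a₁ a a≢0 = [ reducible , (λ irr → Quadratic.irreducible⇒plan Δ irr red) ]′ (∃-√? Δ)
  where
  Δ = a₁ ⊗ a₁ ⊖ + 4 ⊗ (a ⊗ a₀)
  red = completeSquare a₀ a₁ a a≢0
  lem : ∀ Δ X → ⊝ Δ ⊕ X ⊗ (+ 0 ⊕ X ⊗ (+ 1 ⊕ X ⊗ + 0)) ≡ X ⊗ X ⊖ Δ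
  lem = ℤ-Ring.solve-∀
  reducible : ∃[ X ] X ⊗ X ≡ Δ → EventuallyPlan (a₀ ∷ a₁ ∷ a ∷ [])
  reducible (X , e) = Reduction.root⇒plan red X (trans (lem Δ X) (trans (cong (_⊖ Δ) e) (ℤₚ.+-inverseʳ Δ)))

-- Cubic polynomials

module CubicForms (P Q : ℤ) where

  g : Poly
  g = Q ∷ P ∷ + 0 ∷ + 1 ∷ []

  Norm₃ : ℤ → ℤ → ℤ → ℤ
  α β′ : ℤ → ℤ → ℤ → ℤ
  α u v w = w ⊗ w ⊗ P ⊖ w ⊗ u ⊕ v ⊗ v
  β′ u v w = w ⊗ w ⊗ Q ⊕ u ⊗ v

  F : ℤ → ℤ → ℤ

  abstract
    F u v = u ⊗ u ⊗ u ⊕ P ⊗ u ⊗ (v ⊗ v) ⊕ Q ⊗ (v ⊗ v ⊗ v)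

    -- The norm of u + v θ + w θ² for a root θ of g.
    Norm₃ u v w = + 1 ⊗ (u ⊗ (u ⊗ u)) ⊕ ⊝ (+ 2 ⊗ P) ⊗ (u ⊗ (u ⊗ w)) ⊕ P ⊗ (u ⊗ (v ⊗ v)) ⊕ (+ 3 ⊗ Q) ⊗ (u ⊗ (v ⊗ w))
      ⊕ (P ⊗ P) ⊗ (u ⊗ (w ⊗ w)) ⊕ ⊝ Q ⊗ (v ⊗ (v ⊗ v)) ⊕ ⊝ (P ⊗ Q) ⊗ (v ⊗ (w ⊗ w)) ⊕ (Q ⊗ Q) ⊗ (w ⊗ (w ⊗ w))

    Norm₃-def : ∀ u v w → Norm₃ u v w ≡ + 1 ⊗ (u ⊗ (u ⊗ u)) ⊕ ⊝ (+ 2 ⊗ P) ⊗ (u ⊗ (u ⊗ w)) ⊕ P ⊗ (u ⊗ (v ⊗ v)) ⊕ (+ 3 ⊗ Q) ⊗ (u ⊗ (v ⊗ w))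
      ⊕ (P ⊗ P) ⊗ (u ⊗ (w ⊗ w)) ⊕ ⊝ Q ⊗ (v ⊗ (v ⊗ v)) ⊕ ⊝ (P ⊗ Q) ⊗ (v ⊗ (w ⊗ w)) ⊕ (Q ⊗ Q) ⊗ (w ⊗ (w ⊗ w))
    Norm₃-def u v w = refl

    g-eval : ∀ X → eval g X ≡ X ⊗ X ⊗ X ⊕ P ⊗ X ⊕ Q
    g-eval = lem P Q
      where
      lem : ∀ P Q X → Q ⊕ X ⊗ (P ⊕ X ⊗ (+ 0 ⊕ X ⊗ (+ 1 ⊕ X ⊗ + 0))) ≡ X ⊗ X ⊗ X ⊕ P ⊗ X ⊕ Q
      lem = ℤ-Ring.solve-∀

    F-def : ∀ u v → F u v ≡ u ⊗ u ⊗ u ⊕ P ⊗ u ⊗ (v ⊗ v) ⊕ Q ⊗ (v ⊗ v ⊗ v)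
    F-def u v = refl

    F-scale : ∀ d u v → F (d ⊗ u) (d ⊗ v) ≡ (d ⊗ d ⊗ d) ⊗ F u v
    F-scale = lem P Q
      where
      lem : ∀ P Q d u v → (d ⊗ u) ⊗ (d ⊗ u) ⊗ (d ⊗ u) ⊕ P ⊗ (d ⊗ u) ⊗ ((d ⊗ v) ⊗ (d ⊗ v)) ⊕ Q ⊗ ((d ⊗ v) ⊗ (d ⊗ v) ⊗ (d ⊗ v)) ≡ (d ⊗ d ⊗ d) ⊗ (u ⊗ u ⊗ u ⊕ P ⊗ u ⊗ (v ⊗ v) ⊕ Q ⊗ (v ⊗ v ⊗ v))
      lem = ℤ-Ring.solve-∀

    F≡Norm₃ : ∀ u v → F u v ≡ Norm₃ u (⊝ v) (+ 0)
    F≡Norm₃ = lem P Q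
      where
      lem : ∀ P Q u v → u ⊗ u ⊗ u ⊕ P ⊗ u ⊗ (v ⊗ v) ⊕ Q ⊗ (v ⊗ v ⊗ v) ≡ + 1 ⊗ (u ⊗ (u ⊗ u)) ⊕ ⊝ (+ 2 ⊗ P) ⊗ (u ⊗ (u ⊗ + 0)) ⊕ P ⊗ (u ⊗ (⊝ v ⊗ ⊝ v)) ⊕ (+ 3 ⊗ Q) ⊗ (u ⊗ (⊝ v ⊗ + 0)) ⊕ (P ⊗ P) ⊗ (u ⊗ (+ 0 ⊗ + 0)) ⊕ ⊝ Q ⊗ (⊝ v ⊗ (⊝ v ⊗ ⊝ v)) ⊕ ⊝ (P ⊗ Q) ⊗ (⊝ v ⊗ (+ 0 ⊗ + 0)) ⊕ (Q ⊗ Q) ⊗ (+ 0 ⊗ (+ 0 ⊗ + 0))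
      lem = ℤ-Ring.solve-∀

    -- Division of w²g by q = w X² + v X + u leaves the remainder α X + β′, so the resultant Norm₃ is q evaluated at -β′/α.
    F[-β,α] : ∀ u v w → F (⊝ (β′ u v w)) (α u v w) ≡ ⊝ (w ⊗ β′ u v w ⊕ v ⊗ α u v w) ⊗ Norm₃ u v w
    F[-β,α] = lem P Q
      where
      lem : ∀ P Q u v w → let a = w ⊗ w ⊗ P ⊖ w ⊗ u ⊕ v ⊗ v ; b = w ⊗ w ⊗ Q ⊕ u ⊗ v in
        ⊝ b ⊗ ⊝ b ⊗ ⊝ b ⊕ P ⊗ ⊝ b ⊗ (a ⊗ a) ⊕ Q ⊗ (a ⊗ a ⊗ a) ≡ ⊝ (w ⊗ b ⊕ v ⊗ a) ⊗ (+ 1 ⊗ (u ⊗ (u ⊗ u)) ⊕ ⊝ (+ 2 ⊗ P) ⊗ (u ⊗ (u ⊗ w)) ⊕ P ⊗ (u ⊗ (v ⊗ v)) ⊕ (+ 3 ⊗ Q) ⊗ (u ⊗ (v ⊗ w))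
          ⊕ (P ⊗ P) ⊗ (u ⊗ (w ⊗ w)) ⊕ ⊝ Q ⊗ (v ⊗ (v ⊗ v)) ⊕ ⊝ (P ⊗ Q) ⊗ (v ⊗ (w ⊗ w)) ⊕ (Q ⊗ Q) ⊗ (w ⊗ (w ⊗ w)))
      lem = ℤ-Ring.solve-∀

    F[v,w] : ∀ u v w → F v w ≡ α u v w ⊗ v ⊕ β′ u v w ⊗ w
    F[v,w] = lem P Q
      where
      lem : ∀ P Q u v w → v ⊗ v ⊗ v ⊕ P ⊗ v ⊗ (w ⊗ w) ⊕ Q ⊗ (w ⊗ w ⊗ w) ≡ (w ⊗ w ⊗ P ⊖ w ⊗ u ⊕ v ⊗ v) ⊗ v ⊕ (w ⊗ w ⊗ Q ⊕ u ⊗ v) ⊗ w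
      lem = ℤ-Ring.solve-∀

    q[-β,α] : ∀ u v w → let a = α u v w ; b = β′ u v w in u ⊗ (a ⊗ a) ⊖ v ⊗ (a ⊗ b) ⊕ w ⊗ (b ⊗ b) ≡ (w ⊗ w) ⊗ Norm₃ u v w
    q[-β,α] = lem P Q
      where
      lem : ∀ P Q u v w → let a = w ⊗ w ⊗ P ⊖ w ⊗ u ⊕ v ⊗ v ; b = w ⊗ w ⊗ Q ⊕ u ⊗ v in
        u ⊗ (a ⊗ a) ⊖ v ⊗ (a ⊗ b) ⊕ w ⊗ (b ⊗ b) ≡ (w ⊗ w) ⊗ (+ 1 ⊗ (u ⊗ (u ⊗ u)) ⊕ ⊝ (+ 2 ⊗ P) ⊗ (u ⊗ (u ⊗ w)) ⊕ P ⊗ (u ⊗ (v ⊗ v)) ⊕ (+ 3 ⊗ Q) ⊗ (u ⊗ (v ⊗ w))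
          ⊕ (P ⊗ P) ⊗ (u ⊗ (w ⊗ w)) ⊕ ⊝ Q ⊗ (v ⊗ (v ⊗ v)) ⊕ ⊝ (P ⊗ Q) ⊗ (v ⊗ (w ⊗ w)) ⊕ (Q ⊗ Q) ⊗ (w ⊗ (w ⊗ w)))
      lem = ℤ-Ring.solve-∀

    -- The coefficients below the leading one of the norm as a polynomial in u, where it is monic,
    -- and in v. Through `eval-transfer` a congruence between coordinates becomes one between norms.
    inU inV : ℤ → ℤ → List ℤ
    inU v w = (P ⊗ Q) ⊗ ⊝ (v ⊗ (w ⊗ w)) ⊕ (Q ⊗ Q) ⊗ (w ⊗ (w ⊗ w)) ⊕ ⊝ Q ⊗ (v ⊗ (v ⊗ v)) ∷ P ⊗ (v ⊗ v) ⊕ (+ 3 ⊗ Q) ⊗ (v ⊗ w) ⊕ (P ⊗ P) ⊗ (w ⊗ w) ∷ ⊝ (+ 2 ⊗ P) ⊗ w ∷ []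
    inV u w = u ⊗ (u ⊗ u) ⊕ ⊝ (+ 2 ⊗ P) ⊗ (u ⊗ (u ⊗ w)) ⊕ (P ⊗ P) ⊗ (u ⊗ (w ⊗ w)) ⊕ (Q ⊗ Q) ⊗ (w ⊗ (w ⊗ w)) ∷ (+ 3 ⊗ Q) ⊗ (u ⊗ w) ⊕ ⊝ (P ⊗ Q) ⊗ (w ⊗ w) ∷ P ⊗ u ∷ []

    length-inU : ∀ v w → length (inU v w) ≡ 3
    length-inU v w = refl

    Norm₃-inU : ∀ u v w → Norm₃ u v w ≡ eval (inU v w ++ + 1 ∷ []) u
    Norm₃-inU = lem P Q
      where
      lem : ∀ P Q u v w → + 1 ⊗ (u ⊗ (u ⊗ u)) ⊕ ⊝ (+ 2 ⊗ P) ⊗ (u ⊗ (u ⊗ w)) ⊕ P ⊗ (u ⊗ (v ⊗ v)) ⊕ (+ 3 ⊗ Q) ⊗ (u ⊗ (v ⊗ w))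
          ⊕ (P ⊗ P) ⊗ (u ⊗ (w ⊗ w)) ⊕ ⊝ Q ⊗ (v ⊗ (v ⊗ v)) ⊕ ⊝ (P ⊗ Q) ⊗ (v ⊗ (w ⊗ w)) ⊕ (Q ⊗ Q) ⊗ (w ⊗ (w ⊗ w))
        ≡ ((P ⊗ Q) ⊗ ⊝ (v ⊗ (w ⊗ w)) ⊕ (Q ⊗ Q) ⊗ (w ⊗ (w ⊗ w)) ⊕ ⊝ Q ⊗ (v ⊗ (v ⊗ v))) ⊕ u ⊗ ((P ⊗ (v ⊗ v) ⊕ (+ 3 ⊗ Q) ⊗ (v ⊗ w) ⊕ (P ⊗ P) ⊗ (w ⊗ w)) ⊕ u ⊗ (⊝ (+ 2 ⊗ P) ⊗ w ⊕ u ⊗ (+ 1 ⊕ u ⊗ + 0)))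
      lem = ℤ-Ring.solve-∀

    Norm₃-inV : ∀ u v w → Norm₃ u v w ≡ eval (inV u w ++ ⊝ Q ∷ []) v
    Norm₃-inV = lem P Q
      where
      lem : ∀ P Q u v w → + 1 ⊗ (u ⊗ (u ⊗ u)) ⊕ ⊝ (+ 2 ⊗ P) ⊗ (u ⊗ (u ⊗ w)) ⊕ P ⊗ (u ⊗ (v ⊗ v)) ⊕ (+ 3 ⊗ Q) ⊗ (u ⊗ (v ⊗ w))
          ⊕ (P ⊗ P) ⊗ (u ⊗ (w ⊗ w)) ⊕ ⊝ Q ⊗ (v ⊗ (v ⊗ v)) ⊕ ⊝ (P ⊗ Q) ⊗ (v ⊗ (w ⊗ w)) ⊕ (Q ⊗ Q) ⊗ (w ⊗ (w ⊗ w))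
        ≡ (u ⊗ (u ⊗ u) ⊕ ⊝ (+ 2 ⊗ P) ⊗ (u ⊗ (u ⊗ w)) ⊕ (P ⊗ P) ⊗ (u ⊗ (w ⊗ w)) ⊕ (Q ⊗ Q) ⊗ (w ⊗ (w ⊗ w))) ⊕ v ⊗ (((+ 3 ⊗ Q) ⊗ (u ⊗ w) ⊕ ⊝ (P ⊗ Q) ⊗ (w ⊗ w)) ⊕ v ⊗ (P ⊗ u ⊕ v ⊗ (⊝ Q ⊕ v ⊗ + 0)))
      lem = ℤ-Ring.solve-∀

    -- The norms of (θ - r)(V + W (θ + r)) and of W (g (θ) - g (r)) / (θ - r).
    Norm₃-typeI : ∀ r V W → Norm₃ (⊝ (V ⊗ r ⊕ W ⊗ r ⊗ r)) V W ≡ ⊝ (eval g r) ⊗ F (V ⊕ W ⊗ r) (⊝ W)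
    Norm₃-typeI r V W = trans (lem P Q r V W) (cong (λ z → ⊝ z ⊗ F (V ⊕ W ⊗ r) (⊝ W)) (sym (g-eval r)))
      where
      lem : ∀ P Q r V W → let u = ⊝ (V ⊗ r ⊕ W ⊗ r ⊗ r) ; a = V ⊕ W ⊗ r ; b = ⊝ W in
        + 1 ⊗ (u ⊗ (u ⊗ u)) ⊕ ⊝ (+ 2 ⊗ P) ⊗ (u ⊗ (u ⊗ W)) ⊕ P ⊗ (u ⊗ (V ⊗ V)) ⊕ (+ 3 ⊗ Q) ⊗ (u ⊗ (V ⊗ W))
          ⊕ (P ⊗ P) ⊗ (u ⊗ (W ⊗ W)) ⊕ ⊝ Q ⊗ (V ⊗ (V ⊗ V)) ⊕ ⊝ (P ⊗ Q) ⊗ (V ⊗ (W ⊗ W)) ⊕ (Q ⊗ Q) ⊗ (W ⊗ (W ⊗ W))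
        ≡ ⊝ (r ⊗ r ⊗ r ⊕ P ⊗ r ⊕ Q) ⊗ (a ⊗ a ⊗ a ⊕ P ⊗ a ⊗ (b ⊗ b) ⊕ Q ⊗ (b ⊗ b ⊗ b))
      lem = ℤ-Ring.solve-∀

    Norm₃-typeII : ∀ r W → Norm₃ (W ⊗ (r ⊗ r ⊕ P)) (W ⊗ r) W ≡ eval g r ⊗ (eval g r ⊗ (W ⊗ W ⊗ W))
    Norm₃-typeII r W = trans (lem P Q r W) (cong (λ z → z ⊗ (z ⊗ (W ⊗ W ⊗ W))) (sym (g-eval r)))
      where
      lem : ∀ P Q r W → let u = W ⊗ (r ⊗ r ⊕ P) ; v = W ⊗ r ; z = r ⊗ r ⊗ r ⊕ P ⊗ r ⊕ Q in
        + 1 ⊗ (u ⊗ (u ⊗ u)) ⊕ ⊝ (+ 2 ⊗ P) ⊗ (u ⊗ (u ⊗ W)) ⊕ P ⊗ (u ⊗ (v ⊗ v)) ⊕ (+ 3 ⊗ Q) ⊗ (u ⊗ (v ⊗ W))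
          ⊕ (P ⊗ P) ⊗ (u ⊗ (W ⊗ W)) ⊕ ⊝ Q ⊗ (v ⊗ (v ⊗ v)) ⊕ ⊝ (P ⊗ Q) ⊗ (v ⊗ (W ⊗ W)) ⊕ (Q ⊗ Q) ⊗ (W ⊗ (W ⊗ W))
        ≡ z ⊗ (z ⊗ (W ⊗ W ⊗ W))
      lem = ℤ-Ring.solve-∀

    C : ℕ
    C = 1 + ∣ ⊝ (+ 2 ⊗ P) ∣ + ∣ P ∣ + ∣ + 3 ⊗ Q ∣ + ∣ P ⊗ P ∣ + ∣ ⊝ Q ∣ + ∣ ⊝ (P ⊗ Q) ∣ + ∣ Q ⊗ Q ∣

    C≥1 : 1 ≤ C
    C≥1 = s≤s z≤n

    Norm₃-bound : ∀ x u v w → ∣ u ∣ ≤ x → ∣ v ∣ ≤ x → ∣ w ∣ ≤ x → ∣ Norm₃ u v w ∣ ≤ C * x ^ 3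
    Norm₃-bound x u v w hu hv hw = ≤-trans
      (add (t₁ ⊕ t₂ ⊕ t₃ ⊕ t₄ ⊕ t₅ ⊕ t₆ ⊕ t₇) t₈ (∣ + 1 ∣ + ∣ ⊝ (+ 2 ⊗ P) ∣ + ∣ P ∣ + ∣ + 3 ⊗ Q ∣ + ∣ P ⊗ P ∣ + ∣ ⊝ Q ∣ + ∣ ⊝ (P ⊗ Q) ∣) ∣ Q ⊗ Q ∣ (add (t₁ ⊕ t₂ ⊕ t₃ ⊕ t₄ ⊕ t₅ ⊕ t₆) t₇ (∣ + 1 ∣ + ∣ ⊝ (+ 2 ⊗ P) ∣ + ∣ P ∣ + ∣ + 3 ⊗ Q ∣ + ∣ P ⊗ P ∣ + ∣ ⊝ Q ∣) ∣ ⊝ (P ⊗ Q) ∣ (add (t₁ ⊕ t₂ ⊕ t₃ ⊕ t₄ ⊕ t₅) t₆ (∣ + 1 ∣ + ∣ ⊝ (+ 2 ⊗ P) ∣ + ∣ P ∣ + ∣ + 3 ⊗ Q ∣ + ∣ P ⊗ P ∣) ∣ ⊝ Q ∣ (add (t₁ ⊕ t₂ ⊕ t₃ ⊕ t₄) t₅ (∣ + 1 ∣ + ∣ ⊝ (+ 2 ⊗ P) ∣ + ∣ P ∣ + ∣ + 3 ⊗ Q ∣) ∣ P ⊗ P ∣ (add (t₁ ⊕ t₂ ⊕ t₃) t₄ (∣ + 1 ∣ + ∣ ⊝ (+ 2 ⊗ P) ∣ + ∣ P ∣) ∣ + 3 ⊗ Q ∣ (add (t₁ ⊕ t₂) t₃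 (∣ + 1 ∣ + ∣ ⊝ (+ 2 ⊗ P) ∣) ∣ P ∣ (add (t₁) t₂ (∣ + 1 ∣) ∣ ⊝ (+ 2 ⊗ P) ∣ (mono (+ 1) u u u hu hu hu) (mono (⊝ (+ 2 ⊗ P)) u u w hu hu hw)) (mono (P) u v v hu hv hv)) (mono (+ 3 ⊗ Q) u v w hu hv hw)) (mono (P ⊗ P) u w w hu hw hw)) (mono (⊝ Q) v v v hv hv hv)) (mono (⊝ (P ⊗ Q)) v w w hv hw hw)) (mono (Q ⊗ Q) w w w hw hw hw))
      (≤-reflexive (cong (λ z → C * (x * (x * z))) (sym (*-identityʳ x))))
      where
      t₁ t₂ t₃ t₄ t₅ t₆ t₇ t₈ : ℤ
      t₁ = + 1 ⊗ (u ⊗ (u ⊗ u))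
      t₂ = ⊝ (+ 2 ⊗ P) ⊗ (u ⊗ (u ⊗ w))
      t₃ = P ⊗ (u ⊗ (v ⊗ v))
      t₄ = (+ 3 ⊗ Q) ⊗ (u ⊗ (v ⊗ w))
      t₅ = (P ⊗ P) ⊗ (u ⊗ (w ⊗ w))
      t₆ = ⊝ Q ⊗ (v ⊗ (v ⊗ v))
      t₇ = ⊝ (P ⊗ Q) ⊗ (v ⊗ (w ⊗ w))
      t₈ = (Q ⊗ Q) ⊗ (w ⊗ (w ⊗ w))
      add : ∀ a b κ λ′ → ∣ a ∣ ≤ κ * (x * (x * x)) → ∣ b ∣ ≤ λ′ * (x * (x * x)) → ∣ a ⊕ b ∣ ≤ (κ + λ′) * (x * (x * x))
      add a b κ λ′ = ⊕-bound {a} {b} {κ} {λ′} {x * (x * x)}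
      mono : ∀ k a b c → ∣ a ∣ ≤ x → ∣ b ∣ ≤ x → ∣ c ∣ ≤ x → ∣ k ⊗ (a ⊗ (b ⊗ c)) ∣ ≤ ∣ k ∣ * (x * (x * x))
      mono k a b c ha hb hc = ⊗-bound {k} {a ⊗ (b ⊗ c)} ≤-refl (⊗-bound {a} {b ⊗ c} ha (⊗-bound {b} {c} hb hc))

-- For β = 2b, σ = Δ β² and w = Δ σ x² = (Δ β x)² the polynomial T (x) is the resultant of g (X) and g (X + Δ β x), divided by Δ;
-- a common root y ± Δ b x satisfies 2 (w + P) y = - 3 Q.
module CubicResultant (P Q : ℤ) where
  open CubicForms P Q

  Tₗ : ℤ → ℤ → List ℤ
  Tₗ Δ σ = + 1 ∷ + 0 ∷ + 9 ⊗ (P ⊗ P) ⊗ σ ∷ + 0 ∷ + 6 ⊗ P ⊗ Δ ⊗ (σ ⊗ σ) ∷ + 0 ∷ []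

  leadₗ : ℤ → ℤ → ℤ
  leadₗ Δ σ = Δ ⊗ Δ ⊗ (σ ⊗ σ ⊗ σ)

  disc : ℤ
  disc = + 4 ⊗ (P ⊗ P ⊗ P) ⊕ + 27 ⊗ (Q ⊗ Q)

  abstract
    T-eval : ∀ Δ σ x → eval (Tₗ Δ σ ++ leadₗ Δ σ ∷ []) x ≡ + 1 ⊕ σ ⊗ (x ⊗ x) ⊗ ((Δ ⊗ σ ⊗ (x ⊗ x) ⊕ + 3 ⊗ P) ⊗ (Δ ⊗ σ ⊗ (x ⊗ x) ⊕ + 3 ⊗ P))
    T-eval = lem P
      where
      lem : ∀ P Δ σ x → + 1 ⊕ x ⊗ (+ 0 ⊕ x ⊗ (+ 9 ⊗ (P ⊗ P) ⊗ σ ⊕ x ⊗ (+ 0 ⊕ x ⊗ (+ 6 ⊗ P ⊗ Δ ⊗ (σ ⊗ σ) ⊕ x ⊗ (+ 0 ⊕ x ⊗ (Δ ⊗ Δ ⊗ (σ ⊗ σ ⊗ σ) ⊕ x ⊗ + 0))))))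
        ≡ + 1 ⊕ σ ⊗ (x ⊗ x) ⊗ ((Δ ⊗ σ ⊗ (x ⊗ x) ⊕ + 3 ⊗ P) ⊗ (Δ ⊗ σ ⊗ (x ⊗ x) ⊕ + 3 ⊗ P))
      lem = ℤ-Ring.solve-∀

    deriv-shape : ∀ c₀ c₁ c₂ c₃ c₄ c₅ c₆ x → deriv (c₀ ∷ c₁ ∷ c₂ ∷ c₃ ∷ c₄ ∷ c₅ ∷ c₆ ∷ []) x ≡ c₁ ⊕ x ⊗ (+ 2 ⊗ c₂ ⊕ x ⊗ (+ 3 ⊗ c₃ ⊕ x ⊗ (+ 4 ⊗ c₄ ⊕ x ⊗ (+ 5 ⊗ c₅ ⊕ x ⊗ (+ 6 ⊗ c₆)))))
    deriv-shape c₀ = lem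
      where
      lem : ∀ c₁ c₂ c₃ c₄ c₅ c₆ x → (c₁ ⊕ x ⊗ (c₂ ⊕ x ⊗ (c₃ ⊕ x ⊗ (c₄ ⊕ x ⊗ (c₅ ⊕ x ⊗ (c₆ ⊕ x ⊗ + 0))))))
        ⊕ x ⊗ ((c₂ ⊕ x ⊗ (c₃ ⊕ x ⊗ (c₄ ⊕ x ⊗ (c₅ ⊕ x ⊗ (c₆ ⊕ x ⊗ + 0))))) ⊕ x ⊗ ((c₃ ⊕ x ⊗ (c₄ ⊕ x ⊗ (c₅ ⊕ x ⊗ (c₆ ⊕ x ⊗ + 0)))) ⊕ x ⊗ ((c₄ ⊕ x ⊗ (c₅ ⊕ x ⊗ (c₆ ⊕ x ⊗ + 0))) ⊕ x ⊗ ((c₅ ⊕ x ⊗ (c₆ ⊕ x ⊗ + 0)) ⊕ x ⊗ ((c₆ ⊕ x ⊗ + 0) ⊕ x ⊗ (+ 0 ⊕ x ⊗ + 0))))))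
        ≡ c₁ ⊕ x ⊗ (+ 2 ⊗ c₂ ⊕ x ⊗ (+ 3 ⊗ c₃ ⊕ x ⊗ (+ 4 ⊗ c₄ ⊕ x ⊗ (+ 5 ⊗ c₅ ⊕ x ⊗ (+ 6 ⊗ c₆)))))
      lem = ℤ-Ring.solve-∀

    T-deriv : ∀ Δ σ x → deriv (Tₗ Δ σ ++ leadₗ Δ σ ∷ []) x ≡ + 6 ⊗ (σ ⊗ x) ⊗ (Δ ⊗ σ ⊗ (x ⊗ x) ⊕ + 3 ⊗ P) ⊗ (Δ ⊗ σ ⊗ (x ⊗ x) ⊕ P)
    T-deriv Δ σ x = trans (deriv-shape (+ 1) (+ 0) (+ 9 ⊗ (P ⊗ P) ⊗ σ) (+ 0) (+ 6 ⊗ P ⊗ Δ ⊗ (σ ⊗ σ)) (+ 0) (Δ ⊗ Δ ⊗ (σ ⊗ σ ⊗ σ)) x) (lem P Δ σ x)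
      where
      lem : ∀ P Δ σ x → + 0 ⊕ x ⊗ (+ 2 ⊗ (+ 9 ⊗ (P ⊗ P) ⊗ σ) ⊕ x ⊗ (+ 3 ⊗ + 0 ⊕ x ⊗ (+ 4 ⊗ (+ 6 ⊗ P ⊗ Δ ⊗ (σ ⊗ σ)) ⊕ x ⊗ (+ 5 ⊗ + 0 ⊕ x ⊗ (+ 6 ⊗ (Δ ⊗ Δ ⊗ (σ ⊗ σ ⊗ σ)))))))
        ≡ + 6 ⊗ (σ ⊗ x) ⊗ (Δ ⊗ σ ⊗ (x ⊗ x) ⊕ + 3 ⊗ P) ⊗ (Δ ⊗ σ ⊗ (x ⊗ x) ⊕ P)
      lem = ℤ-Ring.solve-∀

    ΔT : ∀ σ x w → w ≡ disc ⊗ σ ⊗ (x ⊗ x) → disc ⊗ (+ 1 ⊕ σ ⊗ (x ⊗ x) ⊗ ((w ⊕ + 3 ⊗ P) ⊗ (w ⊕ + 3 ⊗ P))) ≡ (w ⊕ P) ⊗ (w ⊕ P) ⊗ (w ⊕ + 4 ⊗ P) ⊕ + 27 ⊗ (Q ⊗ Q)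
    ΔT σ x w w≡ = trans (lem₁ disc σ (x ⊗ x) (w ⊕ + 3 ⊗ P)) (trans (cong (λ z → disc ⊕ z ⊗ ((w ⊕ + 3 ⊗ P) ⊗ (w ⊕ + 3 ⊗ P))) (sym w≡)) (lem₂ P Q w))
      where
      lem₁ : ∀ D σ y z → D ⊗ (+ 1 ⊕ σ ⊗ y ⊗ (z ⊗ z)) ≡ D ⊕ D ⊗ σ ⊗ y ⊗ (z ⊗ z)
      lem₁ = ℤ-Ring.solve-∀
      lem₂ : ∀ P Q w → + 4 ⊗ (P ⊗ P ⊗ P) ⊕ + 27 ⊗ (Q ⊗ Q) ⊕ w ⊗ ((w ⊕ + 3 ⊗ P) ⊗ (w ⊕ + 3 ⊗ P)) ≡ (w ⊕ P) ⊗ (w ⊕ P) ⊗ (w ⊕ + 4 ⊗ P) ⊕ + 27 ⊗ (Q ⊗ Q)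
      lem₂ = ℤ-Ring.solve-∀

    w≡4h² : ∀ Δ b x → Δ ⊗ (Δ ⊗ ((+ 2 ⊗ b) ⊗ (+ 2 ⊗ b))) ⊗ (x ⊗ x) ≡ + 4 ⊗ ((Δ ⊗ (b ⊗ x)) ⊗ (Δ ⊗ (b ⊗ x)))
    w≡4h² = ℤ-Ring.solve-∀

    -- g(y ± h) = G ± h E with E = 3 y² + h² + P and G = y³ + 3 y h² + P y + Q, so both vanish if E
    -- and G do. Eliminating y² between them leaves the linear condition B y + 3 Q = 0. The present
    -- identity shows that, under this condition and the vanishing of the resultant, B² E vanishes;
    -- `G-identity` then gives 3 G.
    E-identity : ∀ y h w → w ≡ + 4 ⊗ (h ⊗ h) → let B = + 2 ⊗ (w ⊕ P) in
      + 3 ⊗ (B ⊗ y ⊖ + 3 ⊗ Q) ⊗ (B ⊗ y ⊕ + 3 ⊗ Q) ⊕ ((w ⊕ P) ⊗ (w ⊕ P) ⊗ (w ⊕ + 4 ⊗ P) ⊕ + 27 ⊗ (Q ⊗ Q)) ≡ B ⊗ (B ⊗ (+ 3 ⊗ (y ⊗ y) ⊕ h ⊗ h ⊕ P))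
    E-identity y h w refl = lem P Q y h
      where
      lem : ∀ P Q y h → let w = + 4 ⊗ (h ⊗ h) ; B = + 2 ⊗ (w ⊕ P) in
        + 3 ⊗ (B ⊗ y ⊖ + 3 ⊗ Q) ⊗ (B ⊗ y ⊕ + 3 ⊗ Q) ⊕ ((w ⊕ P) ⊗ (w ⊕ P) ⊗ (w ⊕ + 4 ⊗ P) ⊕ + 27 ⊗ (Q ⊗ Q)) ≡ B ⊗ (B ⊗ (+ 3 ⊗ (y ⊗ y) ⊕ h ⊗ h ⊕ P))
      lem = ℤ-Ring.solve-∀

    G-identity : ∀ y h w → w ≡ + 4 ⊗ (h ⊗ h) → y ⊗ (+ 3 ⊗ (y ⊗ y) ⊕ h ⊗ h ⊕ P) ⊕ (+ 2 ⊗ (w ⊕ P) ⊗ y ⊕ + 3 ⊗ Q) ≡ + 3 ⊗ (y ⊗ y ⊗ y ⊕ + 3 ⊗ y ⊗ (h ⊗ h) ⊕ P ⊗ y ⊕ Q)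
    G-identity y h w refl = lem P Q y h
      where
      lem : ∀ P Q y h → y ⊗ (+ 3 ⊗ (y ⊗ y) ⊕ h ⊗ h ⊕ P) ⊕ (+ 2 ⊗ (+ 4 ⊗ (h ⊗ h) ⊕ P) ⊗ y ⊕ + 3 ⊗ Q) ≡ + 3 ⊗ (y ⊗ y ⊗ y ⊕ + 3 ⊗ y ⊗ (h ⊗ h) ⊕ P ⊗ y ⊕ Q)
      lem = ℤ-Ring.solve-∀

    g[y+h] : ∀ y h → (y ⊗ y ⊗ y ⊕ + 3 ⊗ y ⊗ (h ⊗ h) ⊕ P ⊗ y ⊕ Q) ⊕ h ⊗ (+ 3 ⊗ (y ⊗ y) ⊕ h ⊗ h ⊕ P) ≡ eval g (y ⊕ h)
    g[y+h] y h = trans (lem P Q y h) (sym (g-eval (y ⊕ h)))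
      where
      lem : ∀ P Q y h → (y ⊗ y ⊗ y ⊕ + 3 ⊗ y ⊗ (h ⊗ h) ⊕ P ⊗ y ⊕ Q) ⊕ h ⊗ (+ 3 ⊗ (y ⊗ y) ⊕ h ⊗ h ⊕ P) ≡ (y ⊕ h) ⊗ (y ⊕ h) ⊗ (y ⊕ h) ⊕ P ⊗ (y ⊕ h) ⊕ Q
      lem = ℤ-Ring.solve-∀

    g[y-h] : ∀ y h → (y ⊗ y ⊗ y ⊕ + 3 ⊗ y ⊗ (h ⊗ h) ⊕ P ⊗ y ⊕ Q) ⊖ h ⊗ (+ 3 ⊗ (y ⊗ y) ⊕ h ⊗ h ⊕ P) ≡ eval g (y ⊖ h)
    g[y-h] y h = trans (lem P Q y h) (sym (g-eval (y ⊖ h)))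
      where
      lem : ∀ P Q y h → (y ⊗ y ⊗ y ⊕ + 3 ⊗ y ⊗ (h ⊗ h) ⊕ P ⊗ y ⊕ Q) ⊖ h ⊗ (+ 3 ⊗ (y ⊗ y) ⊕ h ⊗ h ⊕ P) ≡ (y ⊖ h) ⊗ (y ⊖ h) ⊗ (y ⊖ h) ⊕ P ⊗ (y ⊖ h) ⊕ Q
      lem = ℤ-Ring.solve-∀

    g-deriv : ∀ r → deriv g r ≡ + 3 ⊗ (r ⊗ r) ⊕ P
    g-deriv = lem P
      where
      lem : ∀ P r → (P ⊕ r ⊗ (+ 0 ⊕ r ⊗ (+ 1 ⊕ r ⊗ + 0))) ⊕ r ⊗ ((+ 0 ⊕ r ⊗ (+ 1 ⊕ r ⊗ + 0)) ⊕ r ⊗ ((+ 1 ⊕ r ⊗ + 0) ⊕ r ⊗ (+ 0 ⊕ r ⊗ + 0))) ≡ + 3 ⊗ (r ⊗ r) ⊕ P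
      lem = ℤ-Ring.solve-∀

    -- The discriminant, up to sign, as a combination of g and g′: a prime not dividing it sees only
    -- simple roots.
    disc-combination : ∀ r → (+ 27 ⊗ Q ⊖ + 18 ⊗ P ⊗ r) ⊗ eval g r ⊕ (+ 6 ⊗ P ⊗ (r ⊗ r) ⊖ + 9 ⊗ Q ⊗ r ⊕ + 4 ⊗ (P ⊗ P)) ⊗ deriv g r ≡ disc
    disc-combination r = trans (cong₂ (λ a b → (+ 27 ⊗ Q ⊖ + 18 ⊗ P ⊗ r) ⊗ a ⊕ (+ 6 ⊗ P ⊗ (r ⊗ r) ⊖ + 9 ⊗ Q ⊗ r ⊕ + 4 ⊗ (P ⊗ P)) ⊗ b) (g-eval r) (g-deriv r)) (lem P Q r)
      where
      lem : ∀ P Q r → (+ 27 ⊗ Q ⊖ + 18 ⊗ P ⊗ r) ⊗ (r ⊗ r ⊗ r ⊕ P ⊗ r ⊕ Q) ⊕ (+ 6 ⊗ P ⊗ (r ⊗ r) ⊖ + 9 ⊗ Q ⊗ r ⊕ + 4 ⊗ (P ⊗ P)) ⊗ (+ 3 ⊗ (r ⊗ r) ⊕ P) ≡ + 4 ⊗ (P ⊗ P ⊗ P) ⊕ + 27 ⊗ (Q ⊗ Q)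
      lem = ℤ-Ring.solve-∀

    g-difference : ∀ a b → (a ⊗ a ⊕ a ⊗ b ⊕ b ⊗ b ⊕ P) ⊗ (a ⊖ b) ≡ eval g a ⊖ eval g b
    g-difference a b = trans (lem P Q a b) (cong₂ _⊖_ (sym (g-eval a)) (sym (g-eval b)))
      where
      lem : ∀ P Q a b → (a ⊗ a ⊕ a ⊗ b ⊕ b ⊗ b ⊕ P) ⊗ (a ⊖ b) ≡ (a ⊗ a ⊗ a ⊕ P ⊗ a ⊕ Q) ⊖ (b ⊗ b ⊗ b ⊕ P ⊗ b ⊕ Q)
      lem = ℤ-Ring.solve-∀

    -- As g has no quadratic term, roots a and b determine the third root - (a + b). The leading
    -- quadratic factor is (g(a) - g(b)) / (a - b), so it vanishes whenever the difference of the
    -- values does and a - b can be cancelled.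
    F-factors : ∀ a b u v → (a ⊗ a ⊕ a ⊗ b ⊕ b ⊗ b ⊕ P) ⊗ (u ⊗ (v ⊗ v) ⊖ a ⊗ (v ⊗ v ⊗ v)) ⊕ eval g a ⊗ (v ⊗ v ⊗ v) ≡ F u v ⊖ linProd (a ∷ b ∷ ⊝ (a ⊕ b) ∷ []) u v
    F-factors a b u v = trans (cong (λ z → (a ⊗ a ⊕ a ⊗ b ⊕ b ⊗ b ⊕ P) ⊗ (u ⊗ (v ⊗ v) ⊖ a ⊗ (v ⊗ v ⊗ v)) ⊕ z ⊗ (v ⊗ v ⊗ v)) (g-eval a)) (trans (lem P Q a b u v) (cong (_⊖ linProd (a ∷ b ∷ ⊝ (a ⊕ b) ∷ []) u v) (sym (F-def u v))))
      where
      lem : ∀ P Q a b u v → (a ⊗ a ⊕ a ⊗ b ⊕ b ⊗ b ⊕ P) ⊗ (u ⊗ (v ⊗ v) ⊖ a ⊗ (v ⊗ v ⊗ v)) ⊕ (a ⊗ a ⊗ a ⊕ P ⊗ a ⊕ Q) ⊗ (v ⊗ v ⊗ v)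
        ≡ (u ⊗ u ⊗ u ⊕ P ⊗ u ⊗ (v ⊗ v) ⊕ Q ⊗ (v ⊗ v ⊗ v)) ⊖ ((u ⊖ a ⊗ v) ⊗ ((u ⊖ b ⊗ v) ⊗ ((u ⊖ ⊝ (a ⊕ b) ⊗ v) ⊗ + 1)))
      lem = ℤ-Ring.solve-∀

    -- If the discriminant vanished, - 3 Q / (2 P) would be the double root of g. Evaluating the
    -- form there rules this out for irreducible g, even when P = 0.
    F-double-root : F (⊝ (+ 3 ⊗ Q)) (+ 2 ⊗ P) ≡ ⊝ Q ⊗ disc
    F-double-root = trans (F-def (⊝ (+ 3 ⊗ Q)) (+ 2 ⊗ P)) (lem P Q)
      where
      lem : ∀ P Q → ⊝ (+ 3 ⊗ Q) ⊗ ⊝ (+ 3 ⊗ Q) ⊗ ⊝ (+ 3 ⊗ Q) ⊕ P ⊗ ⊝ (+ 3 ⊗ Q) ⊗ ((+ 2 ⊗ P) ⊗ (+ 2 ⊗ P)) ⊕ Q ⊗ ((+ 2 ⊗ P) ⊗ (+ 2 ⊗ P) ⊗ (+ 2 ⊗ P)) ≡ ⊝ Q ⊗ (+ 4 ⊗ (P ⊗ P ⊗ P) ⊕ + 27 ⊗ (Q ⊗ Q))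
      lem = ℤ-Ring.solve-∀

prime-∤-⊗ : ∀ {p} → Prime p → ∀ {a b} → ¬ (+ p ∣ℤ a) → ¬ (+ p ∣ℤ b) → ¬ (+ p ∣ℤ a ⊗ b)
prime-∤-⊗ pp {a} {b} p∤a p∤b d = [ p∤a , p∤b ]′ (primeℤ pp a b d)

∤-⊗ˡ : ∀ {p a} b → ¬ (+ p ∣ℤ a ⊗ b) → ¬ (+ p ∣ℤ a)
∤-⊗ˡ b p∤ d = p∤ (∣⇒∣⊗ˡ b d)

∤-⊗ʳ : ∀ {p b} a → ¬ (+ p ∣ℤ a ⊗ b) → ¬ (+ p ∣ℤ b)
∤-⊗ʳ a p∤ d = p∤ (∣⇒∣⊗ʳ a d)

module Cubic (P Q : ℤ) (irr : ∀ X → X ⊗ X ⊗ X ⊕ P ⊗ X ⊕ Q ≢ + 0) where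
  open CubicForms P Q
  open CubicResultant P Q

  abstract
    F-anisotropic : ∀ u v → F u v ≡ + 0 → v ≡ + 0
    F-anisotropic u v e with v ≟ℤ0
    ... | yes v≡0 = v≡0
    ... | no v≢0 with lowest-terms u v v≢0
    ... | d , u′ , v′ , d≢0 , refl , refl , cop = ⊥-elim ([ plus , minus ]′ (unit-sign v′ unit))
      where
      F′≡0 : u′ ⊗ u′ ⊗ u′ ⊕ P ⊗ u′ ⊗ (v′ ⊗ v′) ⊕ Q ⊗ (v′ ⊗ v′ ⊗ v′) ≡ + 0
      F′≡0 = trans (sym (F-def u′ v′)) (⊗≡0ˡ (⊗≢0 (⊗≢0 d≢0 d≢0) d≢0) (trans (sym (F-scale d u′ v′)) e))
      lem₁ : ∀ P Q u v → v ⊗ ⊝ (P ⊗ u ⊗ v ⊕ Q ⊗ (v ⊗ v)) ≡ u ⊗ u ⊗ u ⊖ (u ⊗ u ⊗ u ⊕ P ⊗ u ⊗ (v ⊗ v) ⊕ Q ⊗ (v ⊗ v ⊗ v))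
      lem₁ = ℤ-Ring.solve-∀
      lem₂ : ∀ x → x ⊖ + 0 ≡ x
      lem₂ = ℤ-Ring.solve-∀
      v′∣ : + ∣ v′ ∣ ∣ℤ (u′ ⊗ u′ ⊗ u′)
      v′∣ = ∣ℤ-≡ (trans (lem₁ P Q u′ v′) (trans (cong (u′ ⊗ u′ ⊗ u′ ⊖_) F′≡0) (lem₂ (u′ ⊗ u′ ⊗ u′)))) (ℤ∣.∣m⇒∣m*n (⊝ (P ⊗ u′ ⊗ v′ ⊕ Q ⊗ (v′ ⊗ v′))) (∣-abs {∣ v′ ∣} {v′} ∣-refl))
      cube : ∀ n → n * n * n ≡ n ^ 3
      cube n = trans (*-assoc n n n) (cong (λ z → n * (n * z)) (sym (*-identityʳ n)))
      unit : ∣ v′ ∣ ≡ 1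
      unit = coprime-∣^⇒unit {∣ u′ ∣} 3 cop (subst (∣ v′ ∣ ∣_) (trans (ℤₚ.abs-* (u′ ⊗ u′) u′) (trans (cong (_* ∣ u′ ∣) (ℤₚ.abs-* u′ u′)) (cube ∣ u′ ∣))) (abs-∣ v′∣))
      lem₃ : ∀ P Q u → u ⊗ u ⊗ u ⊕ P ⊗ u ⊕ Q ≡ u ⊗ u ⊗ u ⊕ P ⊗ u ⊗ (+ 1 ⊗ + 1) ⊕ Q ⊗ (+ 1 ⊗ + 1 ⊗ + 1)
      lem₃ = ℤ-Ring.solve-∀
      lem₄ : ∀ P Q u → ⊝ u ⊗ ⊝ u ⊗ ⊝ u ⊕ P ⊗ ⊝ u ⊕ Q ≡ ⊝ (u ⊗ u ⊗ u ⊕ P ⊗ u ⊗ (⊝ (+ 1) ⊗ ⊝ (+ 1)) ⊕ Q ⊗ (⊝ (+ 1) ⊗ ⊝ (+ 1) ⊗ ⊝ (+ 1)))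
      lem₄ = ℤ-Ring.solve-∀
      plus : v′ ≡ + 1 → ⊥
      plus e = irr u′ (trans (lem₃ P Q u′) (trans (cong (λ v → u′ ⊗ u′ ⊗ u′ ⊕ P ⊗ u′ ⊗ (v ⊗ v) ⊕ Q ⊗ (v ⊗ v ⊗ v)) (sym e)) F′≡0))
      minus : v′ ≡ -[1+ 0 ] → ⊥
      minus e = irr (⊝ u′) (trans (lem₄ P Q u′) (cong ⊝_ (trans (cong (λ v → u′ ⊗ u′ ⊗ u′ ⊕ P ⊗ u′ ⊗ (v ⊗ v) ⊕ Q ⊗ (v ⊗ v ⊗ v)) (sym e)) F′≡0)))

    F-nonzero : ∀ u v → F u v ≡ + 0 → u ≡ + 0 × v ≡ + 0
    F-nonzero u v e = u≡0 , v≡0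
      where
      v≡0 : v ≡ + 0
      v≡0 = F-anisotropic u v e
      lem : ∀ P Q u → u ⊗ (u ⊗ u) ≡ u ⊗ u ⊗ u ⊕ P ⊗ u ⊗ (+ 0 ⊗ + 0) ⊕ Q ⊗ (+ 0 ⊗ + 0 ⊗ + 0)
      lem = ℤ-Ring.solve-∀
      u≡0 : u ≡ + 0
      u≡0 with u ≟ℤ0
      ... | yes h = h
      ... | no h = ⊥-elim (⊗≢0 h (⊗≢0 h h) (trans (lem P Q u) (trans (sym (F-def u (+ 0))) (trans (cong (F u) (sym v≡0)) e))))

    -- Anisotropy of the binary form is used three times: at the remainder (-β′, α), which must
    -- vanish; at (v, w), where the value is α v + β′ w = 0; and at (u, 0), where the value is the
    -- norm itself.
    Norm₃-nonzero : ∀ u v w → Norm₃ u v w ≡ + 0 → u ≡ + 0 × v ≡ + 0 × w ≡ + 0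
    Norm₃-nonzero u v w e = proj₁ u-zero , v≡0 , w≡0
      where
      remainder : ⊝ (β′ u v w) ≡ + 0 × α u v w ≡ + 0
      remainder = F-nonzero (⊝ (β′ u v w)) (α u v w) (trans (F[-β,α] u v w) (trans (cong (⊝ (w ⊗ β′ u v w ⊕ v ⊗ α u v w) ⊗_) e) (ℤₚ.*-zeroʳ (⊝ (w ⊗ β′ u v w ⊕ v ⊗ α u v w)))))
      β≡0 : β′ u v w ≡ + 0
      β≡0 = trans (sym (ℤₚ.neg-involutive (β′ u v w))) (cong ⊝_ (proj₁ remainder))
      lem : ∀ v w → + 0 ⊗ v ⊕ + 0 ⊗ w ≡ + 0
      lem = ℤ-Ring.solve-∀
      vw≡0 : v ≡ + 0 × w ≡ + 0
      vw≡0 = F-nonzero v w (trans (F[v,w] u v w) (trans (cong₂ (λ a b → a ⊗ v ⊕ b ⊗ w) (proj₂ remainder) β≡0) (lem v w)))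
      v≡0 : v ≡ + 0
      v≡0 = proj₁ vw≡0
      w≡0 : w ≡ + 0
      w≡0 = proj₂ vw≡0
      u-zero : u ≡ + 0 × + 0 ≡ + 0
      u-zero = F-nonzero u (+ 0) (trans (F≡Norm₃ u (+ 0)) (trans (cong₂ (Norm₃ u) (sym v≡0) (sym w≡0)) e))

  Q≢0 : Q ≢ + 0
  Q≢0 e = case proj₂ (F-nonzero (+ 0) (+ 1) (trans (F-def (+ 0) (+ 1)) (trans (lem P Q) e))) of λ ()
    where
    lem : ∀ P Q → + 0 ⊗ + 0 ⊗ + 0 ⊕ P ⊗ + 0 ⊗ (+ 1 ⊗ + 1) ⊕ Q ⊗ (+ 1 ⊗ + 1 ⊗ + 1) ≡ Q
    lem = ℤ-Ring.solve-∀

  disc≢0 : disc ≢ + 0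
  disc≢0 e = Q≢0 (⊗≡0ˡ {+ 3} (λ ()) (trans (sym (ℤₚ.neg-involutive (+ 3 ⊗ Q))) (cong ⊝_ (proj₁ (F-nonzero (⊝ (+ 3 ⊗ Q)) (+ 2 ⊗ P) (trans F-double-root (trans (cong (⊝ Q ⊗_) e) (ℤₚ.*-zeroʳ (⊝ Q)))))))))

  F-bound : ∀ x u v → ∣ u ∣ ≤ x → ∣ v ∣ ≤ x → ∣ F u v ∣ ≤ C * x ^ 3
  F-bound x u v hu hv = subst (λ z → ∣ z ∣ ≤ C * x ^ 3) (sym (F≡Norm₃ u v)) (Norm₃-bound x u (⊝ v) (+ 0) hu (≤-trans (≤-reflexive (ℤₚ.∣-i∣≡∣i∣ v)) hv) z≤n)

  module _ {f : Poly} (red : Reduction f g) where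
    open Reduction red using (A; c; A≢0; c≢0; bad; rootMod; descend)

    -- All of 2, 3, A, c, Q, Δ divide σ, and T has constant term 1, so a prime dividing T(x) divides
    -- none of them. The factor ν = 1 + 3 |P| makes |w| at least d² + 3 |P|, which gives the lower
    -- bound for T despite the shift by 3 P. The square of c Q, with the further Δ, makes the
    -- distance 2 Δ b d equal to A δ d with δ = 6 ν (c Q Δ)² positive.
    module Split (Δ κ b β σ : ℤ) (ν : ℕ) (Δ≡ : Δ ≡ disc) (ν≡ : ν ≡ suc (3 * ∣ P ∣)) (κ≡ : κ ≡ + ν ⊗ ((c ⊗ Q) ⊗ (c ⊗ Q)) ⊗ Δ)
      (b≡ : b ≡ + 3 ⊗ (κ ⊗ A)) (β≡ : β ≡ + 2 ⊗ b) (σ≡ : σ ≡ Δ ⊗ (β ⊗ β)) where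

      Δ≢0 : Δ ≢ + 0
      Δ≢0 = subst (_≢ + 0) (sym Δ≡) disc≢0

      ν≥1 : 1 ≤ ν
      ν≥1 = subst (1 ≤_) (sym ν≡) (s≤s z≤n)

      cQ≢0 : c ⊗ Q ≢ + 0
      cQ≢0 = ⊗≢0 c≢0 Q≢0

      T : Poly
      T = Tₗ Δ σ ++ leadₗ Δ σ ∷ []

      W : ℤ → ℤ
      W x = Δ ⊗ σ ⊗ (x ⊗ x)

      module _ {p x} (pp : Prime p) (root : + p ∣ℤ eval T x) where
        w : ℤ
        w = W x

        ∤-part : ¬ (+ p ∣ℤ σ ⊗ (x ⊗ x) ⊗ ((w ⊕ + 3 ⊗ P) ⊗ (w ⊕ + 3 ⊗ P)))
        ∤-part d = prime∤1 pp (abs-∣ (ℤ∣.∣m+n∣n⇒∣m {m = + 1} {n = σ ⊗ (x ⊗ x) ⊗ ((w ⊕ + 3 ⊗ P) ⊗ (w ⊕ + 3 ⊗ P))} (∣ℤ-≡ (T-eval Δ σ x) root) d))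

        p∤σxx : ¬ (+ p ∣ℤ σ ⊗ (x ⊗ x))
        p∤σxx = ∤-⊗ˡ ((w ⊕ + 3 ⊗ P) ⊗ (w ⊕ + 3 ⊗ P)) ∤-part

        p∤w+3P : ¬ (+ p ∣ℤ (w ⊕ + 3 ⊗ P))
        p∤w+3P = ∤-⊗ˡ (w ⊕ + 3 ⊗ P) (∤-⊗ʳ (σ ⊗ (x ⊗ x)) ∤-part)

        p∤σ : ¬ (+ p ∣ℤ σ)
        p∤σ = ∤-⊗ˡ (x ⊗ x) p∤σxx

        p∤x : ¬ (+ p ∣ℤ x)
        p∤x = ∤-⊗ˡ x (∤-⊗ʳ σ p∤σxx)

        p∤Δββ : ¬ (+ p ∣ℤ Δ ⊗ (β ⊗ β))
        p∤Δββ = subst (λ z → ¬ (+ p ∣ℤ z)) σ≡ p∤σ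

        p∤Δ : ¬ (+ p ∣ℤ Δ)
        p∤Δ = ∤-⊗ˡ (β ⊗ β) p∤Δββ

        p∤2b : ¬ (+ p ∣ℤ + 2 ⊗ b)
        p∤2b = subst (λ z → ¬ (+ p ∣ℤ z)) β≡ (∤-⊗ˡ β (∤-⊗ʳ Δ p∤Δββ))

        p∤2 : ¬ (+ p ∣ℤ + 2)
        p∤2 = ∤-⊗ˡ b p∤2b

        p∤b : ¬ (+ p ∣ℤ b)
        p∤b = ∤-⊗ʳ (+ 2) p∤2b

        p∤3κA : ¬ (+ p ∣ℤ + 3 ⊗ (κ ⊗ A))
        p∤3κA = subst (λ z → ¬ (+ p ∣ℤ z)) b≡ p∤b

        p∤3 : ¬ (+ p ∣ℤ + 3)
        p∤3 = ∤-⊗ˡ (κ ⊗ A) p∤3κA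

        p∤A : ¬ (+ p ∣ℤ A)
        p∤A = ∤-⊗ʳ κ (∤-⊗ʳ (+ 3) p∤3κA)

        p∤cQ : ¬ (+ p ∣ℤ c ⊗ Q)
        p∤cQ = ∤-⊗ˡ (c ⊗ Q) (∤-⊗ʳ (+ ν) (∤-⊗ˡ Δ (subst (λ z → ¬ (+ p ∣ℤ z)) κ≡ (∤-⊗ˡ A (∤-⊗ʳ (+ 3) p∤3κA)))))

        p∤c : ¬ (+ p ∣ℤ c)
        p∤c = ∤-⊗ˡ Q p∤cQ

        p∤Q : ¬ (+ p ∣ℤ Q)
        p∤Q = ∤-⊗ʳ c p∤cQ

        key : + p ∣ℤ ((w ⊕ P) ⊗ (w ⊕ P) ⊗ (w ⊕ + 4 ⊗ P) ⊕ + 27 ⊗ (Q ⊗ Q))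
        key = ∣ℤ-≡ (ΔT σ x w (cong (λ z → z ⊗ σ ⊗ (x ⊗ x)) Δ≡)) (∣⇒∣⊗ʳ disc (∣ℤ-≡ (T-eval Δ σ x) root))

        p∤w+P : ¬ (+ p ∣ℤ (w ⊕ P))
        p∤w+P d = prime-∤-⊗ pp {+ 3 ⊗ (+ 3 ⊗ + 3)} {Q ⊗ Q} (prime-∤-⊗ pp {+ 3} {+ 3 ⊗ + 3} p∤3 (prime-∤-⊗ pp {+ 3} {+ 3} p∤3 p∤3)) (prime-∤-⊗ pp {Q} {Q} p∤Q p∤Q)
          (ℤ∣.∣m+n∣m⇒∣n {m = (w ⊕ P) ⊗ (w ⊕ P) ⊗ (w ⊕ + 4 ⊗ P)} {n = + 27 ⊗ (Q ⊗ Q)} key (∣⇒∣⊗ˡ (w ⊕ + 4 ⊗ P) (∣⇒∣⊗ˡ (w ⊕ P) d)))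

        T-simple : ¬ (+ p ∣ℤ deriv T x)
        T-simple d = prime-∤-⊗ pp {+ 6 ⊗ (σ ⊗ x) ⊗ (w ⊕ + 3 ⊗ P)} {w ⊕ P} (prime-∤-⊗ pp {+ 6 ⊗ (σ ⊗ x)} {w ⊕ + 3 ⊗ P} (prime-∤-⊗ pp {+ 2 ⊗ + 3} {σ ⊗ x} (prime-∤-⊗ pp {+ 2} {+ 3} p∤2 p∤3) (prime-∤-⊗ pp {σ} {x} p∤σ p∤x)) p∤w+3P) p∤w+P (∣ℤ-≡ (T-deriv Δ σ x) d)

        T-lead : ¬ (+ p ∣ℤ leadₗ Δ σ)
        T-lead = prime-∤-⊗ pp {Δ ⊗ Δ} {σ ⊗ σ ⊗ σ} (prime-∤-⊗ pp {Δ} {Δ} p∤Δ p∤Δ) (prime-∤-⊗ pp {σ ⊗ σ} {σ} (prime-∤-⊗ pp {σ} {σ} p∤σ p∤σ) p∤σ)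

        B h y : ℤ
        B = + 2 ⊗ (w ⊕ P)
        h = Δ ⊗ (b ⊗ x)

        p∤B : ¬ (+ p ∣ℤ B)
        p∤B = prime-∤-⊗ pp {+ 2} {w ⊕ P} p∤2 p∤w+P

        inv : ∃[ i ] + p ∣ℤ (B ⊗ i ⊖ + 1)
        inv = prime-inverse pp B p∤B

        y = ⊝ (+ 3 ⊗ Q) ⊗ proj₁ inv

        abstract
          By : + p ∣ℤ (B ⊗ y ⊕ + 3 ⊗ Q)
          By = ∣ℤ-≡ (lem B Q (proj₁ inv)) (∣⇒∣⊗ʳ (⊝ (+ 3 ⊗ Q)) (proj₂ inv))
            where
            lem : ∀ B Q i → ⊝ (+ 3 ⊗ Q) ⊗ (B ⊗ i ⊖ + 1) ≡ B ⊗ (⊝ (+ 3 ⊗ Q) ⊗ i) ⊕ + 3 ⊗ Q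
            lem = ℤ-Ring.solve-∀

          w≡ : w ≡ + 4 ⊗ (h ⊗ h)
          w≡ = trans (cong (λ z → Δ ⊗ z ⊗ (x ⊗ x)) (trans σ≡ (cong (λ z → Δ ⊗ (z ⊗ z)) β≡))) (w≡4h² Δ b x)

          p∣E : + p ∣ℤ (+ 3 ⊗ (y ⊗ y) ⊕ h ⊗ h ⊕ P)
          p∣E = cancel (cancel (∣ℤ-≡ (E-identity y h w w≡) (ℤ∣.∣m∣n⇒∣m+n (∣⇒∣⊗ʳ (+ 3 ⊗ (B ⊗ y ⊖ + 3 ⊗ Q)) By) key)))
            where
            cancel : ∀ {z} → + p ∣ℤ B ⊗ z → + p ∣ℤ z
            cancel {z} d = [ (λ e → ⊥-elim (p∤B e)) , id ]′ (primeℤ pp B z d)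

          p∣G : + p ∣ℤ (y ⊗ y ⊗ y ⊕ + 3 ⊗ y ⊗ (h ⊗ h) ⊕ P ⊗ y ⊕ Q)
          p∣G = [ (λ e → ⊥-elim (p∤3 e)) , id ]′ (primeℤ pp (+ 3) (y ⊗ y ⊗ y ⊕ + 3 ⊗ y ⊗ (h ⊗ h) ⊕ P ⊗ y ⊕ Q) (∣ℤ-≡ (G-identity y h w w≡) (ℤ∣.∣m∣n⇒∣m+n (∣⇒∣⊗ʳ y p∣E) By)))

          root⁺ : + p ∣ℤ eval g (y ⊕ h)
          root⁺ = ∣ℤ-≡ (g[y+h] y h) (ℤ∣.∣m∣n⇒∣m+n p∣G (∣⇒∣⊗ʳ h p∣E))

          root⁻ : + p ∣ℤ eval g (y ⊖ h)
          root⁻ = ∣ℤ-≡ (g[y-h] y h) (ℤ∣.∣m∣n⇒∣m-n p∣G (∣⇒∣⊗ʳ h p∣E))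

          g-simple : ∀ r → + p ∣ℤ eval g r → ¬ (+ p ∣ℤ deriv g r)
          g-simple r d d′ = p∤Δ (∣ℤ-≡ (trans (disc-combination r) (sym Δ≡)) (ℤ∣.∣m∣n⇒∣m+n (∣⇒∣⊗ʳ (+ 27 ⊗ Q ⊖ + 18 ⊗ P ⊗ r) d) (∣⇒∣⊗ʳ (+ 6 ⊗ P ⊗ (r ⊗ r) ⊖ + 9 ⊗ Q ⊗ r ⊕ + 4 ⊗ (P ⊗ P)) d′)))

          -- The lifts a and b₂ of y + h and y - h remain distinct modulo p because p does not
          -- divide 2 h. So a - b₂ can be cancelled from g(a) - g(b₂) modulo p^E, and the third
          -- linear factor follows from the first two.
          T-splits : ∀ E → ∃[ rs ] (length rs ≡ 3 × ∀ u v → + (p ^ E) ∣ℤ (F u v ⊖ linProd rs u v))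
          T-splits E = from-lifts (hensel-lift pp g (y ⊕ h) root⁺ (g-simple (y ⊕ h) root⁺) E) (hensel-lift pp g (y ⊖ h) root⁻ (g-simple (y ⊖ h) root⁻) E)
            where
            from-lifts : ∃[ R ] (+ p ∣ℤ (R ⊖ (y ⊕ h)) × + (p ^ E) ∣ℤ eval g R) → ∃[ R ] (+ p ∣ℤ (R ⊖ (y ⊖ h)) × + (p ^ E) ∣ℤ eval g R) → ∃[ rs ] (length rs ≡ 3 × ∀ u v → + (p ^ E) ∣ℤ (F u v ⊖ linProd rs u v))
            from-lifts (a , a≡ , ga) (b₂ , b≡₂ , gb) = a ∷ b₂ ∷ ⊝ (a ⊕ b₂) ∷ [] , refl , λ u v → ∣ℤ-≡ (F-factors a b₂ u v) (ℤ∣.∣m∣n⇒∣m+n (ℤ∣.∣m⇒∣m*n (u ⊗ (v ⊗ v) ⊖ a ⊗ (v ⊗ v ⊗ v)) E₁) (ℤ∣.∣m⇒∣m*n (v ⊗ v ⊗ v) ga))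
              where
              lem : ∀ a b y h → (a ⊖ b) ⊖ ((a ⊖ (y ⊕ h)) ⊖ (b ⊖ (y ⊖ h))) ≡ + 2 ⊗ h
              lem = ℤ-Ring.solve-∀
              p∤a-b : ¬ (+ p ∣ℤ (a ⊖ b₂))
              p∤a-b d = prime-∤-⊗ pp {+ 2} {h} p∤2 (prime-∤-⊗ pp {Δ} {b ⊗ x} p∤Δ (prime-∤-⊗ pp {b} {x} p∤b p∤x)) (∣ℤ-≡ (lem a b₂ y h) (ℤ∣.∣m∣n⇒∣m-n d (ℤ∣.∣m∣n⇒∣m-n a≡ b≡₂)))
              E₁ : + (p ^ E) ∣ℤ (a ⊗ a ⊕ a ⊗ b₂ ⊕ b₂ ⊗ b₂ ⊕ P)
              E₁ = prime-power-cancel pp E (a ⊗ a ⊕ a ⊗ b₂ ⊕ b₂ ⊗ b₂ ⊕ P) (a ⊖ b₂) p∤a-b (∣ℤ-≡ (sym (g-difference a b₂)) (ℤ∣.∣m∣n⇒∣m-n ga gb))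

      abstract
        ∣β∣≥ν : ν ≤ ∣ β ∣
        ∣β∣≥ν = begin
          ν                                                      ≤⟨ m≤m*n ν (∣ (c ⊗ Q) ⊗ (c ⊗ Q) ∣ * ∣ Δ ∣) {{>-nonZero (*-mono-≤ (∣z∣≥1 (⊗≢0 cQ≢0 cQ≢0)) (∣z∣≥1 Δ≢0))}} ⟩
          ν * (∣ (c ⊗ Q) ⊗ (c ⊗ Q) ∣ * ∣ Δ ∣)                    ≡⟨ *-assoc ν ∣ (c ⊗ Q) ⊗ (c ⊗ Q) ∣ ∣ Δ ∣ ⟨
          ν * ∣ (c ⊗ Q) ⊗ (c ⊗ Q) ∣ * ∣ Δ ∣                      ≡⟨ trans (ℤₚ.abs-* (+ ν ⊗ ((c ⊗ Q) ⊗ (c ⊗ Q))) Δ) (cong (_* ∣ Δ ∣) (ℤₚ.abs-* (+ ν) ((c ⊗ Q) ⊗ (c ⊗ Q)))) ⟨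
          ∣ + ν ⊗ ((c ⊗ Q) ⊗ (c ⊗ Q)) ⊗ Δ ∣                      ≡⟨ cong ∣_∣ κ≡ ⟨
          ∣ κ ∣                                                  ≤⟨ m≤m*n ∣ κ ∣ ∣ A ∣ {{>-nonZero (∣z∣≥1 A≢0)}} ⟩
          ∣ κ ∣ * ∣ A ∣                                          ≡⟨ ℤₚ.abs-* κ A ⟨
          ∣ κ ⊗ A ∣                                              ≤⟨ m≤n*m ∣ κ ⊗ A ∣ 3 ⟩
          3 * ∣ κ ⊗ A ∣                                          ≡⟨ ℤₚ.abs-* (+ 3) (κ ⊗ A) ⟨
          ∣ + 3 ⊗ (κ ⊗ A) ∣                                      ≡⟨ cong ∣_∣ b≡ ⟨
          ∣ b ∣                                                  ≤⟨ m≤n*m ∣ b ∣ 2 ⟩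
          2 * ∣ b ∣                                              ≡⟨ ℤₚ.abs-* (+ 2) b ⟨
          ∣ + 2 ⊗ b ∣                                            ≡⟨ cong ∣_∣ β≡ ⟨
          ∣ β ∣                                                  ∎
          where open ≤-Reasoning

        2≤∣β∣ : 2 ≤ ∣ β ∣
        2≤∣β∣ = ≤-trans (*-monoʳ-≤ 2 (∣z∣≥1 b≢0)) (≤-reflexive (trans (sym (ℤₚ.abs-* (+ 2) b)) (cong ∣_∣ (sym β≡))))
          where
          b≢0 : b ≢ + 0
          b≢0 e = 1+n≰n (≤-trans ν≥1 (≤-trans ∣β∣≥ν (≤-reflexive (cong ∣_∣ (trans β≡ (cong (+ 2 ⊗_) e))))))

        ∣β∣≤∣σ∣ : ∣ β ∣ ≤ ∣ σ ∣
        ∣β∣≤∣σ∣ = begin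
          ∣ β ∣                      ≤⟨ m≤m*n ∣ β ∣ ∣ β ∣ {{β-nz}} ⟩
          ∣ β ∣ * ∣ β ∣              ≤⟨ m≤n*m (∣ β ∣ * ∣ β ∣) ∣ Δ ∣ {{>-nonZero (∣z∣≥1 Δ≢0)}} ⟩
          ∣ Δ ∣ * (∣ β ∣ * ∣ β ∣)    ≡⟨ trans (ℤₚ.abs-* Δ (β ⊗ β)) (cong (∣ Δ ∣ *_) (ℤₚ.abs-* β β)) ⟨
          ∣ Δ ⊗ (β ⊗ β) ∣            ≡⟨ cong ∣_∣ σ≡ ⟨
          ∣ σ ∣                      ∎
          where
          open ≤-Reasoning
          β-nz : NonZero ∣ β ∣
          β-nz = >-nonZero (≤-trans (s≤s z≤n) 2≤∣β∣)

        w+3P≥ : ∀ d → 1 ≤ d → d * d ≤ ∣ W (+ d) ⊕ + 3 ⊗ P ∣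
        w+3P≥ d 1≤d = +-cancelʳ-≤ (3 * ∣ P ∣) _ _ (begin
          d * d + 3 * ∣ P ∣                              ≤⟨ +-monoʳ-≤ (d * d) (m≤m*n (3 * ∣ P ∣) (d * d) {{>-nonZero (*-mono-≤ 1≤d 1≤d)}}) ⟩
          suc (3 * ∣ P ∣) * (d * d)                      ≤⟨ *-monoˡ-≤ (d * d) (≤-trans (≤-reflexive (sym ν≡)) (≤-trans ∣β∣≥ν (≤-trans ∣β∣≤∣σ∣ (m≤n*m ∣ σ ∣ ∣ Δ ∣ {{>-nonZero (∣z∣≥1 Δ≢0)}})))) ⟩
          ∣ Δ ∣ * ∣ σ ∣ * (d * d)                        ≡⟨ trans (ℤₚ.abs-* (Δ ⊗ σ) (+ d ⊗ + d)) (cong₂ _*_ (ℤₚ.abs-* Δ σ) (ℤₚ.abs-* (+ d) (+ d))) ⟨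
          ∣ W (+ d) ∣                                    ≡⟨ cong ∣_∣ (lem (W (+ d)) (+ 3 ⊗ P)) ⟩
          ∣ (W (+ d) ⊕ + 3 ⊗ P) ⊖ + 3 ⊗ P ∣              ≤⟨ ℤₚ.∣i-j∣≤∣i∣+∣j∣ (W (+ d) ⊕ + 3 ⊗ P) (+ 3 ⊗ P) ⟩
          ∣ W (+ d) ⊕ + 3 ⊗ P ∣ + ∣ + 3 ⊗ P ∣            ≡⟨ cong (λ z → ∣ W (+ d) ⊕ + 3 ⊗ P ∣ + z) (ℤₚ.abs-* (+ 3) P) ⟩
          ∣ W (+ d) ⊕ + 3 ⊗ P ∣ + 3 * ∣ P ∣              ∎)
          where
          open ≤-Reasoning
          lem : ∀ a b → a ≡ (a ⊕ b) ⊖ b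
          lem = ℤ-Ring.solve-∀

        T-lower : ∀ d → 1 ≤ d → d ^ 6 ≤ ∣ eval T (+ d) ∣
        T-lower d 1≤d = begin
          d ^ 6                                           ≡⟨ lem₁ d ⟩
          d * d * (d * d * (d * d))                       ≤⟨ ∸-monoˡ-≤ {suc X} 1 (+-mono-≤ 1≤X (≤-reflexive (sym (+-identityʳ X)))) ⟩
          2 * X ∸ 1                                       ≤⟨ ∸-monoˡ-≤ 1 (≤-trans (≤-reflexive (sym (*-assoc 2 (d * d) (d * d * (d * d))))) (*-mono-≤ (*-monoˡ-≤ (d * d) (≤-trans 2≤∣β∣ ∣β∣≤∣σ∣)) (*-mono-≤ (w+3P≥ d 1≤d) (w+3P≥ d 1≤d)))) ⟩
          ∣ σ ∣ * (d * d) * (∣ V ∣ * ∣ V ∣) ∸ 1           ≡⟨ cong (_∸ 1) (sym (trans (ℤₚ.abs-* (σ ⊗ (+ d ⊗ + d)) (V ⊗ V)) (cong₂ _*_ (trans (ℤₚ.abs-* σ (+ d ⊗ + d)) (cong (∣ σ ∣ *_) (ℤₚ.abs-* (+ d) (+ d)))) (ℤₚ.abs-* V V)))) ⟩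
          ∣ σ ⊗ (+ d ⊗ + d) ⊗ (V ⊗ V) ∣ ∸ 1               ≤⟨ ∣1⊕z∣≥ (σ ⊗ (+ d ⊗ + d) ⊗ (V ⊗ V)) ⟩
          ∣ + 1 ⊕ σ ⊗ (+ d ⊗ + d) ⊗ (V ⊗ V) ∣             ≡⟨ cong ∣_∣ (T-eval Δ σ (+ d)) ⟨
          ∣ eval T (+ d) ∣                                ∎
          where
          open ≤-Reasoning
          V : ℤ
          V = W (+ d) ⊕ + 3 ⊗ P
          X : ℕ
          X = d * d * (d * d * (d * d))
          1≤X : 1 ≤ X
          1≤X = *-mono-≤ (*-mono-≤ 1≤d 1≤d) (*-mono-≤ (*-mono-≤ 1≤d 1≤d) (*-mono-≤ 1≤d 1≤d))
          lem₁ : ∀ d → d * (d * (d * (d * (d * (d * 1))))) ≡ d * d * (d * d * (d * d))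
          lem₁ = ℕ-Ring.solve-∀

      splitData : SplitData
      splitData = record
        { m = 3 ; t = 5 ; C = C ; Cₜ = coeffSum T ; m≥1 = s≤s z≤n ; C≥1 = C≥1
        ; F = F ; F-bound = F-bound ; F-nonzero = F-nonzero
        ; cs = Tₗ Δ σ ; lead = leadₗ Δ σ ; length-cs = refl
        ; T-lower = T-lower ; T-upper = λ d 1≤d → eval-upper (Tₗ Δ σ) (leadₗ Δ σ) d 1≤d
        ; T-lead = λ {p} {x} pp r → T-lead {p} {x} pp r ; T-simple = λ {p} {x} pp r → T-simple {p} {x} pp r ; T-splits = λ {p} {x} pp r → T-splits {p} {x} pp r
        }

      z : ℤ
      z = c ⊗ Q ⊗ Δ

      δ : ℕ
      δ = 6 * ν * (∣ z ∣ * ∣ z ∣)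

      abstract
        shift≡ : ∀ d y → y ⊖ Δ ⊗ (b ⊗ + d) ⊕ A ⊗ + (δ * d) ≡ y ⊕ Δ ⊗ (b ⊗ + d)
        shift≡ d y = trans (cong₂ (λ s t → y ⊖ Δ ⊗ (s ⊗ + d) ⊕ A ⊗ t) b′ δ≡) (trans (lem y Δ (+ ν) (c ⊗ Q) A (+ d)) (cong (λ s → y ⊕ Δ ⊗ (s ⊗ + d)) (sym b′)))
          where
          b′ : b ≡ + 3 ⊗ ((+ ν ⊗ ((c ⊗ Q) ⊗ (c ⊗ Q)) ⊗ Δ) ⊗ A)
          b′ = trans b≡ (cong (λ k → + 3 ⊗ (k ⊗ A)) κ≡)
          δ≡ : + (δ * d) ≡ + 6 ⊗ + ν ⊗ (z ⊗ z) ⊗ + d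
          δ≡ = trans (ℤₚ.pos-* δ d) (cong (_⊗ + d) (trans (ℤₚ.pos-* (6 * ν) (∣ z ∣ * ∣ z ∣)) (cong₂ _⊗_ (ℤₚ.pos-* 6 ν) (sym (⊗-self z)))))
          lem : ∀ y Δ ν q A d → y ⊖ Δ ⊗ ((+ 3 ⊗ ((ν ⊗ (q ⊗ q) ⊗ Δ) ⊗ A)) ⊗ d) ⊕ A ⊗ (+ 6 ⊗ ν ⊗ ((q ⊗ Δ) ⊗ (q ⊗ Δ)) ⊗ d) ≡ y ⊕ Δ ⊗ ((+ 3 ⊗ ((ν ⊗ (q ⊗ q) ⊗ Δ) ⊗ A)) ⊗ d)
          lem = ℤ-Ring.solve-∀

      manyRootPairs : ManyRootPairs f
      manyRootPairs = splits⇒manyRootPairs {f} splitData δ (*-mono-≤ (*-mono-≤ (s≤s (z≤n {5})) ν≥1) (*-mono-≤ (∣z∣≥1 z≢0) (∣z∣≥1 z≢0))) pair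
        where
        z≢0 : z ≢ + 0
        z≢0 = ⊗≢0 cQ≢0 Δ≢0
        pair : ∀ {p} d → Prime p → + p ∣ℤ eval T (+ d) → ∃[ x ] (+ p ∣ℤ eval f x × + p ∣ℤ eval f (x ⊕ + (δ * d)))
        pair {p} d pp root = case descend pp (p∤A {p} {+ d} pp root) (p∤c {p} {+ d} pp root) (y {p} {+ d} pp root ⊖ Δ ⊗ (b ⊗ + d)) (root⁻ {p} {+ d} pp root) of λ
          { (x , rx , shift) → x , rx , shift (y {p} {+ d} pp root ⊕ Δ ⊗ (b ⊗ + d)) (+ (δ * d)) (shift≡ d (y {p} {+ d} pp root)) (root⁺ {p} {+ d} pp root) }

    Ty : Set
    Ty = ℕ × Bool

    -- For q = w X² + v X + u modulo p, the first type says that q(r) = 0, the second that q is w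
    -- times the cofactor g / (X - r) = X² + r X + r² + P. The second is needed because that
    -- cofactor may have no root modulo p.
    TypI TypII : ℕ → ℕ → ℤ → ℤ → ℤ → Set
    TypI p r u v w = + p ∣ℤ (u ⊕ (v ⊗ + r ⊕ w ⊗ + r ⊗ + r))
    TypII p r u v w = + p ∣ℤ (v ⊖ w ⊗ + r) × + p ∣ℤ (u ⊖ w ⊗ (+ r ⊗ + r ⊕ P))

    Typ₃ : ℕ → Ty → ℤ → ℤ → ℤ → Set
    Typ₃ p (r , true) = TypI p r
    Typ₃ p (r , false) = TypII p r

    Typ₃? : ∀ p τ u v w → Dec (Typ₃ p τ u v w)
    Typ₃? p (r , true) u v w = + p ∣ℤ? (u ⊕ (v ⊗ + r ⊕ w ⊗ + r ⊗ + r))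
    Typ₃? p (r , false) u v w = (+ p ∣ℤ? (v ⊖ w ⊗ + r)) ×-dec (+ p ∣ℤ? (u ⊖ w ⊗ (+ r ⊗ + r ⊕ P)))

    types : ℕ → List Ty
    types p = cartesianProduct (rootsMod g p) (true ∷ false ∷ [])

    types-root : ∀ {p r t} → (r , t) ∈ types p → + p ∣ℤ eval g (+ r)
    types-root {p} τ∈ = proj₂ (∈-filter⁻ (λ r → + p ∣ℤ? eval g (+ r)) {xs = upTo p} (proj₁ (∈-cartesianProduct⁻ (rootsMod g p) (true ∷ false ∷ []) τ∈)))

    abstract
      types-few : ∀ {p} → Prime p → length (types p) ≤ 6
      types-few {p} pp = ≤-trans (≤-reflexive (length-cartesianProduct (rootsMod g p) (true ∷ false ∷ []))) (*-monoˡ-≤ 2 (length-rootsMod pp (Q ∷ P ∷ + 0 ∷ []) (+ 1) (λ d → prime∤1 pp (abs-∣ d))))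

      closedI : ∀ {p} r u v w u′ v′ w′ → + p ∣ℤ eval g (+ r) → TypI p r u v w → TypI p r u′ v′ w′ → + p ∣ℤ Norm₃ (u ⊖ u′) (v ⊖ v′) (w ⊖ w′)
      closedI {p} r u v w u′ v′ w′ root h h′ = ∣ℤ-≡ (sym (Norm₃-inU U V W)) (eval-transfer (inU V W ++ + 1 ∷ []) (∣ℤ-≡ (lem (+ r) u v w u′ v′ w′) (ℤ∣.∣m∣n⇒∣m-n h h′))
          (∣ℤ-≡ (trans (sym (Norm₃-typeI (+ r) V W)) (Norm₃-inU (⊝ (V ⊗ + r ⊕ W ⊗ + r ⊗ + r)) V W)) (∣⇒∣⊗ˡ (F (V ⊕ W ⊗ + r) (⊝ W)) (ℤ∣.∣m⇒∣-m root))))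
        where
        U V W : ℤ
        U = u ⊖ u′
        V = v ⊖ v′
        W = w ⊖ w′
        lem : ∀ r u v w u′ v′ w′ → (u ⊕ (v ⊗ r ⊕ w ⊗ r ⊗ r)) ⊖ (u′ ⊕ (v′ ⊗ r ⊕ w′ ⊗ r ⊗ r)) ≡ (u ⊖ u′) ⊖ ⊝ ((v ⊖ v′) ⊗ r ⊕ (w ⊖ w′) ⊗ r ⊗ r)
        lem = ℤ-Ring.solve-∀

      closedII : ∀ {p} r u v w u′ v′ w′ → + p ∣ℤ eval g (+ r) → TypII p r u v w → TypII p r u′ v′ w′ → + p ∣ℤ Norm₃ (u ⊖ u′) (v ⊖ v′) (w ⊖ w′)
      closedII {p} r u v w u′ v′ w′ root (hv , hu) (hv′ , hu′) = ∣ℤ-≡ (sym (Norm₃-inU U V W)) (eval-transfer (inU V W ++ + 1 ∷ []) (∣ℤ-≡ (lem₁ (+ r ⊗ + r ⊕ P) u w u′ w′) (ℤ∣.∣m∣n⇒∣m-n hu hu′))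
          (∣ℤ-≡ (trans (sym (Norm₃-inV U₀ V W)) (Norm₃-inU U₀ V W)) (eval-transfer (inV U₀ W ++ ⊝ Q ∷ []) (∣ℤ-≡ (lem₁ (+ r) v w v′ w′) (ℤ∣.∣m∣n⇒∣m-n hv hv′))
            (∣ℤ-≡ (trans (sym (Norm₃-typeII (+ r) W)) (Norm₃-inV U₀ (W ⊗ + r) W)) (∣⇒∣⊗ˡ (eval g (+ r) ⊗ (W ⊗ W ⊗ W)) root)))))
        where
        U V W U₀ : ℤ
        U = u ⊖ u′
        V = v ⊖ v′
        W = w ⊖ w′
        U₀ = W ⊗ (+ r ⊗ + r ⊕ P)
        lem₁ : ∀ s u w u′ w′ → (u ⊖ w ⊗ s) ⊖ (u′ ⊖ w′ ⊗ s) ≡ (u ⊖ u′) ⊖ (w ⊖ w′) ⊗ s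
        lem₁ = ℤ-Ring.solve-∀

      closed₃ : ∀ {p} τ u v w u′ v′ w′ → τ ∈ types p → Typ₃ p τ u v w → Typ₃ p τ u′ v′ w′ → + p ∣ℤ Norm₃ (u ⊖ u′) (v ⊖ v′) (w ⊖ w′)
      closed₃ (r , true) u v w u′ v′ w′ τ∈ = closedI r u v w u′ v′ w′ (types-root τ∈)
      closed₃ (r , false) u v w u′ v′ w′ τ∈ = closedII r u v w u′ v′ w′ (types-root τ∈)

      ∣cube⇒∣ : ∀ {p} → Prime p → ∀ x → + p ∣ℤ (x ⊗ x ⊗ x) → + p ∣ℤ x
      ∣cube⇒∣ pp x d = [ (λ e → [ id , id ]′ (primeℤ pp x x e)) , id ]′ (primeℤ pp (x ⊗ x) x d)

      -- The remainder of w² g modulo q is α X + β′. If p does not divide α, its root - β′ / α is a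
      -- common root of g and q, which gives type I. If p divides α it divides β′ too, so q divides
      -- w² g modulo p. Then either p divides w, and with it v and u, or q / w is a quadratic factor
      -- of g; the remaining root is v / w, as the roots add up to 0, and the type is II.
      classify₃ : ∀ {p} → Prime p → ∀ u v w → + p ∣ℤ Norm₃ u v w → (+ p ∣ℤ u × + p ∣ℤ v × + p ∣ℤ w) ⊎ ∃[ τ ] (τ ∈ types p × Typ₃ p τ u v w)
      classify₃ {p} pp u v w d = case (+ p ∣ℤ? a) of λ { (no p∤a) → inj₂ (typeI p∤a (prime-inverse pp a p∤a)) ; (yes p∣a) → degenerate p∣a }
        where
        instance
          p≢0 : NonZero p
          p≢0 = prime⇒nonZero pp
        a b : ℤ
        a = α u v w
        b = β′ u v w
        p∣F[-b,a] : + p ∣ℤ (⊝ b ⊗ ⊝ b ⊗ ⊝ b ⊕ P ⊗ ⊝ b ⊗ (a ⊗ a) ⊕ Q ⊗ (a ⊗ a ⊗ a))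
        p∣F[-b,a] = ∣ℤ-≡ (trans (sym (F[-β,α] u v w)) (F-def (⊝ b) a)) (∣⇒∣⊗ʳ (⊝ (w ⊗ b ⊕ v ⊗ a)) d)
        typeI : ¬ (+ p ∣ℤ a) → ∃[ i ] + p ∣ℤ (a ⊗ i ⊖ + 1) → ∃[ τ ] (τ ∈ types p × Typ₃ p τ u v w)
        typeI p∤a (i , inv) = (r , true) , ∈-cartesianProduct⁺ (∈-rootsMod g R root) (here refl) ,
            ∣ℤ-≡ (lem₃ u v w R (+ r)) (ℤ∣.∣m∣n⇒∣m+n q[R] (∣⇒∣⊗ˡ (v ⊕ w ⊗ (+ r ⊕ R)) (%ℕ-cong R p)))
          where
          R : ℤ
          R = ⊝ b ⊗ i
          r : ℕ
          r = R %ℕ p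
          i³ : + p ∣ℤ (a ⊗ i ⊗ (a ⊗ i) ⊗ (a ⊗ i) ⊖ + 1)
          i³ = ∣ℤ-≡ (lem (a ⊗ i)) (∣⇒∣⊗ˡ (a ⊗ i ⊗ (a ⊗ i) ⊕ a ⊗ i ⊕ + 1) inv)
            where
            lem : ∀ x → (x ⊖ + 1) ⊗ (x ⊗ x ⊕ x ⊕ + 1) ≡ x ⊗ x ⊗ x ⊖ + 1
            lem = ℤ-Ring.solve-∀
          lem₁ : ∀ P Q a b i → (⊝ b ⊗ ⊝ b ⊗ ⊝ b ⊕ P ⊗ ⊝ b ⊗ (a ⊗ a) ⊕ Q ⊗ (a ⊗ a ⊗ a)) ⊗ (i ⊗ i ⊗ i)
            ⊕ ((a ⊗ i ⊖ + 1) ⊗ ⊝ (P ⊗ (⊝ b ⊗ i) ⊗ (a ⊗ i ⊕ + 1)) ⊕ ⊝ Q ⊗ (a ⊗ i ⊗ (a ⊗ i) ⊗ (a ⊗ i) ⊖ + 1)) ≡ (⊝ b ⊗ i) ⊗ (⊝ b ⊗ i) ⊗ (⊝ b ⊗ i) ⊕ P ⊗ (⊝ b ⊗ i) ⊕ Q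
          lem₁ = ℤ-Ring.solve-∀
          root : + p ∣ℤ eval g R
          root = ∣ℤ-≡ (trans (lem₁ P Q a b i) (sym (g-eval R))) (ℤ∣.∣m∣n⇒∣m+n (∣⇒∣⊗ˡ (i ⊗ i ⊗ i) p∣F[-b,a]) (ℤ∣.∣m∣n⇒∣m+n (∣⇒∣⊗ˡ (⊝ (P ⊗ (⊝ b ⊗ i) ⊗ (a ⊗ i ⊕ + 1))) inv) (∣⇒∣⊗ʳ (⊝ Q) i³)))
          lem₂ : ∀ u v w a b i → (u ⊗ (a ⊗ a) ⊖ v ⊗ (a ⊗ b) ⊕ w ⊗ (b ⊗ b)) ⊗ (i ⊗ i) ⊕ (a ⊗ i ⊖ + 1) ⊗ (v ⊗ b ⊗ i ⊖ u ⊗ (a ⊗ i ⊕ + 1)) ≡ u ⊕ (v ⊗ (⊝ b ⊗ i) ⊕ w ⊗ (⊝ b ⊗ i) ⊗ (⊝ b ⊗ i))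
          lem₂ = ℤ-Ring.solve-∀
          q[R] : + p ∣ℤ (u ⊕ (v ⊗ R ⊕ w ⊗ R ⊗ R))
          q[R] = ∣ℤ-≡ (lem₂ u v w a b i) (ℤ∣.∣m∣n⇒∣m+n (∣⇒∣⊗ˡ (i ⊗ i) (∣ℤ-≡ (sym (q[-β,α] u v w)) (∣⇒∣⊗ʳ (w ⊗ w) d))) (∣⇒∣⊗ˡ (v ⊗ b ⊗ i ⊖ u ⊗ (a ⊗ i ⊕ + 1)) inv))
          lem₃ : ∀ u v w R r → (u ⊕ (v ⊗ R ⊕ w ⊗ R ⊗ R)) ⊕ (r ⊖ R) ⊗ (v ⊕ w ⊗ (r ⊕ R)) ≡ u ⊕ (v ⊗ r ⊕ w ⊗ r ⊗ r)
          lem₃ = ℤ-Ring.solve-∀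
        degenerate : + p ∣ℤ a → (+ p ∣ℤ u × + p ∣ℤ v × + p ∣ℤ w) ⊎ ∃[ τ ] (τ ∈ types p × Typ₃ p τ u v w)
        degenerate p∣a = case (+ p ∣ℤ? w) of λ { (yes p∣w) → inj₁ (allDivisible p∣w) ; (no p∤w) → inj₂ (typeII (prime-inverse pp w p∤w)) }
          where
          lem₁ : ∀ P Q a b → (⊝ b ⊗ ⊝ b ⊗ ⊝ b ⊕ P ⊗ ⊝ b ⊗ (a ⊗ a) ⊕ Q ⊗ (a ⊗ a ⊗ a)) ⊖ a ⊗ (P ⊗ ⊝ b ⊗ a ⊕ Q ⊗ (a ⊗ a)) ≡ ⊝ b ⊗ ⊝ b ⊗ ⊝ b
          lem₁ = ℤ-Ring.solve-∀
          p∣b : + p ∣ℤ b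
          p∣b = ∣ℤ-≡ (ℤₚ.neg-involutive b) (ℤ∣.∣m⇒∣-m (∣cube⇒∣ pp (⊝ b) (∣ℤ-≡ (lem₁ P Q a b) (ℤ∣.∣m∣n⇒∣m-n p∣F[-b,a] (∣⇒∣⊗ˡ (P ⊗ ⊝ b ⊗ a ⊕ Q ⊗ (a ⊗ a)) p∣a)))))
          p∣F[v,w] : + p ∣ℤ (v ⊗ v ⊗ v ⊕ P ⊗ v ⊗ (w ⊗ w) ⊕ Q ⊗ (w ⊗ w ⊗ w))
          p∣F[v,w] = ∣ℤ-≡ (trans (sym (F[v,w] u v w)) (F-def v w)) (ℤ∣.∣m∣n⇒∣m+n (∣⇒∣⊗ˡ v p∣a) (∣⇒∣⊗ˡ w p∣b))
          allDivisible : + p ∣ℤ w → + p ∣ℤ u × + p ∣ℤ v × + p ∣ℤ w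
          allDivisible p∣w = p∣u , p∣v , p∣w
            where
            lem₂ : ∀ P Q v w → (v ⊗ v ⊗ v ⊕ P ⊗ v ⊗ (w ⊗ w) ⊕ Q ⊗ (w ⊗ w ⊗ w)) ⊖ w ⊗ (P ⊗ v ⊗ w ⊕ Q ⊗ (w ⊗ w)) ≡ v ⊗ v ⊗ v
            lem₂ = ℤ-Ring.solve-∀
            p∣v : + p ∣ℤ v
            p∣v = ∣cube⇒∣ pp v (∣ℤ-≡ (lem₂ P Q v w) (ℤ∣.∣m∣n⇒∣m-n p∣F[v,w] (∣⇒∣⊗ˡ (P ⊗ v ⊗ w ⊕ Q ⊗ (w ⊗ w)) p∣w)))
            lem₃ : ∀ u P Q v w → + 1 ⊗ (u ⊗ (u ⊗ u)) ⊕ ⊝ (+ 2 ⊗ P) ⊗ (u ⊗ (u ⊗ w)) ⊕ P ⊗ (u ⊗ (v ⊗ v)) ⊕ (+ 3 ⊗ Q) ⊗ (u ⊗ (v ⊗ w))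
                ⊕ (P ⊗ P) ⊗ (u ⊗ (w ⊗ w)) ⊕ ⊝ Q ⊗ (v ⊗ (v ⊗ v)) ⊕ ⊝ (P ⊗ Q) ⊗ (v ⊗ (w ⊗ w)) ⊕ (Q ⊗ Q) ⊗ (w ⊗ (w ⊗ w))
                ⊖ (w ⊗ (⊝ (+ 2 ⊗ P) ⊗ (u ⊗ u) ⊕ (+ 3 ⊗ Q) ⊗ (u ⊗ v) ⊕ (P ⊗ P) ⊗ (u ⊗ w) ⊕ ⊝ (P ⊗ Q) ⊗ (v ⊗ w) ⊕ (Q ⊗ Q) ⊗ (w ⊗ w)) ⊕ v ⊗ (P ⊗ (u ⊗ v) ⊕ ⊝ Q ⊗ (v ⊗ v))) ≡ u ⊗ u ⊗ u
            lem₃ = ℤ-Ring.solve-∀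
            p∣u : + p ∣ℤ u
            p∣u = ∣cube⇒∣ pp u (∣ℤ-≡ (lem₃ u P Q v w) (ℤ∣.∣m∣n⇒∣m-n (∣ℤ-≡ (Norm₃-def u v w) d) (ℤ∣.∣m∣n⇒∣m+n (∣⇒∣⊗ˡ (⊝ (+ 2 ⊗ P) ⊗ (u ⊗ u) ⊕ (+ 3 ⊗ Q) ⊗ (u ⊗ v) ⊕ (P ⊗ P) ⊗ (u ⊗ w) ⊕ ⊝ (P ⊗ Q) ⊗ (v ⊗ w) ⊕ (Q ⊗ Q) ⊗ (w ⊗ w)) p∣w) (∣⇒∣⊗ˡ (P ⊗ (u ⊗ v) ⊕ ⊝ Q ⊗ (v ⊗ v)) p∣v))))
          typeII : ∃[ i ] + p ∣ℤ (w ⊗ i ⊖ + 1) → ∃[ τ ] (τ ∈ types p × Typ₃ p τ u v w)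
          typeII (i , inv) = (r , false) , ∈-cartesianProduct⁺ (∈-rootsMod g R root) (there (here refl)) , v≡ , u≡
            where
            R : ℤ
            R = v ⊗ i
            r : ℕ
            r = R %ℕ p
            i³ : + p ∣ℤ (w ⊗ i ⊗ (w ⊗ i) ⊗ (w ⊗ i) ⊖ + 1)
            i³ = ∣ℤ-≡ (lem (w ⊗ i)) (∣⇒∣⊗ˡ (w ⊗ i ⊗ (w ⊗ i) ⊕ w ⊗ i ⊕ + 1) inv)
              where
              lem : ∀ x → (x ⊖ + 1) ⊗ (x ⊗ x ⊕ x ⊕ + 1) ≡ x ⊗ x ⊗ x ⊖ + 1
              lem = ℤ-Ring.solve-∀
            lem₂ : ∀ P Q v w i → (v ⊗ v ⊗ v ⊕ P ⊗ v ⊗ (w ⊗ w) ⊕ Q ⊗ (w ⊗ w ⊗ w)) ⊗ (i ⊗ i ⊗ i)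
              ⊕ ((w ⊗ i ⊖ + 1) ⊗ ⊝ (P ⊗ (v ⊗ i) ⊗ (w ⊗ i ⊕ + 1)) ⊕ ⊝ Q ⊗ (w ⊗ i ⊗ (w ⊗ i) ⊗ (w ⊗ i) ⊖ + 1)) ≡ (v ⊗ i) ⊗ (v ⊗ i) ⊗ (v ⊗ i) ⊕ P ⊗ (v ⊗ i) ⊕ Q
            lem₂ = ℤ-Ring.solve-∀
            root : + p ∣ℤ eval g R
            root = ∣ℤ-≡ (trans (lem₂ P Q v w i) (sym (g-eval R))) (ℤ∣.∣m∣n⇒∣m+n (∣⇒∣⊗ˡ (i ⊗ i ⊗ i) p∣F[v,w]) (ℤ∣.∣m∣n⇒∣m+n (∣⇒∣⊗ˡ (⊝ (P ⊗ (v ⊗ i) ⊗ (w ⊗ i ⊕ + 1))) inv) (∣⇒∣⊗ʳ (⊝ Q) i³)))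
            lem₃ : ∀ v w i r → ⊝ (v ⊗ (w ⊗ i ⊖ + 1)) ⊖ w ⊗ (r ⊖ v ⊗ i) ≡ v ⊖ w ⊗ r
            lem₃ = ℤ-Ring.solve-∀
            v≡ : + p ∣ℤ (v ⊖ w ⊗ + r)
            v≡ = ∣ℤ-≡ (lem₃ v w i (+ r)) (ℤ∣.∣m∣n⇒∣m-n (ℤ∣.∣m⇒∣-m (∣⇒∣⊗ʳ v inv)) (∣⇒∣⊗ʳ w (%ℕ-cong R p)))
            lem₄ : ∀ P u v w r i → (v ⊖ w ⊗ r) ⊗ (v ⊕ w ⊗ r) ⊗ i ⊕ (⊝ ((w ⊗ w ⊗ P ⊖ w ⊗ u ⊕ v ⊗ v) ⊗ i) ⊕ (w ⊗ i ⊖ + 1) ⊗ (w ⊗ (r ⊗ r ⊕ P) ⊖ u)) ≡ u ⊖ w ⊗ (r ⊗ r ⊕ P)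
            lem₄ = ℤ-Ring.solve-∀
            u≡ : + p ∣ℤ (u ⊖ w ⊗ (+ r ⊗ + r ⊕ P))
            u≡ = ∣ℤ-≡ (lem₄ P u v w (+ r) i) (ℤ∣.∣m∣n⇒∣m+n (∣⇒∣⊗ˡ i (∣⇒∣⊗ˡ (v ⊕ w ⊗ + r) v≡)) (ℤ∣.∣m∣n⇒∣m+n (ℤ∣.∣m⇒∣-m (∣⇒∣⊗ˡ i p∣a)) (∣⇒∣⊗ˡ (w ⊗ (+ r ⊗ + r ⊕ P) ⊖ u) inv)))

    normData : NormData f
    normData = record
      { n = 1 ; C = C ; R = 6 ; M₀ = bad ; C≥1 = C≥1
      ; N = λ v → Norm₃ (Vec.head v) (Vec.head (Vec.tail v)) (Vec.head (Vec.tail (Vec.tail v)))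
      ; N-bound = λ { x (u ∷ v ∷ w ∷ []) (hu ∷ hv ∷ hw ∷ []) → Norm₃-bound x u v w hu hv hw }
      ; N-nonzero = λ { (u ∷ v ∷ w ∷ []) e → case Norm₃-nonzero u v w e of λ { (a , b , c) → a ∷ b ∷ c ∷ [] } }
      ; coeffs = λ v → inU (Vec.head v) (Vec.head (Vec.tail v))
      ; length-coeffs = λ v → length-inU (Vec.head v) (Vec.head (Vec.tail v))
      ; N-monic = λ u v → Norm₃-inU u (Vec.head v) (Vec.head (Vec.tail v))
      ; Ty = Ty ; types = types
      ; Typ = λ p τ v → Typ₃ p τ (Vec.head v) (Vec.head (Vec.tail v)) (Vec.head (Vec.tail (Vec.tail v)))
      ; Typ? = λ p τ v → Typ₃? p τ (Vec.head v) (Vec.head (Vec.tail v)) (Vec.head (Vec.tail (Vec.tail v)))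
      ; types-few = types-few
      ; types-root = λ { {p} {r , t} pp bad<p τ∈ → rootMod pp bad<p (+ r) (types-root τ∈) }
      ; classify = λ { pp (u ∷ v ∷ w ∷ []) d → [ (λ { (a , b , c) → inj₁ (a ∷ b ∷ c ∷ []) }) , inj₂ ]′ (classify₃ pp u v w d) }
      ; closed = λ { {p} {τ} {u ∷ v ∷ w ∷ []} {u′ ∷ v′ ∷ w′ ∷ []} pp τ∈ h h′ → closed₃ τ u v w u′ v′ w′ τ∈ h h′ }
      }

    irreducible⇒plan : EventuallyPlan f
    irreducible⇒plan = rootPrimes+rootPairs⇒plan {f} (normData⇒manyRootPrimes normData) (Split.manyRootPairs disc κ b (+ 2 ⊗ b) (disc ⊗ ((+ 2 ⊗ b) ⊗ (+ 2 ⊗ b))) ν refl refl refl refl refl refl)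
      where
      ν : ℕ
      ν = suc (3 * ∣ P ∣)
      κ b : ℤ
      κ = + ν ⊗ ((c ⊗ Q) ⊗ (c ⊗ Q)) ⊗ disc
      b = + 3 ⊗ (κ ⊗ A)

completeCube : ∀ a₀ a₁ a₂ a → a ≢ + 0 →
  Reduction (a₀ ∷ a₁ ∷ a₂ ∷ a ∷ []) (+ 27 ⊗ (a ⊗ a ⊗ a₀) ⊖ + 9 ⊗ (a ⊗ a₂ ⊗ a₁) ⊕ + 2 ⊗ (a₂ ⊗ a₂ ⊗ a₂) ∷ + 9 ⊗ (a ⊗ a₁) ⊖ + 3 ⊗ (a₂ ⊗ a₂) ∷ + 0 ∷ + 1 ∷ [])
completeCube a₀ a₁ a₂ a a≢0 = record
  { A = + 3 ⊗ a ; B = a₂ ; c = + 27 ⊗ (a ⊗ a) ; A≢0 = ⊗≢0 {+ 3} (λ ()) a≢0 ; c≢0 = ⊗≢0 {+ 27} (λ ()) (⊗≢0 a≢0 a≢0) ; reduces = completed a₀ a₁ a₂ a }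
  where
  completed : ∀ a₀ a₁ a₂ a x → let X = (+ 3 ⊗ a) ⊗ x ⊕ a₂ in
    (+ 27 ⊗ (a ⊗ a)) ⊗ (a₀ ⊕ x ⊗ (a₁ ⊕ x ⊗ (a₂ ⊕ x ⊗ (a ⊕ x ⊗ + 0))))
      ≡ (+ 27 ⊗ (a ⊗ a ⊗ a₀) ⊖ + 9 ⊗ (a ⊗ a₂ ⊗ a₁) ⊕ + 2 ⊗ (a₂ ⊗ a₂ ⊗ a₂)) ⊕ X ⊗ ((+ 9 ⊗ (a ⊗ a₁) ⊖ + 3 ⊗ (a₂ ⊗ a₂)) ⊕ X ⊗ (+ 0 ⊕ X ⊗ (+ 1 ⊕ X ⊗ + 0)))
  completed = ℤ-Ring.solve-∀

-- An integer root divides Q, which bounds the search when Q is not 0; otherwise 0 is a root.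
∃-cubic-root? : ∀ P Q → (∃[ X ] X ⊗ X ⊗ X ⊕ P ⊗ X ⊕ Q ≡ + 0) ⊎ (∀ X → X ⊗ X ⊗ X ⊕ P ⊗ X ⊕ Q ≢ + 0)
∃-cubic-root? P Q with Q ≟ℤ0
... | yes Q≡0 = inj₁ (+ 0 , trans (lem P Q) Q≡0)
  where
  lem : ∀ P Q → + 0 ⊗ + 0 ⊗ + 0 ⊕ P ⊗ + 0 ⊕ Q ≡ Q
  lem = ℤ-Ring.solve-∀
... | no Q≢0 = ∃-integer? (λ X → X ⊗ X ⊗ X ⊕ P ⊗ X ⊕ Q ≡ + 0) (λ X → (X ⊗ X ⊗ X ⊕ P ⊗ X ⊕ Q) ≟ℤ0) ∣ Q ∣ bounded
  where
  lem : ∀ P Q X → X ⊗ ⊝ (X ⊗ X ⊕ P) ≡ Q ⊖ (X ⊗ X ⊗ X ⊕ P ⊗ X ⊕ Q)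
  lem = ℤ-Ring.solve-∀
  lem₀ : ∀ Q → Q ⊖ + 0 ≡ Q
  lem₀ = ℤ-Ring.solve-∀
  bounded : ∀ X → X ⊗ X ⊗ X ⊕ P ⊗ X ⊕ Q ≡ + 0 → ∣ X ∣ ≤ ∣ Q ∣
  bounded X e = ∣⇒≤ {{≢-nonZero λ z → Q≢0 (ℤₚ.∣i∣≡0⇒i≡0 z)}} (abs-∣ {x = Q} (∣ℤ-≡ (trans (lem P Q X) (trans (cong (Q ⊖_) e) (lem₀ Q))) (ℤ∣.∣m⇒∣m*n (⊝ (X ⊗ X ⊕ P)) (∣-abs {∣ X ∣} {X} ∣-refl))))

cubic⇒plan : ∀ a₀ a₁ a₂ a → a ≢ + 0 → EventuallyPlan (a₀ ∷ a₁ ∷ a₂ ∷ a ∷ [])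
cubic⇒plan a₀ a₁ a₂ a a≢0 = [ reducible , (λ irr → Cubic.irreducible⇒plan P Q irr red) ]′ (∃-cubic-root? P Q)
  where
  P = + 9 ⊗ (a ⊗ a₁) ⊖ + 3 ⊗ (a₂ ⊗ a₂)
  Q = + 27 ⊗ (a ⊗ a ⊗ a₀) ⊖ + 9 ⊗ (a ⊗ a₂ ⊗ a₁) ⊕ + 2 ⊗ (a₂ ⊗ a₂ ⊗ a₂)
  red = completeCube a₀ a₁ a₂ a a≢0
  reducible : ∃[ X ] X ⊗ X ⊗ X ⊕ P ⊗ X ⊕ Q ≡ + 0 → EventuallyPlan (a₀ ∷ a₁ ∷ a₂ ∷ a ∷ [])
  reducible (X , e) = Reduction.root⇒plan red X (trans (CubicForms.g-eval P Q X) e)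

-- From plans to the theorem

plan⇒works : ∀ {f} → EventuallyNonzero f → EventuallyPlan f → ∃[ G ] Works f G
plan⇒works nz (G , plan) = 2 ⊔ G , m≤m⊔n 2 G , λ k G≤k → plan⇒noneCoprime nz (plan k (≤-trans (m≤n⊔m 2 G) G≤k))

theorem1 : (f : Poly) → HasDegree f 2 ⊎ HasDegree f 3 →
    (∃[ G ] Works f G) ×
    (∀ G → IsGf f G → ∀ k → G ≤ k → ∀ N → ∃[ n ] (N ≤ n × NoneCoprimeToOthers f n k))
theorem1 f deg = plan⇒works (nonzero deg) (plan deg) ,
  λ { G ((_ , works) , _) k G≤k N → case works k G≤k of λ { (n , nc) → noneCoprime-unbounded {f} {n} (nonzero deg) nc N } }
  where
  nonzero : HasDegree f 2 ⊎ HasDegree f 3 → EventuallyNonzero f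
  nonzero (inj₁ (cs , a , refl , a≢0 , _)) = leading≢0⇒eventuallyNonzero cs a a≢0
  nonzero (inj₂ (cs , a , refl , a≢0 , _)) = leading≢0⇒eventuallyNonzero cs a a≢0
  plan : HasDegree f 2 ⊎ HasDegree f 3 → EventuallyPlan f
  plan (inj₁ (a₀ ∷ a₁ ∷ [] , a , refl , a≢0 , _)) = quadratic⇒plan a₀ a₁ a a≢0
  plan (inj₂ (a₀ ∷ a₁ ∷ a₂ ∷ [] , a , refl , a≢0 , _)) = cubic⇒plan a₀ a₁ a₂ a a≢0
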